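{- Let $0 < 1/n_0 \ll 1/r_0 \ll 1/r_1, \beta \ll \gamma_1 \ll \sigma \ll \delta \ll \gamma_2 \ll 1$, and let $n \geq n_0$. If $\mathcal{H}$ is an $n$-vertex linear hypergraph in which every edge $e$ satisfies $|e| > r_1$, then at least one of the following holds. (a) There exists a proper edge-colouring of $\mathcal{H}$ using at most $(1-\sigma)n$ colours such that: (i) every colour assigned to a huge edge is assigned to no other edge; (ii) every medium edge is assigned a colour from a set $C_{\mathrm{med}}$ of size at most $\gamma_1 n$ such that for every $c \in C_{\mathrm{med}}$, at most $\gamma_1 n$ vertices are incident to an edge coloured $c$; and (iii) for every colour $c \notin C_{\mathrm{med}}$ not assigned to a huge edge, at most $\beta n$ vertices are incident to an edge coloured $c$. (b) There exists a set of FPP-extremal edges of $\mathcal{H}$ of normalised volume at least $1-\delta$, and a proper edge-colouring of $\mathcal{H}$ using at most $n$ colours such that: (i) for every colour $c$ assigned to a huge edge, at most $\delta n$ vertices are incident to an edge coloured $c$; (ii) every medium edge is assigned a colour from a set $C_{\mathrm{med}}$ of size at most $\gamma_2 n$ such that for every $c \in C_{\mathrm{med}}$, at most $\gamma_1 n$ vertices are incident to an edge coloured $c$; and (iii) for every colour $c \notin C_{\mathrm{med}}$ not assigned to a huge edge, at most $\beta n$ vertices are incident to an edge coloured $c$.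
   Context: Hierarchy convention: a statement holding for "$0 < a \ll b \le 1$" means there is a non-decreasing function $f:(0,1]\to(0,1]$ such that it holds whenever $a \le f(b)$; longer hierarchies are chosen from right to left analogously ($r_0, r_1$ are integers, and $1/r_0, 1/r_1$ appear in the hierarchy). A hypergraph has a finite vertex set and a set of (non-repeated) nonempty subsets as edges; it is linear if distinct edges share at most one vertex. A proper edge-colouring gives intersecting distinct edges different colours. For an $n$-vertex hypergraph $\mathcal{H}$: an edge $e$ is medium if $r_1 < |e| \le r_0$; huge if $|e| \ge \beta n/4$; FPP-extremal if $(1-\delta)\sqrt{n} \le |e| \le (1+\delta)\sqrt{n}$. The normalised volume of a set $W$ of edges is $\sum_{e \in W}\binom{|e|}{2}/\binom{n}{2}$.
   Formalization: The hierarchy parameters β, γ₁, σ, δ and γ₂ range over rational numbers in (0,1] instead of real numbers. -}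

module Defs where

open import Data.Nat as ℕ using (ℕ; zero; suc)
open import Data.Nat.Combinatorics using (_C_)
open import Data.Integer using (+_)
open import Data.Rational using (ℚ; _/_; 0ℚ; 1ℚ; _≤_; _<_; _*_; _-_; _+_)
open import Data.Fin using (Fin; _≟_)
open import Data.Fin.Subset using (Subset; _∈_; _∉_; ∣_∣; ⋃; Nonempty)
open import Data.List using (List; filter; map; allFin)
open import Data.Nat.ListAction using (sum)
open import Data.Product using (Σ; ∃; _×_; _,_)
open import Relation.Binary.PropositionalEquality using (_≡_; _≢_)
open import Relation.Nullary using (¬_)

toℚ : ℕ → ℚ
toℚ k = (+ k) / 1

record Hypergraph (n : ℕ) : Set where
  field
    m         : ℕ
    edge      : Fin m → Subset n
    distinct  : ∀ i j → edge i ≡ edge j → i ≡ j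
    nonempty  : ∀ i → Nonempty (edge i)
open Hypergraph public

∣e∣ : ∀ {n} (H : Hypergraph n) → Fin (m H) → ℕ
∣e∣ H i = ∣ edge H i ∣

Linear : ∀ {n} → Hypergraph n → Set
Linear H = ∀ i j → i ≢ j → ∀ u v → u ∈ edge H i → u ∈ edge H j
           → v ∈ edge H i → v ∈ edge H j → u ≡ v

Colouring : ∀ {n} → Hypergraph n → ℕ → Set
Colouring H k = Fin (m H) → Fin k

Proper : ∀ {n} (H : Hypergraph n) {k} → Colouring H k → Set
Proper {n} H c = ∀ i j → i ≢ j → (Σ (Fin n) λ v → v ∈ edge H i × v ∈ edge H j)
                 → c i ≢ c j

Medium : ∀ {n} (H : Hypergraph n) (r₁ r₀ : ℕ) → Fin (m H) → Set
Medium H r₁ r₀ i = r₁ ℕ.< ∣e∣ H i × ∣e∣ H i ℕ.≤ r₀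

Huge : ∀ {n} (H : Hypergraph n) (β : ℚ) → Fin (m H) → Set
Huge {n} H β i = (+ 1 / 4) * β * toℚ n ≤ toℚ (∣e∣ H i)

-- FPP-extremal: (1-δ)√n ≤ |e| ≤ (1+δ)√n, written with squares
-- (all quantities are nonnegative when 0 < δ ≤ 1).
FPPExtremal : ∀ {n} (H : Hypergraph n) (δ : ℚ) → Fin (m H) → Set
FPPExtremal {n} H δ i =
  ((1ℚ - δ) * (1ℚ - δ) * toℚ n ≤ toℚ (∣e∣ H i ℕ.* ∣e∣ H i)) ×
  (toℚ (∣e∣ H i ℕ.* ∣e∣ H i) ≤ (1ℚ + δ) * (1ℚ + δ) * toℚ n)

colourClass : ∀ {n} (H : Hypergraph n) {k} → Colouring H k → Fin k → List (Fin (m H))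
colourClass H c col = filter (λ i → c i ≟ col) (allFin (m H))

incident : ∀ {n} (H : Hypergraph n) {k} → Colouring H k → Fin k → Subset n
incident H c col = ⋃ (map (edge H) (colourClass H c col))

HugeColour : ∀ {n} (H : Hypergraph n) {k} → Colouring H k → ℚ → Fin k → Set
HugeColour H c β col = Σ (Fin (m H)) λ i → Huge H β i × c i ≡ col

volumeSum : ∀ {n} (H : Hypergraph n) → Subset (m H) → ℕ
volumeSum H W = sum (map (λ i → ∣e∣ H i C 2) (filter (λ i → Data.Fin.Subset.Properties._∈?_ i W) (allFin (m H))))
  where import Data.Fin.Subset.Properties

NormVolumeAtLeast : ∀ {n} (H : Hypergraph n) → Subset (m H) → ℚ → Set
NormVolumeAtLeast {n} H W x = x * toℚ (n C 2) ≤ toℚ (volumeSum H W)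

-- conditions (ii),(iii) shared by both outcomes, with medium-set size bound s
MedAndRest : ∀ {n} (H : Hypergraph n) {k} → Colouring H k →
             (r₁ r₀ : ℕ) (β γ₁ s : ℚ) → Set
MedAndRest {n} H {k} c r₁ r₀ β γ₁ s =
  Σ (Subset k) λ Cmed →
    (toℚ ∣ Cmed ∣ ≤ s * toℚ n) ×
    (∀ i → Medium H r₁ r₀ i → c i ∈ Cmed) ×
    (∀ col → col ∈ Cmed → toℚ ∣ incident H c col ∣ ≤ γ₁ * toℚ n) ×
    (∀ col → col ∉ Cmed → ¬ HugeColour H c β col →
       toℚ ∣ incident H c col ∣ ≤ β * toℚ n)

OutcomeA : ∀ {n} → Hypergraph n → (r₁ r₀ : ℕ) (β γ₁ σ : ℚ) → Set
OutcomeA {n} H r₁ r₀ β γ₁ σ =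
  Σ ℕ λ k → Σ (Colouring H k) λ c →
    Proper H c × (toℚ k ≤ (1ℚ - σ) * toℚ n) ×
    (∀ i j → Huge H β i → c j ≡ c i → j ≡ i) ×
    MedAndRest H c r₁ r₀ β γ₁ γ₁

OutcomeB : ∀ {n} → Hypergraph n → (r₁ r₀ : ℕ) (β γ₁ δ γ₂ : ℚ) → Set
OutcomeB {n} H r₁ r₀ β γ₁ δ γ₂ =
  (Σ (Subset (m H)) λ W → (∀ i → i ∈ W → FPPExtremal H δ i) ×
                          NormVolumeAtLeast H W (1ℚ - δ)) ×
  (Σ ℕ λ k → Σ (Colouring H k) λ c →
    Proper H c × k ℕ.≤ n ×
    (∀ col → HugeColour H c β col → toℚ ∣ incident H c col ∣ ≤ δ * toℚ n) ×
    MedAndRest H c r₁ r₀ β γ₁ γ₂)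

InUnit : ℚ → Set
InUnit x = (0ℚ < x) × (x ≤ 1ℚ)

InvLe : ℕ → ℚ → Set
InvLe r t = (1 ℕ.≤ r) × (1ℚ ≤ t * toℚ r)

-- Huge edges are few and receive private colours; medium edges have so small a total size that a few reserved colours
-- suffice.  Among the remaining edges, peel off repeatedly an edge that meets fewer than about n others: peeled edges are
-- coloured greedily at the end.  In a core S in which every edge meets almost n others, linearity forces almost all of
-- the volume into edges of nearly the minimal size r.  If r exceeds √n by a constant factor, S has too few edges to need
-- n colours.  If r is a small multiple of √n, a derandomised nibble yields independent sets of large weight, and the
-- edges of nearly minimal size need few colours.  In between, colouring many disjoint pairs of disjoint edges
-- monochromatically repeats colours in the neighbourhood of nearly every other edge, which saves colours in a greedy
-- completion.  What is left is r close to √n, which is outcome (b): a de Bruijn–Erdős double count finds x disjoint pairs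
-- of disjoint edges among any n + x edges of size about √n, so n colours with classes of at most two long edges suffice.

module Submission where

-- Why cores are rigid: by linearity the edges through a vertex are disjoint elsewhere, so an edge
-- of minimal size r meets at most about n others. If every edge meets almost n others, counting
-- neighbours along a single star shows that r times the total size is almost n², whereas the sum of
-- size² is at most n² plus the total size: longer edges find no room. The trichotomy in r comes
-- from common neighbours. Two meeting edges of size about r have at most about n/r + r² of them.
-- For r² below (1 - c)n, neighbourhoods therefore contain many disjoint pairs; for r² above (1 +
-- c)n there are at most n²/r(r - 1) edges; near r² = n, as in a projective plane, neither helps.
-- Vertex counts per colour are controlled by loads, the total sizes of classes: a greedy step
-- avoids the colours of coloured neighbours and the few colours whose load is nearly exhausted. One
-- unit u, the integer part of n/U, measures every loss: n - 32u main colours, peeling threshold n -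
-- 64u, at most 9u colours for medium and huge edges.

-- Finite sums and decidable subsets of `Fin n`

module FiniteSums where

  open import Data.Bool using (Bool; true; false; _∧_; _∨_; not)
  open import Data.Empty using (⊥; ⊥-elim)
  open import Data.Fin using (Fin; zero; suc)
  import Data.Fin as Fin
  open import Data.Nat using (ℕ; zero; suc; _+_; _*_; _≤_; _<_; z≤n; s≤s; _<ᵇ_)
  open import Data.Nat.Properties
  open import Data.Product using (∃; _×_; _,_; proj₁; proj₂)
  open import Data.Sum using (_⊎_; inj₁; inj₂)
  open import Function using (_∘_)
  open import Relation.Binary.PropositionalEquality
  open import Relation.Nullary using (¬_; yes; no; does)
  import Algebra.Properties.CommutativeMonoid.Sum +-0-commutativeMonoid as Sum
  import Algebra.Properties.Semiring.Sum +-*-semiring as Sum*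

  𝟙 : Bool → ℕ
  𝟙 true  = 1
  𝟙 false = 0

  Pred : ℕ → Set
  Pred n = Fin n → Bool

  infix 4 _∈ᵇ_ _∉ᵇ_ _⊆ᵇ_
  _∈ᵇ_ _∉ᵇ_ : ∀ {n} → Fin n → Pred n → Set
  i ∈ᵇ S = S i ≡ true
  i ∉ᵇ S = S i ≡ false

  _⊆ᵇ_ : ∀ {n} → Pred n → Pred n → Set
  S ⊆ᵇ R = ∀ i → i ∈ᵇ S → i ∈ᵇ R

  infixl 6 _∪ᵇ_ _∖_ _∖ᵇ_
  infixl 7 _∩ᵇ_
  _∪ᵇ_ _∩ᵇ_ _∖ᵇ_ : ∀ {n} → Pred n → Pred n → Pred n
  (S ∪ᵇ R) i = S i ∨ R i
  (S ∩ᵇ R) i = S i ∧ R i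
  (S ∖ᵇ R) i = S i ∧ not (R i)

  infix 8 _==_
  opaque
    _==_ : ∀ {n} → Fin n → Fin n → Bool
    i == j = does (i Fin.≟ j)

    ==-does : ∀ {n} (i j : Fin n) → (i == j) ≡ does (i Fin.≟ j)
    ==-does i j = refl

    ==-refl : ∀ {n} (i : Fin n) → (i == i) ≡ true
    ==-refl i with i Fin.≟ i
    ... | yes _ = refl
    ... | no ¬p = ⊥-elim (¬p refl)

    ==⇒≡ : ∀ {n} {i j : Fin n} → (i == j) ≡ true → i ≡ j
    ==⇒≡ {i = i} {j} p with i Fin.≟ j
    ... | yes q = q
    ==⇒≡ () | no _

    ≢⇒== : ∀ {n} {i j : Fin n} → i ≢ j → (i == j) ≡ false
    ≢⇒== {i = i} {j} p with i Fin.≟ j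
    ... | yes q = ⊥-elim (p q)
    ... | no _ = refl

  _∖_ : ∀ {n} → Pred n → Fin n → Pred n
  (S ∖ e) i = S i ∧ not (i == e)

  -- Opaque, so that unification sees a rigid head.
  opaque
    unfolding _==_

    ∑ : ∀ {n} → (Fin n → ℕ) → ℕ
    ∑ = Sum.sum

    ∑-zero : (f : Fin 0 → ℕ) → ∑ f ≡ 0
    ∑-zero f = refl

    ∑-suc : ∀ {n} (f : Fin (suc n) → ℕ) → ∑ f ≡ f zero + ∑ (f ∘ suc)
    ∑-suc f = refl

    ∑-cong : ∀ {n} {f g : Fin n → ℕ} → (∀ i → f i ≡ g i) → ∑ f ≡ ∑ g
    ∑-cong = Sum.sum-cong-≗

    ∑-+ : ∀ {n} (f g : Fin n → ℕ) → ∑ (λ i → f i + g i) ≡ ∑ f + ∑ g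
    ∑-+ = Sum.∑-distrib-+

    ∑-swap : ∀ {n m} (f : Fin n → Fin m → ℕ) → ∑ (λ i → ∑ (λ j → f i j)) ≡ ∑ (λ j → ∑ (λ i → f i j))
    ∑-swap = Sum.∑-comm

    ∑-*ˡ : ∀ {n} c (f : Fin n → ℕ) → c * ∑ f ≡ ∑ (λ i → c * f i)
    ∑-*ˡ = Sum*.*-distribˡ-sum

    ∑-mono : ∀ {n} {f g : Fin n → ℕ} → (∀ i → f i ≤ g i) → ∑ f ≤ ∑ g
    ∑-mono {zero} _ = z≤n
    ∑-mono {suc n} p = +-mono-≤ (p zero) (∑-mono (p ∘ suc))

    ∑-0 : ∀ {n} {f : Fin n → ℕ} → (∀ i → f i ≡ 0) → ∑ f ≡ 0
    ∑-0 {zero} _ = refl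
    ∑-0 {suc n} p = cong₂ _+_ (p zero) (∑-0 (p ∘ suc))

    ∑-const : ∀ n c → ∑ {n} (λ _ → c) ≡ n * c
    ∑-const zero c = refl
    ∑-const (suc n) c = cong (c +_) (∑-const n c)

    ∑-term : ∀ {n} (f : Fin n → ℕ) i → f i ≤ ∑ f
    ∑-term f zero = m≤m+n _ _
    ∑-term f (suc i) = ≤-trans (∑-term (f ∘ suc) i) (m≤n+m _ _)

    -- The averaging principle behind the choice of a free colour and of a good pair of edges.
    ∑-exists-< : ∀ {n} {f g : Fin n → ℕ} → ∑ f < ∑ g → ∃ λ i → f i < g i
    ∑-exists-< {zero} ()
    ∑-exists-< {suc n} {f} {g} p with f zero <? g zero
    ... | yes q = zero , q
    ... | no q with ∑-exists-< {n} {f ∘ suc} {g ∘ suc}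
                     (+-cancelˡ-< (f zero) _ _ (<-≤-trans p (+-monoˡ-≤ _ (≮⇒≥ q))))
    ... | i , r = suc i , r

    ∑-≡-pick : ∀ {n} (i : Fin n) (f : Fin n → ℕ) → ∑ (λ j → 𝟙 (j == i) * f j) ≡ f i
    ∑-≡-pick {suc n} zero f = trans (cong₂ _+_ (+-identityʳ (f zero)) (∑-0 {n} (λ i → refl))) (+-identityʳ _)
    ∑-≡-pick (suc i) f = ∑-≡-pick i (f ∘ suc)

  # : ∀ {n} → Pred n → ℕ
  # S = ∑ (λ i → 𝟙 (S i))

  ∑∈ : ∀ {n} → Pred n → (Fin n → ℕ) → ℕ
  ∑∈ S f = ∑ (λ i → 𝟙 (S i) * f i)

  ==⇒≢ : ∀ {n} {i j : Fin n} → (i == j) ≡ false → i ≢ j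
  ==⇒≢ {i = i} p refl with trans (sym p) (==-refl i)
  ... | ()

  ==-sym : ∀ {n} (i j : Fin n) → (i == j) ≡ (j == i)
  ==-sym i j with i Fin.≟ j
  ... | yes refl = refl
  ... | no p = trans (≢⇒== p) (sym (≢⇒== (p ∘ sym)))

  ∧-true : ∀ {a b} → a ∧ b ≡ true → a ≡ true × b ≡ true
  ∧-true {true} {true} _ = refl , refl

  ∧-intro : ∀ {a b} → a ≡ true → b ≡ true → a ∧ b ≡ true
  ∧-intro refl refl = refl

  ∨-true : ∀ {a b} → a ∨ b ≡ true → a ≡ true ⊎ b ≡ true
  ∨-true {true} _ = inj₁ refl
  ∨-true {false} p = inj₂ p

  ∨-introˡ : ∀ {a b} → a ≡ true → a ∨ b ≡ true
  ∨-introˡ refl = refl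

  ∨-introʳ : ∀ {a b} → b ≡ true → a ∨ b ≡ true
  ∨-introʳ {true} _ = refl
  ∨-introʳ {false} p = p

  not-true : ∀ {b} → not b ≡ true → b ≡ false
  not-true {false} _ = refl

  not-intro : ∀ {b} → b ≡ false → not b ≡ true
  not-intro refl = refl

  true≢false : ∀ {b} → b ≡ true → b ≡ false → ⊥
  true≢false refl ()

  ≢true⇒false : ∀ {b} → ¬ (b ≡ true) → b ≡ false
  ≢true⇒false {true} p = ⊥-elim (p refl)
  ≢true⇒false {false} _ = refl

  ∧-not : ∀ {a b} → a ∧ not b ≡ true → a ∧ b ≡ false
  ∧-not {true} {false} _ = refl

  ∖-∪-∩ : ∀ {n} (S R : Pred n) i → ((S ∖ᵇ R) ∪ᵇ (S ∩ᵇ R)) i ≡ S i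
  ∖-∪-∩ S R i = lemma (S i) (R i)
    where
    lemma : ∀ x y → (x ∧ not y) ∨ (x ∧ y) ≡ x
    lemma true true = refl
    lemma true false = refl
    lemma false _ = refl

  ∖-∖ : ∀ {a b c d} → (a ∧ not b) ∧ not ((a ∧ not b) ∧ (not c ∨ d)) ≡ true → a ≡ true × b ≡ false × c ≡ true × d ≡ false
  ∖-∖ {true} {false} {true} {false} _ = refl , refl , refl , refl

  ∨-∉-∖ : ∀ {s d b} → d ∨ b ≡ true → (s ∧ not d) ∧ not b ≡ false
  ∨-∉-∖ {false} _ = refl
  ∨-∉-∖ {true} {true} _ = refl
  ∨-∉-∖ {true} {false} {true} _ = refl

  𝟙-*-positive : ∀ b {x h} → h < 𝟙 b * x → b ≡ true × h < x
  𝟙-*-positive true p = refl , <-≤-trans p (≤-reflexive (+-identityʳ _))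
  𝟙-*-positive false ()

  -- Gives up one multiple of `v` to gain strictness; `1 ≤ x` covers `v = 0`.
  below-suc : ∀ k v {x} → 1 ≤ x → suc k * v ≤ x → k * v < x
  below-suc k zero 1≤x _ = ≤-trans (s≤s (≤-reflexive (*-zeroʳ k))) 1≤x
  below-suc k (suc v) _ p = ≤-trans (s≤s (m≤n+m _ v)) p

  dec-Bool : ∀ b → b ≡ true ⊎ b ≡ false
  dec-Bool true = inj₁ refl
  dec-Bool false = inj₂ refl

  𝟙-mono : ∀ {a b} → (a ≡ true → b ≡ true) → 𝟙 a ≤ 𝟙 b
  𝟙-mono {false} _ = z≤n
  𝟙-mono {true} p rewrite p refl = ≤-refl

  𝟙≤1 : ∀ b → 𝟙 b ≤ 1
  𝟙≤1 true = ≤-refl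
  𝟙≤1 false = z≤n

  𝟙-∧ : ∀ a b → 𝟙 (a ∧ b) ≡ 𝟙 a * 𝟙 b
  𝟙-∧ true b = sym (+-identityʳ _)
  𝟙-∧ false b = refl

  <ᵇ-true : ∀ {a b} → (a <ᵇ b) ≡ true → a < b
  <ᵇ-true {a} {b} p = <ᵇ⇒< a b (subst Data.Bool.T (sym p) _)
    where import Data.Bool

  <ᵇ-false : ∀ {a b} → (a <ᵇ b) ≡ false → b ≤ a
  <ᵇ-false {a} {b} p with a <? b
  ... | yes q = ⊥-elim (lemma (<⇒<ᵇ q) p)
    where
    import Data.Bool
    lemma : ∀ {c} → Data.Bool.T c → c ≡ false → ⊥
    lemma {true} _ ()
  ... | no q = ≮⇒≥ q

  <ᵇ-intro : ∀ {a b} → a < b → (a <ᵇ b) ≡ true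
  <ᵇ-intro {a} {b} q with dec-Bool (a <ᵇ b)
  ... | inj₁ p = p
  ... | inj₂ p = ⊥-elim (<⇒≱ q (<ᵇ-false p))

  <ᵇ-introF : ∀ {a b} → b ≤ a → (a <ᵇ b) ≡ false
  <ᵇ-introF {a} {b} q with dec-Bool (a <ᵇ b)
  ... | inj₁ p = ⊥-elim (<⇒≱ (<ᵇ-true p) q)
  ... | inj₂ p = p

  ∑-*ʳ : ∀ {n} (f : Fin n → ℕ) c → ∑ (λ i → f i * c) ≡ ∑ f * c
  ∑-*ʳ f c = trans (∑-cong (λ i → *-comm (f i) c)) (trans (sym (∑-*ˡ c f)) (*-comm c _))

  ∑∈-cong : ∀ {n} {S : Pred n} {f g : Fin n → ℕ} → (∀ i → i ∈ᵇ S → f i ≡ g i) → ∑∈ S f ≡ ∑∈ S g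
  ∑∈-cong {S = S} {f} {g} p = ∑-cong lemma
    where
    lemma : ∀ i → 𝟙 (S i) * f i ≡ 𝟙 (S i) * g i
    lemma i with S i in eq
    ... | true = cong (_+ 0) (p i eq)
    ... | false = refl

  ∑∈-mono : ∀ {n} {S R : Pred n} {f g : Fin n → ℕ} → (∀ i → i ∈ᵇ S → i ∈ᵇ R × f i ≤ g i) → ∑∈ S f ≤ ∑∈ R g
  ∑∈-mono {S = S} {R} {f} {g} p = ∑-mono lemma
    where
    lemma : ∀ i → 𝟙 (S i) * f i ≤ 𝟙 (R i) * g i
    lemma i with S i in eq
    ... | false = z≤n
    ... | true rewrite proj₁ (p i eq) = +-monoˡ-≤ 0 (proj₂ (p i eq))

  ∑∈-monoʳ : ∀ {n} {S : Pred n} {f g : Fin n → ℕ} → (∀ i → i ∈ᵇ S → f i ≤ g i) → ∑∈ S f ≤ ∑∈ S g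
  ∑∈-monoʳ p = ∑∈-mono (λ i q → q , p i q)

  ∑∈-monoˡ : ∀ {n} {S R : Pred n} {f : Fin n → ℕ} → S ⊆ᵇ R → ∑∈ S f ≤ ∑∈ R f
  ∑∈-monoˡ p = ∑∈-mono (λ i q → p i q , ≤-refl)

  ∑∈-≤∑ : ∀ {n} (S : Pred n) (f : Fin n → ℕ) → ∑∈ S f ≤ ∑ f
  ∑∈-≤∑ S f = ∑-mono (λ i → ≤-trans (*-monoˡ-≤ (f i) (𝟙≤1 (S i))) (≤-reflexive (+-identityʳ _)))

  ∑∈-+ : ∀ {n} (S : Pred n) (f g : Fin n → ℕ) → ∑∈ S (λ i → f i + g i) ≡ ∑∈ S f + ∑∈ S g
  ∑∈-+ S f g = trans (∑-cong (λ i → *-distribˡ-+ (𝟙 (S i)) (f i) (g i))) (∑-+ _ _)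

  ∑∈-*ˡ : ∀ {n} (S : Pred n) c (f : Fin n → ℕ) → ∑∈ S (λ i → c * f i) ≡ c * ∑∈ S f
  ∑∈-*ˡ S c f = trans (∑-cong (λ i → lemma (𝟙 (S i)) c (f i))) (sym (∑-*ˡ c _))
    where
    lemma : ∀ a c b → a * (c * b) ≡ c * (a * b)
    lemma a c b = trans (sym (*-assoc a c b)) (trans (cong (_* b) (*-comm a c)) (*-assoc c a b))

  ∑∈-const : ∀ {n} (S : Pred n) c → ∑∈ S (λ _ → c) ≡ # S * c
  ∑∈-const S c = ∑-*ʳ (𝟙 ∘ S) c

  ∑∈-0 : ∀ {n} {S : Pred n} (f : Fin n → ℕ) → (∀ i → i ∉ᵇ S) → ∑∈ S f ≡ 0
  ∑∈-0 f p = ∑-0 (λ i → cong (λ b → 𝟙 b * f i) (p i))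

  ∑∈-swap : ∀ {n m} (S : Pred n) (R : Pred m) (f : Fin n → Fin m → ℕ) →
            ∑∈ S (λ i → ∑∈ R (f i)) ≡ ∑∈ R (λ j → ∑∈ S (λ i → f i j))
  ∑∈-swap S R f = begin
    ∑ (λ i → 𝟙 (S i) * ∑ (λ j → 𝟙 (R j) * f i j))   ≡⟨ ∑-cong (λ i → ∑-*ˡ (𝟙 (S i)) _) ⟩
    ∑ (λ i → ∑ (λ j → 𝟙 (S i) * (𝟙 (R j) * f i j))) ≡⟨ ∑-swap (λ i j → 𝟙 (S i) * (𝟙 (R j) * f i j)) ⟩
    ∑ (λ j → ∑ (λ i → 𝟙 (S i) * (𝟙 (R j) * f i j))) ≡⟨ ∑-cong (λ j → ∑∈-*ˡ S (𝟙 (R j)) (λ i → f i j)) ⟩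
    ∑ (λ j → 𝟙 (R j) * ∑ (λ i → 𝟙 (S i) * f i j)) ∎
    where open ≡-Reasoning

  ∑∈-∪ : ∀ {n} {S R : Pred n} (f : Fin n → ℕ) → (∀ i → i ∈ᵇ R → i ∉ᵇ S) → ∑∈ (S ∪ᵇ R) f ≡ ∑∈ S f + ∑∈ R f
  ∑∈-∪ {S = S} {R} f d = trans (∑-cong lemma) (∑-+ _ _)
    where
    lemma : ∀ i → 𝟙 (S i ∨ R i) * f i ≡ 𝟙 (S i) * f i + 𝟙 (R i) * f i
    lemma i with S i in p | R i in q
    ... | true | true = ⊥-elim (true≢false p (d i q))
    ... | true | false = sym (+-identityʳ _)
    ... | false | _ = refl

  ∑∈-∪-≤ : ∀ {n} (S R : Pred n) (f : Fin n → ℕ) → ∑∈ (S ∪ᵇ R) f ≤ ∑∈ S f + ∑∈ R f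
  ∑∈-∪-≤ S R f = ≤-trans (∑-mono lemma) (≤-reflexive (∑-+ _ _))
    where
    lemma : ∀ i → 𝟙 (S i ∨ R i) * f i ≤ 𝟙 (S i) * f i + 𝟙 (R i) * f i
    lemma i with S i
    ... | true = m≤m+n _ _
    ... | false = ≤-refl

  ∑∈-split : ∀ {n} (S R : Pred n) (f : Fin n → ℕ) → ∑∈ S f ≡ ∑∈ (S ∩ᵇ R) f + ∑∈ (S ∖ᵇ R) f
  ∑∈-split S R f = trans (∑-cong lemma) (∑-+ _ _)
    where
    lemma : ∀ i → 𝟙 (S i) * f i ≡ 𝟙 (S i ∧ R i) * f i + 𝟙 (S i ∧ not (R i)) * f i
    lemma i with S i | R i
    ... | true | true = sym (+-identityʳ _)
    ... | true | false = refl
    ... | false | _ = refl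

  ∑∈-remove : ∀ {n} {S : Pred n} (f : Fin n → ℕ) {e} → e ∈ᵇ S → ∑∈ S f ≡ f e + ∑∈ (S ∖ e) f
  ∑∈-remove {S = S} f {e} p = begin
    ∑∈ S f                                    ≡⟨ ∑-cong lemma ⟩
    ∑ (λ i → 𝟙 (i == e) * f i + 𝟙 ((S ∖ e) i) * f i) ≡⟨ ∑-+ _ _ ⟩
    ∑ (λ i → 𝟙 (i == e) * f i) + ∑∈ (S ∖ e) f ≡⟨ cong (_+ ∑∈ (S ∖ e) f) (∑-≡-pick e f) ⟩
    f e + ∑∈ (S ∖ e) f ∎
    where
    open ≡-Reasoning
    lemma : ∀ i → 𝟙 (S i) * f i ≡ 𝟙 (i == e) * f i + 𝟙 ((S ∖ e) i) * f i
    lemma i with i == e in q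
    ... | true rewrite ==⇒≡ q | p = sym (+-identityʳ _)
    ... | false with S i
    ... | true = refl
    ... | false = refl

  #-mono : ∀ {n} {S R : Pred n} → S ⊆ᵇ R → # S ≤ # R
  #-mono p = ∑-mono (λ i → 𝟙-mono (p i))

  #≡∑∈ : ∀ {n} (S : Pred n) → # S ≡ ∑∈ S (λ _ → 1)
  #≡∑∈ S = ∑-cong (λ i → sym (*-identityʳ _))

  #-remove : ∀ {n} {S : Pred n} {e} → e ∈ᵇ S → # S ≡ suc (# (S ∖ e))
  #-remove {S = S} {e} p = trans (#≡∑∈ S) (trans (∑∈-remove {S = S} (λ _ → 1) p) (cong suc (sym (#≡∑∈ (S ∖ e)))))

  #-∪-≤ : ∀ {n} (S R : Pred n) → # (S ∪ᵇ R) ≤ # S + # R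
  #-∪-≤ S R = subst₂ _≤_ (sym (#≡∑∈ (S ∪ᵇ R))) (sym (cong₂ _+_ (#≡∑∈ S) (#≡∑∈ R))) (∑∈-∪-≤ S R _)

  #≤n : ∀ {n} (S : Pred n) → # S ≤ n
  #≤n {n} S = ≤-trans (∑-mono (λ i → 𝟙≤1 (S i))) (≤-reflexive (trans (∑-const n 1) (*-identityʳ n)))

  #-true : ∀ {n} {S : Pred n} → (∀ i → i ∈ᵇ S) → # S ≡ n
  #-true {n} {S} p = trans (∑-cong (λ i → cong 𝟙 (p i))) (trans (∑-const n 1) (*-identityʳ n))

  #-member : ∀ {n} {S : Pred n} {i} → i ∈ᵇ S → 1 ≤ # S
  #-member {S = S} {i} p = ≤-trans (≤-reflexive (sym (cong 𝟙 p))) (∑-term (𝟙 ∘ S) i)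

  #-nonempty : ∀ {n} {S : Pred n} → 1 ≤ # S → ∃ λ i → i ∈ᵇ S
  #-nonempty {n} {S} p with ∑-exists-< {f = λ _ → 0} {𝟙 ∘ S} (subst (_< # S) (sym (∑-0 {n} (λ _ → refl))) p)
  ... | i , q = i , lemma q
    where
    lemma : ∀ {b} → 0 < 𝟙 b → b ≡ true
    lemma {true} _ = refl

  #≤1 : ∀ {n} {S : Pred n} → (∀ i j → i ∈ᵇ S → j ∈ᵇ S → i ≡ j) → # S ≤ 1
  #≤1 {S = S} u with # S in eq
  ... | zero = z≤n
  ... | suc k with #-nonempty {S = S} (subst (1 ≤_) (sym eq) (s≤s z≤n))
  ... | e , p = subst (_≤ 1) (trans (sym (#-remove {S = S} p)) eq) (s≤s (≤-reflexive (∑-0 lemma)))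
    where
    lemma : ∀ i → 𝟙 ((S ∖ e) i) ≡ 0
    lemma i with S i in q | i == e in r
    ... | false | _ = refl
    ... | true | true = refl
    ... | true | false = ⊥-elim (==⇒≢ r (u i e q p))

  some : ∀ {n} → Pred n → Bool
  some {zero} P = false
  some {suc n} P = P zero ∨ some (P ∘ suc)

  some-true : ∀ {n} {P : Pred n} → some P ≡ true → ∃ λ i → i ∈ᵇ P
  some-true {suc n} {P} p with P zero in eq
  ... | true = zero , eq
  ... | false with some-true {n} p
  ... | i , q = suc i , q

  some-intro : ∀ {n} {P : Pred n} {i} → i ∈ᵇ P → some P ≡ true
  some-intro {suc n} {P} {zero} p rewrite p = refl
  some-intro {suc n} {P} {suc i} p = ∨-introʳ {P zero} (some-intro {n} {P ∘ suc} p)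

  some-false : ∀ {n} {P : Pred n} → some P ≡ false → ∀ i → i ∉ᵇ P
  some-false {P = P} p i = ≢true⇒false (λ q → true≢false (some-intro {P = P} q) p)

  𝟙-some≤# : ∀ {n} (P : Pred n) → 𝟙 (some P) ≤ # P
  𝟙-some≤# P with some P in eq
  ... | false = z≤n
  ... | true = #-member {S = P} (proj₂ (some-true {P = P} eq))

  ∑-fibres : ∀ {m k} (col : Fin m → Fin k) (f : Fin m → ℕ) → ∑ (λ c → ∑ (λ i → 𝟙 (col i == c) * f i)) ≡ ∑ f
  ∑-fibres col f = trans (∑-swap (λ c i → 𝟙 (col i == c) * f i)) (∑-cong (λ i → lemma (col i) (f i)))
    where
    lemma : ∀ {k} (a : Fin k) y → ∑ (λ c → 𝟙 (a == c) * y) ≡ y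
    lemma a y = trans (∑-cong (λ c → cong (λ b → 𝟙 b * y) (==-sym a c))) (∑-≡-pick a (λ _ → y))

  min-element : ∀ {n} {S : Pred n} (f : Fin n → ℕ) {i₀} → i₀ ∈ᵇ S → ∃ λ i → i ∈ᵇ S × (∀ j → j ∈ᵇ S → f i ≤ f j)
  min-element {n} {S} f {i₀} p = go (f i₀) p ≤-refl
    where
    -- `b` is fuel: each improvement strictly lowers the value of `f`, which starts at `f i₀`.
    go : ∀ b {i} → i ∈ᵇ S → f i ≤ b → ∃ λ i → i ∈ᵇ S × (∀ j → j ∈ᵇ S → f i ≤ f j)
    go b {i} q r with some (λ j → S j ∧ (f j <ᵇ f i)) in eq
    ... | false = i , q , λ j s → <ᵇ-false (≢true⇒false (λ t → true≢false (∧-intro s t) (some-false eq j)))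
    go b {i} q r | true with some-true eq
    ... | j , t with ∧-true {S j} t
    go zero q r | true | j , t | s , u = ⊥-elim (n≮0 (<-≤-trans (<ᵇ-true {f j} u) r))
    go (suc b) q r | true | j , t | s , u = go b s (s≤s⁻¹ (≤-trans (<ᵇ-true {f j} u) r))
      where open Data.Nat using (s≤s⁻¹)

-- Polynomial identities over the natural numbers by reflection

module PolynomialIdentities where
  open import Data.List using (List; []; _∷_)
  open import Data.Nat using (ℕ; zero; suc; _+_; _*_)
  open import Data.Nat.Properties
  open import Data.Nat.Tactic.RingSolver using (solve-∀)
  open import Data.Product using (_×_; _,_)
  open import Data.Vec using (Vec; []; _∷_)
  open import Relation.Binary.PropositionalEquality

  infixl 6 _:+_
  infixl 7 _:*_
  infix 4 _:=_
  data Expr : Set where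
    var con   : ℕ → Expr
    _:+_ _:*_ : Expr → Expr → Expr

  _:=_ : Expr → Expr → Expr × Expr
  _:=_ = _,_

  variable-value : ∀ {k} → Vec ℕ k → ℕ → ℕ
  variable-value [] _ = 0
  variable-value (x ∷ ρ) zero = x
  variable-value (x ∷ ρ) (suc i) = variable-value ρ i

  ⟦_⟧ : ∀ {k} → Expr → Vec ℕ k → ℕ
  ⟦ var i ⟧ ρ = variable-value ρ i
  ⟦ con c ⟧ ρ = c
  ⟦ s :+ t ⟧ ρ = ⟦ s ⟧ ρ + ⟦ t ⟧ ρ
  ⟦ s :* t ⟧ ρ = ⟦ s ⟧ ρ * ⟦ t ⟧ ρ

  -- Dense Horner forms. Coefficients are natural numbers, so nothing cancels and no trailing zeros arise:
  -- the forms are canonical.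
  Poly : ℕ → Set
  Poly zero = ℕ
  Poly (suc k) = List (Poly k)

  eval : ∀ {k} → Poly k → Vec ℕ k → ℕ
  eval {zero} c _ = c
  eval {suc k} [] _ = 0
  eval {suc k} (c ∷ p) (x ∷ ρ) = eval c ρ + x * eval p (x ∷ ρ)

  -- In positive arity zero is the empty list; a list holding a zero would break canonicity.
  const : ∀ {k} → ℕ → Poly k
  const {zero} c = c
  const {suc k} zero = []
  const {suc k} (suc c) = const (suc c) ∷ []

  indeterminate : ∀ {k} → ℕ → Poly k
  indeterminate {zero} _ = 0
  indeterminate {suc k} zero = const 0 ∷ const 1 ∷ []
  indeterminate {suc k} (suc i) = indeterminate i ∷ []

  infixl 6 _⊕_
  infixl 7 _⊛_
  _⊕_ : ∀ {k} → Poly k → Poly k → Poly k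
  _⊕_ {zero} c d = c + d
  _⊕_ {suc k} [] q = q
  _⊕_ {suc k} p@(_ ∷ _) [] = p
  _⊕_ {suc k} (c ∷ p) (d ∷ q) = c ⊕ d ∷ p ⊕ q

  _⊛_ : ∀ {k} → Poly k → Poly k → Poly k
  scale : ∀ {k} → Poly k → Poly (suc k) → Poly (suc k)
  _⊛_ {zero} c d = c * d
  _⊛_ {suc k} [] q = []
  _⊛_ {suc k} (c ∷ p) [] = []
  _⊛_ {suc k} (c ∷ p) q@(_ ∷ _) = scale c q ⊕ (const 0 ∷ p ⊛ q)
  scale c [] = []
  scale c (d ∷ q) = c ⊛ d ∷ scale c q

  normalise : ∀ {k} → Expr → Poly k
  normalise (var i) = indeterminate i
  normalise (con c) = const c
  normalise (s :+ t) = normalise s ⊕ normalise t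
  normalise (s :* t) = normalise s ⊛ normalise t

  eval-const : ∀ {k} c (ρ : Vec ℕ k) → eval (const c) ρ ≡ c
  eval-const {zero} c _ = refl
  eval-const {suc k} zero _ = refl
  eval-const {suc k} (suc c) (x ∷ ρ) = trans (cong₂ _+_ (eval-const (suc c) ρ) (*-zeroʳ x)) (+-identityʳ (suc c))

  eval-indeterminate : ∀ {k} i (ρ : Vec ℕ k) → eval (indeterminate i) ρ ≡ variable-value ρ i
  eval-indeterminate i [] = refl
  eval-indeterminate zero (x ∷ ρ) = trans (cong₂ (λ u v → u + x * (v + x * 0)) (eval-const 0 ρ) (eval-const 1 ρ))
    (trans (cong (λ z → x * suc z) (*-zeroʳ x)) (*-identityʳ x))
  eval-indeterminate (suc i) (x ∷ ρ) = trans (cong₂ _+_ (eval-indeterminate i ρ) (*-zeroʳ x)) (+-identityʳ _)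

  collect : ∀ a b x u v → a + b + x * (u + v) ≡ a + x * u + (b + x * v)
  collect = solve-∀

  eval-⊕ : ∀ {k} (p q : Poly k) ρ → eval (p ⊕ q) ρ ≡ eval p ρ + eval q ρ
  eval-⊕ {zero} c d ρ = refl
  eval-⊕ {suc k} [] q ρ = refl
  eval-⊕ {suc k} (c ∷ p) [] ρ = sym (+-identityʳ _)
  eval-⊕ {suc k} (c ∷ p) (d ∷ q) (x ∷ ρ) = trans (cong₂ (λ u v → u + x * v) (eval-⊕ c d ρ) (eval-⊕ p q (x ∷ ρ)))
    (collect (eval c ρ) (eval d ρ) x (eval p (x ∷ ρ)) (eval q (x ∷ ρ)))

  eval-⊛ : ∀ {k} (p q : Poly k) ρ → eval (p ⊛ q) ρ ≡ eval p ρ * eval q ρ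
  eval-scale : ∀ {k} (c : Poly k) q x ρ → eval (scale c q) (x ∷ ρ) ≡ eval c ρ * eval q (x ∷ ρ)
  eval-⊛ {zero} c d ρ = refl
  eval-⊛ {suc k} [] q ρ = refl
  eval-⊛ {suc k} (c ∷ p) [] ρ = sym (*-zeroʳ (eval (c ∷ p) ρ))
  eval-⊛ {suc k} (c ∷ p) q@(_ ∷ _) (x ∷ ρ) = trans (eval-⊕ (scale c q) (const 0 ∷ p ⊛ q) (x ∷ ρ))
    (trans (cong₂ _+_ (eval-scale c q x ρ) (cong₂ (λ z u → z + x * u) (eval-const 0 ρ) (eval-⊛ p q (x ∷ ρ))))
      (trans (cong (eval c ρ * eval q (x ∷ ρ) +_) (sym (*-assoc x (eval p (x ∷ ρ)) (eval q (x ∷ ρ)))))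
        (sym (*-distribʳ-+ (eval q (x ∷ ρ)) (eval c ρ) (x * eval p (x ∷ ρ))))))
  eval-scale c [] x ρ = sym (*-zeroʳ (eval c ρ))
  eval-scale c (d ∷ q) x ρ = trans (cong₂ (λ u v → u + x * v) (eval-⊛ c d ρ) (eval-scale c q x ρ))
    (distribute (eval c ρ) (eval d ρ) x (eval q (x ∷ ρ)))
    where
    distribute : ∀ a b x v → a * b + x * (a * v) ≡ a * (b + x * v)
    distribute = solve-∀

  eval-normalise : ∀ {k} t (ρ : Vec ℕ k) → eval (normalise t) ρ ≡ ⟦ t ⟧ ρ
  eval-normalise (var i) ρ = eval-indeterminate i ρ
  eval-normalise (con c) ρ = eval-const c ρ
  eval-normalise (s :+ t) ρ = trans (eval-⊕ (normalise s) (normalise t) ρ) (cong₂ _+_ (eval-normalise s ρ) (eval-normalise t ρ))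
  eval-normalise (s :* t) ρ = trans (eval-⊛ (normalise s) (normalise t) ρ) (cong₂ _*_ (eval-normalise s ρ) (eval-normalise t ρ))

  -- Equations are functions of their variables, so that a use site names the variables instead of
  -- indexing them; `sides` supplies `var 0`, `var 1` and so on.
  Equation : ℕ → Set
  Equation zero = Expr × Expr
  Equation (suc k) = Expr → Equation k

  sides : ∀ k → ℕ → Equation k → Expr × Expr
  sides zero _ e = e
  sides (suc k) i e = sides k (suc i) (e (var i))

  -- Only soundness is needed: equal normal forms evaluate equally. At a use site both normal forms
  -- are closed, so `refl` verifies the identity by computation, whatever the values in `ρ`.
  polynomial : ∀ {k} (ρ : Vec ℕ k) (e : Equation k) → let s , t = sides k 0 e in normalise {k} s ≡ normalise t → ⟦ s ⟧ ρ ≡ ⟦ t ⟧ ρ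
  polynomial {k} ρ e eq = let s , t = sides k 0 e in trans (sym (eval-normalise s ρ)) (trans (cong (λ p → eval p ρ) eq) (eval-normalise t ρ))

-- Greedy colouring with bounded loads

module GreedyColouring where
  open FiniteSums
  open import Data.Bool using (Bool; true; false; _∧_; if_then_else_)
  open import Data.Empty using (⊥-elim)
  open import Data.Fin using (Fin; zero; suc)
  open import Data.Nat using (ℕ; zero; suc; _+_; _*_; _∸_; _≤_; _<_; z≤n; s≤s; _<ᵇ_)
  open import Data.Nat.Properties
  open import Data.Product using (∃; _×_; _,_; proj₁; proj₂)
  open import Data.Sum using (_⊎_; inj₁; inj₂)
  open import Relation.Binary.PropositionalEquality

  ∪-∖ : ∀ {n} {D S : Pred n} {e} → e ∉ᵇ D → ∀ i → ((D ∪ᵇ S) ∖ e) i ≡ (D ∪ᵇ (S ∖ e)) i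
  ∪-∖ {D = D} {S} {e} p i with D i in q | i == e in r
  ... | false | _ = refl
  ... | true | false = refl
  ... | true | true = ⊥-elim (true≢false q (trans (cong D (==⇒≡ r)) p))

  ∉∪ : ∀ {n} {D S : Pred n} → (∀ i → i ∉ᵇ S) → ∀ i → (D ∪ᵇ S) i ≡ D i
  ∉∪ {D = D} p i with D i
  ... | true = refl
  ... | false = p i

  ∖-∉ : ∀ {n} (S : Pred n) e → e ∉ᵇ S ∖ e
  ∖-∉ S e rewrite ==-refl e with S e
  ... | true = refl
  ... | false = refl

  ∖-∈ : ∀ {n} {S : Pred n} {e i} → i ∈ᵇ S → i ≢ e → i ∈ᵇ S ∖ e
  ∖-∈ p q = ∧-intro p (not-intro (≢⇒== q))

  ∖-⊆ : ∀ {n} {S : Pred n} {e} → S ∖ e ⊆ᵇ S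
  ∖-⊆ i p = proj₁ (∧-true p)

  ∖-≢ : ∀ {n} {S : Pred n} {e i} → i ∈ᵇ S ∖ e → i ≢ e
  ∖-≢ {S = S} {i = i} p = ==⇒≢ (not-true (proj₂ (∧-true {S i} p)))

  #-image : ∀ {m k} (P : Pred m) (col : Fin m → Fin k) → # (λ c → some (λ i → P i ∧ (col i == c))) ≤ # P
  #-image P col = begin
    # (λ c → some (λ i → P i ∧ (col i == c)))      ≤⟨ ∑-mono (λ c → 𝟙-some≤# (λ i → P i ∧ (col i == c))) ⟩
    ∑ (λ c → # (λ i → P i ∧ (col i == c)))         ≡⟨ ∑-cong (λ c → ∑-cong (λ i → lemma (P i) (col i == c))) ⟩
    ∑ (λ c → ∑ (λ i → 𝟙 (col i == c) * 𝟙 (P i)))   ≡⟨ ∑-fibres col (λ i → 𝟙 (P i)) ⟩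
    # P ∎
    where
    open ≤-Reasoning
    lemma : ∀ a b → 𝟙 (a ∧ b) ≡ 𝟙 b * 𝟙 a
    lemma a b = trans (𝟙-∧ a b) (*-comm (𝟙 a) (𝟙 b))

  module Greedy {m k : ℕ} (adj : Fin m → Fin m → Bool)
                (adj-sym : ∀ i j → adj i j ≡ true → adj j i ≡ true)
                (adj-irrefl : ∀ i → adj i i ≡ false)
                (size : Fin m → ℕ) where

    deg : Pred m → Fin m → ℕ
    deg S e = # (λ i → S i ∧ adj e i)

    deg-mono : ∀ {S R} e → S ⊆ᵇ R → deg S e ≤ deg R e
    deg-mono {S} e p = #-mono (λ i q → let a , b = ∧-true {S i} q in ∧-intro (p i a) b)

    -- The total size of a class bounds the number of vertices that it covers.
    load : Pred m → (Fin m → Fin k) → Fin k → ℕ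
    load D col c = ∑∈ D (λ i → 𝟙 (col i == c) * size i)

    seen : Pred m → (Fin m → Fin k) → Fin m → Pred k
    seen D col e c = some (λ i → (D i ∧ adj e i) ∧ (col i == c))

    Proper : Pred m → (Fin m → Fin k) → Set
    Proper D col = ∀ i j → i ∈ᵇ D → j ∈ᵇ D → adj i j ≡ true → col i ≢ col j

    seen≤deg : ∀ D col e → # (seen D col e) ≤ deg D e
    seen≤deg D col e = #-image (λ i → D i ∧ adj e i) col

    load-cong : ∀ {D D'} {col col'} c → (∀ i → D i ≡ D' i) → (∀ i → i ∈ᵇ D → col i ≡ col' i) → load D col c ≡ load D' col' c
    load-cong {D} {D'} {col} {col'} c p q = trans
      (∑∈-cong {S = D} {f = λ i → 𝟙 (col i == c) * size i} {g = λ i → 𝟙 (col' i == c) * size i}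
        (λ i r → cong (λ x → 𝟙 (x == c) * size i) (q i r)))
      (∑-cong {f = λ i → 𝟙 (D i) * (𝟙 (col' i == c) * size i)} {g = λ i → 𝟙 (D' i) * (𝟙 (col' i == c) * size i)}
        (λ i → cong (λ b → 𝟙 b * (𝟙 (col' i == c) * size i)) (p i)))

    load-total : ∀ (D : Pred m) col (A : Pred k) → ∑∈ A (load D col) ≡ ∑∈ D (λ i → 𝟙 (A (col i)) * size i)
    load-total D col A = begin
      ∑∈ A (λ c → ∑∈ D (λ i → 𝟙 (col i == c) * size i))
        ≡⟨ ∑∈-swap A D (λ c i → 𝟙 (col i == c) * size i) ⟩
      ∑∈ D (λ i → ∑∈ A (λ c → 𝟙 (col i == c) * size i))
        ≡⟨ ∑∈-cong {S = D} (λ i _ → trans (∑-cong (λ c → lemma c i)) (∑-≡-pick (col i) (λ c → 𝟙 (A c) * size i))) ⟩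
      ∑∈ D (λ i → 𝟙 (A (col i)) * size i) ∎
      where
      open ≡-Reasoning
      lemma : ∀ c i → 𝟙 (A c) * (𝟙 (col i == c) * size i) ≡ 𝟙 (c == col i) * (𝟙 (A c) * size i)
      lemma c i rewrite ==-sym (col i) c = trans (sym (*-assoc (𝟙 (A c)) (𝟙 (c == col i)) (size i)))
        (trans (cong (_* size i) (*-comm (𝟙 (A c)) (𝟙 (c == col i)))) (*-assoc (𝟙 (c == col i)) (𝟙 (A c)) (size i)))

    -- Classes inherited from `D` may already exceed `cap`, hence the alternative in `load′`: a load
    -- either stays as it was or obeys the cap.
    record Extension (D : Pred m) (col : Fin m → Fin k) (S : Pred m) (A : Pred k) (cap : ℕ) : Set where
      field
        col′    : Fin m → Fin k
        agree   : ∀ i → i ∉ᵇ S → col′ i ≡ col i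
        proper′ : Proper (D ∪ᵇ S) col′
        palette : ∀ i → i ∈ᵇ S → col′ i ∈ᵇ A
        load′   : ∀ c → load (D ∪ᵇ S) col′ c ≡ load D col c ⊎ load (D ∪ᵇ S) col′ c ≤ cap

    Full : Pred m → (Fin m → Fin k) → Pred k → ℕ → ℕ → Pred k
    Full D col A cap s c = A c ∧ (cap <ᵇ load D col c + s)

    -- A full colour carries load at least `suc cap ∸ s`, and the loads over `A` sum to the
    -- left-hand side of the hypothesis, which is too little for `suc F` full colours.
    full-few : ∀ D col A cap s F → ∑∈ D (λ i → 𝟙 (A (col i)) * size i) < suc F * (suc cap ∸ s) → # (Full D col A cap s) ≤ F
    full-few D col A cap s F p = s≤s⁻¹ (*-cancelʳ-< (suc cap ∸ s) _ _ (≤-<-trans lemma p))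
      where
      open Data.Nat using (s≤s⁻¹)
      open ≤-Reasoning
      pt : ∀ c → 𝟙 (Full D col A cap s c) * (suc cap ∸ s) ≤ 𝟙 (A c) * load D col c
      pt c with A c
      ... | false = z≤n
      ... | true with cap <ᵇ load D col c + s in eq
      ... | false = z≤n
      ... | true = +-monoˡ-≤ 0 (≤-trans (∸-monoˡ-≤ s (<ᵇ-true {cap} eq)) (≤-reflexive (m+n∸n≡m _ s)))
      lemma : # (Full D col A cap s) * (suc cap ∸ s) ≤ ∑∈ D (λ i → 𝟙 (A (col i)) * size i)
      lemma = begin
        # (Full D col A cap s) * (suc cap ∸ s) ≡⟨ ∑-*ʳ (λ c → 𝟙 (Full D col A cap s c)) _ ⟨
        ∑ (λ c → 𝟙 (Full D col A cap s c) * (suc cap ∸ s)) ≤⟨ ∑-mono pt ⟩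
        ∑∈ A (load D col) ≡⟨ load-total D col A ⟩
        ∑∈ D (λ i → 𝟙 (A (col i)) * size i) ∎

    add-edge : ∀ {D col R A cap e s c} (E : Extension D col (R ∖ e) A cap) →
               (∀ i → i ∈ᵇ R → i ∉ᵇ D) → e ∈ᵇ R → c ∈ᵇ A → size e ≤ s →
               (∀ i → i ∈ᵇ D ∪ᵇ (R ∖ e) → adj e i ≡ true → Extension.col′ E i ≢ c) →
               load (D ∪ᵇ (R ∖ e)) (Extension.col′ E) c + s ≤ cap → Extension D col R A cap
    add-edge {D} {col} {R} {A} {cap} {e} {s} {c} E disj e∈R c∈A small fresh room = result
      where
      open Extension E renaming (col′ to col₀; agree to agree₀; proper′ to proper₀; palette to palette₀; load′ to load₀)
      R₀ = R ∖ e
      D₀ = D ∪ᵇ R₀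
      e∉D : e ∉ᵇ D
      e∉D = disj e e∈R
      col₁ : Fin m → Fin k
      col₁ i = if i == e then c else col₀ i

      col₁-e : col₁ e ≡ c
      col₁-e rewrite ==-refl e = refl

      col₁-≢ : ∀ {i} → i ≢ e → col₁ i ≡ col₀ i
      col₁-≢ p rewrite ≢⇒== p = refl

      back : ∀ {i} → i ∈ᵇ D ∪ᵇ R → i ≢ e → i ∈ᵇ D₀
      back {i} p q with ∨-true {D i} p
      ... | inj₁ d = ∨-introˡ d
      ... | inj₂ r = ∨-introʳ {D i} (∖-∈ {S = R} r q)

      proper₁ : Proper (D ∪ᵇ R) col₁
      proper₁ i j p q a with i == e in x | j == e in y
      ... | true | true rewrite ==⇒≡ {i = i} x | ==⇒≡ {i = j} y = ⊥-elim (true≢false a (adj-irrefl e))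
      ... | true | false rewrite ==⇒≡ {i = i} x = λ z → fresh j (back {j} q (==⇒≢ y)) a (sym z)
      ... | false | true rewrite ==⇒≡ {i = j} y = fresh i (back {i} p (==⇒≢ x)) (adj-sym i e a)
      ... | false | false = proper₀ i j (back {i} p (==⇒≢ x)) (back {j} q (==⇒≢ y)) a

      load₁ : ∀ c′ → load (D ∪ᵇ R) col₁ c′ ≡ 𝟙 (c == c′) * size e + load D₀ col₀ c′
      load₁ c′ = begin
        load (D ∪ᵇ R) col₁ c′ ≡⟨ ∑∈-remove {S = D ∪ᵇ R} _ (∨-introʳ {D e} e∈R) ⟩
        𝟙 (col₁ e == c′) * size e + load ((D ∪ᵇ R) ∖ e) col₁ c′
          ≡⟨ cong₂ (λ x y → 𝟙 (x == c′) * size e + y) col₁-e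
               (load-cong c′ (∪-∖ {D = D} {R} e∉D) (λ i p → col₁-≢ (∖-≢ {S = D ∪ᵇ R} p))) ⟩
        𝟙 (c == c′) * size e + load D₀ col₀ c′ ∎
        where open ≡-Reasoning

      result : Extension D col R A cap
      result = record
        { col′ = col₁
        ; agree = λ i p → trans (col₁-≢ (λ { refl → true≢false e∈R p }))
                    (agree₀ i (≢true⇒false (λ q → true≢false (∖-⊆ {S = R} i q) p)))
        ; proper′ = proper₁
        ; palette = pal
        ; load′ = ld }
        where
        pal : ∀ i → i ∈ᵇ R → col₁ i ∈ᵇ A
        pal i p with i == e in q
        ... | true = c∈A
        ... | false = palette₀ i (∖-∈ {S = R} p (==⇒≢ q))
        ld : ∀ c′ → load (D ∪ᵇ R) col₁ c′ ≡ load D col c′ ⊎ load (D ∪ᵇ R) col₁ c′ ≤ cap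
        ld c′ with c == c′ in q | load₁ c′
        ... | false | r = subst (λ x → x ≡ _ ⊎ x ≤ cap) (sym r) (load₀ c′)
        ... | true | r = inj₂ (begin
          load (D ∪ᵇ R) col₁ c′ ≡⟨ r ⟩
          size e + 0 + load D₀ col₀ c′ ≡⟨ cong₂ (λ x y → x + load D₀ col₀ y) (+-identityʳ (size e)) (sym (==⇒≡ q)) ⟩
          size e + load D₀ col₀ c ≤⟨ +-monoˡ-≤ _ small ⟩
          s + load D₀ col₀ c ≡⟨ +-comm s _ ⟩
          load D₀ col₀ c + s ≤⟨ room ⟩
          cap ∎)
          where open ≤-Reasoning

    -- Degeneracy: the edge `e` supplied for a set is coloured after the rest of that set. Its
    -- colour then has to avoid the colours seen in `D`, those of at most `deg S′ e` neighbours in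
    -- the set, and at most `F` full colours.
    extend : ∀ {D col} → Proper D col → (A : Pred k) (cap s F : ℕ) (S : Pred m) →
             (∀ i → i ∈ᵇ S → i ∉ᵇ D) →
             (∀ i → i ∈ᵇ S → size i ≤ s) →
             ∑∈ D (λ i → 𝟙 (A (col i)) * size i) + ∑∈ S size < suc F * (suc cap ∸ s) →
             (∀ S′ → S′ ⊆ᵇ S → ∀ i → i ∈ᵇ S′ → ∃ λ e → e ∈ᵇ S′ × deg S′ e + # (A ∩ᵇ seen D col e) + F < # A) →
             Extension D col S A cap
    extend {D} {col} pr A cap s F S disj small few degen = go (# S) S (λ _ p → p) ≤-refl
      where
      go : ∀ b R → R ⊆ᵇ S → # R ≤ b → Extension D col R A cap
      go b R R⊆S bound with some R in anyR
      ... | false = record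
        { col′ = col ; agree = λ _ _ → refl
        ; proper′ = λ i j p q → pr i j (trans (sym (eq i)) p) (trans (sym (eq j)) q)
        ; palette = λ i p → ⊥-elim (true≢false p (some-false {P = R} anyR i))
        ; load′ = λ c → inj₁ (load-cong c eq (λ _ _ → refl)) }
        where
        eq : ∀ i → (D ∪ᵇ R) i ≡ D i
        eq = ∉∪ {D = D} (some-false {P = R} anyR)
      go zero R R⊆S bound | true = ⊥-elim (1+n≰n (≤-trans (#-member {S = R} (proj₂ (some-true {P = R} anyR))) bound))
      go (suc b) R R⊆S bound | true with degen R R⊆S _ (proj₂ (some-true {P = R} anyR))
      ... | e , e∈R , room = step
        where
        R₀ = R ∖ e
        IH : Extension D col R₀ A cap
        IH = go b R₀ (λ i p → R⊆S i (proj₁ (∧-true p)))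
               (Data.Nat.s≤s⁻¹ (subst (_≤ suc b) (#-remove {S = R} e∈R) bound))
        open Extension IH renaming (col′ to col₀; agree to agree₀; proper′ to proper₀; palette to palette₀; load′ to load₀)
        D₀ = D ∪ᵇ R₀
        full = Full D₀ col₀ A cap s
        D⇒∉R₀ : ∀ i → i ∈ᵇ D → i ∉ᵇ R₀
        D⇒∉R₀ i p = ≢true⇒false (λ q → true≢false p (disj i (R⊆S i (∖-⊆ {S = R} i q))))

        total : ∑∈ D₀ (λ i → 𝟙 (A (col₀ i)) * size i) ≤ ∑∈ D (λ i → 𝟙 (A (col i)) * size i) + ∑∈ S size
        total = ≤-trans (∑∈-∪-≤ D R₀ _) (+-mono-≤
          (≤-reflexive (∑∈-cong {S = D} (λ i p → cong (λ x → 𝟙 (A x) * size i) (agree₀ i (D⇒∉R₀ i p)))))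
          (∑∈-mono {S = R₀} {S} (λ i p → R⊆S i (∖-⊆ {S = R} i p) ,
            ≤-trans (*-monoˡ-≤ (size i) (𝟙≤1 (A (col₀ i)))) (≤-reflexive (*-identityˡ (size i))))))

        few-full : # full ≤ F
        few-full = full-few D₀ col₀ A cap s F (≤-<-trans total few)

        -- Counts the objections to a colour. Where `busy c < 𝟙 (A c)`, the colour lies in `A` and
        -- meets no objection.
        busy : Fin k → ℕ
        busy c = 𝟙 ((A ∩ᵇ seen D col e) c) + 𝟙 (seen R₀ col₀ e c) + 𝟙 (full c)

        busy-few : ∑ busy < # A
        busy-few = ≤-<-trans (begin
          ∑ busy ≡⟨ trans (∑-+ _ _) (cong (_+ # full) (∑-+ _ _)) ⟩
          # (A ∩ᵇ seen D col e) + # (seen R₀ col₀ e) + # full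
            ≤⟨ +-mono-≤ (+-monoʳ-≤ (# (A ∩ᵇ seen D col e)) (≤-trans (seen≤deg R₀ col₀ e) (deg-mono {R₀} {R} e (∖-⊆ {S = R})))) few-full ⟩
          # (A ∩ᵇ seen D col e) + deg R e + F ≡⟨ cong (_+ F) (+-comm _ (deg R e)) ⟩
          deg R e + # (A ∩ᵇ seen D col e) + F ∎) room
          where open ≤-Reasoning

        c-free : ∀ a x y z → 𝟙 (a ∧ x) + 𝟙 y + 𝟙 (a ∧ z) < 𝟙 a → a ≡ true × x ≡ false × y ≡ false × z ≡ false
        c-free true false false false _ = refl , refl , refl , refl
        c-free true true _ _ (s≤s ())
        c-free true false true _ (s≤s ())
        c-free true false false true (s≤s ())

        step : Extension D col R A cap
        step with ∑-exists-< {f = busy} {λ c → 𝟙 (A c)} busy-few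
        ... | c , p with c-free (A c) (seen D col e c) (seen R₀ col₀ e c) (cap <ᵇ load D₀ col₀ c + s) p
        ... | c∈A , unseenD , unseenR , unfull =
          add-edge IH (λ i p → disj i (R⊆S i p)) e∈R c∈A (small e (R⊆S e e∈R)) fresh (<ᵇ-false unfull)
          where
          fresh : ∀ i → i ∈ᵇ D₀ → adj e i ≡ true → col₀ i ≢ c
          fresh i p a q with ∨-true {D i} p
          ... | inj₁ d = true≢false
            (some-intro {P = λ i → (D i ∧ adj e i) ∧ (col i == c)} {i} (∧-intro (∧-intro d a)
              (trans (cong (_== c) (trans (sym (agree₀ i (D⇒∉R₀ i d))) q)) (==-refl c)))) unseenD
          ... | inj₂ r = true≢false
            (some-intro {P = λ i → (R₀ i ∧ adj e i) ∧ (col₀ i == c)} {i} (∧-intro (∧-intro r a)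
              (trans (cong (_== c) q) (==-refl c)))) unseenR

-- Double counting in linear hypergraphs

module LinearIncidence where
  open FiniteSums
  open GreedyColouring
  open PolynomialIdentities using (polynomial; _:=_; _:+_; _:*_; con)
  open import Data.Bool using (Bool; true; false; _∧_; not)
  open import Data.Empty using (⊥-elim)
  open import Data.Fin using (Fin; zero; suc)
  import Data.Fin as Fin
  open import Data.Nat using (ℕ; zero; suc; _+_; _*_; _∸_; _≤_; z≤n; s≤s; _<ᵇ_)
  open import Data.Nat.Properties
  open import Data.Product using (∃; _×_; _,_; proj₁; proj₂)
  open import Data.Vec using ([]; _∷_)
  open import Relation.Binary.PropositionalEquality
  open import Relation.Nullary using (yes; no)

  -- The multipliers below are certificates found by linear programming.  The identity keeps a on the left, the
  -- hypotheses crossed over and a slack s, so that no subtraction occurs.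
  farkas : ∀ k {L R a b s} → L ≤ R → suc k * a + R + s ≡ suc k * b + L → a ≤ b
  farkas k {L} {R} {a} {b} {s} p eq = *-cancelˡ-≤ (suc k) (+-cancelʳ-≤ R _ _ (begin
    suc k * a + R     ≤⟨ m≤m+n _ s ⟩
    suc k * a + R + s ≡⟨ eq ⟩
    suc k * b + L     ≤⟨ +-monoʳ-≤ (suc k * b) p ⟩
    suc k * b + R ∎))
    where open ≤-Reasoning

  -- The inequality 0 ≤ (b - a)(d - c) without subtraction: it lets a certificate use the product of
  -- two hypotheses.
  ≤-prod : ∀ {a b c d} → a ≤ b → c ≤ d → a * d + b * c ≤ b * d + a * c
  ≤-prod {a} {b} {c} {d} p q with m≤n⇒∃[o]m+o≡n p | m≤n⇒∃[o]m+o≡n q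
  ... | k , refl | l , refl = farkas 0 (≤-refl {0})
    (polynomial (a ∷ k ∷ c ∷ l ∷ []) (λ a k c l → con 1 :* (a :* (c :+ l) :+ (a :+ k) :* c) :+ con 0 :+ k :* l := con 1 :* ((a :+ k) :* (c :+ l) :+ a :* c) :+ con 0) refl)

  module Linear {n m : ℕ} (a : Fin m → Fin n → Bool)
    (lin : ∀ i j → i ≢ j → ∀ u v → u ∈ᵇ a i → u ∈ᵇ a j → v ∈ᵇ a i → v ∈ᵇ a j → u ≡ v) where

    size : Fin m → ℕ
    size i = # (a i)

    meets : Fin m → Fin m → Bool
    meets i j = some (a i ∩ᵇ a j)

    adj : Fin m → Fin m → Bool
    adj i j = not (i == j) ∧ meets i j

    meets-sym : ∀ i j → meets i j ≡ true → meets j i ≡ true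
    meets-sym i j p with some-true {P = a i ∩ᵇ a j} p
    ... | v , q = some-intro {P = a j ∩ᵇ a i} {v} (∧-intro (proj₂ (∧-true {a i v} q)) (proj₁ (∧-true {a i v} q)))

    adj-sym : ∀ i j → adj i j ≡ true → adj j i ≡ true
    adj-sym i j p with ∧-true {not (i == j)} p
    ... | q , r = ∧-intro (trans (cong not (==-sym j i)) q) (meets-sym i j r)

    adj-irrefl : ∀ i → adj i i ≡ false
    adj-irrefl i rewrite ==-refl i = refl

    adj-≢ : ∀ {i j} → adj i j ≡ true → i ≢ j
    adj-≢ {i} {j} p = ==⇒≢ (not-true (proj₁ (∧-true {not (i == j)} p)))

    adj-point : ∀ {i j} → adj i j ≡ true → ∃ λ v → v ∈ᵇ a i × v ∈ᵇ a j
    adj-point {i} {j} p with some-true {P = a i ∩ᵇ a j} (proj₂ (∧-true {not (i == j)} p))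
    ... | v , q = v , ∧-true {a i v} q

    adj-intro : ∀ {i j v} → i ≢ j → v ∈ᵇ a i → v ∈ᵇ a j → adj i j ≡ true
    adj-intro {i} {j} {v} p q r = ∧-intro (not-intro (≢⇒== p)) (some-intro {P = a i ∩ᵇ a j} {v} (∧-intro q r))

    d : Pred m → Fin n → ℕ
    d S v = # (λ j → S j ∧ a j v)

    codeg : Pred m → Fin n → Fin n → ℕ
    codeg S u v = # (λ j → (S j ∧ a j u) ∧ a j v)

    supp : Pred m → Pred n
    supp S u = some (λ j → S j ∧ a j u)

    codeg≤1 : ∀ S {u v} → u ≢ v → codeg S u v ≤ 1
    codeg≤1 S {u} {v} p = #≤1 λ i j q r → lemma i j (∧-true {S i ∧ a i u} q) (∧-true {S j ∧ a j u} r)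
      where
      lemma : ∀ i j → S i ∧ a i u ≡ true × a i v ≡ true → S j ∧ a j u ≡ true × a j v ≡ true → i ≡ j
      lemma i j (x , y) (z , w) with i Fin.≟ j
      ... | yes q = q
      ... | no q = ⊥-elim (p (lin i j q u v (proj₂ (∧-true {S i} x)) (proj₂ (∧-true {S j} z)) y w))

    -- `deg` depends on adjacency alone; the number of colours gets the dummy value `0`.
    open Greedy {m} {0} adj adj-sym adj-irrefl size using (deg) public

    ∑-d : ∀ (S : Pred m) → ∑ (d S) ≡ ∑∈ S size
    ∑-d S = trans (∑-swap (λ v j → 𝟙 (S j ∧ a j v))) (∑-cong (λ j →
      trans (∑-cong (λ v → 𝟙-∧ (S j) (a j v))) (sym (∑-*ˡ (𝟙 (S j)) (λ v → 𝟙 (a j v))))))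

    -- Regrouped by vertices, a sum along the star of `v` weights `u` by its codegree with `v`,
    -- which linearity bounds by 1 away from `v`.
    star-sum : ∀ (S : Pred m) v (f : Fin n → ℕ) →
               ∑∈ (λ j → S j ∧ a j v) (λ j → ∑∈ (a j) f) ≡ ∑ (λ u → codeg S v u * f u)
    star-sum S v f = begin
      ∑ (λ j → 𝟙 (S j ∧ a j v) * ∑ (λ u → 𝟙 (a j u) * f u))
        ≡⟨ ∑-cong (λ j → ∑-*ˡ (𝟙 (S j ∧ a j v)) _) ⟩
      ∑ (λ j → ∑ (λ u → 𝟙 (S j ∧ a j v) * (𝟙 (a j u) * f u)))
        ≡⟨ ∑-swap (λ j u → 𝟙 (S j ∧ a j v) * (𝟙 (a j u) * f u)) ⟩
      ∑ (λ u → ∑ (λ j → 𝟙 (S j ∧ a j v) * (𝟙 (a j u) * f u)))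
        ≡⟨ ∑-cong (λ u → trans (∑-cong (λ j → lemma (S j ∧ a j v) (a j u) (f u)))
                               (∑-*ʳ (λ j → 𝟙 ((S j ∧ a j v) ∧ a j u)) (f u))) ⟩
      ∑ (λ u → codeg S v u * f u) ∎
      where
      open ≡-Reasoning
      lemma : ∀ b c x → 𝟙 b * (𝟙 c * x) ≡ 𝟙 (b ∧ c) * x
      lemma true c x = +-identityʳ _
      lemma false c x = refl

    codeg-self : ∀ S v → codeg S v v ≡ d S v
    codeg-self S v = ∑-cong (λ j → cong 𝟙 (lemma (S j) (a j v)))
      where
      lemma : ∀ x y → (x ∧ y) ∧ y ≡ x ∧ y
      lemma true true = refl
      lemma true false = refl
      lemma false _ = refl

    size≡∑∈ : ∀ j → size j ≡ ∑∈ (a j) (λ _ → 1)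
    size≡∑∈ j = #≡∑∈ (a j)

    -- The edges through `v` are disjoint outside `v`. The bound is stated with the support of `S`
    -- rather than all vertices because the de Bruijn-Erdős count compares the number of edges with
    -- that support.
    star-size : ∀ S v → ∑∈ (λ j → S j ∧ a j v) size ≤ d S v + # (supp S ∖ v)
    star-size S v = begin
      ∑∈ (λ j → S j ∧ a j v) size
        ≡⟨ ∑∈-cong {S = λ j → S j ∧ a j v} (λ j _ → size≡∑∈ j) ⟩
      ∑∈ (λ j → S j ∧ a j v) (λ j → ∑∈ (a j) (λ _ → 1)) ≡⟨ star-sum S v (λ _ → 1) ⟩
      ∑ (λ u → codeg S v u * 1) ≤⟨ ∑-mono lemma ⟩
      ∑ (λ u → 𝟙 (u == v) * d S u + 𝟙 ((supp S ∖ v) u)) ≡⟨ ∑-+ _ _ ⟩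
      ∑ (λ u → 𝟙 (u == v) * d S u) + # (supp S ∖ v) ≡⟨ cong (_+ # (supp S ∖ v)) (∑-≡-pick v (d S)) ⟩
      d S v + # (supp S ∖ v) ∎
      where
      open ≤-Reasoning
      lemma : ∀ u → codeg S v u * 1 ≤ 𝟙 (u == v) * d S u + 𝟙 ((supp S ∖ v) u)
      lemma u rewrite *-identityʳ (codeg S v u) with u == v in eq
      ... | true rewrite ==⇒≡ {i = u} eq | codeg-self S v = ≤-trans (≤-reflexive (sym (+-identityʳ _))) (m≤m+n _ _)
      ... | false with supp S u in eq'
      ... | true = codeg≤1 S (λ q → ==⇒≢ eq (sym q))
      ... | false = ≤-reflexive (∑-0 (λ j → cong 𝟙 (trans (cong (_∧ a j u) refl) (none j))))
        where
        none : ∀ j → (S j ∧ a j v) ∧ a j u ≡ false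
        none j = ≢true⇒false (λ q → let x , y = ∧-true {S j ∧ a j v} q in
          true≢false (∧-intro (proj₁ (∧-true {S j} x)) y) (some-false {P = λ j → S j ∧ a j u} eq' j))

    star-size≤n : ∀ S v → ∑∈ (λ j → S j ∧ a j v) size ≤ d S v + n
    star-size≤n S v = ≤-trans (star-size S v) (+-monoʳ-≤ (d S v) (#≤n (supp S ∖ v)))

    d-bound : ∀ S ρ → (∀ j → j ∈ᵇ S → suc ρ ≤ size j) → ∀ v → d S v * ρ ≤ n
    d-bound S ρ p v = +-cancelˡ-≤ (d S v) _ _ (begin
      d S v + d S v * ρ ≡⟨ *-suc (d S v) ρ ⟨
      d S v * suc ρ ≡⟨ ∑∈-const (λ j → S j ∧ a j v) (suc ρ) ⟨
      ∑∈ (λ j → S j ∧ a j v) (λ _ → suc ρ) ≤⟨ ∑∈-monoʳ {S = λ j → S j ∧ a j v} (λ j q → p j (proj₁ (∧-true {S j} q))) ⟩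
      ∑∈ (λ j → S j ∧ a j v) size ≤⟨ star-size≤n S v ⟩
      d S v + n ∎)
      where open ≤-Reasoning

    deg≤∑d : ∀ S e → deg S e ≤ ∑∈ (a e) (d S)
    deg≤∑d S e = begin
      # (λ i → S i ∧ adj e i) ≤⟨ ∑-mono lemma ⟩
      ∑ (λ i → ∑ (λ v → 𝟙 (a e v) * 𝟙 (S i ∧ a i v))) ≡⟨ ∑-swap (λ i v → 𝟙 (a e v) * 𝟙 (S i ∧ a i v)) ⟩
      ∑ (λ v → ∑ (λ i → 𝟙 (a e v) * 𝟙 (S i ∧ a i v))) ≡⟨ ∑-cong (λ v → sym (∑-*ˡ (𝟙 (a e v)) _)) ⟩
      ∑∈ (a e) (d S) ∎
      where
      open ≤-Reasoning
      lemma : ∀ i → 𝟙 (S i ∧ adj e i) ≤ ∑ (λ v → 𝟙 (a e v) * 𝟙 (S i ∧ a i v))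
      lemma i with S i ∧ adj e i in eq
      ... | false = z≤n
      ... | true with ∧-true {S i} eq
      ... | x , y with adj-point {e} {i} y
      ... | v , p , q = ≤-trans (≤-reflexive (sym (cong₂ (λ b c → 𝟙 b * 𝟙 c) p (∧-intro x q))))
                          (∑-term (λ v → 𝟙 (a e v) * 𝟙 (S i ∧ a i v)) v)

    deg-bound : ∀ S ρ → (∀ j → j ∈ᵇ S → suc ρ ≤ size j) → ∀ e → deg S e * ρ ≤ size e * n
    deg-bound S ρ p e = begin
      deg S e * ρ ≤⟨ *-monoˡ-≤ ρ (deg≤∑d S e) ⟩
      ∑∈ (a e) (d S) * ρ ≡⟨ *-comm _ ρ ⟩
      ρ * ∑∈ (a e) (d S) ≡⟨ ∑∈-*ˡ (a e) ρ (d S) ⟨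
      ∑∈ (a e) (λ v → ρ * d S v) ≤⟨ ∑∈-monoʳ {S = a e} (λ v _ → ≤-trans (≤-reflexive (*-comm ρ _)) (d-bound S ρ p v)) ⟩
      ∑∈ (a e) (λ _ → n) ≡⟨ ∑∈-const (a e) n ⟩
      size e * n ∎
      where open ≤-Reasoning

    -- Summing the star bound over all vertices counts every edge once per vertex with weight its
    -- size; this takes the place of counting pairs of vertices.
    ∑-size² : ∀ S → ∑∈ S (λ j → size j * size j) ≤ ∑∈ S size + n * n
    ∑-size² S = begin
      ∑∈ S (λ j → size j * size j) ≡⟨ ∑-cong (λ j → trans (cong (λ x → 𝟙 (S j) * x) (*-comm-∑ j)) (∑-*ˡ (𝟙 (S j)) _)) ⟩
      ∑ (λ j → ∑ (λ v → 𝟙 (S j) * (𝟙 (a j v) * size j))) ≡⟨ ∑-swap (λ j v → 𝟙 (S j) * (𝟙 (a j v) * size j)) ⟩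
      ∑ (λ v → ∑ (λ j → 𝟙 (S j) * (𝟙 (a j v) * size j))) ≡⟨ ∑-cong (λ v → ∑-cong (λ j → lemma (S j) (a j v) (size j))) ⟩
      ∑ (λ v → ∑∈ (λ j → S j ∧ a j v) size) ≤⟨ ∑-mono (star-size≤n S) ⟩
      ∑ (λ v → d S v + n) ≡⟨ trans (∑-+ _ _) (cong₂ _+_ (∑-d S) (∑-const n n)) ⟩
      ∑∈ S size + n * n ∎
      where
      open ≤-Reasoning
      *-comm-∑ : ∀ j → size j * size j ≡ ∑ (λ v → 𝟙 (a j v) * size j)
      *-comm-∑ j = sym (∑-*ʳ (λ v → 𝟙 (a j v)) (size j))
      lemma : ∀ b c x → 𝟙 b * (𝟙 c * x) ≡ 𝟙 (b ∧ c) * x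
      lemma true c x = +-identityʳ _
      lemma false c x = refl

    -- Twice the numerator of the normalised volume.
    vol : Pred m → ℕ
    vol S = ∑∈ S (λ j → size j * (size j ∸ 1))

    vol+∑size : ∀ S → vol S + ∑∈ S size ≡ ∑∈ S (λ j → size j * size j)
    vol+∑size S = trans (sym (∑∈-+ S (λ j → size j * (size j ∸ 1)) size)) (∑∈-cong {S = S} (λ j _ → lemma (size j)))
      where
      lemma : ∀ x → x * (x ∸ 1) + x ≡ x * x
      lemma zero = refl
      lemma (suc x) = trans (+-comm (suc x * x) (suc x)) (sym (*-suc (suc x) x))

    vol≤n² : ∀ S → vol S ≤ n * n
    vol≤n² S = +-cancelʳ-≤ (∑∈ S size) _ _ (≤-trans (≤-reflexive (vol+∑size S))
      (≤-trans (∑-size² S) (≤-reflexive (+-comm (∑∈ S size) _))))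

    ρ∑size≤vol : ∀ S ρ → (∀ j → j ∈ᵇ S → suc ρ ≤ size j) → ρ * ∑∈ S size ≤ vol S
    ρ∑size≤vol S ρ p = ≤-trans (≤-reflexive (sym (∑∈-*ˡ S ρ size))) (∑∈-monoʳ {S = S} (λ j q →
      ≤-trans (≤-reflexive (*-comm ρ (size j))) (*-monoʳ-≤ (size j) (∸-monoˡ-≤ 1 (p j q)))))

    vol-split : ∀ S R → vol S ≡ vol (S ∩ᵇ R) + vol (S ∖ᵇ R)
    vol-split S R = ∑∈-split S R _

    vol-mono : ∀ {S R} → S ⊆ᵇ R → vol S ≤ vol R
    vol-mono {S} {R} p = ∑∈-monoˡ {S = S} {R} p

    common : Pred m → Fin m → Fin m → ℕ
    common S i j = # (λ w → (S w ∧ adj i w) ∧ adj j w)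

    -- Let x be the common vertex of `i` and `j`. An edge meeting both contains x, or it is
    -- determined by its two distinct meeting points, one on `i` and one on `j`.
    common-bound : ∀ S ρ → (∀ j → j ∈ᵇ S → suc ρ ≤ size j) → ∀ {i j} → adj i j ≡ true →
                   common S i j * ρ ≤ n + size i * size j * ρ
    common-bound S ρ p {i} {j} ij with adj-point {i} {j} ij
    ... | x , xi , xj = begin
      common S i j * ρ ≤⟨ *-monoˡ-≤ ρ count ⟩
      (d S x + size i * size j) * ρ ≡⟨ *-distribʳ-+ ρ (d S x) _ ⟩
      d S x * ρ + size i * size j * ρ ≤⟨ +-monoˡ-≤ _ (d-bound S ρ p x) ⟩
      n + size i * size j * ρ ∎
      where
      open ≤-Reasoning
      g : Fin m → Fin n → Fin n → ℕ
      g w u v = 𝟙 (a i u) * (𝟙 (a j v) * (𝟙 (not (u == v)) * 𝟙 ((S w ∧ a w u) ∧ a w v)))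
      pt : ∀ w → 𝟙 ((S w ∧ adj i w) ∧ adj j w) ≤ 𝟙 (S w ∧ a w x) + ∑ (λ u → ∑ (λ v → g w u v))
      pt w with (S w ∧ adj i w) ∧ adj j w in eq
      ... | false = z≤n
      ... | true with ∧-true {S w ∧ adj i w} eq
      ... | q , jw with ∧-true {S w} q
      ... | sw , iw with adj-point {i} {w} iw | adj-point {j} {w} jw
      ... | u , ui , uw | v , vj , vw with u Fin.≟ v
      ... | yes refl rewrite lin i j (adj-≢ {i} {j} ij) x u xi xj ui vj | sw | uw = s≤s z≤n
      ... | no u≢v = ≤-trans (≤-trans (≤-reflexive (sym one))
                (≤-trans (∑-term (g w u) v) (∑-term (λ u → ∑ (g w u)) u))) (m≤n+m _ _)
        where
        one : g w u v ≡ 1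
        one rewrite ui | vj | ≢⇒== u≢v | sw | uw | vw = refl
      cd : ∀ u v → 𝟙 (not (u == v)) * codeg S u v ≤ 1
      cd u v with u == v in eq
      ... | true = z≤n
      ... | false = ≤-trans (≤-reflexive (+-identityʳ _)) (codeg≤1 S (==⇒≢ eq))
      gsum : ∀ u v → ∑ (λ w → g w u v) ≤ 𝟙 (a i u) * (𝟙 (a j v) * 1)
      gsum u v = begin
        ∑ (λ w → g w u v) ≡⟨ ∑-*ˡ (𝟙 (a i u)) _ ⟨
        𝟙 (a i u) * ∑ (λ w → 𝟙 (a j v) * (𝟙 (not (u == v)) * 𝟙 ((S w ∧ a w u) ∧ a w v)))
          ≡⟨ cong (𝟙 (a i u) *_) (trans (sym (∑-*ˡ (𝟙 (a j v)) _)) (cong (𝟙 (a j v) *_) (sym (∑-*ˡ (𝟙 (not (u == v))) _)))) ⟩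
        𝟙 (a i u) * (𝟙 (a j v) * (𝟙 (not (u == v)) * codeg S u v))
          ≤⟨ *-monoʳ-≤ (𝟙 (a i u)) (*-monoʳ-≤ (𝟙 (a j v)) (cd u v)) ⟩
        𝟙 (a i u) * (𝟙 (a j v) * 1) ∎
      count : common S i j ≤ d S x + size i * size j
      count = begin
        common S i j ≤⟨ ∑-mono pt ⟩
        ∑ (λ w → 𝟙 (S w ∧ a w x) + ∑ (λ u → ∑ (λ v → g w u v))) ≡⟨ ∑-+ _ _ ⟩
        d S x + ∑ (λ w → ∑ (λ u → ∑ (λ v → g w u v)))
          ≡⟨ cong (d S x +_) (trans (∑-swap (λ w u → ∑ (λ v → g w u v))) (∑-cong (λ u → ∑-swap (λ w v → g w u v)))) ⟩
        d S x + ∑ (λ u → ∑ (λ v → ∑ (λ w → g w u v)))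
          ≤⟨ +-monoʳ-≤ (d S x) (∑-mono (λ u → ∑-mono (gsum u))) ⟩
        d S x + ∑ (λ u → ∑ (λ v → 𝟙 (a i u) * (𝟙 (a j v) * 1)))
          ≡⟨ cong (d S x +_) (∑-cong (λ u → trans (sym (∑-*ˡ (𝟙 (a i u)) _)) (cong (𝟙 (a i u) *_) (sym (size≡∑∈ j))))) ⟩
        d S x + ∑ (λ u → 𝟙 (a i u) * size j) ≡⟨ cong (d S x +_) (∑-*ʳ (λ u → 𝟙 (a i u)) (size j)) ⟩
        d S x + size i * size j ∎

    -- Averaging the neighbours of `e₀` over its vertices yields a vertex of degree `d₀` at least D
    -- / size e₀. The last bound counts the neighbours of the `d₀` edges at this vertex: these edges
    -- overlap only there, so each other vertex contributes its degree at most once, and the vertex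
    -- itself contributes `d₀ * d₀`.
    dense-core : ∀ S ρ D {e₀} → (∀ j → j ∈ᵇ S → suc ρ ≤ size j) → (∀ j → j ∈ᵇ S → D ≤ deg S j) → e₀ ∈ᵇ S →
                 ∃ λ d₀ → D ≤ size e₀ * d₀ × d₀ * ρ ≤ n × d₀ * D ≤ ∑∈ S size + d₀ * d₀
    dense-core S ρ D {e₀} p q e₀∈S =
      let v , good-v = pick in d S v , good-v , d-bound S ρ p v , third v
      where
      open ≤-Reasoning
      good : Pred n
      good v = a e₀ v ∧ not (size e₀ * d S v <ᵇ D)
      exists : some good ≡ true
      exists with some good in eq
      ... | true = refl
      ... | false = ⊥-elim (1+n≰n (≤-trans (s≤s (m≤n+m _ ρ)) (≤-trans (+-monoˡ-≤ X (p e₀ e₀∈S)) lt)))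
        where
        X = size e₀ * ∑∈ (a e₀) (d S)
        bad : ∀ v → v ∈ᵇ a e₀ → 1 + size e₀ * d S v ≤ D
        bad v r with size e₀ * d S v <ᵇ D in eq'
        ... | true = <ᵇ-true eq'
        ... | false = ⊥-elim (true≢false (∧-intro r (not-intro eq')) (some-false {P = good} eq v))
        -- If no vertex of `e₀` were good, the unit of slack in `bad`, summed over `e₀`, would add
        -- the positive number `size e₀`.
        lt : size e₀ + X ≤ X
        lt = begin
          size e₀ + X ≡⟨ cong₂ _+_ (size≡∑∈ e₀) (sym (∑∈-*ˡ (a e₀) (size e₀) (d S))) ⟩
          ∑∈ (a e₀) (λ _ → 1) + ∑∈ (a e₀) (λ v → size e₀ * d S v) ≡⟨ ∑∈-+ (a e₀) (λ _ → 1) _ ⟨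
          ∑∈ (a e₀) (λ v → 1 + size e₀ * d S v) ≤⟨ ∑∈-monoʳ {S = a e₀} bad ⟩
          ∑∈ (a e₀) (λ _ → D) ≡⟨ ∑∈-const (a e₀) D ⟩
          size e₀ * D ≤⟨ *-monoʳ-≤ (size e₀) (≤-trans (q e₀ e₀∈S) (deg≤∑d S e₀)) ⟩
          X ∎
      pick : ∃ λ v → D ≤ size e₀ * d S v
      pick with some-true {P = good} exists
      ... | v , r = v , <ᵇ-false (not-true (proj₂ (∧-true {a e₀ v} r)))
      third : ∀ v → d S v * D ≤ ∑∈ S size + d S v * d S v
      third v = begin
        d S v * D ≡⟨ ∑∈-const (λ j → S j ∧ a j v) D ⟨
        ∑∈ (λ j → S j ∧ a j v) (λ _ → D)
          ≤⟨ ∑∈-monoʳ {S = λ j → S j ∧ a j v} (λ j r → ≤-trans (q j (proj₁ (∧-true {S j} r))) (deg≤∑d S j)) ⟩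
        ∑∈ (λ j → S j ∧ a j v) (λ j → ∑∈ (a j) (d S)) ≡⟨ star-sum S v (d S) ⟩
        ∑ (λ u → codeg S v u * d S u) ≤⟨ ∑-mono lemma ⟩
        ∑ (λ u → d S u + 𝟙 (u == v) * (d S v * d S u)) ≡⟨ ∑-+ _ _ ⟩
        ∑ (d S) + ∑ (λ u → 𝟙 (u == v) * (d S v * d S u)) ≡⟨ cong₂ _+_ (∑-d S) (∑-≡-pick v (λ u → d S v * d S u)) ⟩
        ∑∈ S size + d S v * d S v ∎
        where
        lemma : ∀ u → codeg S v u * d S u ≤ d S u + 𝟙 (u == v) * (d S v * d S u)
        lemma u with u == v in eq
        ... | false = ≤-trans (*-monoˡ-≤ (d S u) (codeg≤1 S (λ r → ==⇒≢ eq (sym r)))) (≤-reflexive refl)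
        ... | true rewrite ==⇒≡ {i = u} eq | codeg-self S v = ≤-trans (≤-reflexive (sym (+-identityʳ (d S v * d S v)))) (m≤n+m _ (d S v))

-- Subfamilies of large minimum degree and peeling

module DenseSubsets where
  open FiniteSums
  open GreedyColouring
  open LinearIncidence
  open PolynomialIdentities using (polynomial; _:=_; _:+_; _:*_; con)
  open import Data.Bool using (Bool; true; false; _∧_; not)
  open import Data.Empty using (⊥; ⊥-elim)
  open import Data.Fin using (Fin; zero; suc)
  open import Data.Nat using (ℕ; zero; suc; _+_; _*_; _∸_; _≤_; _<_; z≤n; s≤s; s≤s⁻¹; _<ᵇ_)
  open import Data.Nat.Properties
  open import Data.Product using (∃; _×_; _,_; proj₁)
  open import Data.Sum using (inj₁; inj₂)
  open import Data.Vec using ([]; _∷_)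
  open import Relation.Binary.PropositionalEquality
  open import Relation.Nullary using (yes; no)
  -- The steps towards `uniform-arith`, in real terms: d ≤ n/q, hence d ≤ D; then D² ≤ rT + Dd,
  -- hence rT ≥ (1 - 3/q)n² and finally ρT ≥ (1 - 4/q)n².
  u-s1 : ∀ q ρ d n → q ≤ ρ → d * ρ ≤ n → q * d ≤ n
  u-s1 q ρ d n h1 h2 = farkas 0 (+-mono-≤ (*-monoʳ-≤ d h1) h2)
    (polynomial (q ∷ ρ ∷ d ∷ n ∷ []) (λ q ρ d n → con 1 :* (q :* d) :+ (d :* ρ :+ n) :+ con 0 := con 1 :* n :+ (d :* q :+ (d :* ρ))) refl)

  u-s2 : ∀ q d D n → q * d ≤ n → q * n ≤ q * D + n → 2 ≤ q → q * d ≤ q * D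
  u-s2 q d D n h1 h2 h3 = farkas 0 (+-mono-≤ (+-mono-≤ h1 h2) (*-monoʳ-≤ n h3))
    (polynomial (q ∷ d ∷ D ∷ n ∷ []) (λ q d D n → con 1 :* (q :* d) :+ (n :+ (q :* D :+ n) :+ n :* q) :+ con 0 := con 1 :* (q :* D) :+ ((q :* d) :+ (q :* n) :+ n :* con 2)) refl)

  u-s3 : ∀ d D r T → d ≤ D → D ≤ r * d → d * D ≤ T + d * d → D * D ≤ r * T + D * d
  u-s3 d D r T h1 h2 h3 = farkas 0 (+-mono-≤ (*-monoʳ-≤ r h3) (≤-prod h1 h2))
    (polynomial (d ∷ D ∷ r ∷ T ∷ []) (λ d D r T → con 1 :* (D :* D) :+ (r :* (T :+ d :* d) :+ (D :* (r :* d) :+ d :* D)) :+ con 0 := con 1 :* (r :* T :+ D :* d) :+ (r :* (d :* D) :+ (d :* (r :* d) :+ D :* D))) refl)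

  u-s4 : ∀ q d D n r T → q * d ≤ n → q * n ≤ q * D + n → D * D ≤ r * T + D * d → 2 ≤ q → q * (q * (n * n)) ≤ q * (q * (r * T) + 3 * (n * n))
  u-s4 q d D n r T h1 h2 h3 h4 = farkas 0 (+-mono-≤ (+-mono-≤ (+-mono-≤ (*-monoʳ-≤ (D * q) h1) (*-monoʳ-≤ (D * q) h2)) (*-monoʳ-≤ (q * q) h3)) (*-monoʳ-≤ n (≤-prod h2 h4)))
    (polynomial (q ∷ d ∷ D ∷ n ∷ r ∷ T ∷ []) (λ q d D n r T → con 1 :* (q :* (q :* (n :* n))) :+ ((D :* q) :* n :+ (D :* q) :* (q :* D :+ n) :+ (q :* q) :* (r :* T :+ D :* d) :+ n :* ((q :* D :+ n) :* q :+ (q :* n) :* con 2)) :+ (con 2 :* n :* n) := con 1 :* (q :* (q :* (r :* T) :+ con 3 :* (n :* n))) :+ ((D :* q) :* (q :* d) :+ (D :* q) :* (q :* n) :+ (q :* q) :* (D :* D) :+ n :* ((q :* n) :* q :+ (q :* D :+ n) :* con 2))) refl)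

  u-s5 : ∀ q n ρ T → q * (n * n) ≤ q * ((1 + ρ) * T) + 3 * (n * n) → ρ * T ≤ n * n → q ≤ ρ → q * (n * n) ≤ q * (ρ * T) + 4 * (n * n)
  u-s5 q n ρ T h1 h2 h3 = farkas 0 (+-mono-≤ (+-mono-≤ h1 h2) (*-monoʳ-≤ T h3))
    (polynomial (q ∷ n ∷ ρ ∷ T ∷ []) (λ q n ρ T → con 1 :* (q :* (n :* n)) :+ ((q :* ((con 1 :+ ρ) :* T) :+ con 3 :* (n :* n)) :+ (n :* n) :+ T :* ρ) :+ con 0 := con 1 :* (q :* (ρ :* T) :+ con 4 :* (n :* n)) :+ ((q :* (n :* n)) :+ (ρ :* T) :+ T :* q)) refl)

  -- The steps towards `dense-arith`: 2d ≤ D gives D² ≤ 2rT with r = 1 + ρ ≤ 2ρ; since D ≥ n/K and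
  -- ρT ≤ V, this yields V ≥ n²/4K².
  d-s1 : ∀ K d ρ n D → d * ρ ≤ n → n ≤ K * D → 2 * K ≤ ρ → K * (2 * d) ≤ K * D
  d-s1 K d ρ n D h1 h2 h3 = farkas 0 (+-mono-≤ (+-mono-≤ h1 h2) (*-monoʳ-≤ d h3))
    (polynomial (K ∷ d ∷ ρ ∷ n ∷ D ∷ []) (λ K d ρ n D → con 1 :* (K :* (con 2 :* d)) :+ (n :+ (K :* D) :+ d :* ρ) :+ con 0 := con 1 :* (K :* D) :+ ((d :* ρ) :+ n :+ d :* (con 2 :* K))) refl)

  d-s2 : ∀ d D r T → 2 * d ≤ D → D ≤ r * d → d * D ≤ T + d * d → D * D ≤ 2 * (r * T)
  d-s2 d D r T h1 h2 h3 = farkas 0 (+-mono-≤ (+-mono-≤ (+-mono-≤ (*-monoʳ-≤ D h1) (*-monoʳ-≤ D h2)) (*-monoʳ-≤ (2 * r) h3)) (≤-prod h1 h2))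
    (polynomial (d ∷ D ∷ r ∷ T ∷ []) (λ d D r T → con 1 :* (D :* D) :+ (D :* D :+ D :* (r :* d) :+ (con 2 :* r) :* (T :+ d :* d) :+ (D :* (r :* d) :+ (con 2 :* d) :* D)) :+ con 0 := con 1 :* (con 2 :* (r :* T)) :+ (D :* (con 2 :* d) :+ D :* D :+ (con 2 :* r) :* (d :* D) :+ ((con 2 :* d) :* (r :* d) :+ D :* D))) refl)

  d-s3 : ∀ K n D ρ T V → D * D ≤ 2 * ((1 + ρ) * T) → ρ * T ≤ V → n * n ≤ K * D * (K * D) → 1 ≤ ρ → n * n ≤ 4 * K * K * V
  d-s3 K n D ρ T V h1 h2 h3 h4 = farkas 0 (+-mono-≤ (+-mono-≤ (+-mono-≤ (*-monoʳ-≤ (K * K) h1) (*-monoʳ-≤ (4 * K * K) h2)) h3) (*-monoʳ-≤ (2 * K * K * T) h4))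
    (polynomial (K ∷ n ∷ D ∷ ρ ∷ T ∷ V ∷ []) (λ K n D ρ T V → con 1 :* (n :* n) :+ ((K :* K) :* (con 2 :* ((con 1 :+ ρ) :* T)) :+ (con 4 :* K :* K) :* V :+ (K :* D :* (K :* D)) :+ (con 2 :* K :* K :* T) :* ρ) :+ con 0 := con 1 :* (con 4 :* K :* K :* V) :+ ((K :* K) :* (D :* D) :+ (con 4 :* K :* K) :* (ρ :* T) :+ (n :* n) :+ (con 2 :* K :* K :* T) :* con 1)) refl)

  -- For `r` = ρ: the volume of a long edge exceeds ρ times its size by at least the fraction 1/(z +
  -- 1) of that volume.
  nice-pt : ∀ z r x → (z + 1) * (1 + r) ≤ z * (1 + x) → (1 + x) * x + (z + 1) * (r * (1 + x)) ≤ (z + 1) * ((1 + x) * x)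
  nice-pt z r x h1 = farkas 0 (*-monoʳ-≤ (1 + x) h1)
    (polynomial (z ∷ r ∷ x ∷ []) (λ z r x → con 1 :* ((con 1 :+ x) :* x :+ (z :+ con 1) :* (r :* (con 1 :+ x))) :+ ((con 1 :+ x) :* (z :* (con 1 :+ x))) :+ (con 1 :+ x) := con 1 :* ((z :+ con 1) :* ((con 1 :+ x) :* x)) :+ ((con 1 :+ x) :* ((z :+ con 1) :* (con 1 :+ r)))) refl)

  p1 : ∀ q z N R V m → N + (z + 1) * R ≤ (z + 1) * V → V ≤ m → q * m ≤ q * R + 4 * m → q * N ≤ (z + 1) * (4 * m)
  p1 q z N R V m h1 h2 h3 = farkas 0 (+-mono-≤ (+-mono-≤ (*-monoʳ-≤ q h1) (*-monoʳ-≤ (q + q * z) h2)) (*-monoʳ-≤ (1 + z) h3))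
    (polynomial (q ∷ z ∷ N ∷ R ∷ V ∷ m ∷ []) (λ q z N R V m → con 1 :* (q :* N) :+ (q :* ((z :+ con 1) :* V) :+ (q :+ q :* z) :* m :+ (con 1 :+ z) :* (q :* R :+ con 4 :* m)) :+ con 0 := con 1 :* ((z :+ con 1) :* (con 4 :* m)) :+ (q :* (N :+ (z :+ con 1) :* R) :+ (q :+ q :* z) :* V :+ (con 1 :+ z) :* (q :* m))) refl)

  suc≡ : ∀ {a b} → suc a ≤ b → ∃ λ x → b ≡ suc x
  suc≡ (s≤s _) = _ , refl

  -- q D ≥ (q − 1) n in additive form, and ρ Σ is the lower bound for the volume
  uniform-arith : ∀ q ρ n D d T → 2 ≤ q → q ≤ ρ → q * n ≤ q * D + n → D ≤ suc ρ * d → d * ρ ≤ n → d * D ≤ T + d * d →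
                  ρ * T ≤ n * n → q * (n * n) ≤ q * (ρ * T) + 4 * (n * n)
  uniform-arith (suc q) ρ n D d T 2≤q q≤ρ h h₁ h₂ h₃ h₄ = u-s5 (suc q) n ρ T
    (*-cancelˡ-≤ (suc q) (u-s4 (suc q) d D n (suc ρ) T s1 h (u-s3 d D (suc ρ) T s2 h₁ h₃) 2≤q)) h₄ q≤ρ
    where
    s1 : suc q * d ≤ n
    s1 = u-s1 (suc q) ρ d n q≤ρ h₂
    s2 : d ≤ D
    s2 = *-cancelˡ-≤ (suc q) (u-s2 (suc q) d D n s1 h 2≤q)

  dense-arith : ∀ K ρ n D d T V → 1 ≤ K → 2 * K ≤ ρ → n ≤ K * D → D ≤ suc ρ * d → d * ρ ≤ n → d * D ≤ T + d * d →
                ρ * T ≤ V → n * n ≤ 4 * K * K * V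
  dense-arith (suc K) ρ n D d T V _ k h h₁ h₂ h₃ h₄ =
    d-s3 (suc K) n D ρ T V (d-s2 d D (suc ρ) T s1 h₁ h₃) h₄ (*-mono-≤ h h) (≤-trans (s≤s z≤n) k)
    where
    s1 : 2 * d ≤ D
    s1 = *-cancelˡ-≤ (suc K) (d-s1 (suc K) d ρ n D h₂ h k)

  module Dense {n m : ℕ} (a : Fin m → Fin n → Bool)
    (lin : ∀ i j → i ≢ j → ∀ u v → u ∈ᵇ a i → u ∈ᵇ a j → v ∈ᵇ a i → v ∈ᵇ a j → u ≡ v) where

    open Linear a lin public

    -- Otherwise some subfamily has minimum degree at least n/K, and a single star in it already
    -- forces volume n²/4K².
    degenerate : ∀ K {S} → 1 ≤ K → (∀ j → j ∈ᵇ S → suc (2 * K) ≤ size j) → 4 * K * K * vol S < n * n →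
                 ∀ S′ → S′ ⊆ᵇ S → ∀ i → i ∈ᵇ S′ → ∃ λ e → e ∈ᵇ S′ × K * deg S′ e < n
    degenerate K {S} K≥1 large small S′ sub i i∈S′ with min-element {S = S′} (deg S′) i∈S′ | min-element {S = S′} size i∈S′
    ... | e , e∈ , e-min | f , f∈ , f-min with K * deg S′ e <? n
    ... | yes p = e , e∈ , p
    ... | no p with suc≡ (large f (sub f f∈))
    ... | ρ , eq with dense-core S′ ρ (deg S′ e) {f} (λ j q → ≤-trans (≤-reflexive (sym eq)) (f-min j q)) e-min f∈
    ... | d₀ , h₁ , h₂ , h₃ = ⊥-elim (<⇒≱ small (≤-trans
      (dense-arith K ρ n (deg S′ e) d₀ (∑∈ S′ size) (vol S′) K≥1
        (s≤s⁻¹ (≤-trans (large f (sub f f∈)) (≤-reflexive eq))) (≮⇒≥ p) (subst (λ x → deg S′ e ≤ x * d₀) eq h₁) h₂ h₃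
        (ρ∑size≤vol S′ ρ (λ j q → ≤-trans (≤-reflexive (sym eq)) (f-min j q))))
      (*-monoʳ-≤ (4 * K * K) (vol-mono {S′} {S} sub))))

    Long : ℕ → ℕ → Pred m
    Long z r j = (z + 1) * r ≤ᵇ z * size j
      where open Data.Nat using (_≤ᵇ_)

    Long-false : ∀ z r j → j ∉ᵇ Long z r → z * size j ≤ (z + 1) * r
    Long-false z r j q = <⇒≤ (≰⇒> (λ p → true≢false (T⇒true (≤⇒≤ᵇ p)) q))
      where
      open import Data.Bool using (T)
      T⇒true : ∀ {b} → T b → b ≡ true
      T⇒true {true} _ = refl

    -- The volume is at most n², but ρ times the total size is already at least (1 - 4/q)n². The
    -- excess of the volume over the latter is thus at most 4n²/q, while long edges contribute a
    -- fixed share of their volume to it.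
    uniform : ∀ q z ρ {S e₀ D} → 2 ≤ q → q ≤ ρ → e₀ ∈ᵇ S → size e₀ ≡ suc ρ → (∀ j → j ∈ᵇ S → size e₀ ≤ size j) →
              (∀ j → j ∈ᵇ S → D ≤ deg S j) → q * n ≤ q * D + n →
              q * vol (S ∩ᵇ Long z (suc ρ)) ≤ (z + 1) * (4 * (n * n)) × q * (n * n) ≤ q * vol S + 4 * (n * n)
    uniform q z ρ {S} {e₀} {D} 2≤q q≤ρ e₀∈ eq e₀-min dense h
      with dense-core S ρ D {e₀} (λ j p → ≤-trans (≤-reflexive (sym eq)) (e₀-min j p)) dense e₀∈
    ... | d₀ , h₁ , h₂ , h₃ = part1 , ≤-trans main (+-monoˡ-≤ _ (*-monoʳ-≤ q low))
      where
      open ≤-Reasoning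
      T = ∑∈ S size
      V = vol S
      N = S ∩ᵇ Long z (suc ρ)
      big : ∀ j → j ∈ᵇ S → suc ρ ≤ size j
      big j p = ≤-trans (≤-reflexive (sym eq)) (e₀-min j p)
      low : ρ * T ≤ V
      low = ρ∑size≤vol S ρ big
      main : q * (n * n) ≤ q * (ρ * T) + 4 * (n * n)
      main = uniform-arith q ρ n D d₀ T 2≤q q≤ρ h (subst (λ x → D ≤ x * d₀) eq h₁) h₂ h₃ (≤-trans low (vol≤n² S))
      pt : ∀ j → j ∈ᵇ S → 𝟙 (Long z (suc ρ) j) * (size j * (size j ∸ 1)) + (z + 1) * (ρ * size j) ≤ (z + 1) * (size j * (size j ∸ 1))
      pt j p with suc≡ (big j p)
      ... | x , eq′ rewrite eq′ with (z + 1) * suc ρ ≤ᵇ z * suc x in l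
        where open Data.Nat using (_≤ᵇ_)
      ... | true = subst (λ y → y + (z + 1) * (ρ * suc x) ≤ (z + 1) * (suc x * x)) (sym (+-identityʳ (suc x * x)))
                     (nice-pt z ρ x (≤ᵇ⇒≤ _ _ (subst Data.Bool.T (sym l) _)))
        where import Data.Bool
      ... | false = *-monoʳ-≤ (z + 1) (≤-trans (≤-reflexive (*-comm ρ (suc x))) (*-monoʳ-≤ (suc x)
                      (s≤s⁻¹ (≤-trans (big j p) (≤-reflexive eq′)))))
      sum : vol N + (z + 1) * (ρ * T) ≤ (z + 1) * V
      sum = begin
        vol N + (z + 1) * (ρ * T)
          ≡⟨ cong₂ _+_ (∑-cong (λ j → lemma (S j) (Long z (suc ρ) j) (size j * (size j ∸ 1))))
               (trans (cong ((z + 1) *_) (sym (∑∈-*ˡ S ρ size))) (sym (∑∈-*ˡ S (z + 1) (λ j → ρ * size j)))) ⟩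
        ∑∈ S (λ j → 𝟙 (Long z (suc ρ) j) * (size j * (size j ∸ 1))) + ∑∈ S (λ j → (z + 1) * (ρ * size j))
          ≡⟨ ∑∈-+ S _ _ ⟨
        ∑∈ S (λ j → 𝟙 (Long z (suc ρ) j) * (size j * (size j ∸ 1)) + (z + 1) * (ρ * size j))
          ≤⟨ ∑∈-monoʳ {S = S} pt ⟩
        ∑∈ S (λ j → (z + 1) * (size j * (size j ∸ 1))) ≡⟨ ∑∈-*ˡ S (z + 1) _ ⟩
        (z + 1) * V ∎
        where
        lemma : ∀ b c x → 𝟙 (b ∧ c) * x ≡ 𝟙 b * (𝟙 c * x)
        lemma true c x = sym (+-identityʳ _)
        lemma false c x = refl
      part1 : q * vol N ≤ (z + 1) * (4 * (n * n))
      part1 = p1 q z (vol N) (ρ * T) V (n * n) sum (vol≤n² S) main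

    -- The last component is what a greedy completion needs. Among any set of peeled edges, the one
    -- peeled first had small degree while the core and all the others were still present.
    peel : ∀ D X → ∃ λ S → S ⊆ᵇ X × (∀ e → e ∈ᵇ S → D ≤ deg S e) ×
           (∀ S′ → S′ ⊆ᵇ X ∖ᵇ S → ∀ i → i ∈ᵇ S′ → ∃ λ e → e ∈ᵇ S′ × deg (S ∪ᵇ S′) e < D)
    peel D X = go (# X) X ≤-refl
      where
      go : ∀ b X → # X ≤ b → ∃ λ S → S ⊆ᵇ X × (∀ e → e ∈ᵇ S → D ≤ deg S e) ×
           (∀ S′ → S′ ⊆ᵇ X ∖ᵇ S → ∀ i → i ∈ᵇ S′ → ∃ λ e → e ∈ᵇ S′ × deg (S ∪ᵇ S′) e < D)
      go b X bound with some (λ e → X e ∧ (deg X e <ᵇ D)) in eq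
      ... | false = X , (λ _ p → p) , (λ e p → <ᵇ-false (≢true⇒false (λ q → true≢false (∧-intro p q)
                      (some-false {P = λ e → X e ∧ (deg X e <ᵇ D)} eq e)))) ,
                    λ S′ sub i p → ⊥-elim (none (X i) (sub i p))
        where
        none : ∀ b → b ∧ not b ≡ true → ⊥
        none true ()
        none false ()
      go b X bound | true with some-true {P = λ e → X e ∧ (deg X e <ᵇ D)} eq
      ... | e , p with ∧-true {X e} p
      go zero X bound | true | e , p | e∈X , low = ⊥-elim (1+n≰n (≤-trans (#-member {S = X} e∈X) bound))
      go (suc b) X bound | true | e , p | e∈X , low
        with go b (X ∖ e) (s≤s⁻¹ (subst (_≤ suc b) (#-remove {S = X} e∈X) bound))
      ... | S , S⊆ , dense , rest = S , (λ i q → ∖-⊆ {S = X} i (S⊆ i q)) , dense , rest′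
        where
        rest′ : ∀ S′ → S′ ⊆ᵇ X ∖ᵇ S → ∀ i → i ∈ᵇ S′ → ∃ λ e → e ∈ᵇ S′ × deg (S ∪ᵇ S′) e < D
        rest′ S′ sub i i∈ with S′ e in q
        ... | true = e , q , ≤-<-trans (deg-mono {R = X} e sub′) (<ᵇ-true low)
          where
          open Greedy {m} {0} adj adj-sym adj-irrefl size using (deg-mono)
          sub′ : S ∪ᵇ S′ ⊆ᵇ X
          sub′ j r with ∨-true {S j} r
          ... | inj₁ x = ∖-⊆ {S = X} j (S⊆ j x)
          ... | inj₂ x = proj₁ (∧-true {X j} (sub j x))
        ... | false = rest S′ (λ j r → let x , y = ∧-true {X j} (sub j r) in
                        ∧-intro (∖-∈ {S = X} x (λ { refl → true≢false r q })) y) i i∈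

-- A derandomised nibble: potential and conditional expectations

module NibblePotential where
  open FiniteSums
  open import Data.Bool using (Bool; true; false; _∧_; if_then_else_)
  open import Data.Empty using (⊥-elim)
  open import Data.Fin using (Fin; zero; suc; toℕ)
  open import Data.Nat as ℕ using (ℕ; zero; suc; _<ᵇ_)
  import Data.Nat.Properties as ℕₚ
  open import Data.Product using (∃; _×_; _,_; proj₁)
  open import Data.Rational using (ℚ; 0ℚ; 1ℚ; _+_; _*_; _-_; -_; _≤_; _<_; nonNegative)
  import Data.Rational.Properties as ℚₚ
  open import Data.Rational.Solver using (module +-*-Solver)
  open import Function using (_∘_)
  open import Relation.Binary.PropositionalEquality hiding (J)
  open import Relation.Nullary using (yes; no)
  open +-*-Solver using (solve; _:=_; _:+_; _:*_; _:-_; con)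

  0≤+ : ∀ {p q} → 0ℚ ≤ p → 0ℚ ≤ q → 0ℚ ≤ p + q
  0≤+ p q = ℚₚ.+-mono-≤ p q

  0≤* : ∀ {p q} → 0ℚ ≤ p → 0ℚ ≤ q → 0ℚ ≤ p * q
  0≤* {p} {q} a b = ℚₚ.nonNegative⁻¹ (p * q) ⦃ ℚₚ.nonNeg*nonNeg⇒nonNeg p ⦃ nonNegative a ⦄ q ⦃ nonNegative b ⦄ ⦄

  0≤1 : 0ℚ ≤ 1ℚ
  0≤1 = ℚₚ.nonNegative⁻¹ 1ℚ

  0≤- : ∀ {p q} → p ≤ q → 0ℚ ≤ q - p
  0≤- {p} {q} h = subst (_≤ q - p) (ℚₚ.+-inverseʳ p) (ℚₚ.+-monoˡ-≤ (- p) h)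

  ≤-by : ∀ {a b} t → 0ℚ ≤ t → b ≡ a + t → a ≤ b
  ≤-by {a} t h refl = subst (_≤ a + t) (ℚₚ.+-identityʳ a) (ℚₚ.+-monoʳ-≤ a h)

  -- Defined by recursion, so that additivity and multiplicativity follow by induction instead of
  -- through normalised fractions; `toℚ-ι` later identifies it with `toℚ`.
  ι : ℕ → ℚ
  ι zero = 0ℚ
  ι (suc n) = 1ℚ + ι n

  ι≥0 : ∀ n → 0ℚ ≤ ι n
  ι≥0 zero = ℚₚ.≤-refl
  ι≥0 (suc n) = 0≤+ 0≤1 (ι≥0 n)

  ι-+ : ∀ m n → ι (m ℕ.+ n) ≡ ι m + ι n
  ι-+ zero n = sym (ℚₚ.+-identityˡ _)
  ι-+ (suc m) n = trans (cong (1ℚ +_) (ι-+ m n)) (sym (ℚₚ.+-assoc 1ℚ (ι m) (ι n)))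

  ι-* : ∀ m n → ι (m ℕ.* n) ≡ ι m * ι n
  ι-* zero n = sym (ℚₚ.*-zeroˡ (ι n))
  ι-* (suc m) n = trans (ι-+ n (m ℕ.* n)) (trans (cong (ι n +_) (ι-* m n)) (eq (ι m) (ι n)))
    where
    eq : ∀ a b → b + a * b ≡ (1ℚ + a) * b
    eq = solve 2 (λ a b → b :+ a :* b := (con 1ℚ :+ a) :* b) refl

  ι-mono : ∀ {m n} → m ℕ.≤ n → ι m ≤ ι n
  ι-mono {n = n} ℕ.z≤n = ι≥0 n
  ι-mono (ℕ.s≤s p) = ℚₚ.+-monoʳ-≤ 1ℚ (ι-mono p)

  ι-cancel : ∀ {m n} → ι m ≤ ι n → m ℕ.≤ n
  ι-cancel {m} {n} p with m ℕ.≤? n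
  ... | yes q = q
  ... | no q = ⊥-elim (ℚₚ.<-irrefl refl (ℚₚ.<-≤-trans (lt (ι n)) (ℚₚ.≤-trans (ι-mono (ℕₚ.≰⇒> q)) p)))
    where
    lt : ∀ a → a < 1ℚ + a
    lt a = subst (_< 1ℚ + a) (ℚₚ.+-identityˡ a) (ℚₚ.+-monoˡ-< a (ℚₚ.positive⁻¹ 1ℚ))

  ∑q : ∀ {n} → (Fin n → ℚ) → ℚ
  ∑q {zero} f = 0ℚ
  ∑q {suc n} f = f zero + ∑q (f ∘ suc)

  ∑q-mono : ∀ {n} {f g : Fin n → ℚ} → (∀ i → f i ≤ g i) → ∑q f ≤ ∑q g
  ∑q-mono {zero} _ = ℚₚ.≤-refl
  ∑q-mono {suc n} p = ℚₚ.+-mono-≤ (p zero) (∑q-mono (p ∘ suc))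

  ∑q-cong : ∀ {n} {f g : Fin n → ℚ} → (∀ i → f i ≡ g i) → ∑q f ≡ ∑q g
  ∑q-cong {zero} _ = refl
  ∑q-cong {suc n} p = cong₂ _+_ (p zero) (∑q-cong (p ∘ suc))

  ∑q-* : ∀ {n} c (f : Fin n → ℚ) → ∑q (λ i → c * f i) ≡ c * ∑q f
  ∑q-* {zero} c f = sym (ℚₚ.*-zeroʳ c)
  ∑q-* {suc n} c f = trans (cong (c * f zero +_) (∑q-* c (f ∘ suc))) (sym (ℚₚ.*-distribˡ-+ c _ _))

  ∑q-+ : ∀ {n} (f g : Fin n → ℚ) → ∑q (λ i → f i + g i) ≡ ∑q f + ∑q g
  ∑q-+ {zero} f g = refl
  ∑q-+ {suc n} f g = trans (cong (f zero + g zero +_) (∑q-+ (f ∘ suc) (g ∘ suc))) (eq (f zero) (g zero) (∑q (f ∘ suc)) (∑q (g ∘ suc)))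
    where
    eq : ∀ a b c d → a + b + (c + d) ≡ a + c + (b + d)
    eq = solve 4 (λ a b c d → a :+ b :+ (c :+ d) := a :+ c :+ (b :+ d)) refl

  ∑q-0 : ∀ {n} → ∑q {n} (λ _ → 0ℚ) ≡ 0ℚ
  ∑q-0 {zero} = refl
  ∑q-0 {suc n} = trans (ℚₚ.+-identityˡ _) (∑q-0 {n})

  earlier : ∀ {N} → (Fin N → Fin N → Bool) → Fin N → Fin N → Bool
  earlier adj u v = (toℕ v <ᵇ toℕ u) ∧ adj u v

  -- Only these vertices can act on `u` and `v` together before `v` is processed, so they alone
  -- cause the drift.
  between : ∀ {N} → (Fin N → Fin N → Bool) → Fin N → Fin N → ℕ
  between adj u v = # (λ w → (toℕ w <ᵇ toℕ v) ∧ (adj u w ∧ adj v w))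

  between-zero : ∀ {N} (adj : Fin (suc N) → Fin (suc N) → Bool) u → between adj u zero ≡ 0
  between-zero adj u = ∑-0 (λ i → refl)

  between-suc : ∀ {N} (adj : Fin (suc N) → Fin (suc N) → Bool) u v →
                between adj (suc u) (suc v) ≡ 𝟙 (adj (suc u) zero ∧ adj (suc v) zero) ℕ.+ between (λ i j → adj (suc i) (suc j)) u v
  between-suc adj u v = ∑-suc _

  -- Vertices are processed in order.  Vertex v is selected with odds x(v), after which the weights x of its
  -- neighbours drop to 0; if it is not selected they grow by the factor 1 + x(v), so that x(u) is a martingale.
  -- A(u) records the odds met so far by u, and gain(u) bounds x(u)·(ℓ − final value of A(u)) from below in expectation;
  -- the factor 1 + 2κ·between compensates the drift of x(u)·x(v) caused by common neighbours.
  -- Once x(u) exceeds the cap κ, the invariant J forces A(u) ≥ ℓ and u may be discarded.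
  record NibbleData : Set₁ where
    constructor nibble-data
    field
      ℓ κ : ℚ
      0≤ℓ : 0ℚ ≤ ℓ
      0≤κ : 0ℚ ≤ κ
      κ≤1 : κ ≤ 1ℚ
      J : ℚ → ℚ → Set
      J-zero : ∀ {A} → 0ℚ ≤ A → J 0ℚ A
      J-step : ∀ {x A o} → 0ℚ ≤ x → 0ℚ ≤ A → 0ℚ ≤ o → o ≤ κ → J x A → J (x * (1ℚ + o)) (A + o)
      J-cap : ∀ {x A} → 0ℚ ≤ x → 0ℚ ≤ A → J x A → κ < x → ℓ ≤ A

  module Nibble (P : NibbleData) where
    open NibbleData P

    drift : ℕ → ℚ
    drift c = 1ℚ + (κ + κ) * ι c

    drift≥0 : ∀ c → 0ℚ ≤ drift c
    drift≥0 c = 0≤+ 0≤1 (0≤* (0≤+ 0≤κ 0≤κ) (ι≥0 c))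

    expo : ∀ {N} → (Fin N → Fin N → Bool) → (Fin N → ℚ) → Fin N → Fin N → ℚ
    expo adj x u v = if earlier adj u v then x v * drift (between adj u v) else 0ℚ

    gain : ∀ {N} → (Fin N → Fin N → Bool) → (Fin N → ℚ) → (Fin N → ℚ) → Fin N → ℚ
    gain adj x A u = x u * (ℓ - A u - ∑q (expo adj x u))

    potential : ∀ {N} → (Fin N → Fin N → Bool) → (Fin N → ℕ) → (Fin N → ℚ) → (Fin N → ℚ) → ℚ
    potential adj w x A = ∑q (λ u → ι (w u) * gain adj x A u)

    private
      -- A common neighbour of `u` and `v` has been passed over. The weight of `v` has grown by 1 +
      -- o, and the drop of `between` by one pays for it, because `(κ + κ) * d ≤ 1`.
      term-both : ∀ {x o d} → 0ℚ ≤ x → o ≤ κ → 0ℚ ≤ d → (κ + κ) * d ≤ 1ℚ →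
                  x * (1ℚ + o) * (1ℚ + (κ + κ) * d) ≤ x * (1ℚ + (κ + κ) * (1ℚ + d))
      term-both {x} {o} {d} 0≤x o≤κ 0≤d h = ≤-by _
        (0≤* 0≤x (0≤+ (0≤* (0≤- o≤κ) (0≤+ 0≤1 (0≤* (0≤+ 0≤κ 0≤κ) 0≤d))) (0≤* 0≤κ (0≤- h)))) (eq x o κ d)
        where
        eq : ∀ x o κ d → x * (1ℚ + (κ + κ) * (1ℚ + d)) ≡ x * (1ℚ + o) * (1ℚ + (κ + κ) * d) +
                         x * ((κ - o) * (1ℚ + (κ + κ) * d) + κ * (1ℚ - (κ + κ) * d))
        eq = solve 4 (λ x o κ d → x :* (con 1ℚ :+ (κ :+ κ) :* (con 1ℚ :+ d)) := x :* (con 1ℚ :+ o) :* (con 1ℚ :+ (κ :+ κ) :* d) :+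
                         x :* ((κ :- o) :* (con 1ℚ :+ (κ :+ κ) :* d) :+ κ :* (con 1ℚ :- (κ :+ κ) :* d))) refl

      gain-skip : ∀ {x A B B′} → 0ℚ ≤ x → B′ ≤ B → x * (ℓ - A - B) ≤ x * (ℓ - A - B′)
      gain-skip {x} {A} {B} {B′} 0≤x h = ≤-by _ (0≤* 0≤x (0≤- h)) (eq x ℓ A B B′)
        where
        eq : ∀ x ℓ A B B′ → x * (ℓ - A - B′) ≡ x * (ℓ - A - B) + x * (B - B′)
        eq = solve 5 (λ x ℓ A B B′ → x :* (ℓ :- A :- B′) := x :* (ℓ :- A :- B) :+ x :* (B :- B′)) refl

      -- A neighbour `u` of the processed vertex survives only if that vertex is rejected. Its
      -- weight then grows by 1 + o, which compensates the odds, and the exposure falls by the o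
      -- that is added to `A`.
      gain-adj : ∀ {x A B B′ o} C → 0ℚ ≤ x → 0ℚ ≤ o → o + B′ ≤ B →
                 (1ℚ + o) * (x * (ℓ - A - B)) ≤ o * (0ℚ * C) + x * (1ℚ + o) * (ℓ - (A + o) - B′)
      gain-adj {x} {A} {B} {B′} {o} C 0≤x 0≤o h = ≤-by _ (0≤* (0≤* 0≤x (0≤+ 0≤1 0≤o)) (0≤- h)) (eq x ℓ A B B′ o C)
        where
        eq : ∀ x ℓ A B B′ o C → o * (0ℚ * C) + x * (1ℚ + o) * (ℓ - (A + o) - B′) ≡
               (1ℚ + o) * (x * (ℓ - A - B)) + x * (1ℚ + o) * (B - (o + B′))
        eq = solve 7 (λ x ℓ A B B′ o C → o :* (con 0ℚ :* C) :+ x :* (con 1ℚ :+ o) :* (ℓ :- (A :+ o) :- B′) :=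
               (con 1ℚ :+ o) :* (x :* (ℓ :- A :- B)) :+ x :* (con 1ℚ :+ o) :* (B :- (o :+ B′))) refl

      gain-non : ∀ {x A B B₁ B₂ o} → 0ℚ ≤ x → o * B₁ + B₂ ≤ (1ℚ + o) * B →
                 (1ℚ + o) * (x * (ℓ - A - B)) ≤ o * (x * (ℓ - A - B₁)) + x * (ℓ - A - B₂)
      gain-non {x} {A} {B} {B₁} {B₂} {o} 0≤x h = ≤-by _ (0≤* 0≤x (0≤- h)) (eq x ℓ A B B₁ B₂ o)
        where
        eq : ∀ x ℓ A B B₁ B₂ o → o * (x * (ℓ - A - B₁)) + x * (ℓ - A - B₂) ≡
               (1ℚ + o) * (x * (ℓ - A - B)) + x * ((1ℚ + o) * B - (o * B₁ + B₂))
        eq = solve 7 (λ x ℓ A B B₁ B₂ o → o :* (x :* (ℓ :- A :- B₁)) :+ x :* (ℓ :- A :- B₂) :=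
               (con 1ℚ :+ o) :* (x :* (ℓ :- A :- B)) :+ x :* ((con 1ℚ :+ o) :* B :- (o :* B₁ :+ B₂))) refl

      -- Conditional expectation in odds: selecting has weight o, rejecting has weight 1. If
      -- selecting misses the bound, rejecting attains it. The factor 2 in `ℓ + ℓ` absorbs 1 + o ≤
      -- 2.
      choose-arith : ∀ {Φ S Φ₁ Φ₂ W₀ W₁ W₂ o A} → 0ℚ ≤ W₀ → 0ℚ ≤ o → o ≤ 1ℚ → 0ℚ ≤ A →
        Φ ≡ W₀ * (o * (ℓ - A - 0ℚ)) + S → (1ℚ + o) * S ≤ o * Φ₁ + Φ₂ →
        Φ₁ ≤ (ℓ + ℓ) * W₁ → Φ₂ ≤ (ℓ + ℓ) * W₂ → (ℓ + ℓ) * (W₀ + W₁) ≤ Φ → Φ ≤ (ℓ + ℓ) * W₂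
      choose-arith {_} {S} {Φ₁} {Φ₂} {W₀} {W₁} {W₂} {o} {A} w o≥0 o≤1 A≥0 refl h h₁ h₂ h₃ = ≤-by _
        (0≤+ (0≤+ (0≤+ (0≤+ (0≤+ (0≤- h) (0≤* o≥0 (0≤- h₁))) (0≤- h₂)) (0≤* o≥0 (0≤- h₃)))
          (0≤* (0≤* (0≤* w o≥0) 0≤ℓ) (0≤- o≤1))) (0≤* (0≤* (0≤* w o≥0) (0≤+ 0≤1 o≥0)) A≥0))
        (eq S Φ₁ Φ₂ W₀ W₁ W₂ o A ℓ)
        where
        eq : ∀ S Φ₁ Φ₂ W₀ W₁ W₂ o A ℓ → (ℓ + ℓ) * W₂ ≡ W₀ * (o * (ℓ - A - 0ℚ)) + S +
          ((o * Φ₁ + Φ₂ - (1ℚ + o) * S) + o * ((ℓ + ℓ) * W₁ - Φ₁) + ((ℓ + ℓ) * W₂ - Φ₂) +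
           o * ((W₀ * (o * (ℓ - A - 0ℚ)) + S) - (ℓ + ℓ) * (W₀ + W₁)) + W₀ * o * ℓ * (1ℚ - o) + W₀ * o * (1ℚ + o) * A)
        eq = solve 9 (λ S Φ₁ Φ₂ W₀ W₁ W₂ o A ℓ → (ℓ :+ ℓ) :* W₂ := W₀ :* (o :* (ℓ :- A :- con 0ℚ)) :+ S :+
          ((o :* Φ₁ :+ Φ₂ :- (con 1ℚ :+ o) :* S) :+ o :* ((ℓ :+ ℓ) :* W₁ :- Φ₁) :+ ((ℓ :+ ℓ) :* W₂ :- Φ₂) :+
           o :* ((W₀ :* (o :* (ℓ :- A :- con 0ℚ)) :+ S) :- (ℓ :+ ℓ) :* (W₀ :+ W₁)) :+ W₀ :* o :* ℓ :* (con 1ℚ :- o) :+ W₀ :* o :* (con 1ℚ :+ o) :* A)) refl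

    Independent : ∀ {N} → (Fin N → Fin N → Bool) → Pred N → Set
    Independent adj I = ∀ u v → u ∈ᵇ I → v ∈ᵇ I → toℕ v ℕ.< toℕ u → adj u v ≡ false

    drift-mono : ∀ {c c′} → c ℕ.≤ c′ → drift c ≤ drift c′
    drift-mono p = ℚₚ.+-monoʳ-≤ 1ℚ (ℚₚ.*-monoˡ-≤-nonNeg (κ + κ) ⦃ nonNegative (0≤+ 0≤κ 0≤κ) ⦄ (ι-mono p))

    private
      term-skip : ∀ e {x c c′} → 0ℚ ≤ x → c′ ℕ.≤ c → (if e then x * drift c′ else 0ℚ) ≤ (if e then x * drift c else 0ℚ)
      term-skip false _ _ = ℚₚ.≤-refl
      term-skip true {x} p q = ℚₚ.*-monoˡ-≤-nonNeg x ⦃ nonNegative p ⦄ (drift-mono q)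

      term-adj : ∀ e b {x o c c′} → 0ℚ ≤ x → o ≤ κ → (e ≡ true → (κ + κ) * ι c′ ≤ 1ℚ) → c ≡ 𝟙 (true ∧ b) ℕ.+ c′ →
                 (if e then (if b then x * (1ℚ + o) else x) * drift c′ else 0ℚ) ≤ (if e then x * drift c else 0ℚ)
      term-adj false _ _ _ _ _ = ℚₚ.≤-refl
      term-adj true false _ _ _ refl = ℚₚ.≤-refl
      term-adj true true {c′ = c′} p q h refl = term-both p q (ι≥0 c′) (h refl)

      term-non : ∀ e b {x c c′} o → c ≡ 𝟙 (false ∧ b) ℕ.+ c′ →
                 o * (if e then (if b then 0ℚ else x) * drift c′ else 0ℚ) +
                 (if e then (if b then x * (1ℚ + o) else x) * drift c′ else 0ℚ) ≡
                 (1ℚ + o) * (if e then x * drift c else 0ℚ)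
      term-non false b o refl = solve 1 (λ o → o :* con 0ℚ :+ con 0ℚ := (con 1ℚ :+ o) :* con 0ℚ) refl o
      term-non true true {x} {c} o refl = eq o x (drift c)
        where
        eq : ∀ o x d → o * (0ℚ * d) + x * (1ℚ + o) * d ≡ (1ℚ + o) * (x * d)
        eq = solve 3 (λ o x d → o :* (con 0ℚ :* d) :+ x :* (con 1ℚ :+ o) :* d := (con 1ℚ :+ o) :* (x :* d)) refl
      term-non true false {x} {c} o refl = eq o x (drift c)
        where
        eq : ∀ o x d → o * (x * d) + x * d ≡ (1ℚ + o) * (x * d)
        eq = solve 3 (λ o x d → o :* (x :* d) :+ x :* d := (con 1ℚ :+ o) :* (x :* d)) refl

    -- `thin` keeps all drift factors at most 2 and is what allows `term-both`.
    record State {N} (adj : Fin N → Fin N → Bool) (x A : Fin N → ℚ) : Set where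
      field
        x≥0  : ∀ u → 0ℚ ≤ x u
        A≥0  : ∀ u → 0ℚ ≤ A u
        inv  : ∀ u → J (x u) (A u)
        thin : ∀ u v → earlier adj u v ≡ true → (κ + κ) * ι (between adj u v) ≤ 1ℚ

    -- Weight 0 marks dead vertices, in particular the neighbours of selected ones. Keeping them out
    -- of the set is how independence is carried through the recursion.
    Selection : ∀ {N} (adj : Fin N → Fin N → Bool) (w : Fin N → ℕ) (x A : Fin N → ℚ) → Set
    Selection {N} adj w x A = ∃ λ (I : Pred N) → Independent adj I × (∀ u → x u ≡ 0ℚ → u ∉ᵇ I) ×
                              potential adj w x A ≤ (ℓ + ℓ) * ι (∑∈ I w)

    module Step {N} (adj : Fin (suc N) → Fin (suc N) → Bool) (w : Fin (suc N) → ℕ) (x A : Fin (suc N) → ℚ)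
                (st : State adj x A) where
      open State st

      adj′ : Fin N → Fin N → Bool
      adj′ u v = adj (suc u) (suc v)

      o = x zero

      hit : Fin N → Bool
      hit u = adj (suc u) zero

      x₁ x₂ A₂ : Fin N → ℚ
      x₁ u = if hit u then 0ℚ else x (suc u)
      x₂ u = if hit u then x (suc u) * (1ℚ + o) else x (suc u)
      A₂ u = if hit u then A (suc u) + o else A (suc u)

      between′ : ∀ u v → between adj (suc u) (suc v) ≡ 𝟙 (hit u ∧ hit v) ℕ.+ between adj′ u v
      between′ = between-suc adj

      thin′ : ∀ u v → earlier adj′ u v ≡ true → (κ + κ) * ι (between adj′ u v) ≤ 1ℚ
      thin′ u v e = ℚₚ.≤-trans (ℚₚ.*-monoˡ-≤-nonNeg (κ + κ) ⦃ nonNegative (0≤+ 0≤κ 0≤κ) ⦄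
        (ι-mono (ℕₚ.≤-trans (ℕₚ.m≤n+m (between adj′ u v) (𝟙 (hit u ∧ hit v))) (ℕₚ.≤-reflexive (sym (between′ u v)))))) (thin (suc u) (suc v) e)

      state₀ : State adj′ (x ∘ suc) (A ∘ suc)
      state₀ = record { x≥0 = x≥0 ∘ suc ; A≥0 = A≥0 ∘ suc ; inv = inv ∘ suc ; thin = thin′ }

      state₁ : State adj′ x₁ (A ∘ suc)
      state₁ = record { x≥0 = λ u → lemma (hit u) (x≥0 (suc u)) ; A≥0 = A≥0 ∘ suc
                      ; inv = λ u → lemma′ (hit u) (A≥0 (suc u)) (inv (suc u)) ; thin = thin′ }
        where
        lemma : ∀ b {y} → 0ℚ ≤ y → 0ℚ ≤ (if b then 0ℚ else y)
        lemma true _ = ℚₚ.≤-refl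
        lemma false p = p
        lemma′ : ∀ b {y B} → 0ℚ ≤ B → J y B → J (if b then 0ℚ else y) B
        lemma′ true p _ = J-zero p
        lemma′ false _ q = q

      state₂ : o ≤ κ → State adj′ x₂ A₂
      state₂ o≤κ = record { x≥0 = λ u → lemma (hit u) (x≥0 (suc u)) ; A≥0 = λ u → lemma″ (hit u) (A≥0 (suc u))
                          ; inv = λ u → lemma′ (hit u) (x≥0 (suc u)) (A≥0 (suc u)) (inv (suc u)) ; thin = thin′ }
        where
        lemma : ∀ b {y} → 0ℚ ≤ y → 0ℚ ≤ (if b then y * (1ℚ + o) else y)
        lemma true p = 0≤* p (0≤+ 0≤1 (x≥0 zero))
        lemma false p = p
        lemma″ : ∀ b {y} → 0ℚ ≤ y → 0ℚ ≤ (if b then y + o else y)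
        lemma″ true p = 0≤+ p (x≥0 zero)
        lemma″ false p = p
        lemma′ : ∀ b {y B} → 0ℚ ≤ y → 0ℚ ≤ B → J y B → J (if b then y * (1ℚ + o) else y) (if b then B + o else B)
        lemma′ true p q r = J-step p q (x≥0 zero) o≤κ r
        lemma′ false _ _ r = r

      rest : ℚ
      rest = ∑q (λ u → ι (w (suc u)) * gain adj x A (suc u))

      gain-zero : gain adj x A zero ≡ o * (ℓ - A zero - 0ℚ)
      gain-zero = cong (λ y → o * (ℓ - A zero - y)) (∑q-0 {suc N})

      skip-rest : rest ≤ potential adj′ (w ∘ suc) (x ∘ suc) (A ∘ suc)
      skip-rest = ∑q-mono (λ u → ℚₚ.*-monoˡ-≤-nonNeg (ι (w (suc u))) ⦃ nonNegative (ι≥0 (w (suc u))) ⦄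
        (gain-skip (x≥0 (suc u)) (ℚₚ.≤-trans
          (∑q-mono (λ v → term-skip (earlier adj′ u v) (x≥0 (suc v))
            (ℕₚ.≤-trans (ℕₚ.m≤n+m (between adj′ u v) (𝟙 (hit u ∧ hit v))) (ℕₚ.≤-reflexive (sym (between′ u v))))))
          (subst (_≤ ∑q (expo adj x (suc u))) (ℚₚ.+-identityˡ _) (ℚₚ.+-monoˡ-≤ _ (pos u))))))
        where
        pos : ∀ u → 0ℚ ≤ expo adj x (suc u) zero
        pos u with hit u
        ... | true = 0≤* (x≥0 zero) (drift≥0 (between adj (suc u) zero))
        ... | false = ℚₚ.≤-refl

      expo-hit : ∀ u → x zero * drift (between adj (suc u) zero) ≡ o
      expo-hit u rewrite between-zero adj (suc u) = solve 2 (λ o κ → o :* (con 1ℚ :+ (κ :+ κ) :* con 0ℚ) := o) refl o κ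

      -- Under the odds o : 1 the gain of every later vertex is a submartingale, whether or not that
      -- vertex is a neighbour of the processed one.
      split : o ≤ κ → ∀ u → (1ℚ + o) * gain adj x A (suc u) ≤ o * gain adj′ x₁ (A ∘ suc) u + gain adj′ x₂ A₂ u
      split o≤κ u with hit u in eq
      ... | true = gain-adj {A = A (suc u)} {x zero * drift (between adj (suc u) zero) + ∑q (expo adj x (suc u) ∘ suc)} {∑q (expo adj′ x₂ u)} {o} (ℓ - A (suc u) - ∑q (expo adj′ x₁ u)) (x≥0 (suc u)) (x≥0 zero) (subst (λ y → o + ∑q (expo adj′ x₂ u) ≤ y + ∑q (expo adj x (suc u) ∘ suc))
                    (sym (expo-hit u)) (ℚₚ.+-monoʳ-≤ o (∑q-mono (λ v →
                      term-adj (earlier adj′ u v) (hit v) (x≥0 (suc v)) o≤κ (thin′ u v)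
                        (trans (between′ u v) (cong (λ b → 𝟙 (b ∧ hit v) ℕ.+ between adj′ u v) eq))))))
      ... | false = gain-non {A = A (suc u)} {0ℚ + ∑q (expo adj x (suc u) ∘ suc)} {∑q (expo adj′ x₁ u)} {∑q (expo adj′ x₂ u)} {o} (x≥0 (suc u)) (ℚₚ.≤-reflexive (begin
          o * ∑q (expo adj′ x₁ u) + ∑q (expo adj′ x₂ u) ≡⟨ cong (_+ ∑q (expo adj′ x₂ u)) (∑q-* o (expo adj′ x₁ u)) ⟨
          ∑q (λ v → o * expo adj′ x₁ u v) + ∑q (expo adj′ x₂ u) ≡⟨ ∑q-+ (λ v → o * expo adj′ x₁ u v) (expo adj′ x₂ u) ⟨
          ∑q (λ v → o * expo adj′ x₁ u v + expo adj′ x₂ u v) ≡⟨ ∑q-cong (λ v → term-non (earlier adj′ u v) (hit v) o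
              (trans (between′ u v) (cong (λ b → 𝟙 (b ∧ hit v) ℕ.+ between adj′ u v) eq))) ⟩
          ∑q (λ v → (1ℚ + o) * expo adj x (suc u) (suc v)) ≡⟨ ∑q-* (1ℚ + o) (expo adj x (suc u) ∘ suc) ⟩
          (1ℚ + o) * ∑q (expo adj x (suc u) ∘ suc) ≡⟨ cong ((1ℚ + o) *_) (sym (ℚₚ.+-identityˡ _)) ⟩
          (1ℚ + o) * (0ℚ + ∑q (expo adj x (suc u) ∘ suc)) ∎))
        where open ≡-Reasoning

      split-rest : o ≤ κ → (1ℚ + o) * rest ≤ o * potential adj′ (w ∘ suc) x₁ (A ∘ suc) + potential adj′ (w ∘ suc) x₂ A₂
      split-rest o≤κ = subst₂ _≤_ (∑q-* (1ℚ + o) (λ u → ι (w (suc u)) * gain adj x A (suc u)))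
        (trans (∑q-+ (λ u → o * (ι (w (suc u)) * gain adj′ x₁ (A ∘ suc) u)) (λ u → ι (w (suc u)) * gain adj′ x₂ A₂ u))
          (cong (_+ potential adj′ (w ∘ suc) x₂ A₂) (∑q-* o (λ u → ι (w (suc u)) * gain adj′ x₁ (A ∘ suc) u))))
        (∑q-mono (λ u → subst₂ _≤_ (eq₁ (ι (w (suc u))) o (gain adj x A (suc u)))
          (eq₂ (ι (w (suc u))) o (gain adj′ x₁ (A ∘ suc) u) (gain adj′ x₂ A₂ u))
          (ℚₚ.*-monoˡ-≤-nonNeg (ι (w (suc u))) ⦃ nonNegative (ι≥0 (w (suc u))) ⦄ (split o≤κ u))))
        where
        eq₁ : ∀ w o g → w * ((1ℚ + o) * g) ≡ (1ℚ + o) * (w * g)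
        eq₁ = solve 3 (λ w o g → w :* ((con 1ℚ :+ o) :* g) := (con 1ℚ :+ o) :* (w :* g)) refl
        eq₂ : ∀ w o g h → w * (o * g + h) ≡ o * (w * g) + w * h
        eq₂ = solve 4 (λ w o g h → w :* (o :* g :+ h) := o :* (w :* g) :+ w :* h) refl

      cons : Bool → Pred N → Pred (suc N)
      cons b I zero = b
      cons b I (suc i) = I i

      ∑-cons-false : ∀ I → ∑∈ (cons false I) w ≡ ∑∈ I (w ∘ suc)
      ∑-cons-false I = ∑-suc _

      ∑-cons-true : ∀ I → ∑∈ (cons true I) w ≡ w zero ℕ.+ ∑∈ I (w ∘ suc)
      ∑-cons-true I = trans (∑-suc _) (cong (ℕ._+ ∑∈ I (w ∘ suc)) (ℕₚ.+-identityʳ (w zero)))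

      without : ∀ {y B} → (∀ u → x (suc u) ≡ 0ℚ → y u ≡ 0ℚ) → (s : Selection adj′ (w ∘ suc) y B) →
                potential adj w x A ≤ (ℓ + ℓ) * ι (∑∈ (proj₁ s) (w ∘ suc)) → Selection adj w x A
      without z (I , ind , zer , _) h = cons false I , ind′ , zer′ , subst (λ k → potential adj w x A ≤ (ℓ + ℓ) * ι k) (sym (∑-cons-false I)) h
        where
        ind′ : Independent adj (cons false I)
        ind′ (suc u) (suc v) p q (ℕ.s≤s r) = ind u v p q r
        zer′ : ∀ u → x u ≡ 0ℚ → u ∉ᵇ cons false I
        zer′ zero _ = refl
        zer′ (suc u) p = zer u (z u p)

      -- Passing over a vertex without positive gain costs nothing: its disappearance from the
      -- exposures only raises the other gains.
      skip : ι (w zero) * gain adj x A zero ≤ 0ℚ → Selection adj′ (w ∘ suc) (x ∘ suc) (A ∘ suc) → Selection adj w x A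
      skip h s@(I , _ , _ , bound) = without (λ _ p → p) s (ℚₚ.≤-trans
        (subst (potential adj w x A ≤_) (ℚₚ.+-identityˡ rest) (ℚₚ.+-monoˡ-≤ rest h)) (ℚₚ.≤-trans skip-rest bound))

      branch : o ≤ κ → o ≢ 0ℚ → Selection adj′ (w ∘ suc) x₁ (A ∘ suc) → Selection adj′ (w ∘ suc) x₂ A₂ → Selection adj w x A
      branch o≤κ o≢0 (I , ind , zer , bound₁) s₂@(I₂ , _ , _ , bound₂)
        with potential adj w x A ℚₚ.≤? (ℓ + ℓ) * ι (w zero ℕ.+ ∑∈ I (w ∘ suc))
      ... | yes p = cons true I , ind′ , zer′ , subst (λ k → potential adj w x A ≤ (ℓ + ℓ) * ι k) (sym (∑-cons-true I)) p
        where
        ind′ : Independent adj (cons true I)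
        ind′ (suc u) (suc v) p q (ℕ.s≤s r) = ind u v p q r
        ind′ (suc u) zero p _ _ = ≢true⇒false (λ q → true≢false p (zer u (cong (λ b → if b then 0ℚ else x (suc u)) q)))
        zer′ : ∀ u → x u ≡ 0ℚ → u ∉ᵇ cons true I
        zer′ zero p = ⊥-elim (o≢0 p)
        zer′ (suc u) p = zer u (lemma (hit u))
          where
          lemma : ∀ b → (if b then 0ℚ else x (suc u)) ≡ 0ℚ
          lemma true = refl
          lemma false = p
      ... | no p = without zero₂ s₂ (choose-arith (ι≥0 (w zero)) (x≥0 zero) (ℚₚ.≤-trans o≤κ κ≤1) (A≥0 zero)
          (cong (λ y → ι (w zero) * y + rest) gain-zero) (split-rest o≤κ) bound₁ bound₂
          (subst (λ y → (ℓ + ℓ) * y ≤ potential adj w x A) (ι-+ (w zero) (∑∈ I (w ∘ suc))) (ℚₚ.<⇒≤ (ℚₚ.≰⇒> p))))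
        where
        zero₂ : ∀ u → x (suc u) ≡ 0ℚ → x₂ u ≡ 0ℚ
        zero₂ u p with hit u
        ... | true = trans (cong (_* (1ℚ + o)) p) (ℚₚ.*-zeroˡ (1ℚ + o))
        ... | false = p

    select : ∀ {N} (adj : Fin N → Fin N → Bool) (w : Fin N → ℕ) (x A : Fin N → ℚ) → State adj x A → Selection adj w x A
    select {zero} adj w x A st = (λ ()) , (λ ()) , (λ ()) , 0≤* (0≤+ 0≤ℓ 0≤ℓ) (ι≥0 (∑∈ {0} (λ ()) w))
    select {suc N} adj w x A st with x zero ℚₚ.≟ 0ℚ
    ... | yes p = skip (ℚₚ.≤-reflexive (trans (cong (λ y → ι (w zero) * (y * (ℓ - A zero - ∑q (expo adj x zero)))) p)
                    (solve 2 (λ a b → a :* (con 0ℚ :* b) := con 0ℚ) refl (ι (w zero)) (ℓ - A zero - ∑q (expo adj x zero)))))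
                    (select _ _ _ _ state₀)
      where open Step adj w x A st
    ... | no p with x zero ℚₚ.≤? κ
    ... | yes q = branch q p (select _ _ _ _ state₁) (select _ _ _ _ (state₂ q))
      where open Step adj w x A st
    ... | no q = skip (≤-by _ (0≤* (0≤* (ι≥0 (w zero)) (State.x≥0 st zero)) (0≤- ℓ≤A))
                   (trans (eq (ι (w zero)) (x zero) ℓ (A zero)) (cong (λ y → ι (w zero) * y + ι (w zero) * x zero * (A zero - ℓ)) (sym gain-zero))))
                   (select _ _ _ _ state₀)
      where
      open Step adj w x A st
      ℓ≤A : ℓ ≤ A zero
      ℓ≤A = J-cap (State.x≥0 st zero) (State.A≥0 st zero) (State.inv st zero) (ℚₚ.≰⇒> q)
      eq : ∀ w x ℓ A → 0ℚ ≡ w * (x * (ℓ - A - 0ℚ)) + w * x * (A - ℓ)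
      eq = solve 4 (λ w x ℓ A → con 0ℚ := w :* (x :* (ℓ :- A :- con 0ℚ)) :+ w :* x :* (A :- ℓ)) refl

-- Heavy independent sets in graphs with few common neighbours

module IndependentSets where
  open NibblePotential
  open FiniteSums
  open import Data.Bool using (Bool; true; false)
  open import Data.Empty using (⊥-elim)
  open import Data.Fin using (Fin; zero; suc; toℕ)
  open import Data.Nat as ℕ using (ℕ; zero; suc)
  import Data.Nat.Properties as ℕₚ
  open import Data.Product using (∃; _×_; _,_; proj₁; proj₂)
  open import Data.Rational using (ℚ; 0ℚ; 1ℚ; _+_; _*_; _-_; -_; _≤_; _<_; nonNegative; positive)
  import Data.Rational.Properties as ℚₚ
  open import Data.Rational.Solver using (module +-*-Solver)
  open import Function using (_∘_)
  open import Relation.Binary.PropositionalEquality hiding (J)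
  open import Relation.Nullary using (yes; no)
  open +-*-Solver using (solve; _:=_; _:+_; _:*_; _:-_; con)

  pw : ℚ → ℕ → ℚ
  pw x zero = 1ℚ
  pw x (suc k) = x * pw x k

  pw≥0 : ∀ {x} k → 0ℚ ≤ x → 0ℚ ≤ pw x k
  pw≥0 zero _ = 0≤1
  pw≥0 (suc k) p = 0≤* p (pw≥0 k p)

  *-mono : ∀ {a b c d} → 0ℚ ≤ a → 0ℚ ≤ d → a ≤ b → c ≤ d → a * c ≤ b * d
  *-mono {a} {b} {c} {d} 0≤a 0≤d p q = ℚₚ.≤-trans (ℚₚ.*-monoˡ-≤-nonNeg a ⦃ nonNegative 0≤a ⦄ q)
    (ℚₚ.*-monoʳ-≤-nonNeg d ⦃ nonNegative 0≤d ⦄ p)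

  pw-mono : ∀ {x y} k → 0ℚ ≤ x → x ≤ y → pw x k ≤ pw y k
  pw-mono zero _ _ = ℚₚ.≤-refl
  pw-mono {x} {y} (suc k) p q = *-mono p (pw≥0 k (ℚₚ.≤-trans p q)) q (pw-mono k p q)

  bernoulli : ∀ {c o} k → 0ℚ ≤ c → 0ℚ ≤ o → pw c (suc k) + ι (suc k) * o * pw c k ≤ pw (c + o) (suc k)
  bernoulli {c} {o} zero p q = ℚₚ.≤-reflexive (solve 2 (λ c o → c :* con 1ℚ :+ (con 1ℚ :+ con 0ℚ) :* o :* con 1ℚ := (c :+ o) :* con 1ℚ) refl c o)
  bernoulli {c} {o} (suc k) p q = ℚₚ.≤-trans
    (≤-by (ι (suc k) * o * o * pw c k) (0≤* (0≤* (0≤* (ι≥0 (suc k)) q) q) (pw≥0 k p)) (eq c o (pw c k) (ι k)))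
    (ℚₚ.*-monoˡ-≤-nonNeg (c + o) ⦃ nonNegative (0≤+ p q) ⦄ (bernoulli k p q))
    where
    eq : ∀ c o z i → (c + o) * (c * z + (1ℚ + i) * o * z) ≡ c * (c * z) + (1ℚ + (1ℚ + i)) * o * (c * z) + (1ℚ + i) * o * o * z
    eq = solve 4 (λ c o z i → (c :+ o) :* (c :* z :+ (con 1ℚ :+ i) :* o :* z) :=
      c :* (c :* z) :+ (con 1ℚ :+ (con 1ℚ :+ i)) :* o :* (c :* z) :+ (con 1ℚ :+ i) :* o :* o :* z) refl

  -- A polynomial substitute for the exponential: as long as b is at most the exponent, lowering b
  -- by o costs its power at least the factor 1 + o.
  decay : ∀ {b o} k → 0ℚ ≤ o → o ≤ b → b ≤ ι (suc k) → (1ℚ + o) * pw (b - o) (suc k) ≤ pw b (suc k)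
  decay {b} {o} k 0≤o o≤b b≤k = ℚₚ.≤-trans
    (≤-by _ (0≤* (0≤* (0≤- c≤k) 0≤o) (pw≥0 k (0≤- o≤b))) (eq (b - o) o (pw (b - o) k) (ι (suc k))))
    (subst (λ y → pw (b - o) (suc k) + ι (suc k) * o * pw (b - o) k ≤ pw y (suc k)) (eq′ b o) (bernoulli k (0≤- o≤b) 0≤o))
    where
    c≤k : b - o ≤ ι (suc k)
    c≤k = ℚₚ.≤-trans (≤-by o 0≤o (sym (eq′ b o))) b≤k
      where
      eq′ : ∀ b o → b - o + o ≡ b
      eq′ = solve 2 (λ b o → b :- o :+ o := b) refl
    eq : ∀ c o z i → c * z + i * o * z ≡ (1ℚ + o) * (c * z) + (i - c) * o * z
    eq = solve 4 (λ c o z i → c :* z :+ i :* o :* z := (con 1ℚ :+ o) :* (c :* z) :+ (i :- c) :* o :* z) refl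
    eq′ : ∀ b o → b - o + o ≡ b
    eq′ = solve 2 (λ b o → b :- o :+ o := b) refl

  pw-double : ∀ x k → pw (x + x) k ≡ ι (2 ℕ.^ k) * pw x k
  pw-double x zero = refl
  pw-double x (suc k) = trans (cong ((x + x) *_) (pw-double x k)) (trans (eq x (ι (2 ℕ.^ k)) (pw x k))
    (cong (_* (x * pw x k)) (sym (trans (cong ι (cong (2 ℕ.^ k ℕ.+_) (ℕₚ.+-identityʳ (2 ℕ.^ k)))) (ι-+ (2 ℕ.^ k) (2 ℕ.^ k))))))
    where
    eq : ∀ x t z → (x + x) * (t * z) ≡ (t + t) * (x * z)
    eq = solve 3 (λ x t z → (x :+ x) :* (t :* z) := (t :+ t) :* (x :* z)) refl

  pw-pos : ∀ {x} k → 0ℚ < x → 0ℚ < pw x k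
  pw-pos zero _ = ℚₚ.positive⁻¹ 1ℚ
  pw-pos {x} (suc k) p = subst (_< x * pw x k) (ℚₚ.*-zeroʳ x) (ℚₚ.*-monoʳ-<-pos x ⦃ positive p ⦄ (pw-pos k p))

  ι-pos : ∀ n → 0ℚ < ι (suc n)
  ι-pos n = subst (_< 1ℚ + ι n) (ℚₚ.+-identityʳ 0ℚ) (ℚₚ.+-mono-<-≤ (ℚₚ.positive⁻¹ 1ℚ) (ι≥0 n))

  ratio : ∀ a b → ∃ λ q → 0ℚ ≤ q × ι (suc b) * q ≡ ι a
  ratio a b = (1/ ι (suc b)) * ι a , 0≤* (ℚₚ.<⇒≤ (ℚₚ.positive⁻¹ (1/ ι (suc b)) ⦃ ℚₚ.1/pos⇒pos (ι (suc b)) ⦄)) (ι≥0 a) ,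
    trans (sym (ℚₚ.*-assoc (ι (suc b)) (1/ ι (suc b)) (ι a))) (trans (cong (_* ι a) (ℚₚ.*-inverseʳ (ι (suc b)))) (ℚₚ.*-identityˡ (ι a)))
    where
    open Data.Rational using (1/_)
    instance
      pos : Data.Rational.Positive (ι (suc b))
      pos = positive (ι-pos b)
      nz : Data.Rational.NonZero (ι (suc b))
      nz = ℚₚ.pos⇒nonZero (ι (suc b))

  *-cancel : ∀ {r p q} → 0ℚ < r → r * p ≤ r * q → p ≤ q
  *-cancel {r} h = ℚₚ.*-cancelˡ-≤-pos r ⦃ positive h ⦄

  -- All weights start at q = L/4d. Since drifts are at most 2, exposures are at most 2qd = L/2, so
  -- initial gains are at least qL/2 and the set found has at least a quarter of q times the total
  -- weight: a factor L/16 better than the share 1/d. With κ = q · 2^(2L), the two size conditions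
  -- say that κ times `between` is at most 1/2 and that κ ≤ 1.
  independent-set : ∀ {N} (adj : Fin N → Fin N → Bool) (w : Fin N → ℕ) L d → 1 ℕ.≤ L → 1 ℕ.≤ d →
    (∀ u → # (earlier adj u) ℕ.≤ d) → (∀ u v → earlier adj u v ≡ true → L ℕ.* 2 ℕ.^ (L ℕ.+ L) ℕ.* between adj u v ℕ.≤ 2 ℕ.* d) →
    L ℕ.* 2 ℕ.^ (L ℕ.+ L) ℕ.≤ 4 ℕ.* d →
    ∃ λ (I : Pred N) → (∀ u v → u ∈ᵇ I → v ∈ᵇ I → toℕ v ℕ.< toℕ u → adj u v ≡ false) × L ℕ.* ∑ w ℕ.≤ 16 ℕ.* d ℕ.* ∑∈ I w
  independent-set {N} adj w (suc L′) (suc d′) _ _ deg≤ thin≤ small = I , ind , ι-cancel goal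
    where
    L = suc L′
    d = suc d′
    M = L ℕ.+ L
    4d = 4 ℕ.* d
    P = 2 ℕ.^ M
    ℓ = ι L
    0<4d : 0ℚ < ι 4d
    0<4d = ι-pos (ℕ.pred 4d)
    q = proj₁ (ratio L (ℕ.pred 4d))
    0≤q : 0ℚ ≤ q
    0≤q = proj₁ (proj₂ (ratio L (ℕ.pred 4d)))
    q-eq : ι 4d * q ≡ ℓ
    q-eq = proj₂ (proj₂ (ratio L (ℕ.pred 4d)))
    κ = q * ι P
    0≤κ : 0ℚ ≤ κ
    0≤κ = 0≤* 0≤q (ι≥0 P)
    scale : ∀ c → ι 4d * (q * c) ≡ ℓ * c
    scale c = trans (sym (ℚₚ.*-assoc (ι 4d) q c)) (cong (_* c) q-eq)
    κ≤1 : κ ≤ 1ℚ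
    κ≤1 = *-cancel 0<4d (subst₂ _≤_ (trans (ι-* L P) (sym (scale (ι P)))) (sym (ℚₚ.*-identityʳ (ι 4d))) (ι-mono small))
    0≤ℓ : 0ℚ ≤ ℓ
    0≤ℓ = ι≥0 L
    -- Stands in for x ≤ q · e^A. At A = 0 it is an equality for x = q; if x > κ = q · 2^M it forces
    -- ℓ + ℓ - A below ℓ. The exponent M = 2L is the largest value of the base, as `decay` demands.
    J : ℚ → ℚ → Set
    J x A = A ≤ ℓ + ℓ → x * pw (ℓ + ℓ - A) M ≤ q * pw (ℓ + ℓ) M
    J-zero : ∀ {A} → 0ℚ ≤ A → J 0ℚ A
    J-zero {A} _ _ = subst (_≤ q * pw (ℓ + ℓ) M) (sym (ℚₚ.*-zeroˡ (pw (ℓ + ℓ - A) M))) (0≤* 0≤q (pw≥0 M (0≤+ 0≤ℓ 0≤ℓ)))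
    J-step : ∀ {x A o} → 0ℚ ≤ x → 0ℚ ≤ A → 0ℚ ≤ o → o ≤ κ → J x A → J (x * (1ℚ + o)) (A + o)
    J-step {x} {A} {o} 0≤x 0≤A 0≤o _ inv A+o≤ = ℚₚ.≤-trans (subst₂ _≤_ eq refl
        (ℚₚ.*-monoˡ-≤-nonNeg x ⦃ nonNegative 0≤x ⦄ (decay (L′ ℕ.+ L) 0≤o o≤b b≤M)))
        (inv (ℚₚ.≤-trans (≤-by o 0≤o refl) A+o≤))
      where
      b = ℓ + ℓ - A
      o≤b : o ≤ b
      o≤b = ≤-by _ (0≤- A+o≤) (solve 3 (λ ℓ A o → ℓ :+ ℓ :- A := o :+ (ℓ :+ ℓ :- (A :+ o))) refl ℓ A o)
      b≤M : b ≤ ι M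
      b≤M = ≤-by A 0≤A (trans (ι-+ L L) (solve 2 (λ ℓ A → ℓ :+ ℓ := ℓ :+ ℓ :- A :+ A) refl ℓ A))
      eq : x * ((1ℚ + o) * pw (b - o) M) ≡ x * (1ℚ + o) * pw (ℓ + ℓ - (A + o)) M
      eq = trans (sym (ℚₚ.*-assoc x (1ℚ + o) _)) (cong (λ y → x * (1ℚ + o) * pw y M)
        (solve 3 (λ ℓ A o → ℓ :+ ℓ :- A :- o := ℓ :+ ℓ :- (A :+ o)) refl ℓ A o))
    J-cap : ∀ {x A} → 0ℚ ≤ x → 0ℚ ≤ A → J x A → κ < x → ℓ ≤ A
    J-cap {x} {A} 0≤x 0≤A inv κ<x with ℓ ℚₚ.≤? A
    ... | yes p = p
    ... | no p = ⊥-elim (ℚₚ.<-irrefl refl (ℚₚ.<-≤-trans κ<x (*-cancel (pw-pos M (ι-pos L′)) (subst₂ _≤_ (ℚₚ.*-comm x _) eq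
        (ℚₚ.≤-trans (ℚₚ.*-monoˡ-≤-nonNeg x ⦃ nonNegative 0≤x ⦄ (pw-mono M 0≤ℓ ℓ≤)) (inv A≤2ℓ))))))
      where
      A<ℓ = ℚₚ.≰⇒> p
      A≤2ℓ : A ≤ ℓ + ℓ
      A≤2ℓ = ℚₚ.≤-trans (ℚₚ.<⇒≤ A<ℓ) (≤-by ℓ 0≤ℓ refl)
      ℓ≤ : ℓ ≤ ℓ + ℓ - A
      ℓ≤ = ≤-by _ (0≤- (ℚₚ.<⇒≤ A<ℓ)) (solve 2 (λ ℓ A → ℓ :+ ℓ :- A := ℓ :+ (ℓ :- A)) refl ℓ A)
      eq : q * pw (ℓ + ℓ) M ≡ pw ℓ M * κ
      eq = trans (cong (q *_) (pw-double ℓ M)) (solve 3 (λ q P z → q :* (P :* z) := z :* (q :* P)) refl q (ι P) (pw ℓ M))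
    open Nibble (nibble-data ℓ κ 0≤ℓ 0≤κ κ≤1 J J-zero J-step J-cap)
    thin : ∀ u v → earlier adj u v ≡ true → (κ + κ) * ι (between adj u v) ≤ 1ℚ
    thin u v e = *-cancel 0<4d (subst₂ _≤_ lhs (trans (sym (ι-+ (2 ℕ.* d) (2 ℕ.* d)))
        (trans (cong ι (four d)) (sym (ℚₚ.*-identityʳ (ι 4d))))) (ℚₚ.+-mono-≤ (ι-mono (thin≤ u v e)) (ι-mono (thin≤ u v e))))
      where
      c = between adj u v
      four : ∀ d → 2 ℕ.* d ℕ.+ 2 ℕ.* d ≡ 4 ℕ.* d
      four d = sym (ℕₚ.*-distribʳ-+ d 2 2)
      lhs : ι (L ℕ.* P ℕ.* c) + ι (L ℕ.* P ℕ.* c) ≡ ι 4d * ((κ + κ) * ι c)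
      lhs = trans (cong₂ _+_ e₁ e₁) (trans (solve 3 (λ ℓ P c → ℓ :* P :* c :+ ℓ :* P :* c := ℓ :* (P :* c :+ P :* c)) refl ℓ (ι P) (ι c))
        (trans (sym (scale (ι P * ι c + ι P * ι c))) (cong (ι 4d *_)
          (solve 3 (λ q P c → q :* (P :* c :+ P :* c) := (q :* P :+ q :* P) :* c) refl q (ι P) (ι c)))))
        where
        e₁ : ι (L ℕ.* P ℕ.* c) ≡ ℓ * ι P * ι c
        e₁ = trans (ι-* (L ℕ.* P) c) (cong (_* ι c) (ι-* L P))
    start : State adj (λ _ → q) (λ _ → 0ℚ)
    start = record { x≥0 = λ _ → 0≤q ; A≥0 = λ _ → ℚₚ.≤-refl ; thin = thin
                   ; inv = λ _ _ → ℚₚ.≤-reflexive (cong (λ y → q * pw y M) (solve 1 (λ ℓ → ℓ :+ ℓ :- con 0ℚ := ℓ :+ ℓ) refl ℓ)) }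
    sel = select adj w (λ _ → q) (λ _ → 0ℚ) start
    I = proj₁ sel
    ind = proj₁ (proj₂ sel)
    ∑q-ι : ∀ {n} (f : Fin n → ℕ) → ∑q (λ i → ι (f i)) ≡ ι (∑ f)
    ∑q-ι {zero} f = cong ι (sym (∑-zero f))
    ∑q-ι {suc n} f = trans (cong (ι (f zero) +_) (∑q-ι (f ∘ suc))) (trans (sym (ι-+ (f zero) _)) (cong ι (sym (∑-suc f))))
    exposure : ∀ u → ∑q (expo adj (λ _ → q) u) ≤ (q + q) * ι d
    exposure u = ℚₚ.≤-trans (∑q-mono (λ v → term v))
      (subst (_≤ (q + q) * ι d) (sym (trans (∑q-* (q + q) (λ v → ι (𝟙 (earlier adj u v)))) (cong ((q + q) *_) (∑q-ι (λ v → 𝟙 (earlier adj u v))))))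
        (ℚₚ.*-monoˡ-≤-nonNeg (q + q) ⦃ nonNegative (0≤+ 0≤q 0≤q) ⦄ (ι-mono (deg≤ u))))
      where
      term : ∀ v → expo adj (λ _ → q) u v ≤ (q + q) * ι (𝟙 (earlier adj u v))
      term v with earlier adj u v in e
      ... | false = ℚₚ.≤-reflexive (sym (ℚₚ.*-zeroʳ (q + q)))
      ... | true = ≤-by _ (0≤* 0≤q (0≤- (thin u v e)))
        (solve 2 (λ q k → (q :+ q) :* (con 1ℚ :+ con 0ℚ) := q :* (con 1ℚ :+ k) :+ q :* (con 1ℚ :- k)) refl q ((κ + κ) * ι (between adj u v)))
    gain≥ : ∀ u → q * (ℓ - (q + q) * ι d) ≤ gain adj (λ _ → q) (λ _ → 0ℚ) u
    gain≥ u = ≤-by _ (0≤* 0≤q (0≤- (exposure u)))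
      (solve 4 (λ q ℓ B C → q :* (ℓ :- con 0ℚ :- B) := q :* (ℓ :- C) :+ q :* (C :- B)) refl q ℓ (∑q (expo adj (λ _ → q) u)) ((q + q) * ι d))
    W = ι (∑ w)
    V = ι (∑∈ I w)
    bound : q * (ℓ - (q + q) * ι d) * W ≤ (ℓ + ℓ) * V
    bound = ℚₚ.≤-trans (ℚₚ.≤-reflexive (trans (cong (q * (ℓ - (q + q) * ι d) *_) (sym (∑q-ι w)))
        (sym (∑q-* (q * (ℓ - (q + q) * ι d)) (λ u → ι (w u))))))
      (ℚₚ.≤-trans (∑q-mono (λ u → subst (_≤ ι (w u) * gain adj (λ _ → q) (λ _ → 0ℚ) u) (ℚₚ.*-comm (ι (w u)) (q * (ℓ - (q + q) * ι d)))
        (ℚₚ.*-monoˡ-≤-nonNeg (ι (w u)) ⦃ nonNegative (ι≥0 (w u)) ⦄ (gain≥ u))))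
        (proj₂ (proj₂ (proj₂ sel))))
    4d≡ : ι 4d ≡ ι d + ι d + ι d + ι d
    4d≡ = trans (ι-* 4 d) (solve 1 (λ d → (con 1ℚ :+ (con 1ℚ :+ (con 1ℚ :+ (con 1ℚ :+ con 0ℚ)))) :* d := d :+ d :+ d :+ d) refl (ι d))
    half : (ℓ + ℓ) * (q * (ℓ - (q + q) * ι d) * W) ≡ ℓ * (ℓ * (q * W))
    half = trans (solve 4 (λ ℓ q d W → (ℓ :+ ℓ) :* (q :* (ℓ :- (q :+ q) :* d) :* W) :=
              ℓ :* ((ℓ :+ ℓ :- (d :+ d :+ d :+ d) :* q) :* (q :* W))) refl ℓ q (ι d) W)
           (cong (λ y → ℓ * (y * (q * W))) (trans (cong (λ y → ℓ + ℓ - y) (trans (cong (_* q) (sym 4d≡)) q-eq))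
              (solve 1 (λ ℓ → ℓ :+ ℓ :- ℓ := ℓ) refl ℓ)))
    qW : q * W ≤ V + V + (V + V)
    qW = *-cancel (ι-pos L′) (*-cancel (ι-pos L′) (subst₂ _≤_ half
      (solve 2 (λ ℓ V → (ℓ :+ ℓ) :* ((ℓ :+ ℓ) :* V) := ℓ :* (ℓ :* (V :+ V :+ (V :+ V)))) refl ℓ V)
      (ℚₚ.*-monoˡ-≤-nonNeg (ℓ + ℓ) ⦃ nonNegative (0≤+ 0≤ℓ 0≤ℓ) ⦄ bound)))
    goal : ι (L ℕ.* ∑ w) ≤ ι (16 ℕ.* d ℕ.* ∑∈ I w)
    goal = subst₂ _≤_ (trans (scale W) (sym (ι-* L (∑ w))))
      (sym (trans (ι-* (16 ℕ.* d) (∑∈ I w)) (trans (cong (_* V) (trans (cong ι (ℕₚ.*-assoc 4 4 d)) (ι-* 4 4d)))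
        (solve 2 (λ k V → (con 1ℚ :+ (con 1ℚ :+ (con 1ℚ :+ (con 1ℚ :+ con 0ℚ)))) :* k :* V := k :* (V :+ V :+ (V :+ V))) refl (ι 4d) V))))
      (ℚₚ.*-monoˡ-≤-nonNeg (ι 4d) ⦃ nonNegative (ℚₚ.<⇒≤ 0<4d) ⦄ qW)

-- Matchings of large volume among edges of bounded size

module LargeMatchings where
  open FiniteSums
  open GreedyColouring
  open LinearIncidence
  open DenseSubsets
  open NibblePotential using (earlier; between)
  open IndependentSets using (independent-set)
  open PolynomialIdentities using (polynomial; _:=_; _:+_; _:*_; con)
  open import Data.Bool using (Bool; true; false; _∧_; not)
  open import Data.Empty using (⊥-elim)
  open import Data.Fin using (Fin; zero; suc; toℕ)
  open import Data.Nat using (ℕ; zero; suc; _+_; _*_; _∸_; _^_; _≤_; _<_; s≤s; s≤s⁻¹; _<ᵇ_)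
  open import Data.Nat.Properties
  open import Data.Product using (∃; _×_; _,_; proj₁; proj₂)
  open import Data.Vec using ([]; _∷_)
  open import Relation.Binary.PropositionalEquality
  open import Relation.Binary.Definitions using (tri<; tri≈; tri>)
  open import Data.Fin.Properties using (toℕ-injective)
  thin-arith : ∀ LP c n s ρ → c * ρ ≤ n + s * ρ → LP * (n + s * ρ) ≤ 2 * (2 * n) * ρ → LP * c * ρ ≤ 2 * (2 * n) * ρ
  thin-arith LP c n s ρ h1 h2 = farkas 0 (+-mono-≤ (*-monoʳ-≤ LP h1) h2)
    (polynomial (LP ∷ c ∷ n ∷ s ∷ ρ ∷ []) (λ LP c n s ρ → con 1 :* (LP :* c :* ρ) :+ (LP :* (n :+ s :* ρ) :+ (con 2 :* (con 2 :* n) :* ρ)) :+ con 0 := con 1 :* (con 2 :* (con 2 :* n) :* ρ) :+ (LP :* (c :* ρ) :+ (LP :* (n :+ s :* ρ)))) refl)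

  deg-arith : ∀ dg n x → dg * (1 + x) ≤ (2 + x) * n → dg * (1 + x) ≤ 2 * n * (1 + x)
  deg-arith dg n x h1 = farkas 0 h1
    (polynomial (dg ∷ n ∷ x ∷ []) (λ dg n x → con 1 :* (dg :* (con 1 :+ x)) :+ (((con 2 :+ x) :* n)) :+ (n :* x) := con 1 :* (con 2 :* n :* (con 1 :+ x)) :+ ((dg :* (con 1 :+ x)))) refl)

  gain-arith : ∀ L K n Q M → L * Q ≤ 32 * n * M → n * n ≤ K * Q → n * (L * n) ≤ n * (32 * K * M)
  gain-arith L K n Q M h1 h2 = farkas 0 (+-mono-≤ (*-monoʳ-≤ K h1) (*-monoʳ-≤ L h2))
    (polynomial (L ∷ K ∷ n ∷ Q ∷ M ∷ []) (λ L K n Q M → con 1 :* (n :* (L :* n)) :+ (K :* (con 32 :* n :* M) :+ L :* (K :* Q)) :+ con 0 := con 1 :* (n :* (con 32 :* K :* M)) :+ (K :* (L :* Q) :+ L :* (n :* n))) refl)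

  sum-arith : ∀ L K n T M Q → L * n ≤ 32 * K * M → T * L * n ≤ 32 * K * Q → (1 + T) * L * n ≤ 32 * K * (M + Q)
  sum-arith L K n T M Q h1 h2 = farkas 0 (+-mono-≤ h1 h2)
    (polynomial (L ∷ K ∷ n ∷ T ∷ M ∷ Q ∷ []) (λ L K n T M Q → con 1 :* ((con 1 :+ T) :* L :* n) :+ ((con 32 :* K :* M) :+ (con 32 :* K :* Q)) :+ con 0 := con 1 :* (con 32 :* K :* (M :+ Q)) :+ ((L :* n) :+ (T :* L :* n))) refl)

  module Matching {n m : ℕ} (a : Fin m → Fin n → Bool)
    (lin : ∀ i j → i ≢ j → ∀ u v → u ∈ᵇ a i → u ∈ᵇ a j → v ∈ᵇ a i → v ∈ᵇ a j → u ≡ v) where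

    open Dense a lin public

    size≤n : ∀ i → size i ≤ n
    size≤n i = #≤n (a i)

    -- With sizes decreasing, all earlier edges are at least as large, so `deg-bound` leaves an edge
    -- at most 2n earlier neighbours.
    record Sorted (Q : Pred m) : Set where
      field
        N      : ℕ
        ord    : Fin N → Fin m
        member : ∀ u → ord u ∈ᵇ Q
        desc   : ∀ u v → toℕ v < toℕ u → size (ord u) ≤ size (ord v)
        distinct : ∀ u v → toℕ v < toℕ u → ord u ≢ ord v
        total  : ∀ (f : Fin m → ℕ) → ∑ (λ u → f (ord u)) ≡ ∑∈ Q f

    sort : ∀ Q → Sorted Q
    sort Q = go (# Q) Q ≤-refl
      where
      go : ∀ b Q → # Q ≤ b → Sorted Q
      go b Q bound with some Q in eq
      ... | false = record { N = 0 ; ord = λ () ; member = λ () ; desc = λ () ; distinct = λ ()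
                           ; total = λ f → trans (∑-zero _) (sym (∑∈-0 f (some-false {P = Q} eq))) }
      go zero Q bound | true = ⊥-elim (1+n≰n (≤-trans (#-member {S = Q} (proj₂ (some-true {P = Q} eq))) bound))
      -- The least value of `n ∸ size i` belongs to a largest edge.
      go (suc b) Q bound | true with min-element {S = Q} (λ i → n ∸ size i) (proj₂ (some-true {P = Q} eq))
      ... | e , e∈ , top = record
        { N = suc N ; ord = ord′ ; member = member′ ; desc = desc′ ; distinct = distinct′
        ; total = λ f → trans (∑-suc _) (trans (cong (f e +_) (total f)) (sym (∑∈-remove {S = Q} f e∈))) }
        where
        open Sorted (go b (Q ∖ e) (s≤s⁻¹ (subst (_≤ suc b) (#-remove {S = Q} e∈) bound)))
        ord′ : Fin (suc N) → Fin m
        ord′ zero = e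
        ord′ (suc u) = ord u
        member′ : ∀ u → ord′ u ∈ᵇ Q
        member′ zero = e∈
        member′ (suc u) = ∖-⊆ {S = Q} (ord u) (member u)
        desc′ : ∀ u v → toℕ v < toℕ u → size (ord′ u) ≤ size (ord′ v)
        desc′ (suc u) zero _ = ≮⇒≥ (λ lt → <⇒≱ (∸-monoʳ-< lt (size≤n (ord u))) (top (ord u) (∖-⊆ {S = Q} (ord u) (member u))))
        desc′ (suc u) (suc v) (s≤s p) = desc u v p
        distinct′ : ∀ u v → toℕ v < toℕ u → ord′ u ≢ ord′ v
        distinct′ (suc u) zero _ = ∖-≢ {S = Q} (member u)
        distinct′ (suc u) (suc v) (s≤s p) = distinct u v p

    -- The graph is that of meeting edges, weighted by volume; its codegrees are bounded by
    -- `common-bound`. The gain over the trivial share of order 1/n is the factor L/32.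
    matching : ∀ L ρ s Q → 1 ≤ L → 1 ≤ ρ → 1 ≤ n →
               (∀ j → j ∈ᵇ Q → suc ρ ≤ size j) → (∀ j → j ∈ᵇ Q → size j ≤ s) →
               L * 2 ^ (L + L) * (n + s * s * ρ) ≤ 2 * (2 * n) * ρ → L * 2 ^ (L + L) ≤ 4 * (2 * n) →
               ∃ λ M → M ⊆ᵇ Q × (∀ i j → i ∈ᵇ M → j ∈ᵇ M → adj i j ≡ false) × L * vol Q ≤ 32 * n * vol M
    matching L ρ@(suc ρ′) s Q 1≤L _ 1≤n low high c₁ c₂ = from-sorted (sort Q)
     where
     from-sorted : Sorted Q → ∃ λ M → M ⊆ᵇ Q × (∀ i j → i ∈ᵇ M → j ∈ᵇ M → adj i j ≡ false) × L * vol Q ≤ 32 * n * vol M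
     from-sorted sorted = from-set (independent-set adjN W L (2 * n) 1≤L (≤-trans 1≤n (m≤m+n n _)) deg≤ thin c₂)
      where
      open Sorted sorted
      LP = L * 2 ^ (L + L)
      W : Fin N → ℕ
      W u = size (ord u) * (size (ord u) ∸ 1)
      adjN : Fin N → Fin N → Bool
      adjN u v = adj (ord u) (ord v)
      above : Fin m → Pred m
      above e j = Q j ∧ not (size j <ᵇ size e)
      above-low : ∀ e j → j ∈ᵇ above e → size e ≤ size j
      above-low e j p = <ᵇ-false (not-true (proj₂ (∧-true {Q j} p)))
      above-count : ∀ v (P : Pred m) → # (λ w → (toℕ w <ᵇ toℕ v) ∧ P (ord w)) ≤ # (λ j → above (ord v) j ∧ P j)
      above-count v P = ≤-trans (∑-mono pt) (≤-trans (≤-reflexive (total (λ j → 𝟙 (not (size j <ᵇ size (ord v)) ∧ P j))))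
        (∑-mono (λ j → ≤-reflexive (lemma (Q j) (not (size j <ᵇ size (ord v))) (P j)))))
        where
        pt : ∀ w → 𝟙 ((toℕ w <ᵇ toℕ v) ∧ P (ord w)) ≤ 𝟙 (not (size (ord w) <ᵇ size (ord v)) ∧ P (ord w))
        pt w = 𝟙-mono (λ p → let x , y = ∧-true {toℕ w <ᵇ toℕ v} p in
          ∧-intro (not-intro (<ᵇ-introF (desc v w (<ᵇ-true x)))) y)
        lemma : ∀ x y z → 𝟙 x * 𝟙 (y ∧ z) ≡ 𝟙 ((x ∧ y) ∧ z)
        lemma true y z = *-identityˡ _
        lemma false y z = refl
      size-suc : ∀ u → ∃ λ x → size (ord u) ≡ suc (suc x)
      size-suc u with suc≡ (low (ord u) (member u))
      ... | y , eq with suc≡ (s≤s⁻¹ (≤-trans (low (ord u) (member u)) (≤-reflexive eq)))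
      ... | x , refl = x , eq
      deg≤ : ∀ u → # (earlier adjN u) ≤ 2 * n
      deg≤ u with size-suc u
      ... | x , eq = ≤-trans (above-count u (adj (ord u))) (*-cancelʳ-≤ _ _ (suc x)
        (deg-arith (deg (above (ord u)) (ord u)) n x (subst (λ y → deg (above (ord u)) (ord u) * suc x ≤ y * n) eq
          (deg-bound (above (ord u)) (suc x) (λ j p → ≤-trans (≤-reflexive (sym eq)) (above-low (ord u) j p)) (ord u)))))
      thin : ∀ u v → earlier adjN u v ≡ true → LP * between adjN u v ≤ 2 * (2 * n)
      thin u v e = ≤-trans (*-monoʳ-≤ LP (≤-trans (above-count v (λ w → adj (ord u) w ∧ adj (ord v) w))
          (∑-mono (λ j → ≤-reflexive (cong 𝟙 (assoc (above (ord v) j) (adj (ord u) j) (adj (ord v) j)))))))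
        (*-cancelʳ-≤ _ _ ρ (thin-arith LP (common (above (ord v)) (ord u) (ord v)) n (s * s) ρ
          (≤-trans (common-bound (above (ord v)) ρ (λ j p → low j (proj₁ (∧-true {Q j} p))) (proj₂ (∧-true {toℕ v <ᵇ toℕ u} e)))
            (+-monoʳ-≤ n (*-monoˡ-≤ ρ (*-mono-≤ (high (ord u) (member u)) (high (ord v) (member v)))))) c₁))
        where
        assoc : ∀ x y z → x ∧ (y ∧ z) ≡ (x ∧ y) ∧ z
        assoc true y z = refl
        assoc false y z = refl
      from-set : (∃ λ (I : Pred N) → (∀ u v → u ∈ᵇ I → v ∈ᵇ I → toℕ v < toℕ u → adjN u v ≡ false) ×
                   L * ∑ W ≤ 16 * (2 * n) * ∑∈ I W) →
                 ∃ λ M → M ⊆ᵇ Q × (∀ i j → i ∈ᵇ M → j ∈ᵇ M → adj i j ≡ false) × L * vol Q ≤ 32 * n * vol M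
      from-set (I , I-ind , bound) = M , M⊆Q , M-ind , weight
        where
        M : Pred m
        M e = some (λ u → (ord u == e) ∧ I u)
        M-preimage : ∀ e → e ∈ᵇ M → ∃ λ u → ord u ≡ e × u ∈ᵇ I
        M-preimage e p with some-true {P = λ u → (ord u == e) ∧ I u} p
        ... | u , q = u , ==⇒≡ (proj₁ (∧-true {ord u == e} q)) , proj₂ (∧-true {ord u == e} q)
        M⊆Q : M ⊆ᵇ Q
        M⊆Q e p with M-preimage e p
        ... | u , refl , _ = member u
        M-ind : ∀ i j → i ∈ᵇ M → j ∈ᵇ M → adj i j ≡ false
        M-ind i j p q with M-preimage i p | M-preimage j q
        ... | u , refl , x | v , refl , y with <-cmp (toℕ u) (toℕ v)
        ... | tri< lt _ _ = ≢true⇒false (λ z → true≢false (adj-sym (ord u) (ord v) z) (I-ind v u y x lt))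
        ... | tri≈ _ eq _ rewrite toℕ-injective eq = adj-irrefl (ord v)
        ... | tri> _ _ gt = I-ind u v x y gt
        weight : L * vol Q ≤ 32 * n * vol M
        weight = begin
          L * vol Q ≡⟨ cong (L *_) (total (λ j → size j * (size j ∸ 1))) ⟨
          L * ∑ (λ u → W u) ≤⟨ bound ⟩
          16 * (2 * n) * ∑∈ I (λ u → W u) ≤⟨ *-monoʳ-≤ (16 * (2 * n)) transfer ⟩
          16 * (2 * n) * vol M ≡⟨ cong (_* vol M) (*-assoc 16 2 n) ⟨
          32 * n * vol M ∎
          where
          open ≤-Reasoning
          transfer : ∑∈ I (λ u → W u) ≤ vol M
          transfer = begin
            ∑∈ I (λ u → W u) ≤⟨ ∑-mono (λ u → *-monoˡ-≤ (W u) (𝟙-mono (λ p →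
              some-intro {P = λ v → (ord v == ord u) ∧ I v} {u} (∧-intro (==-refl (ord u)) p)))) ⟩
            ∑ (λ u → 𝟙 (M (ord u)) * W u) ≡⟨ total (λ j → 𝟙 (M j) * (size j * (size j ∸ 1))) ⟩
            ∑∈ Q (λ j → 𝟙 (M j) * (size j * (size j ∸ 1))) ≤⟨ ∑∈-≤∑ Q _ ⟩
            vol M ∎

-- Intervals of colours and composition of extensions

module Extensions where
  open FiniteSums
  open GreedyColouring
  open LinearIncidence
  open DenseSubsets
  open LargeMatchings
  open import Data.Bool using (Bool; true; false; _∧_; _∨_; not)
  open import Data.Empty using (⊥-elim)
  open import Data.Fin using (Fin; zero; suc; toℕ)
  open import Data.Nat using (ℕ; zero; suc; _+_; _*_; _∸_; _≤_; _<_; s≤s; _<ᵇ_)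
  open import Data.Nat.Properties
  open import Data.Product using (∃; _×_; _,_; proj₁)
  open import Data.Sum using (_⊎_; inj₁; inj₂)
  open import Relation.Binary.PropositionalEquality

  opaque
    Int : ∀ {k} → ℕ → ℕ → Pred k
    Int b e c = not (toℕ c <ᵇ b) ∧ (toℕ c <ᵇ e)

    Int-elim : ∀ {k b e} {c : Fin k} → c ∈ᵇ Int b e → b ≤ toℕ c × toℕ c < e
    Int-elim {b = b} {e} {c} p with ∧-true {not (toℕ c <ᵇ b)} p
    ... | x , y = <ᵇ-false (not-true x) , <ᵇ-true y

    Int-intro : ∀ {k b e} {c : Fin k} → b ≤ toℕ c → toℕ c < e → c ∈ᵇ Int b e
    Int-intro p q = ∧-intro (not-intro (<ᵇ-introF p)) (<ᵇ-intro q)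

    #-Int : ∀ {k} b l → b + l ≤ k → # (Int {k} b (b + l)) ≡ l
    #-Int {zero} zero zero _ = ∑-zero _
    #-Int {suc k} zero zero _ = ∑-0 (λ i → refl)
    #-Int {suc k} zero (suc l) (s≤s p) = trans (∑-suc _) (cong suc (#-Int {k} zero l p))
    #-Int {suc k} (suc b) l (s≤s p) = trans (∑-suc _) (#-Int {k} b l p)

  module Extend {m k : ℕ} (adj : Fin m → Fin m → Bool)
                (adj-sym : ∀ i j → adj i j ≡ true → adj j i ≡ true)
                (adj-irrefl : ∀ i → adj i i ≡ false)
                (size : Fin m → ℕ) where

    open Greedy {m} {k} adj adj-sym adj-irrefl size public

    extend-∅ : ∀ {D col} {A : Pred k} {cap} → Proper D col → Extension D col (λ _ → false) A cap
    extend-∅ {D} {col} pr = record { col′ = col ; agree = λ _ _ → refl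
      ; proper′ = λ i j p q → pr i j (un i p) (un j q) ; palette = λ i ()
      ; load′ = λ c → inj₁ (load-cong c (∉∪ {D = D} (λ _ → refl)) (λ _ _ → refl)) }
      where
      un : ∀ i → i ∈ᵇ D ∪ᵇ (λ _ → false) → i ∈ᵇ D
      un i p = trans (sym (∉∪ {D = D} (λ _ → refl) i)) p

    ∪-assoc : ∀ (D S R : Pred m) i → ((D ∪ᵇ S) ∪ᵇ R) i ≡ (D ∪ᵇ (S ∪ᵇ R)) i
    ∪-assoc D S R i with D i
    ... | true = refl
    ... | false = refl

    extend-trans : ∀ {D col S R A B C cap} → (∀ i → i ∈ᵇ R → i ∉ᵇ S) → A ⊆ᵇ C → B ⊆ᵇ C →
                   (E : Extension D col S A cap) → Extension (D ∪ᵇ S) (Extension.col′ E) R B cap →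
                   Extension D col (S ∪ᵇ R) C cap
    extend-trans {D} {col} {S} {R} {A} {B} {C} {cap} disj A⊆C B⊆C E F = record
      { col′ = F.col′
      ; agree = λ i p → trans (F.agree i (∨F₂ p)) (E.agree i (∨F₁ p))
      ; proper′ = λ i j p q → F.proper′ i j (trans (∪-assoc D S R i) p) (trans (∪-assoc D S R j) q)
      ; palette = pal
      ; load′ = λ c → subst (λ x → x ≡ load D col c ⊎ x ≤ cap) (load-cong c (∪-assoc D S R) (λ _ _ → refl)) (ld c) }
      where
      module E = Extension E
      module F = Extension F
      ∨F₁ : ∀ {x y} → x ∨ y ≡ false → x ≡ false
      ∨F₁ {false} _ = refl
      ∨F₂ : ∀ {x y} → x ∨ y ≡ false → y ≡ false
      ∨F₂ {false} p = p
      pal : ∀ i → i ∈ᵇ S ∪ᵇ R → F.col′ i ∈ᵇ C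
      pal i p with R i in eq
      ... | true = B⊆C _ (F.palette i eq)
      ... | false with ∨-true {S i} p
      ... | inj₁ q = subst (_∈ᵇ C) (sym (F.agree i eq)) (A⊆C _ (E.palette i q))
      ld : ∀ c → load ((D ∪ᵇ S) ∪ᵇ R) F.col′ c ≡ load D col c ⊎ load ((D ∪ᵇ S) ∪ᵇ R) F.col′ c ≤ cap
      ld c with F.load′ c
      ... | inj₂ p = inj₂ p
      ... | inj₁ p with E.load′ c
      ... | inj₁ q = inj₁ (trans p q)
      ... | inj₂ q = inj₂ (≤-trans (≤-reflexive p) q)

    extend-cong : ∀ {D col S R A cap} → (∀ i → S i ≡ R i) → Extension D col S A cap → Extension D col R A cap
    extend-cong {D} {col} {S} {R} {A} {cap} eq E = record
      { col′ = col′ ; agree = λ i p → agree i (trans (eq i) p)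
      ; proper′ = λ i j p q → proper′ i j (trans (eq′ i) p) (trans (eq′ j) q)
      ; palette = λ i p → palette i (trans (eq i) p)
      ; load′ = λ c → subst (λ x → x ≡ load D col c ⊎ x ≤ cap) (load-cong c eq′ (λ _ _ → refl)) (load′ c) }
      where
      open Extension E
      eq′ : ∀ i → (D ∪ᵇ S) i ≡ (D ∪ᵇ R) i
      eq′ i = cong (D i ∨_) (eq i)

    Unused : Pred m → (Fin m → Fin k) → Pred k → Set
    Unused D col A = ∀ i → i ∈ᵇ D → col i ∉ᵇ A

    unused-seen : ∀ {D col A} → Unused D col A → ∀ e → # (A ∩ᵇ seen D col e) ≡ 0
    unused-seen {D} {col} {A} un e = ∑-0 lemma
      where
      lemma : ∀ c → 𝟙 (A c ∧ seen D col e c) ≡ 0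
      lemma c with A c in p | seen D col e c in q
      ... | false | _ = refl
      ... | true | false = refl
      ... | true | true with some-true {P = λ i → (D i ∧ adj e i) ∧ (col i == c)} q
      ... | i , r with ∧-true {D i ∧ adj e i} r
      ... | x , y = ⊥-elim (true≢false p (subst (_∉ᵇ A) (==⇒≡ y) (un i (proj₁ (∧-true {D i} x)))))

    unused-load : ∀ {D col A} → Unused D col A → ∑∈ D (λ i → 𝟙 (A (col i)) * size i) ≡ 0
    unused-load {D} {col} {A} un = ∑-0 lemma
      where
      lemma : ∀ i → 𝟙 (D i) * (𝟙 (A (col i)) * size i) ≡ 0
      lemma i with D i in p
      ... | false = refl
      ... | true rewrite un i p = refl

    -- On colours that `D` does not use, neither neighbours nor loads in `D` matter: only degrees
    -- inside `S` and the full colours remain.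
    extend-fresh : ∀ {D col} → Proper D col → (A : Pred k) (cap s F X : ℕ) (S : Pred m) →
             (∀ i → i ∈ᵇ S → i ∉ᵇ D) → Unused D col A → (∀ i → i ∈ᵇ S → size i ≤ s) →
             ∑∈ S size < suc F * (suc cap ∸ s) → X + F < # A →
             (∀ S′ → S′ ⊆ᵇ S → ∀ i → i ∈ᵇ S′ → ∃ λ e → e ∈ᵇ S′ × deg S′ e ≤ X) →
             Extension D col S A cap
    extend-fresh {D} {col} pr A cap s F X S disj un small few room degen = extend pr A cap s F S disj small
      (subst (λ x → x + ∑∈ S size < suc F * (suc cap ∸ s)) (sym (unused-load {D} {col} {A} un)) few)
      (λ S′ sub i p → let e , q , r = degen S′ sub i p in e , q ,
        ≤-<-trans (+-monoˡ-≤ F (≤-trans (≤-reflexive (trans (cong (deg S′ e +_) (unused-seen {D} {col} {A} un e)) (+-identityʳ _))) r)) room)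

    unused-⊆ : ∀ {D col A B} → A ⊆ᵇ B → Unused D col B → Unused D col A
    unused-⊆ sub un i p = ≢true⇒false (λ q → true≢false (sub _ q) (un i p))

    unused-extend : ∀ {D col S A B cap} → (E : Extension D col S A cap) → (∀ i → i ∈ᵇ D → i ∉ᵇ S) →
                    (∀ c → c ∈ᵇ B → c ∉ᵇ A) → Unused D col B → Unused (D ∪ᵇ S) (Extension.col′ E) B
    unused-extend {D} {S = S} {A} {B} E disj AB un i p with S i in eq
    ... | true = ≢true⇒false (λ q → true≢false (Extension.palette E i eq) (AB _ q))
    ... | false with ∨-true {D i} p
    ... | inj₁ d = subst (_∉ᵇ B) (sym (Extension.agree E i eq)) (un i d)

-- Few colours suffice for short edges: iterated matchings

module SparseColouring where
  open FiniteSums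
  open GreedyColouring
  open LinearIncidence
  open DenseSubsets
  open LargeMatchings
  open Extensions
  open PolynomialIdentities using (polynomial; _:=_; _:+_; _:*_; con)
  open import Data.Bool using (Bool; true; false; _∧_; _∨_; not)
  open import Data.Empty using (⊥-elim)
  open import Data.Fin using (Fin; zero; suc)
  open import Data.Nat using (ℕ; zero; suc; _+_; _*_; _∸_; _^_; _≤_; _<_; z≤n; s≤s; s≤s⁻¹)
  open import Data.Nat.Properties
  open import Data.Product using (∃; _×_; _,_; proj₁; proj₂)
  open import Data.Sum using (_⊎_; inj₁; inj₂)
  open import Data.Vec using ([]; _∷_)
  open import Relation.Binary.PropositionalEquality
  open import Relation.Nullary using (yes; no)
  budget : ∀ q Y l T P Q R → q * Y ≤ l → l + R ≤ Q → (1 + T) * Y + Q ≤ P * Y → (1 + q) * Y + (T * Y + R) ≤ P * Y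
  budget q Y l T P Q R h1 h2 h3 = farkas 0 (+-mono-≤ (+-mono-≤ h1 h2) h3)
    (polynomial (q ∷ Y ∷ l ∷ T ∷ P ∷ Q ∷ R ∷ []) (λ q Y l T P Q R → con 1 :* ((con 1 :+ q) :* Y :+ (T :* Y :+ R)) :+ (l :+ Q :+ (P :* Y)) :+ con 0 := con 1 :* (P :* Y) :+ ((q :* Y) :+ (l :+ R) :+ ((con 1 :+ T) :* Y :+ Q))) refl)

  open import Data.Nat.DivMod using (_/_; m≡m%n+[m/n]*n; m%n<n; m/n*n≤m)

  module Sparse {n m k : ℕ} (a : Fin m → Fin n → Bool)
    (lin : ∀ i j → i ≢ j → ∀ u v → u ∈ᵇ a i → u ∈ᵇ a j → v ∈ᵇ a i → v ∈ᵇ a j → u ≡ v) where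

    open Matching a lin public
    open Extend {m} {k} adj adj-sym adj-irrefl size hiding (deg) public

    record Rounds : Set where
      constructor rounds-of
      field
        L ρ s K cap Y′ : ℕ
        1≤L : 1 ≤ L
        1≤ρ : 1 ≤ ρ
        1≤n : 1 ≤ n
        Y-eq : suc cap ∸ s ≡ suc Y′
        c₁ : L * 2 ^ (L + L) * (n + s * s * ρ) ≤ 2 * (2 * n) * ρ
        c₂ : L * 2 ^ (L + L) ≤ 4 * (2 * n)

    module Iterate (P : Rounds) where
      open Rounds P

      Y : ℕ
      Y = suc Y′

      -- Either the rest is light, or each of the `T` rounds has collected volume at least Ln/32K.
      -- Since the volume is at most n², enough rounds rule out the second alternative.
      Residue : Pred m → Pred m → ℕ → Set
      Residue Q Q₁ T = K * vol (Q ∖ᵇ Q₁) ≤ n * n ⊎ T * L * n ≤ 32 * K * vol Q₁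

      -- A round colours one heavy matching of total size l with ⌊l/Y⌋ + 1 fresh colours, because
      -- inside a matching full colours are the only obstacle. The summand `T * Y` of the budget
      -- pays for rounding up once per round.
      iterate : ∀ T {D col} b P Q → Proper D col → (∀ i → i ∈ᵇ Q → i ∉ᵇ D) →
                (∀ j → j ∈ᵇ Q → suc ρ ≤ size j) → (∀ j → j ∈ᵇ Q → size j ≤ s) →
                b + P ≤ k → Unused D col (Int b (b + P)) → T * Y + ∑∈ Q size ≤ P * Y →
                ∃ λ Q₁ → Q₁ ⊆ᵇ Q × Extension D col Q₁ (Int b (b + P)) cap × Residue Q Q₁ T
      iterate zero b P Q pr disj low high bP un budg = (λ _ → false) , (λ _ ()) , extend-∅ pr , inj₂ z≤n
      iterate (suc T) {D} {col} b P Q pr disj low high bP un budg with K * vol Q ≤? n * n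
      ... | yes p = (λ _ → false) , (λ _ ()) , extend-∅ pr , inj₁ (≤-trans (*-monoʳ-≤ K (vol-mono {Q ∖ᵇ (λ _ → false)} {Q} (λ i q → proj₁ (∧-true {Q i} q)))) p)
      ... | no large = round (matching L ρ s Q 1≤L 1≤ρ 1≤n low high c₁ c₂)
        where
        round : (∃ λ M → M ⊆ᵇ Q × (∀ i j → i ∈ᵇ M → j ∈ᵇ M → adj i j ≡ false) × L * vol Q ≤ 32 * n * vol M) →
                ∃ λ Q₁ → Q₁ ⊆ᵇ Q × Extension D col Q₁ (Int b (b + P)) cap × Residue Q Q₁ (suc T)
        round (M , M⊆Q , M-ind , weight) = combine (iterate T (b + Z) P′ R (Extension.proper′ E)
            (λ i p → R-disj i p) (λ j p → low j (R⊆Q j p)) (λ j p → high j (R⊆Q j p))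
            (≤-trans (≤-reflexive bP′) bP)
            (unused-extend {A = Int b (b + Z)} {Int (b + Z) (b + Z + P′)} E (λ i p → ≢true⇒false (λ q → true≢false p (disj i (M⊆Q i q))))
              (λ c p → ≢true⇒false (λ q → <⇒≱ (proj₂ (Int-elim {c = c} q)) (proj₁ (Int-elim {c = c} p))))
              (unused-⊆ {D} {col} {B = Int b (b + P)} sub₂ un))
            budget′)
          where
          l = ∑∈ M size
          q = l / Y
          Z = suc q
          R = Q ∖ᵇ M
          R⊆Q : R ⊆ᵇ Q
          R⊆Q i p = proj₁ (∧-true {Q i} p)
          qY≤l : q * Y ≤ l
          qY≤l = m/n*n≤m l Y
          l<ZY : l < Z * Y
          l<ZY = ≤-<-trans (≤-reflexive (m≡m%n+[m/n]*n l Y)) (+-monoˡ-< (q * Y) (m%n<n l Y))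
          l+R : l + ∑∈ R size ≤ ∑∈ Q size
          l+R = ≤-trans (+-monoˡ-≤ _ (∑∈-monoˡ {S = M} {Q ∩ᵇ M} (λ i p → ∧-intro (M⊆Q i p) p))) (≤-reflexive (sym (∑∈-split Q M size)))
          total : Z * Y + (T * Y + ∑∈ R size) ≤ P * Y
          total = budget q Y l T P (∑∈ Q size) (∑∈ R size) qY≤l l+R budg
          Z≤P : Z ≤ P
          Z≤P = *-cancelʳ-≤ Z P Y (≤-trans (m≤m+n _ _) total)
          P′ = P ∸ Z
          Z+P′ : Z + P′ ≡ P
          Z+P′ = m+[n∸m]≡n Z≤P
          budget′ : T * Y + ∑∈ R size ≤ P′ * Y
          budget′ = +-cancelˡ-≤ (Z * Y) _ _ (≤-trans total (≤-reflexive (trans (cong (_* Y) (sym Z+P′)) (*-distribʳ-+ Y Z P′))))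
          bP′ : b + Z + P′ ≡ b + P
          bP′ = trans (+-assoc b Z P′) (cong (b +_) Z+P′)
          sub₁ : Int {k} b (b + Z) ⊆ᵇ Int b (b + P)
          sub₁ c p = let x , y = Int-elim {c = c} p in Int-intro {c = c} x (<-≤-trans y (+-monoʳ-≤ b Z≤P))
          sub₂ : Int {k} (b + Z) (b + Z + P′) ⊆ᵇ Int b (b + P)
          sub₂ c p = let x , y = Int-elim {c = c} p in Int-intro {c = c} (≤-trans (m≤m+n b Z) x) (<-≤-trans y (≤-reflexive bP′))
          E : Extension D col M (Int b (b + Z)) cap
          E = extend-fresh pr (Int b (b + Z)) cap s q 0 M (λ i p → disj i (M⊆Q i p)) (unused-⊆ {D} {col} {B = Int b (b + P)} sub₁ un) (λ i p → high i (M⊆Q i p))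
            (subst (λ y → l < Z * y) (sym Y-eq) l<ZY)
            (≤-reflexive (sym (#-Int {k} b Z (≤-trans (+-monoʳ-≤ b Z≤P) bP))))
            (λ S′ sub i p → i , p , ≤-reflexive (∑-0 (λ j → cong 𝟙 (lemma S′ sub i p j))))
            where
            lemma : ∀ S′ → S′ ⊆ᵇ M → ∀ i → i ∈ᵇ S′ → ∀ j → S′ j ∧ adj i j ≡ false
            lemma S′ sub i p j with S′ j in eq
            ... | false = refl
            ... | true = M-ind i j (sub i p) (sub j eq)
          R-disj : ∀ i → i ∈ᵇ R → i ∉ᵇ D ∪ᵇ M
          R-disj i p with ∧-true {Q i} p
          ... | x , y rewrite disj i x = not-true y
          progress : L * n ≤ 32 * K * vol M
          progress = ≤-trans (*-cancelˡ-≤ n ⦃ Data.Nat.>-nonZero 1≤n ⦄ (gain-arith L K n (vol Q) (vol M) weight (<⇒≤ (≰⇒> large))))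
                       (≤-reflexive refl)
          combine : (∃ λ Q₂ → Q₂ ⊆ᵇ R × Extension (D ∪ᵇ M) (Extension.col′ E) Q₂ (Int (b + Z) (b + Z + P′)) cap × Residue R Q₂ T) →
                    ∃ λ Q₁ → Q₁ ⊆ᵇ Q × Extension D col Q₁ (Int b (b + P)) cap × Residue Q Q₁ (suc T)
          combine (Q₂ , Q₂⊆R , F , res) = M ∪ᵇ Q₂ , sub , extend-trans Q₂∉M sub₁ sub₂ E F , res′ res
            where
            Q₂∉M : ∀ i → i ∈ᵇ Q₂ → i ∉ᵇ M
            Q₂∉M i p = not-true (proj₂ (∧-true {Q i} (Q₂⊆R i p)))
            sub : M ∪ᵇ Q₂ ⊆ᵇ Q
            sub i p with ∨-true {M i} p
            ... | inj₁ x = M⊆Q i x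
            ... | inj₂ x = R⊆Q i (Q₂⊆R i x)
            vol-∪ : vol (M ∪ᵇ Q₂) ≡ vol M + vol Q₂
            vol-∪ = ∑∈-∪ {S = M} {Q₂} _ Q₂∉M
            res′ : Residue R Q₂ T → Residue Q (M ∪ᵇ Q₂) (suc T)
            res′ (inj₁ p) = inj₁ (≤-trans (*-monoʳ-≤ K (vol-mono {Q ∖ᵇ (M ∪ᵇ Q₂)} {R ∖ᵇ Q₂} (λ i → lemma (Q i) (M i) (Q₂ i)))) p)
              where
              lemma : ∀ x y z → x ∧ not (y ∨ z) ≡ true → (x ∧ not y) ∧ not z ≡ true
              lemma true false z p = p
            res′ (inj₂ p) = inj₂ (subst (λ x → suc T * L * n ≤ 32 * K * x) (sym vol-∪)
              (sum-arith L K n T (vol M) (vol Q₂) progress p))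

      -- What the matchings leave has small volume, hence is degenerate and can be coloured greedily.
      sparse-colouring : ∀ Kd T X F P₂ {D col} b P Q → K ≡ 1 + 4 * Kd * Kd → 1 ≤ Kd → 2 * Kd ≤ ρ → 32 * K * n < T * L →
                Proper D col → (∀ i → i ∈ᵇ Q → i ∉ᵇ D) →
                (∀ j → j ∈ᵇ Q → suc ρ ≤ size j) → (∀ j → j ∈ᵇ Q → size j ≤ s) →
                b + (P + P₂) ≤ k → Unused D col (Int b (b + (P + P₂))) → T * Y + ∑∈ Q size ≤ P * Y →
                n ≤ Kd * suc X → X + F < P₂ → ∑∈ Q size < suc F * Y →
                Extension D col Q (Int b (b + (P + P₂))) cap
      sparse-colouring Kd T X F P₂ {D} {col} b P Q K-eq 1≤Kd 2Kd≤ρ rounds pr disj low high bP un budg n≤ room few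
        with iterate T b P Q pr disj low high (≤-trans (+-monoʳ-≤ b (m≤m+n P P₂)) bP)
               (unused-⊆ {D} {col} {Int b (b + P)} {Int b (b + (P + P₂))} (λ c p → let x , y = Int-elim {c = c} p in Int-intro {c = c} x (<-≤-trans y (+-monoʳ-≤ b (m≤m+n P P₂)))) un) budg
      ... | Q₁ , Q₁⊆Q , E , inj₂ p = ⊥-elim (<⇒≱ rounds (*-cancelʳ-≤ (T * L) (32 * K * n) n ⦃ Data.Nat.>-nonZero 1≤n ⦄
              (≤-trans p (≤-trans (*-monoʳ-≤ (32 * K) (vol≤n² Q₁)) (≤-reflexive (sym (*-assoc (32 * K) n n)))))))
      ... | Q₁ , Q₁⊆Q , E , inj₁ p = extend-cong rejoin (extend-trans
              (λ i q → not-true (proj₂ (∧-true {Q i} q)))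
              (λ c q → let x , y = Int-elim {c = c} q in Int-intro {c = c} x (<-≤-trans y (+-monoʳ-≤ b (m≤m+n P P₂))))
              sub₂ E G)
        where
        R = Q ∖ᵇ Q₁
        sub₂ : Int {k} (b + P) (b + P + P₂) ⊆ᵇ Int b (b + (P + P₂))
        sub₂ c q = let x , y = Int-elim {c = c} q in Int-intro {c = c} (≤-trans (m≤m+n b P) x) (<-≤-trans y (≤-reflexive (+-assoc b P P₂)))
        R⊆Q : R ⊆ᵇ Q
        R⊆Q i q = proj₁ (∧-true {Q i} q)
        small-vol : 4 * Kd * Kd * vol R < n * n
        small-vol = below-suc (4 * Kd * Kd) (vol R) (*-mono-≤ 1≤n 1≤n) (subst (λ z → z * vol R ≤ n * n) K-eq p)
        rejoin : ∀ i → (Q₁ ∪ᵇ R) i ≡ Q i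
        rejoin i with Q₁ i in eq
        ... | true = sym (Q₁⊆Q i eq)
        ... | false with Q i
        ... | true = refl
        ... | false = refl
        G : Extension (D ∪ᵇ Q₁) (Extension.col′ E) R (Int (b + P) (b + P + P₂)) cap
        G = extend-fresh (Extension.proper′ E) (Int (b + P) (b + P + P₂)) cap s F X R
          (λ i q → let x , y = ∧-true {Q i} q in trans (cong (_∨ Q₁ i) (disj i x)) (not-true y))
          (unused-extend {A = Int b (b + P)} {Int (b + P) (b + P + P₂)} E (λ i q → ≢true⇒false (λ r → true≢false q (disj i (Q₁⊆Q i r))))
            (λ c q → ≢true⇒false (λ r → <⇒≱ (proj₂ (Int-elim {c = c} r)) (proj₁ (Int-elim {c = c} q))))
            (unused-⊆ {D} {col} {B = Int b (b + (P + P₂))} sub₂ un))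
          (λ i q → high i (R⊆Q i q))
          (subst (λ y → ∑∈ R size < suc F * y) (sym Y-eq) (≤-<-trans (∑∈-monoˡ {S = R} {Q} R⊆Q) few))
          (<-≤-trans room (≤-reflexive (sym (#-Int {k} (b + P) P₂ (≤-trans (≤-reflexive (+-assoc b P P₂)) bP)))))
          (λ S′ sub i q → let e , r , t = degenerate Kd {R} 1≤Kd (λ j u → ≤-trans (s≤s 2Kd≤ρ) (low j (R⊆Q j u))) small-vol S′ sub i q
                          in e , r , s≤s⁻¹ (*-cancelˡ-< Kd _ _ (<-≤-trans t n≤)))

-- A weighted de Bruijn-Erdős count

module DisjointPairs where
  open FiniteSums
  open GreedyColouring
  open LinearIncidence
  open DenseSubsets
  open PolynomialIdentities using (polynomial; _:=_; _:+_; _:*_; con)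
  open import Data.Bool using (Bool; true; false; _∧_; not)
  open import Data.Empty using (⊥-elim)
  open import Data.Fin using (Fin; suc)
  open import Data.Nat using (ℕ; suc; _+_; _*_; _∸_; _≤_; z≤n)
  open import Data.Nat.Properties
  open import Data.Nat.Tactic.RingSolver using (solve-∀)
  open import Data.Product using (_,_; proj₁; proj₂)
  open import Data.Vec using ([]; _∷_)
  open import Relation.Binary.PropositionalEquality
  -- Adding the three counts gives qS ≤ X + b(b - 1) - p(p + 1) - D. The last two hypotheses encode
  -- b = 1 + p + q, for which b(b - 1) - p(p + 1) = q(b + p) ≤ 2bq.
  conway-arith : ∀ X M S b Q D p q → b * S ≤ X + M + S → M + S + p * (1 + p) ≤ Q + p * S → Q + D + b ≤ S + b * b → b ≤ 1 + p + q → 1 + p + q ≤ b → q * S ≤ X + 2 * b * q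
  conway-arith X M S b Q D p q h1 h2 h3 h4 h5 = farkas 0 (+-mono-≤ (+-mono-≤ (+-mono-≤ (+-mono-≤ h1 h2) h3) (*-monoʳ-≤ (b + p) h4)) (*-monoʳ-≤ (S + q) h5))
    (polynomial (X ∷ M ∷ S ∷ b ∷ Q ∷ D ∷ p ∷ q ∷ []) (λ X M S b Q D p q → con 1 :* (q :* S) :+ ((X :+ M :+ S) :+ (Q :+ p :* S) :+ (S :+ b :* b) :+ (b :+ p) :* (con 1 :+ p :+ q) :+ (S :+ q) :* b) :+ (D :+ q :+ q :* q) := con 1 :* (X :+ con 2 :* b :* q) :+ ((b :* S) :+ (M :+ S :+ p :* (con 1 :+ p)) :+ (Q :+ D :+ b) :+ (b :+ p) :* b :+ (S :+ q) :* (con 1 :+ p :+ q))) refl)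

  dis-arith : ∀ X D t x L n → X ≤ 4 * t * D + 2 * x * L → L * (4 * t) ≤ n * n → 4 * t * X ≤ 16 * (t * t) * D + 2 * x * (n * n)
  dis-arith X D t x L n h1 h2 = farkas 0 (+-mono-≤ (*-monoʳ-≤ (4 * t) h1) (*-monoʳ-≤ (2 * x) h2))
    (polynomial (X ∷ D ∷ t ∷ x ∷ L ∷ n ∷ []) (λ X D t x L n → con 1 :* (con 4 :* t :* X) :+ ((con 4 :* t) :* (con 4 :* t :* D :+ con 2 :* x :* L) :+ (con 2 :* x) :* (n :* n)) :+ con 0 := con 1 :* (con 16 :* (t :* t) :* D :+ con 2 :* x :* (n :* n)) :+ ((con 4 :* t) :* X :+ (con 2 :* x) :* (L :* (con 4 :* t)))) refl)

  -- In real terms, with t = 2 + θ: qbθ ≤ X, so 0.9xn² ≤ qbtθ ≤ tX ≤ 4t²D + xn²/2 ≤ 8nD + xn²/2,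
  -- whence D ≥ xn/20. The ratio 9/10 matters only by exceeding 1/2.
  many-arith : ∀ X D θ x b n q S → 4 * (2 + θ) * X ≤ 16 * ((2 + θ) * (2 + θ)) * D + 2 * x * (n * n) → q * S ≤ X + 2 * b * q → b * (2 + θ) ≤ S → x ≤ q → n ≤ b → 9 * n ≤ 10 * ((2 + θ) * θ) → (2 + θ) * (2 + θ) ≤ 2 * n → n * (2 * (x * n)) ≤ n * (40 * D)
  many-arith X D θ x b n q S h1 h2 h3 h4 h5 h6 h7 = farkas 3 (+-mono-≤ (+-mono-≤ (+-mono-≤ (+-mono-≤ (+-mono-≤ (+-mono-≤ (*-monoʳ-≤ 5 h1) (*-monoʳ-≤ (40 + 20 * θ) h2)) (*-monoʳ-≤ (40 * q + 20 * q * θ) h3)) (*-monoʳ-≤ (40 * b * θ + 20 * b * θ * θ) h4)) (*-monoʳ-≤ (18 * n * x) h5)) (*-monoʳ-≤ (2 * b * x) h6)) (*-monoʳ-≤ (80 * D) h7))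
    (polynomial (X ∷ D ∷ θ ∷ x ∷ b ∷ n ∷ q ∷ S ∷ []) (λ X D θ x b n q S → con 4 :* (n :* (con 2 :* (x :* n))) :+ (con 5 :* (con 16 :* ((con 2 :+ θ) :* (con 2 :+ θ)) :* D :+ con 2 :* x :* (n :* n)) :+ (con 40 :+ con 20 :* θ) :* (X :+ con 2 :* b :* q) :+ (con 40 :* q :+ con 20 :* q :* θ) :* S :+ (con 40 :* b :* θ :+ con 20 :* b :* θ :* θ) :* q :+ (con 18 :* n :* x) :* b :+ (con 2 :* b :* x) :* (con 10 :* ((con 2 :+ θ) :* θ)) :+ (con 80 :* D) :* (con 2 :* n)) :+ con 0 := con 4 :* (n :* (con 40 :* D)) :+ (con 5 :* (con 4 :* (con 2 :+ θ) :* X) :+ (con 40 :+ con 20 :* θ) :* (q :* S) :+ (con 40 :* q :+ con 20 :* q :* θ) :* (b :* (con 2 :+ θ)) :+ (con 40 :* b :* θ :+ con 20 :* b :* θ :* θ) :* x :+ (con 18 :* n :* x) :* n :+ (con 2 :* b :* x) :* (con 9 :* n) :+ (con 80 :* D) :* ((con 2 :+ θ) :* (con 2 :+ θ)))) refl)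

  sum-rotate : ∀ x y z w → x + y + z + w ≡ y + (z + x + w)
  sum-rotate = solve-∀

  pull-out : ∀ x y z w → x * (y * z * w) ≡ z * (x * y * w)
  pull-out = solve-∀

  square-step : ∀ x p → x * (suc x + p) + suc x + 1 * p ≡ suc x * suc x + p * suc x
  square-step = solve-∀

  module Disjoint {n m : ℕ} (a : Fin m → Fin n → Bool)
    (lin : ∀ i j → i ≢ j → ∀ u v → u ∈ᵇ a i → u ∈ᵇ a j → v ∈ᵇ a i → v ∈ᵇ a j → u ≡ v) where

    open Linear a lin

    dis : Fin m → Fin m → Bool
    dis i j = not (i == j) ∧ not (meets i j)

    dis-sym : ∀ i j → dis i j ≡ dis j i
    dis-sym i j = cong₂ (λ x y → not x ∧ not y) (==-sym i j) (meets-sym′ i j)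
      where
      meets-sym′ : ∀ i j → meets i j ≡ meets j i
      meets-sym′ i j with meets i j in p | meets j i in q
      ... | true | true = refl
      ... | false | false = refl
      ... | true | false = ⊥-elim (true≢false (meets-sym i j p) q)
      ... | false | true = ⊥-elim (true≢false (meets-sym j i q) p)

    adj-sym≡ : ∀ i j → adj i j ≡ adj j i
    adj-sym≡ i j with adj i j in p | adj j i in q
    ... | true | true = refl
    ... | false | false = refl
    ... | true | false = ⊥-elim (true≢false (adj-sym i j p) q)
    ... | false | true = ⊥-elim (true≢false (adj-sym j i q) p)

    dis-≢ : ∀ {i j} → dis i j ≡ true → i ≢ j
    dis-≢ {i} {j} p = ==⇒≢ (not-true (proj₁ (∧-true {not (i == j)} p)))

    dis-adj : ∀ {i j} → dis i j ≡ true → adj i j ≡ false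
    dis-adj {i} {j} p with i == j | meets i j
    ... | false | false = refl

    ddeg : Pred m → Fin m → ℕ
    ddeg S e = # (λ f → S f ∧ dis e f)

    disPairs : Pred m → ℕ
    disPairs S = ∑∈ S (ddeg S)

    private
      module Count (S : Pred m) where
        b = # S
        S₁ = ∑∈ S size
        Q = ∑ (λ v → d S v * d S v)
        X = ∑∈ S (λ e → ∑∈ S (λ f → 𝟙 (dis e f) * size f))
        M = ∑∈ S (λ e → ∑∈ S (λ f → 𝟙 (adj e f) * size f))

        one : ∀ e f → 𝟙 (dis e f) + 𝟙 (adj e f) + 𝟙 (f == e) ≡ 1
        one e f rewrite ==-sym f e with e == f | meets e f
        ... | true | _ = refl
        ... | false | true = refl
        ... | false | false = refl

        pick : ∀ e → e ∈ᵇ S → (g : Fin m → ℕ) → ∑∈ S (λ f → 𝟙 (f == e) * g f) ≡ g e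
        pick e p g = trans (∑-cong (λ f → lemma (S f) f)) (trans (∑-≡-pick e (λ f → 𝟙 (S f) * g f)) (trans (cong (λ x → 𝟙 x * g e) p) (+-identityʳ _)))
          where
          lemma : ∀ x f → 𝟙 x * (𝟙 (f == e) * g f) ≡ 𝟙 (f == e) * (𝟙 x * g f)
          lemma x f = trans (sym (*-assoc (𝟙 x) _ _)) (trans (cong (_* g f) (*-comm (𝟙 x) (𝟙 (f == e)))) (*-assoc (𝟙 (f == e)) (𝟙 x) (g f)))

        split : ∀ e → e ∈ᵇ S → (g : Fin m → ℕ) →
                ∑∈ S g ≡ ∑∈ S (λ f → 𝟙 (dis e f) * g f) + ∑∈ S (λ f → 𝟙 (adj e f) * g f) + g e
        split e p g = begin
          ∑∈ S g ≡⟨ ∑∈-cong {S = S} (λ f _ → lemma f) ⟩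
          ∑∈ S (λ f → 𝟙 (dis e f) * g f + 𝟙 (adj e f) * g f + 𝟙 (f == e) * g f) ≡⟨ trans (∑∈-+ S _ _) (cong (_+ ∑∈ S (λ f → 𝟙 (f == e) * g f)) (∑∈-+ S _ _)) ⟩
          ∑∈ S (λ f → 𝟙 (dis e f) * g f) + ∑∈ S (λ f → 𝟙 (adj e f) * g f) + ∑∈ S (λ f → 𝟙 (f == e) * g f)
            ≡⟨ cong (∑∈ S (λ f → 𝟙 (dis e f) * g f) + ∑∈ S (λ f → 𝟙 (adj e f) * g f) +_) (pick e p g) ⟩
          ∑∈ S (λ f → 𝟙 (dis e f) * g f) + ∑∈ S (λ f → 𝟙 (adj e f) * g f) + g e ∎
          where
          open ≡-Reasoning
          lemma : ∀ f → g f ≡ 𝟙 (dis e f) * g f + 𝟙 (adj e f) * g f + 𝟙 (f == e) * g f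
          lemma f = trans (trans (sym (+-identityʳ (g f))) (cong (_* g f) (sym (one e f))))
            (trans (*-distribʳ-+ (g f) (𝟙 (dis e f) + 𝟙 (adj e f)) _) (cong (_+ 𝟙 (f == e) * g f) (*-distribʳ-+ (g f) (𝟙 (dis e f)) _)))

        count₁ : b * S₁ ≡ X + M + S₁
        count₁ = begin
          b * S₁ ≡⟨ ∑∈-const S S₁ ⟨
          ∑∈ S (λ _ → S₁) ≡⟨ ∑∈-cong {S = S} (λ e p → split e p size) ⟩
          ∑∈ S (λ e → ∑∈ S (λ f → 𝟙 (dis e f) * size f) + ∑∈ S (λ f → 𝟙 (adj e f) * size f) + size e)
            ≡⟨ trans (∑∈-+ S _ _) (cong (_+ S₁) (∑∈-+ S _ _)) ⟩
          X + M + S₁ ∎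
          where open ≡-Reasoning

        ∑∈-𝟙 : ∀ (r : Pred m) → ∑∈ S (λ f → 𝟙 (r f) * 1) ≡ # (λ f → S f ∧ r f)
        ∑∈-𝟙 r = ∑-cong (λ f → trans (cong (𝟙 (S f) *_) (*-identityʳ _)) (sym (𝟙-∧ (S f) (r f))))

        -- Ordered pairs of edges counted by shared vertices: distinct edges share at most one, and
        -- an edge shares all of its vertices with itself.
        count₃ : Q + disPairs S + b ≤ S₁ + b * b
        count₃ = begin
          Q + disPairs S + b ≤⟨ +-monoˡ-≤ b (+-monoˡ-≤ (disPairs S) Q≤) ⟩
          ∑∈ S (deg S) + S₁ + disPairs S + b ≡⟨ sum-rotate (∑∈ S (deg S)) S₁ (disPairs S) b ⟩
          S₁ + (disPairs S + ∑∈ S (deg S) + b) ≡⟨ cong (S₁ +_) (sym b²) ⟩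
          S₁ + b * b ∎
          where
          open ≤-Reasoning
          b² : b * b ≡ disPairs S + ∑∈ S (deg S) + b
          b² = trans (sym (∑∈-const S b)) (trans (∑∈-cong {S = S} (λ e p → trans (#≡∑∈ S) (trans (split e p (λ _ → 1))
                 (cong (_+ 1) (cong₂ _+_ (∑∈-𝟙 (dis e)) (∑∈-𝟙 (adj e)))))))
                 (trans (∑∈-+ S _ _) (cong₂ _+_ (∑∈-+ S _ _) (sym (#≡∑∈ S)))))
          shared : ∀ e i → ∑ (λ v → 𝟙 (a e v) * 𝟙 (S i ∧ a i v)) ≤ 𝟙 (S i ∧ adj e i) + 𝟙 (i == e) * size e
          shared e i with S i
          ... | false = ≤-trans (≤-reflexive (∑-0 (λ v → *-zeroʳ (𝟙 (a e v))))) z≤n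
          ... | true with i == e in eq | e == i in eq′
          ... | true | false = ⊥-elim (==⇒≢ eq′ (sym (==⇒≡ eq)))
          ... | true | true = ≤-trans (∑-mono (λ v → ≤-trans (*-monoʳ-≤ (𝟙 (a e v)) (𝟙≤1 _)) (≤-reflexive (*-identityʳ _))))
                             (≤-reflexive (sym (+-identityʳ (size e))))
          ... | false | true = ⊥-elim (==⇒≢ eq (sym (==⇒≡ eq′)))
          ... | false | false with meets e i in mt
          ... | true = ≤-trans (≤-reflexive (∑-cong (λ v → sym (𝟙-∧ (a e v) (a i v)))))
                         (#≤1 (λ u v p q → let x , y = ∧-true {a e u} p ; z , w = ∧-true {a e v} q in
                           lin e i (==⇒≢ eq′) u v x y z w))
          ... | false = ≤-trans (≤-reflexive (∑-0 (λ v → trans (sym (𝟙-∧ (a e v) (a i v))) (cong 𝟙 (some-false {P = a e ∩ᵇ a i} mt v))))) z≤n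
          Q≤ : Q ≤ ∑∈ S (deg S) + S₁
          Q≤ = begin
            Q ≡⟨ ∑-cong (λ v → trans (sym (∑-*ʳ (λ e → 𝟙 (S e ∧ a e v)) (d S v))) (∑-cong (λ e →
                   trans (cong (_* d S v) (𝟙-∧ (S e) (a e v))) (*-assoc (𝟙 (S e)) _ _)))) ⟩
            ∑ (λ v → ∑ (λ e → 𝟙 (S e) * (𝟙 (a e v) * d S v))) ≡⟨ ∑-swap (λ v e → 𝟙 (S e) * (𝟙 (a e v) * d S v)) ⟩
            ∑ (λ e → ∑ (λ v → 𝟙 (S e) * (𝟙 (a e v) * d S v))) ≡⟨ ∑-cong (λ e → sym (∑-*ˡ (𝟙 (S e)) _)) ⟩
            ∑∈ S (λ e → ∑∈ (a e) (d S)) ≤⟨ ∑∈-monoʳ {S = S} (λ e p → local e p) ⟩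
            ∑∈ S (λ e → deg S e + size e) ≡⟨ ∑∈-+ S (deg S) size ⟩
            ∑∈ S (deg S) + S₁ ∎
            where
            local : ∀ e → e ∈ᵇ S → ∑∈ (a e) (d S) ≤ deg S e + size e
            local e p = begin
              ∑∈ (a e) (d S) ≡⟨ ∑-cong (λ v → ∑-*ˡ (𝟙 (a e v)) _) ⟩
              ∑ (λ v → ∑ (λ i → 𝟙 (a e v) * 𝟙 (S i ∧ a i v))) ≡⟨ ∑-swap (λ v i → 𝟙 (a e v) * 𝟙 (S i ∧ a i v)) ⟩
              ∑ (λ i → ∑ (λ v → 𝟙 (a e v) * 𝟙 (S i ∧ a i v))) ≤⟨ ∑-mono (shared e) ⟩
              ∑ (λ i → 𝟙 (S i ∧ adj e i) + 𝟙 (i == e) * size e) ≡⟨ ∑-+ _ _ ⟩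
              deg S e + ∑ (λ i → 𝟙 (i == e) * size e) ≡⟨ cong (deg S e +_) (∑-≡-pick e (λ _ → size e)) ⟩
              deg S e + size e ∎

        star : Fin n → ℕ
        star v = ∑∈ (λ j → S j ∧ a j v) size

        -- Each edge at `v` meets at most d - 1 others there, so M is at most the sum of (d - 1) ·
        -- star. At a vertex of the support, star ≤ d + p turns the claim into the identity
        -- `square-step`; p(1 + p) collects p from each of the 1 + p support vertices.
        count₂ : ∀ p → # (supp S) ≡ suc p → M + S₁ + p * (1 + p) ≤ Q + p * S₁
        count₂ p n′ = begin
          M + S₁ + p * (1 + p) ≤⟨ +-monoˡ-≤ (p * (1 + p)) (+-monoˡ-≤ S₁ M≤) ⟩
          ∑ (λ v → (d S v ∸ 1) * star v) + S₁ + p * (1 + p)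
            ≡⟨ cong₂ (λ x y → ∑ (λ v → (d S v ∸ 1) * star v) + x + y) (sym (∑-d S))
                 (trans (*-comm p (1 + p)) (trans (cong (_* p) (sym n′)) (sym (∑-*ʳ (λ v → 𝟙 (supp S v)) p)))) ⟩
          ∑ (λ v → (d S v ∸ 1) * star v) + ∑ (d S) + ∑ (λ v → 𝟙 (supp S v) * p)
            ≡⟨ trans (cong (_+ ∑ (λ v → 𝟙 (supp S v) * p)) (sym (∑-+ _ _))) (sym (∑-+ _ _)) ⟩
          ∑ (λ v → (d S v ∸ 1) * star v + d S v + 𝟙 (supp S v) * p) ≤⟨ ∑-mono local ⟩
          ∑ (λ v → d S v * d S v + p * d S v) ≡⟨ trans (∑-+ _ _) (cong (Q +_) (trans (sym (∑-*ˡ p (d S))) (cong (p *_) (∑-d S)))) ⟩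
          Q + p * S₁ ∎
          where
          open ≤-Reasoning
          M≤ : M ≤ ∑ (λ v → (d S v ∸ 1) * star v)
          M≤ = begin
            M ≡⟨ ∑∈-swap S S (λ e f → 𝟙 (adj e f) * size f) ⟩
            ∑∈ S (λ f → ∑∈ S (λ e → 𝟙 (adj e f) * size f)) ≡⟨ ∑∈-cong {S = S} (λ f _ → inner f) ⟩
            ∑∈ S (λ f → deg S f * size f) ≤⟨ ∑∈-monoʳ {S = S} (λ f q → *-monoˡ-≤ (size f) (deg≤ f q)) ⟩
            ∑∈ S (λ f → ∑∈ (a f) (λ v → d S v ∸ 1) * size f)
              ≡⟨ ∑-cong (λ f → trans (cong (𝟙 (S f) *_) (sym (∑-*ʳ (λ v → 𝟙 (a f v) * (d S v ∸ 1)) (size f)))) (∑-*ˡ (𝟙 (S f)) _)) ⟩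
            ∑ (λ f → ∑ (λ v → 𝟙 (S f) * (𝟙 (a f v) * (d S v ∸ 1) * size f))) ≡⟨ ∑-swap (λ f v → 𝟙 (S f) * (𝟙 (a f v) * (d S v ∸ 1) * size f)) ⟩
            ∑ (λ v → ∑ (λ f → 𝟙 (S f) * (𝟙 (a f v) * (d S v ∸ 1) * size f)))
              ≡⟨ ∑-cong (λ v → trans (∑-cong (λ f → trans (pull-out (𝟙 (S f)) (𝟙 (a f v)) (d S v ∸ 1) (size f))
                   (cong (λ y → (d S v ∸ 1) * (y * size f)) (sym (𝟙-∧ (S f) (a f v)))))) (sym (∑-*ˡ (d S v ∸ 1) _))) ⟩
            ∑ (λ v → (d S v ∸ 1) * star v) ∎
            where
            inner : ∀ f → ∑∈ S (λ e → 𝟙 (adj e f) * size f) ≡ deg S f * size f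
            inner f = trans (∑-cong (λ e → trans (sym (*-assoc (𝟙 (S e)) _ _)) (cong (_* size f)
              (trans (sym (𝟙-∧ (S e) (adj e f))) (cong (λ b → 𝟙 (S e ∧ b)) (adj-sym≡ e f)))))) (∑-*ʳ (λ e → 𝟙 (S e ∧ adj f e)) (size f))
            deg≤ : ∀ f → f ∈ᵇ S → deg S f ≤ ∑∈ (a f) (λ v → d S v ∸ 1)
            deg≤ f q = ≤-trans (#-mono (λ i r → let x , y = ∧-true {S i} r in
                ∧-intro (∖-∈ {S = S} x (λ { refl → true≢false y (adj-irrefl f) })) y))
              (≤-trans (deg≤∑d (S ∖ f) f) (∑∈-monoʳ {S = a f} (λ v r → ≤-reflexive (drop v r))))
              where
              drop : ∀ v → v ∈ᵇ a f → d (S ∖ f) v ≡ d S v ∸ 1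
              drop v r = sym (trans (cong (_∸ 1) (#-remove {S = λ j → S j ∧ a j v} {f} (∧-intro q r)))
                (∑-cong (λ j → cong 𝟙 (comm (S j) (a j v) (not (j == f))))))
                where
                comm : ∀ x y z → (x ∧ y) ∧ z ≡ (x ∧ z) ∧ y
                comm false y z = refl
                comm true true z = sym (∧-id z)
                  where
                  ∧-id : ∀ z → z ∧ true ≡ z
                  ∧-id true = refl
                  ∧-id false = refl
                comm true false true = refl
                comm true false false = refl
          local : ∀ v → (d S v ∸ 1) * star v + d S v + 𝟙 (supp S v) * p ≤ d S v * d S v + p * d S v
          local v with supp S v in eq
          ... | false rewrite ∑-0 {f = λ j → 𝟙 (S j ∧ a j v)} (λ j → cong 𝟙 (some-false {P = λ j → S j ∧ a j v} eq j)) = z≤n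
          ... | true with suc≡ (#-member {S = λ j → S j ∧ a j v} (proj₂ (some-true {P = λ j → S j ∧ a j v} eq)))
          ... | x , dx = bound
            where
            others : # (supp S ∖ v) ≡ p
            others = cong (_∸ 1) (trans (sym (#-remove {S = supp S} eq)) n′)
            star≤ : star v ≤ suc x + p
            star≤ = ≤-trans (star-size S v) (≤-reflexive (cong₂ _+_ dx others))
            bound : (d S v ∸ 1) * star v + d S v + 1 * p ≤ d S v * d S v + p * d S v
            bound rewrite dx = ≤-trans (+-monoˡ-≤ (1 * p) (+-monoˡ-≤ (suc x) (*-monoʳ-≤ x star≤))) (≤-reflexive (square-step x p))

    -- The double count of de Bruijn and Erdős.
    disjoint-sum : ∀ S q → # S ≡ # (supp S) + q → 1 ≤ # (supp S) →
                   q * ∑∈ S size ≤ ∑∈ S (λ f → ddeg S f * size f) + 2 * # S * q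
    disjoint-sum S q eq pos with suc≡ pos
    ... | p , n′ = subst (λ x → q * S₁ ≤ x + 2 * b * q) X≡
        (conway-arith X M S₁ b Q (disPairs S) p q (≤-reflexive count₁) (count₂ p n′) count₃
          (≤-reflexive (trans eq (cong (_+ q) n′))) (≤-reflexive (sym (trans eq (cong (_+ q) n′)))))
      where
      open Count S
      X≡ : X ≡ ∑∈ S (λ f → ddeg S f * size f)
      X≡ = trans (∑∈-swap S S (λ e f → 𝟙 (dis e f) * size f)) (∑∈-cong {S = S} (λ f _ →
        trans (∑-cong (λ e → trans (sym (*-assoc (𝟙 (S e)) _ _)) (cong (_* size f)
              (trans (sym (𝟙-∧ (S e) (dis e f))) (cong (λ b → 𝟙 (S e ∧ b)) (dis-sym e f)))))) (∑-*ʳ (λ e → 𝟙 (S e ∧ dis f e)) (size f))))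

-- Disjoint pairs among more than n long edges

module PairColouring where
  open FiniteSums
  open GreedyColouring
  open LinearIncidence
  open DenseSubsets
  open DisjointPairs
  open PolynomialIdentities using (polynomial; _:=_; _:+_; _:*_; con)
  open import Data.Bool using (Bool; true; false; _∧_; _∨_; not; if_then_else_)
  open import Data.Empty using (⊥-elim)
  open import Data.Fin using (Fin; zero; suc)
  open import Data.Nat using (ℕ; zero; suc; _+_; _*_; _∸_; _≤_; _<_; z≤n; s≤s; s≤s⁻¹; _<ᵇ_; _≡ᵇ_)
  open import Data.Nat.Properties
  open import Data.Nat.Tactic.RingSolver using (solve-∀)
  open import Data.Product using (∃; _×_; _,_; proj₂)
  open import Data.Sum using (_⊎_; inj₁; inj₂)
  open import Data.Vec using ([]; _∷_)
  open import Relation.Binary.PropositionalEquality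
  open import Relation.Nullary using (yes; no)
  greedy-arith : ∀ D D₁ D₂ Δ j de df → D ≤ D₁ + 2 * de → D₁ ≤ D₂ + 2 * df → de ≤ Δ → df ≤ Δ → 4 * Δ * (1 + j) < D → 4 * Δ * j < D₂
  greedy-arith D D₁ D₂ Δ j de df h1 h2 h3 h4 h5 = farkas 0 (+-mono-≤ (+-mono-≤ (+-mono-≤ (+-mono-≤ h1 h2) (*-monoʳ-≤ 2 h3)) (*-monoʳ-≤ 2 h4)) h5)
    (polynomial (D ∷ D₁ ∷ D₂ ∷ Δ ∷ j ∷ de ∷ df ∷ []) (λ D D₁ D₂ Δ j de df → con 1 :* (con 1 :+ (con 4 :* Δ :* j)) :+ ((D₁ :+ con 2 :* de) :+ (D₂ :+ con 2 :* df) :+ con 2 :* Δ :+ con 2 :* Δ :+ D) :+ con 0 := con 1 :* D₂ :+ (D :+ D₁ :+ con 2 :* de :+ con 2 :* df :+ (con 1 :+ (con 4 :* Δ :* (con 1 :+ j))))) refl)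

  start-arith : ∀ x n D → 2 * ((1 + x) * n) ≤ 40 * D → 160 * (1 + x) < n → 20 * (4 * (2 * (1 + x)) * x) < 20 * D
  start-arith x n D h1 h2 = farkas 321 (+-mono-≤ (*-monoʳ-≤ 161 h1) (*-monoʳ-≤ (2 + 322 * x) h2))
    (polynomial (x ∷ n ∷ D ∷ []) (λ x n D → con 322 :* (con 1 :+ (con 20 :* (con 4 :* (con 2 :* (con 1 :+ x)) :* x))) :+ (con 161 :* (con 40 :* D) :+ (con 2 :+ con 322 :* x) :* n) :+ (con 320 :* n :+ con 642 :* x) := con 322 :* (con 20 :* D) :+ (con 161 :* (con 2 :* ((con 1 :+ x) :* n)) :+ (con 2 :+ con 322 :* x) :* (con 1 :+ (con 160 :* (con 1 :+ x))))) refl)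

  deg-pt : ∀ g t s x → g ≤ 2 * x → g * s ≤ 4 * t * g + 1 * (s * (2 * x))
  deg-pt g t s x h1 = farkas 0 (*-monoʳ-≤ s h1)
    (polynomial (g ∷ t ∷ s ∷ x ∷ []) (λ g t s x → con 1 :* (g :* s) :+ (s :* (con 2 :* x)) :+ (con 4 :* g :* t) := con 1 :* (con 4 :* t :* g :+ con 1 :* (s :* (con 2 :* x))) :+ (s :* g)) refl)

  module Pairings {n m : ℕ} (a : Fin m → Fin n → Bool)
    (lin : ∀ i j → i ≢ j → ∀ u v → u ∈ᵇ a i → u ∈ᵇ a j → v ∈ᵇ a i → v ∈ᵇ a j → u ≡ v) where

    open Linear a lin
    open Disjoint a lin

    data Pairing : Pred m → ℕ → Set where
      none : ∀ {S} → Pairing S 0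
      pair : ∀ {S x} e f → e ∈ᵇ S → f ∈ᵇ S → dis e f ≡ true → Pairing (S ∖ e ∖ f) x → Pairing S (suc x)

    ∖-mono : ∀ {S R : Pred m} {e} → S ⊆ᵇ R → S ∖ e ⊆ᵇ R ∖ e
    ∖-mono {S} {R} sub i p = let x , y = ∧-true {S i} p in ∧-intro (sub i x) y

    ddeg-mono : ∀ {S R} e → S ⊆ᵇ R → ddeg S e ≤ ddeg R e
    ddeg-mono {S} e sub = #-mono (λ i p → let x , y = ∧-true {S i} p in ∧-intro (sub i x) y)

    ddeg-∖ : ∀ S e f → ddeg S f ≤ ddeg (S ∖ e) f + 𝟙 (dis f e)
    ddeg-∖ S e f = ≤-trans (∑-mono pt) (≤-reflexive (trans (∑-+ _ _) (cong (ddeg (S ∖ e) f +_) (∑-≡-pick e (λ i → 𝟙 (dis f i))))))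
      where
      pt : ∀ i → 𝟙 (S i ∧ dis f i) ≤ 𝟙 ((S i ∧ not (i == e)) ∧ dis f i) + 𝟙 (i == e) * 𝟙 (dis f i)
      pt i with S i | i == e
      ... | false | _ = z≤n
      ... | true | true = ≤-reflexive (sym (+-identityʳ _))
      ... | true | false = m≤m+n _ _

    -- Each of the `y` pairs uses up at most two of the edges disjoint from `f`; one partner is left
    -- at the end.
    insert : ∀ {S S′ y} f → S′ ⊆ᵇ S → f ∈ᵇ S → f ∉ᵇ S′ → 2 * y < ddeg S′ f → Pairing S′ y → Pairing S (suc y)
    insert {S} {S′} f sub f∈ f∉ big none with #-nonempty {S = λ i → S′ i ∧ dis f i} big
    ... | g , p with ∧-true {S′ g} p
    ... | g∈ , fg = pair f g f∈ (sub g g∈) fg none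
    insert {S} {S′} {suc y} f sub f∈ f∉ big (pair e e′ e∈ e′∈ ee′ rest) =
      pair e e′ (sub e e∈) (sub e′ e′∈) ee′ (insert f
        (∖-mono {S′ ∖ e} {S ∖ e} (∖-mono {S′} {S} sub))
        (∖-∈ {S = S ∖ e} (∖-∈ {S = S} f∈ (λ { refl → true≢false e∈ f∉ })) (λ { refl → true≢false e′∈ f∉ }))
        (≢true⇒false (λ p → true≢false (∖-⊆ {S = S′} f (∖-⊆ {S = S′ ∖ e} f p)) f∉))
        big′ rest)
      where
      open ≤-Reasoning
      big′ : 2 * y < ddeg (S′ ∖ e ∖ e′) f
      big′ = s≤s⁻¹ (s≤s⁻¹ (begin
        3 + 2 * y ≡⟨ lemma y ⟩
        suc (2 * suc y) ≤⟨ big ⟩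
        ddeg S′ f ≤⟨ ddeg-∖ S′ e f ⟩
        ddeg (S′ ∖ e) f + 𝟙 (dis f e) ≤⟨ +-mono-≤ (ddeg-∖ (S′ ∖ e) e′ f) (𝟙≤1 (dis f e)) ⟩
        ddeg (S′ ∖ e ∖ e′) f + 𝟙 (dis f e′) + 1 ≤⟨ +-monoˡ-≤ 1 (+-monoʳ-≤ _ (𝟙≤1 (dis f e′))) ⟩
        ddeg (S′ ∖ e ∖ e′) f + 1 + 1 ≡⟨ lemma′ (ddeg (S′ ∖ e ∖ e′) f) ⟩
        2 + ddeg (S′ ∖ e ∖ e′) f ∎))
        where
        lemma : ∀ y → 3 + 2 * y ≡ suc (2 * suc y)
        lemma = solve-∀
        lemma′ : ∀ y → y + 1 + 1 ≡ 2 + y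
        lemma′ = solve-∀

    disPairs-∖ : ∀ S {e} → e ∈ᵇ S → disPairs S ≤ disPairs (S ∖ e) + 2 * ddeg S e
    disPairs-∖ S {e} e∈ = begin
      disPairs S ≡⟨ ∑∈-remove {S = S} (ddeg S) e∈ ⟩
      ddeg S e + ∑∈ (S ∖ e) (ddeg S) ≤⟨ +-monoʳ-≤ (ddeg S e) (∑∈-monoʳ {S = S ∖ e} (λ i _ → ddeg-∖ S e i)) ⟩
      ddeg S e + ∑∈ (S ∖ e) (λ i → ddeg (S ∖ e) i + 𝟙 (dis i e)) ≡⟨ cong (ddeg S e +_) (∑∈-+ (S ∖ e) _ _) ⟩
      ddeg S e + (disPairs (S ∖ e) + ∑∈ (S ∖ e) (λ i → 𝟙 (dis i e))) ≤⟨ +-monoʳ-≤ (ddeg S e) (+-monoʳ-≤ _ last) ⟩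
      ddeg S e + (disPairs (S ∖ e) + ddeg S e) ≡⟨ lemma (ddeg S e) (disPairs (S ∖ e)) ⟩
      disPairs (S ∖ e) + 2 * ddeg S e ∎
      where
      open ≤-Reasoning
      lemma : ∀ x y → x + (y + x) ≡ y + 2 * x
      lemma = solve-∀
      last : ∑∈ (S ∖ e) (λ i → 𝟙 (dis i e)) ≤ ddeg S e
      last = ≤-trans (∑∈-monoˡ {S = S ∖ e} {S} (∖-⊆ {S = S})) (≤-reflexive (∑-cong (λ i →
        trans (sym (𝟙-∧ (S i) (dis i e))) (cong (λ b → 𝟙 (S i ∧ b)) (dis-sym i e)))))

    -- Removing a pair destroys at most 4Δ ordered disjoint pairs, 2Δ for each of its two edges.
    greedy-pairing : ∀ j S Δ → (∀ f → f ∈ᵇ S → ddeg S f ≤ Δ) → 4 * Δ * j < disPairs S → Pairing S (suc j)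
    greedy-pairing j S Δ bound many with ∑-exists-< {f = λ _ → 0} {λ e → 𝟙 (S e) * ddeg S e} (≤-<-trans (≤-reflexive (∑-0 {m} (λ _ → refl))) (≤-<-trans z≤n many))
    ... | e , p with S e in e∈
    greedy-pairing j S Δ bound many | e , () | false
    ... | true with #-nonempty {S = λ f → S f ∧ dis e f} (subst (1 ≤_) (+-identityʳ (ddeg S e)) p)
    ... | f , q with ∧-true {S f} q
    ... | f∈ , ef = pair e f e∈ f∈ ef (rest j many)
      where
      f∈′ : f ∈ᵇ S ∖ e
      f∈′ = ∖-∈ {S = S} f∈ (λ r → dis-≢ {e} {f} ef (sym r))
      sub : S ∖ e ∖ f ⊆ᵇ S
      sub i r = ∖-⊆ {S = S} i (∖-⊆ {S = S ∖ e} i r)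
      rest : ∀ j → 4 * Δ * j < disPairs S → Pairing (S ∖ e ∖ f) j
      rest zero _ = none
      rest (suc j) many = greedy-pairing j (S ∖ e ∖ f) Δ
        (λ g r → ≤-trans (ddeg-mono {S ∖ e ∖ f} {S} g sub) (bound g (sub g r)))
        (greedy-arith (disPairs S) (disPairs (S ∖ e)) (disPairs (S ∖ e ∖ f)) Δ j (ddeg S e) (ddeg (S ∖ e) f)
          (disPairs-∖ S e∈) (disPairs-∖ (S ∖ e) f∈′) (bound e e∈)
          (≤-trans (ddeg-mono {S ∖ e} {S} f (∖-⊆ {S = S})) (bound f f∈)) many)

    module Long-edges (θ : ℕ) (θ-big : 9 * n ≤ 10 * ((2 + θ) * θ)) (θ-small : (2 + θ) * (2 + θ) ≤ 2 * n) (1≤n : 1 ≤ n) where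

      t = 2 + θ

      -- Bounds the right-hand side of `disjoint-sum` from above. Edges of size at most 4t are
      -- charged to the disjoint pairs; for larger ones the bound 2x on disjoint partners is
      -- combined with their small total size.
      many-disjoint : ∀ S x → (∀ j → j ∈ᵇ S → t ≤ size j) → n + x ≤ # S → (∀ f → f ∈ᵇ S → ddeg S f ≤ 2 * x) →
                      2 * (x * n) ≤ 40 * disPairs S
      many-disjoint S x low big deg≤ = *-cancelˡ-≤ n ⦃ Data.Nat.>-nonZero 1≤n ⦄
        (many-arith X (disPairs S) θ x (# S) n q (∑∈ S size)
          (dis-arith X (disPairs S) t x (∑∈ (S ∩ᵇ large) size) n X≤ large≤)
          (disjoint-sum S q (sym (m+[n∸m]≡n supp≤)) supp≥1)
          (≤-trans (≤-reflexive (sym (∑∈-const S t))) (∑∈-monoʳ {S = S} low))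
          (m+n≤o⇒m≤o∸n x (≤-trans (≤-trans (≤-reflexive (+-comm x _)) (+-monoˡ-≤ x (#≤n (supp S)))) big))
          (≤-trans (m≤m+n n x) big) θ-big θ-small)
        where
        X = ∑∈ S (λ f → ddeg S f * size f)
        q = # S ∸ # (supp S)
        supp≤ : # (supp S) ≤ # S
        supp≤ = ≤-trans (#≤n (supp S)) (≤-trans (m≤m+n n x) big)
        supp≥1 : 1 ≤ # (supp S)
        supp≥1 with #-nonempty {S = S} (≤-trans 1≤n (≤-trans (m≤m+n n x) big))
        ... | j , j∈ with #-nonempty {S = a j} (≤-trans (s≤s z≤n) (low j j∈))
        ... | v , v∈ = #-member {S = supp S} {v} (some-intro {P = λ j → S j ∧ a j v} {j} (∧-intro j∈ v∈))
        large : Pred m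
        large f = 4 * t <ᵇ size f
        X≤ : X ≤ 4 * t * disPairs S + 2 * x * ∑∈ (S ∩ᵇ large) size
        X≤ = begin
          X ≤⟨ ∑∈-monoʳ {S = S} pt ⟩
          ∑∈ S (λ f → 4 * t * ddeg S f + 𝟙 (large f) * (size f * (2 * x))) ≡⟨ ∑∈-+ S _ _ ⟩
          ∑∈ S (λ f → 4 * t * ddeg S f) + ∑∈ S (λ f → 𝟙 (large f) * (size f * (2 * x)))
            ≡⟨ cong₂ _+_ (∑∈-*ˡ S (4 * t) (ddeg S)) (trans (∑-cong (λ f → assoc (S f) (large f) (size f) (2 * x))) (trans (∑-*ʳ (λ f → 𝟙 ((S ∩ᵇ large) f) * size f) (2 * x)) (*-comm _ (2 * x)))) ⟩
          4 * t * disPairs S + 2 * x * ∑∈ (S ∩ᵇ large) size ∎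
          where
          open ≤-Reasoning
          assoc : ∀ b c y z → 𝟙 b * (𝟙 c * (y * z)) ≡ 𝟙 (b ∧ c) * y * z
          assoc b c y z rewrite 𝟙-∧ b c = eq (𝟙 b) (𝟙 c) y z
            where
            eq : ∀ b c y z → b * (c * (y * z)) ≡ b * c * y * z
            eq = solve-∀
          pt : ∀ f → f ∈ᵇ S → ddeg S f * size f ≤ 4 * t * ddeg S f + 𝟙 (large f) * (size f * (2 * x))
          pt f p with 4 * t <ᵇ size f in eq
          ... | true = deg-pt (ddeg S f) t (size f) x (deg≤ f p)
          ... | false = ≤-trans (*-monoʳ-≤ (ddeg S f) (<ᵇ-false {4 * t} eq)) (≤-trans (≤-reflexive (*-comm (ddeg S f) _)) (m≤m+n _ _))
        large≤ : ∑∈ (S ∩ᵇ large) size * (4 * t) ≤ n * n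
        large≤ = ≤-trans (≤-reflexive (*-comm (∑∈ (S ∩ᵇ large) size) (4 * t))) (≤-trans (ρ∑size≤vol (S ∩ᵇ large) (4 * t)
          (λ j p → <ᵇ-true {4 * t} (proj₂ (∧-true {S j} p)))) (vol≤n² (S ∩ᵇ large)))

      -- An edge with at least 2x disjoint partners can be set aside and inserted into a pairing of
      -- the rest. If there is none, the double count gives xn/20 ordered disjoint pairs, against at
      -- most 8x(x - 1) used up by x - 1 greedy choices; hence the factor 160 = 20 · 8.
      pairing : ∀ x S → (∀ j → j ∈ᵇ S → t ≤ size j) → n + x ≤ # S → 160 * x < n → Pairing S x
      pairing zero S _ _ _ = none
      pairing (suc x) S low big small with some (λ f → S f ∧ not (ddeg S f <ᵇ 2 * suc x)) in eq
      ... | true with some-true {P = λ f → S f ∧ not (ddeg S f <ᵇ 2 * suc x)} eq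
      ... | f , p with ∧-true {S f} p
      ... | f∈ , high = insert f (∖-⊆ {S = S}) f∈ (∖-∉ S f) big′
              (pairing x (S ∖ f) (λ j q → low j (∖-⊆ {S = S} j q))
                (s≤s⁻¹ (≤-trans (≤-reflexive (sym (+-suc n x))) (≤-trans big (≤-reflexive (#-remove {S = S} f∈)))))
                (≤-<-trans (*-monoʳ-≤ 160 (n≤1+n x)) small))
        where
        big′ : 2 * x < ddeg (S ∖ f) f
        big′ = ≤-trans (≤-trans (*-monoʳ-< 2 ≤-refl) (<ᵇ-false (not-true high))) (≤-trans (ddeg-∖ S f f)
          (≤-reflexive (trans (cong (λ b → ddeg (S ∖ f) f + 𝟙 b) (cong (λ b → not b ∧ not (meets f f)) (==-refl f))) (+-identityʳ _))))
      pairing (suc x) S low big small | false = greedy-pairing x S (2 * suc x) deg≤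
          (*-cancelˡ-< 20 _ _ (start-arith x n (disPairs S) (many-disjoint S (suc x) low big deg≤) small))
        where
        deg≤ : ∀ f → f ∈ᵇ S → ddeg S f ≤ 2 * suc x
        deg≤ f p with ddeg S f <ᵇ 2 * suc x in q
        ... | true = <⇒≤ (<ᵇ-true q)
        ... | false = ⊥-elim (true≢false (∧-intro p (not-intro q)) (some-false {P = λ f → S f ∧ not (ddeg S f <ᵇ 2 * suc x)} eq f))

    -- Colours are natural numbers here; every colour class is dominated by one of its members.
    record ClassColouring (S : Pred m) (k : ℕ) : Set where
      field
        colour   : Fin m → ℕ
        bounded  : ∀ i → i ∈ᵇ S → colour i < k
        separate : ∀ i j → i ∈ᵇ S → j ∈ᵇ S → adj i j ≡ true → colour i ≢ colour j
        class    : ∀ c → (∀ i → i ∈ᵇ S → colour i ≢ c) ⊎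
                   ∃ λ e → e ∈ᵇ S × colour e ≡ c × ∑∈ S (λ i → 𝟙 (colour i ≡ᵇ c) * size i) ≤ 2 * size e

    add-class : ∀ {S S′ k} (C : Pred m) {e} → C ⊆ᵇ S → S′ ⊆ᵇ S → (∀ i → i ∈ᵇ S → i ∉ᵇ C → i ∈ᵇ S′) → (∀ i → i ∈ᵇ S′ → i ∉ᵇ C) →
                (∀ i j → i ∈ᵇ C → j ∈ᵇ C → adj i j ≡ false) → e ∈ᵇ C → ∑∈ C size ≤ 2 * size e →
                ClassColouring S′ k → ClassColouring S (suc k)
    add-class {S} {S′} {k} C {e} C⊆S S′⊆S cover apart ind e∈ small col = record
      { colour = colour′ ; bounded = bounded′ ; separate = separate′ ; class = class′ }
      where
      open ClassColouring col
      colour′ : Fin m → ℕ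
      colour′ i = if C i then k else colour i
      old : ∀ {i} → i ∉ᵇ C → colour′ i ≡ colour i
      old p rewrite p = refl
      new : ∀ {i} → i ∈ᵇ C → colour′ i ≡ k
      new p rewrite p = refl
      bounded′ : ∀ i → i ∈ᵇ S → colour′ i < suc k
      bounded′ i p with C i in eq
      ... | true = ≤-refl
      ... | false = m<n⇒m<1+n (bounded i (cover i p eq))
      separate′ : ∀ i j → i ∈ᵇ S → j ∈ᵇ S → adj i j ≡ true → colour′ i ≢ colour′ j
      separate′ i j p q r with C i in x | C j in y
      ... | true | true = λ _ → true≢false r (ind i j x y)
      ... | true | false = λ z → <-irrefl (sym z) (bounded j (cover j q y))
      ... | false | true = λ z → <-irrefl z (bounded i (cover i p x))
      ... | false | false = separate i j (cover i p x) (cover j q y) r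
      ≡ᵇ-false : ∀ {x y} → x ≢ y → (x ≡ᵇ y) ≡ false
      ≡ᵇ-false {x} {y} p = ≢true⇒false (λ q → p (≡ᵇ⇒≡ x y (subst Data.Bool.T (sym q) _)))
      class′ : ∀ c → (∀ i → i ∈ᵇ S → colour′ i ≢ c) ⊎
               ∃ λ f → f ∈ᵇ S × colour′ f ≡ c × ∑∈ S (λ i → 𝟙 (colour′ i ≡ᵇ c) * size i) ≤ 2 * size f
      class′ c with c ≟ k
      ... | yes refl = inj₂ (e , C⊆S e e∈ , new e∈ , ≤-trans (∑-mono pt) small)
        where
        pt : ∀ i → 𝟙 (S i) * (𝟙 (colour′ i ≡ᵇ k) * size i) ≤ 𝟙 (C i) * size i
        pt i with S i in p
        ... | false = z≤n
        ... | true with C i in x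
        ... | true = ≤-trans (≤-reflexive (+-identityʳ _)) (*-monoˡ-≤ (size i) (𝟙≤1 (k ≡ᵇ k)))
        ... | false rewrite ≡ᵇ-false (λ z → <-irrefl z (bounded i (cover i p x))) = z≤n
      ... | no c≢k with class c
      ... | inj₁ empty = inj₁ λ i p → lemma i p
        where
        lemma : ∀ i → i ∈ᵇ S → colour′ i ≢ c
        lemma i p with C i in x
        ... | true = λ z → c≢k (sym z)
        ... | false = empty i (cover i p x)
      ... | inj₂ (f , f∈ , fc , bound) = inj₂ (f , S′⊆S f f∈ , trans (old (apart f f∈)) fc , ≤-trans (∑-mono pt) bound)
        where
        pt : ∀ i → 𝟙 (S i) * (𝟙 (colour′ i ≡ᵇ c) * size i) ≤ 𝟙 (S′ i) * (𝟙 (colour i ≡ᵇ c) * size i)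
        pt i with S i in p
        ... | false = z≤n
        ... | true with C i in x
        ... | true rewrite ≡ᵇ-false {k} {c} (λ z → c≢k (sym z)) = z≤n
        ... | false rewrite cover i p x = ≤-refl

    singletons : ∀ k S → # S ≤ k → ClassColouring S k
    singletons k S bound with some S in eq
    ... | false = record { colour = λ _ → 0 ; bounded = λ i p → ⊥-elim (true≢false p (some-false {P = S} eq i))
                         ; separate = λ i _ p → ⊥-elim (true≢false p (some-false {P = S} eq i))
                         ; class = λ c → inj₁ (λ i p → ⊥-elim (true≢false p (some-false {P = S} eq i))) }
    ... | true with some-true {P = S} eq
    singletons zero S bound | true | e , e∈ = ⊥-elim (1+n≰n (≤-trans (#-member {S = S} e∈) bound))
    singletons (suc k) S bound | true | e , e∈ = add-class (_== e) (λ i p → subst (_∈ᵇ S) (sym (==⇒≡ p)) e∈) (∖-⊆ {S = S})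
      (λ i p q → ∖-∈ {S = S} p (==⇒≢ q)) (λ i p → ≢⇒== (∖-≢ {S = S} p))
      (λ i j p q → subst₂ (λ x y → adj x y ≡ false) (sym (==⇒≡ p)) (sym (==⇒≡ q)) (adj-irrefl e)) (==-refl e)
      (≤-trans (≤-reflexive (∑-≡-pick e size)) (m≤m+n _ _))
      (singletons k (S ∖ e) (s≤s⁻¹ (≤-trans (≤-reflexive (sym (#-remove {S = S} e∈))) bound)))

    module PairClass {S : Pred m} e f (e∈ : e ∈ᵇ S) (f∈ : f ∈ᵇ S) (ef : dis e f ≡ true) where
      C : Pred m
      C i = (i == e) ∨ (i == f)
      C⊆S : C ⊆ᵇ S
      C⊆S i p with ∨-true {i == e} p
      ... | inj₁ q = subst (_∈ᵇ S) (sym (==⇒≡ q)) e∈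
      ... | inj₂ q = subst (_∈ᵇ S) (sym (==⇒≡ q)) f∈
      S′⊆S : S ∖ e ∖ f ⊆ᵇ S
      S′⊆S i r = ∖-⊆ {S = S} i (∖-⊆ {S = S ∖ e} i r)
      cover : ∀ i → i ∈ᵇ S → i ∉ᵇ C → i ∈ᵇ S ∖ e ∖ f
      cover i p q with S i | i == e | i == f
      cover i refl refl | true | false | false = refl
      apart : ∀ i → i ∈ᵇ S ∖ e ∖ f → i ∉ᵇ C
      apart i p with S i | i == e | i == f
      apart i refl | true | false | false = refl
      ind : ∀ i j → i ∈ᵇ C → j ∈ᵇ C → adj i j ≡ false
      ind i j p q with ∨-true {i == e} p | ∨-true {j == e} q
      ... | inj₁ x | inj₁ y = subst₂ (λ x y → adj x y ≡ false) (sym (==⇒≡ x)) (sym (==⇒≡ y)) (adj-irrefl e)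
      ... | inj₁ x | inj₂ y = subst₂ (λ x y → adj x y ≡ false) (sym (==⇒≡ x)) (sym (==⇒≡ y)) (dis-adj ef)
      ... | inj₂ x | inj₁ y = subst₂ (λ x y → adj x y ≡ false) (sym (==⇒≡ x)) (sym (==⇒≡ y)) (trans (adj-sym≡ f e) (dis-adj ef))
      ... | inj₂ x | inj₂ y = subst₂ (λ x y → adj x y ≡ false) (sym (==⇒≡ x)) (sym (==⇒≡ y)) (adj-irrefl f)
      C-size : ∑∈ C size ≤ size e + size f
      C-size = ≤-trans (∑∈-∪-≤ (_== e) (_== f) size) (≤-reflexive (cong₂ _+_ (∑-≡-pick e size) (∑-≡-pick f size)))
      count : # S ≡ 2 + # (S ∖ e ∖ f)
      count = trans (#-remove {S = S} e∈) (cong suc (#-remove {S = S ∖ e} (∖-∈ {S = S} f∈ (λ r → dis-≢ {e} {f} ef (sym r)))))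

    pairing-size : ∀ {S x} → Pairing S x → 2 * x ≤ # S
    pairing-size none = z≤n
    pairing-size {S} {suc x} (pair e f e∈ f∈ ef rest) = begin
      2 * suc x ≡⟨ *-suc 2 x ⟩
      2 + 2 * x ≤⟨ +-monoʳ-≤ 2 (pairing-size rest) ⟩
      2 + # (S ∖ e ∖ f) ≡⟨ cong suc (#-remove {S = S ∖ e} (∖-∈ {S = S} f∈ (λ r → dis-≢ {e} {f} ef (sym r)))) ⟨
      1 + # (S ∖ e) ≡⟨ #-remove {S = S} e∈ ⟨
      # S ∎
      where open ≤-Reasoning

    private
      count′ : ∀ k x {y} → 2 + y ≤ suc k + suc x → y ≤ k + x
      count′ k x p = s≤s⁻¹ (s≤s⁻¹ (≤-trans p (≤-reflexive (cong suc (+-suc k x)))))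

    -- The larger edge of a pair dominates its class, so the load is at most twice the size of one
    -- member.
    pairing-colouring : ∀ {S x} k → Pairing S x → # S ≤ k + x → ClassColouring S k
    pairing-colouring k none bound = singletons k _ (≤-trans bound (≤-reflexive (+-identityʳ k)))
    pairing-colouring {S} {suc x} zero p bound = ⊥-elim (<⇒≱ (m<m+n (suc x) {suc x} (s≤s z≤n))
      (≤-trans (≤-reflexive (cong (suc x +_) (sym (+-identityʳ (suc x))))) (≤-trans (pairing-size p) bound)))
    pairing-colouring {S} {suc x} (suc k) (pair e f e∈ f∈ ef rest) bound with size f ≤? size e
    ... | yes le = add-class C C⊆S S′⊆S cover apart ind (∨-introˡ (==-refl e))
          (≤-trans C-size (≤-trans (+-monoʳ-≤ (size e) le) (≤-reflexive (cong (size e +_) (sym (+-identityʳ (size e))))))) IH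
      where
      open PairClass e f e∈ f∈ ef
      IH = pairing-colouring k rest (count′ k x (≤-trans (≤-reflexive (sym count)) bound))
    ... | no gt = add-class C C⊆S S′⊆S cover apart ind (∨-introʳ {f == e} (==-refl f))
          (≤-trans C-size (≤-trans (+-monoˡ-≤ (size f) (<⇒≤ (≰⇒> gt))) (≤-reflexive (cong (size f +_) (sym (+-identityʳ (size f))))))) IH
      where
      open PairClass e f e∈ f∈ ef
      IH = pairing-colouring k rest (count′ k x (≤-trans (≤-reflexive (sym count)) bound))

-- Repeated colours in neighbourhoods

module SavedColours where
  open FiniteSums
  open GreedyColouring
  open LinearIncidence
  open DenseSubsets
  open Extensions
  open DisjointPairs
  open PolynomialIdentities using (polynomial; _:=_; _:+_; _:*_; con)
  open import Data.Bool using (Bool; true; false; _∧_; _∨_; not)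
  open import Data.Empty using (⊥-elim)
  open import Data.Fin using (Fin; zero; suc; toℕ)
  open import Data.Nat using (ℕ; zero; suc; _+_; _*_; _∸_; _≤_; _<_; z≤n; s≤s; s≤s⁻¹; _<ᵇ_)
  open import Data.Nat.Properties
  open import Data.Nat.Tactic.RingSolver using (solve-∀)
  open import Data.Product using (∃; _×_; _,_; proj₁; proj₂)
  open import Data.Sum using (inj₁; inj₂)
  open import Function using (id)
  open import Data.Vec using ([]; _∷_)
  open import Relation.Binary.PropositionalEquality
  open import Data.Fin.Properties using (toℕ-injective)
  open import Data.Sum using ([_,_]′)
  open import Relation.Nullary using (yes; no)
  mu-arith : ∀ μ ν u D dS M V W → D ≤ dS → dS ≤ M + V + W → V ≤ ν → W ≤ u → μ + ν + u ≤ D → μ ≤ M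
  mu-arith μ ν u D dS M V W h1 h2 h3 h4 h5 = farkas 0 (+-mono-≤ (+-mono-≤ (+-mono-≤ (+-mono-≤ h1 h2) h3) h4) h5)
    (polynomial (μ ∷ ν ∷ u ∷ D ∷ dS ∷ M ∷ V ∷ W ∷ []) (λ μ ν u D dS M V W → con 1 :* μ :+ (dS :+ (M :+ V :+ W) :+ ν :+ u :+ D) :+ con 0 := con 1 :* M :+ (D :+ dS :+ V :+ W :+ (μ :+ ν :+ u))) refl)

  psi-arith : ∀ J H P P₁ h → P₁ + h ≤ P → P ≤ (1 + J) * (1 + H) → H < h → P₁ ≤ J * (1 + H)
  psi-arith J H P P₁ h h1 h2 h3 = farkas 0 (+-mono-≤ (+-mono-≤ h1 h2) h3)
    (polynomial (J ∷ H ∷ P ∷ P₁ ∷ h ∷ []) (λ J H P P₁ h → con 1 :* P₁ :+ (P :+ ((con 1 :+ J) :* (con 1 :+ H)) :+ h) :+ con 0 := con 1 :* (J :* (con 1 :+ H)) :+ ((P₁ :+ h) :+ P :+ (con 1 :+ H))) refl)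

  final-arith : ∀ dS dD sn sv σ Δ F k → dS + dD ≤ Δ → sn + sv ≤ dD → σ ≤ sv → Δ + F < k + σ → dS + sn + F < k
  final-arith dS dD sn sv σ Δ F k h1 h2 h3 h4 = farkas 0 (+-mono-≤ (+-mono-≤ (+-mono-≤ h1 h2) h3) h4)
    (polynomial (dS ∷ dD ∷ sn ∷ sv ∷ σ ∷ Δ ∷ F ∷ k ∷ []) (λ dS dD sn sv σ Δ F k → con 1 :* (con 1 :+ (dS :+ sn :+ F)) :+ (Δ :+ dD :+ sv :+ (k :+ σ)) :+ con 0 := con 1 :* k :+ ((dS :+ dD) :+ (sn :+ sv) :+ σ :+ (con 1 :+ (Δ :+ F)))) refl)

  ∑∈-exists : ∀ {n} {S : Pred n} {f : Fin n → ℕ} c → # S * c < ∑∈ S f → ∃ λ i → i ∈ᵇ S × c < f i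
  ∑∈-exists {S = S} {f} c p with ∑-exists-< {f = λ i → 𝟙 (S i) * c} {λ i → 𝟙 (S i) * f i} (subst (_< ∑∈ S f) (sym (∑∈-const S c)) p)
  ... | i , q with S i in eq
  ... | true = i , eq , +-cancelʳ-< 0 c (f i) q
  ∑∈-exists c p | i , () | false

  #≥2 : ∀ {n} {S : Pred n} {i j} → i ∈ᵇ S → j ∈ᵇ S → i ≢ j → 2 ≤ # S
  #≥2 {S = S} {i} {j} p q r = subst (2 ≤_) (sym (#-remove {S = S} p)) (s≤s (#-member {S = S ∖ i} (∖-∈ {S = S} q (λ x → r (sym x)))))

  thrice : ∀ s → s + s + s ≡ 3 * s
  thrice = solve-∀

  add-pair : ∀ x J → 2 + x + 2 * J ≡ x + 2 * suc J
  add-pair = solve-∀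

  module Savings {n m k : ℕ} (a : Fin m → Fin n → Bool)
    (lin : ∀ i j → i ≢ j → ∀ u v → u ∈ᵇ a i → u ∈ᵇ a j → v ∈ᵇ a i → v ∈ᵇ a j → u ≡ v) where

    open Linear a lin
    open Disjoint a lin
    open Extend {m} {k} adj adj-sym adj-irrefl size hiding (deg)

    count : Pred m → (Fin m → Fin k) → Fin m → Fin k → ℕ
    count D col g c = # (λ i → (D i ∧ adj g i) ∧ (col i == c))

    saving : Pred m → (Fin m → Fin k) → Fin m → ℕ
    saving D col g = ∑ (λ c → count D col g c ∸ 1)

    -- Repetitions of colours around `g` become room for its own colour: this identity converts one
    -- into the other.
    seen+saving : ∀ D col g → # (seen D col g) + saving D col g ≡ deg D g
    seen+saving D col g = begin
      # (seen D col g) + saving D col g ≡⟨ ∑-+ _ _ ⟨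
      ∑ (λ c → 𝟙 (seen D col g c) + (count D col g c ∸ 1)) ≡⟨ ∑-cong (λ c → lemma (λ i → (D i ∧ adj g i) ∧ (col i == c))) ⟩
      ∑ (λ c → count D col g c) ≡⟨ ∑-cong (λ c → ∑-cong (λ i → trans (𝟙-∧ (D i ∧ adj g i) (col i == c)) (*-comm (𝟙 (D i ∧ adj g i)) _))) ⟩
      ∑ (λ c → ∑ (λ i → 𝟙 (col i == c) * 𝟙 (D i ∧ adj g i))) ≡⟨ ∑-fibres col (λ i → 𝟙 (D i ∧ adj g i)) ⟩
      deg D g ∎
      where
      open ≡-Reasoning
      lemma : ∀ (P : Pred m) → 𝟙 (some P) + (# P ∸ 1) ≡ # P
      lemma P with some P in eq
      ... | false rewrite ∑-0 {f = λ i → 𝟙 (P i)} (λ i → cong 𝟙 (some-false {P = P} eq i)) = refl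
      ... | true = m+[n∸m]≡n (#-member {S = P} (proj₂ (some-true {P = P} eq)))

    count-mono : ∀ {D D′ col col′} → D ⊆ᵇ D′ → (∀ i → i ∈ᵇ D → col′ i ≡ col i) → ∀ g c → count D col g c ≤ count D′ col′ g c
    count-mono {D} {D′} {col} {col′} sub eq g c = #-mono (λ i p → let x , y = ∧-true {D i ∧ adj g i} p ; z , w = ∧-true {D i} x in
      ∧-intro (∧-intro (sub i z) w) (trans (cong (_== c) (eq i z)) y))

    saving-mono : ∀ {D D′ col col′} → D ⊆ᵇ D′ → (∀ i → i ∈ᵇ D → col′ i ≡ col i) → ∀ g → saving D col g ≤ saving D′ col′ g
    saving-mono sub eq g = ∑-mono (λ c → ∸-monoˡ-≤ 1 (count-mono sub eq g c))

    -- Because the colour of the pair is fresh, its second occurrence next to `g` is a repetition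
    -- that was not counted before.
    saving-pair : ∀ {D D′ col col′ e f} → D ⊆ᵇ D′ → (∀ i → i ∈ᵇ D → col′ i ≡ col i) → e ∈ᵇ D′ → f ∈ᵇ D′ → e ≢ f → col′ e ≡ col′ f →
                  (∀ i → i ∈ᵇ D → col i ≢ col′ e) → ∀ g → saving D col g + 𝟙 (adj g e ∧ adj g f) ≤ saving D′ col′ g
    saving-pair {D} {D′} {col} {col′} {e} {f} sub eq e∈ f∈ e≢f same fresh g = begin
      saving D col g + 𝟙 (adj g e ∧ adj g f) ≡⟨ cong (saving D col g +_) (∑-≡-pick (col′ e) (λ _ → 𝟙 (adj g e ∧ adj g f))) ⟨
      saving D col g + ∑ (λ c → 𝟙 (c == col′ e) * 𝟙 (adj g e ∧ adj g f)) ≡⟨ ∑-+ _ _ ⟨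
      ∑ (λ c → (count D col g c ∸ 1) + 𝟙 (c == col′ e) * 𝟙 (adj g e ∧ adj g f)) ≤⟨ ∑-mono pt ⟩
      saving D′ col′ g ∎
      where
      open ≤-Reasoning
      pt : ∀ c → (count D col g c ∸ 1) + 𝟙 (c == col′ e) * 𝟙 (adj g e ∧ adj g f) ≤ count D′ col′ g c ∸ 1
      pt c with c == col′ e in x
      ... | false = ≤-trans (≤-reflexive (+-identityʳ _)) (∸-monoˡ-≤ 1 (count-mono sub eq g c))
      ... | true with adj g e ∧ adj g f in y
      ... | false = ≤-trans (≤-reflexive (+-identityʳ _)) (∸-monoˡ-≤ 1 (count-mono sub eq g c))
      ... | true rewrite ==⇒≡ {i = c} x = ≤-trans (≤-reflexive (cong (λ y → (y ∸ 1) + 1) zero-count)) (∸-monoˡ-≤ 1 (#≥2 {S = λ i → (D′ i ∧ adj g i) ∧ (col′ i == col′ e)} {e} {f}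
            (∧-intro (∧-intro e∈ (proj₁ (∧-true {adj g e} y))) (==-refl (col′ e)))
            (∧-intro (∧-intro f∈ (proj₂ (∧-true {adj g e} y))) (trans (cong (_== col′ e) (sym same)) (==-refl (col′ e)))) e≢f))
        where
        zero-count : count D col g (col′ e) ≡ 0
        zero-count = ∑-0 (λ i → cong 𝟙 (≢true⇒false (λ p → let z , w = ∧-true {D i ∧ adj g i} p in
          fresh i (proj₁ (∧-true {D i} z)) (==⇒≡ w))))

    record Coloured (S : Pred m) (A : Pred k) (cap : ℕ) : Set where
      field
        col     : Fin m → Fin k
        proper  : Proper S col
        palette : ∀ i → i ∈ᵇ S → col i ∈ᵇ A
        loads   : ∀ c → load S col c ≤ cap

    coloured-cong : ∀ {S S′ A cap} → (∀ i → S i ≡ S′ i) → Coloured S A cap → Coloured S′ A cap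
    coloured-cong eq C = record { col = col ; proper = λ i j p q → proper i j (trans (eq i) p) (trans (eq j) q)
      ; palette = λ i p → palette i (trans (eq i) p) ; loads = λ c → subst (_≤ _) (load-cong c eq (λ _ _ → refl)) (loads c) }
      where open Coloured C

    coloured-extend : ∀ {S R A B cap} (C : Coloured S A cap) → A ⊆ᵇ B → (∀ i → i ∈ᵇ S → i ∉ᵇ R) →
                      Extension S (Coloured.col C) R B cap → Coloured (S ∪ᵇ R) B cap
    coloured-extend {S} {R} {A} {B} {cap} C A⊆B disj E = record { col = col′ ; proper = proper′ ; palette = pal
      ; loads = λ c → [ (λ q → ≤-trans (≤-reflexive q) (loads c)) , id ]′ (load′ c) }
      where
      open Coloured C
      open Extension E renaming (palette to palette′)
      pal : ∀ i → i ∈ᵇ S ∪ᵇ R → col′ i ∈ᵇ B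
      pal i p with ∨-true {S i} p
      ... | inj₁ q = subst (_∈ᵇ B) (sym (agree i (disj i q))) (A⊆B _ (palette i q))
      ... | inj₂ q = palette′ i q

    record PickData : Set where
      constructor pick-data
      field
        S G : Pred m
        ρ s κ D₀ ν u μ h η H′ σ cap : ℕ
        1≤ρ : 1 ≤ ρ
        1≤η : 1 ≤ η
        low : ∀ j → j ∈ᵇ S → suc ρ ≤ size j
        dense : ∀ j → j ∈ᵇ S → D₀ ≤ deg S j
        G⊆S : G ⊆ᵇ S
        nice : ∀ j → j ∈ᵇ G → size j ≤ s
        few : # (S ∖ᵇ G) ≤ ν
        common≤ : n + s * s * ρ ≤ κ * ρ
        μ≤ : μ + ν + u ≤ D₀
        h≤ : h + κ + 1 ≤ μ
        H≤ : # S * (# S * H′) < η * (μ * h)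
        room : 3 * s ≤ cap

    module Pick (P : PickData) where
      open PickData P

      record State (j : ℕ) (D : Pred m) (col : Fin m → Fin k) : Set where
        field
          inside : D ⊆ᵇ G
          proper : Proper D col
          colours : ∀ i → i ∈ᵇ D → toℕ (col i) < j
          loads  : ∀ c → load D col c ≤ cap
          used   : # D ≤ u

      needy : Pred m → (Fin m → Fin k) → Pred m
      needy D col g = G g ∧ (saving D col g <ᵇ σ)

      -- The total missing saving. A round lowers it by more than `H′`, which bounds the number of
      -- rounds.
      Ψ : Pred m → (Fin m → Fin k) → ℕ
      Ψ D col = ∑∈ G (λ g → σ ∸ saving D col g)

      needy≤Ψ : ∀ D col → # (needy D col) ≤ Ψ D col
      needy≤Ψ D col = ∑-mono pt
        where
        pt : ∀ g → 𝟙 (needy D col g) ≤ 𝟙 (G g) * (σ ∸ saving D col g)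
        pt g with G g
        ... | false = z≤n
        ... | true with saving D col g <ᵇ σ in eq
        ... | false = z≤n
        ... | true = ≤-trans (m<n⇒0<n∸m (<ᵇ-true {saving D col g} {σ} eq)) (≤-reflexive (sym (+-identityʳ _)))

      module Find (D : Pred m) (col : Fin m → Fin k) (D-few : # D ≤ u) (needy-many : η ≤ # (needy D col)) where
        U : Pred m
        U e = G e ∧ not (D e)
        M : Fin m → Pred m
        M g e = U e ∧ adj g e
        U⊆S : U ⊆ᵇ S
        U⊆S e p = G⊆S e (proj₁ (∧-true {G e} p))

        M-large : ∀ g → g ∈ᵇ G → μ ≤ # (M g)
        M-large g p = mu-arith μ ν u D₀ (deg S g) (# (M g)) (# (S ∖ᵇ G)) (# D) (dense g (G⊆S g p))
          (≤-trans (∑-mono pt) (≤-reflexive (trans (∑-+ _ _) (cong (_+ # D) (∑-+ _ _))))) few D-few μ≤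
          where
          pt : ∀ i → 𝟙 (S i ∧ adj g i) ≤ 𝟙 (M g i) + 𝟙 ((S ∖ᵇ G) i) + 𝟙 (D i)
          pt i with S i | G i | D i | adj g i
          ... | false | _ | _ | _ = z≤n
          ... | true | _ | _ | false = z≤n
          ... | true | true | true | true = s≤s z≤n
          ... | true | true | false | true = s≤s z≤n
          ... | true | false | _ | true = s≤s z≤n

        M-disjoint : ∀ g e → g ∈ᵇ G → e ∈ᵇ M g → h ≤ # (λ f → M g f ∧ dis e f)
        M-disjoint g e p q = +-cancelʳ-≤ (κ + 1) _ _ (begin
          h + (κ + 1) ≡⟨ +-assoc h κ 1 ⟨
          h + κ + 1 ≤⟨ ≤-trans h≤ (M-large g p) ⟩
          # (M g) ≤⟨ ∑-mono pt ⟩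
          ∑ (λ f → 𝟙 (M g f ∧ dis e f) + 𝟙 ((S f ∧ adj g f) ∧ adj e f) + 𝟙 (f == e) * 1) ≡⟨ trans (∑-+ _ _) (cong₂ _+_ (∑-+ _ _) (∑-≡-pick e (λ _ → 1))) ⟩
          # (λ f → M g f ∧ dis e f) + common S g e + 1 ≤⟨ +-monoˡ-≤ 1 (+-monoʳ-≤ _ common≤κ) ⟩
          # (λ f → M g f ∧ dis e f) + κ + 1 ≡⟨ +-assoc _ κ 1 ⟩
          # (λ f → M g f ∧ dis e f) + (κ + 1) ∎)
          where
          open ≤-Reasoning
          e∈U : e ∈ᵇ U
          e∈U = proj₁ (∧-true {U e} q)
          ge : adj g e ≡ true
          ge = proj₂ (∧-true {U e} q)
          e-nice : size e ≤ s
          e-nice = nice e (proj₁ (∧-true {G e} e∈U))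
          common≤κ : common S g e ≤ κ
          common≤κ = *-cancelʳ-≤ _ κ ρ ⦃ Data.Nat.>-nonZero 1≤ρ ⦄ (≤-trans (common-bound S ρ low ge)
            (≤-trans (+-monoʳ-≤ n (*-monoˡ-≤ ρ (*-mono-≤ (nice g p) e-nice))) common≤))
          pt : ∀ f → 𝟙 (M g f) ≤ 𝟙 (M g f ∧ dis e f) + 𝟙 ((S f ∧ adj g f) ∧ adj e f) + 𝟙 (f == e) * 1
          pt f with U f in x
          ... | false = z≤n
          ... | true rewrite U⊆S f x with adj g f
          ... | false = z≤n
          ... | true with f == e in y | e == f in z | meets e f
          ... | true | _ | _ = m≤n+m 1 _
          ... | false | true | _ = ⊥-elim (==⇒≢ y (sym (==⇒≡ z)))
          ... | false | false | true = s≤s z≤n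
          ... | false | false | false = s≤s z≤n

        hits : Fin m → Fin m → ℕ
        hits e f = ∑∈ (needy D col) (λ g → 𝟙 (adj g e ∧ adj g f))

        total : η * (μ * h) ≤ ∑∈ U (λ e → ∑∈ U (λ f → 𝟙 (dis e f) * hits e f))
        total = begin
          η * (μ * h) ≤⟨ *-monoˡ-≤ (μ * h) needy-many ⟩
          # (needy D col) * (μ * h) ≡⟨ ∑∈-const (needy D col) (μ * h) ⟨
          ∑∈ (needy D col) (λ _ → μ * h) ≤⟨ ∑∈-monoʳ {S = needy D col} (λ g p → at g (proj₁ (∧-true {G g} p))) ⟩
          ∑∈ (needy D col) (λ g → ∑∈ (M g) (λ e → # (λ f → M g f ∧ dis e f)))
            ≡⟨ ∑∈-cong {S = needy D col} (λ g _ → ∑-cong (λ e → trans (cong₂ _*_ (𝟙-∧ (U e) (adj g e)) (∑-cong (λ f → flat (U f) (adj g f) (dis e f))))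
                 (trans (*-assoc (𝟙 (U e)) _ _) (cong (𝟙 (U e) *_) (trans (∑-*ˡ (𝟙 (adj g e)) _) (∑-cong (λ f → flat′ (𝟙 (U f)) (adj g e) (𝟙 (dis e f)) (adj g f)))))))) ⟩
          ∑∈ (needy D col) (λ g → ∑∈ U (λ e → ∑∈ U (λ f → 𝟙 (dis e f) * 𝟙 (adj g e ∧ adj g f))))
            ≡⟨ ∑∈-swap (needy D col) U (λ g e → ∑∈ U (λ f → 𝟙 (dis e f) * 𝟙 (adj g e ∧ adj g f))) ⟩
          ∑∈ U (λ e → ∑∈ (needy D col) (λ g → ∑∈ U (λ f → 𝟙 (dis e f) * 𝟙 (adj g e ∧ adj g f))))
            ≡⟨ ∑∈-cong {S = U} (λ e _ → trans (∑∈-swap (needy D col) U (λ g f → 𝟙 (dis e f) * 𝟙 (adj g e ∧ adj g f)))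
                 (∑∈-cong {S = U} (λ f _ → ∑∈-*ˡ (needy D col) (𝟙 (dis e f)) (λ g → 𝟙 (adj g e ∧ adj g f))))) ⟩
          ∑∈ U (λ e → ∑∈ U (λ f → 𝟙 (dis e f) * hits e f)) ∎
          where
          open ≤-Reasoning
          flat : ∀ x y z → 𝟙 ((x ∧ y) ∧ z) ≡ 𝟙 x * (𝟙 z * 𝟙 y)
          flat true y z = trans (𝟙-∧ y z) (trans (*-comm (𝟙 y) (𝟙 z)) (sym (+-identityʳ _)))
          flat false y z = refl
          flat′ : ∀ u y z w → 𝟙 y * (u * (z * 𝟙 w)) ≡ u * (z * 𝟙 (y ∧ w))
          flat′ u true z w = +-identityʳ _
          flat′ u false z w = sym (trans (cong (u *_) (*-zeroʳ z)) (*-zeroʳ u))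
          at : ∀ g → g ∈ᵇ G → μ * h ≤ ∑∈ (M g) (λ e → # (λ f → M g f ∧ dis e f))
          at g p = ≤-trans (*-monoˡ-≤ h (M-large g p)) (≤-trans (≤-reflexive (sym (∑∈-const (M g) h))) (∑∈-monoʳ {S = M g} (λ e q → M-disjoint g e p q)))

        found : ∃ λ e → ∃ λ f → e ∈ᵇ U × f ∈ᵇ U × dis e f ≡ true × H′ < hits e f
        found =
          let e , e∈ , p = ∑∈-exists {S = U} {λ e → ∑∈ U (λ f → 𝟙 (dis e f) * hits e f)} (# S * H′)
                     (<-≤-trans (≤-<-trans (*-monoˡ-≤ _ (#-mono {S = U} {S} U⊆S)) H≤) total)
              f , f∈ , q = ∑∈-exists {S = U} {λ f → 𝟙 (dis e f) * hits e f} H′ (≤-<-trans (*-monoˡ-≤ H′ (#-mono {S = U} {S} U⊆S)) p)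
              ef , h = 𝟙-*-positive (dis e f) q
          in e , f , e∈ , f∈ , ef , h

      unusedIn : Pred m → Pred m
      unusedIn D e = G e ∧ not (D e)

      module Pair {j : ℕ} {D : Pred m} {col : Fin m → Fin k} (st : State j D col) (j<k : j < k) (D-few : 2 + # D ≤ u)
                  (e f : Fin m) (e∈U : e ∈ᵇ unusedIn D) (f∈U : f ∈ᵇ unusedIn D) (ef : dis e f ≡ true) where
        open State st
        U = unusedIn D
        C : Pred m
        C i = (i == e) ∨ (i == f)
        D′ = D ∪ᵇ C
        e≢f = dis-≢ {e} {f} ef
        in-C : ∀ i → i ∈ᵇ C → i ∈ᵇ U
        in-C i p with ∨-true {i == e} p
        ... | inj₁ q = subst (_∈ᵇ U) (sym (==⇒≡ q)) e∈U
        ... | inj₂ q = subst (_∈ᵇ U) (sym (==⇒≡ q)) f∈U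
        C-free : ∀ i → i ∈ᵇ C → i ∉ᵇ D
        C-free i p = not-true (proj₂ (∧-true {G i} (in-C i p)))
        C⊆G : C ⊆ᵇ G
        C⊆G i p = proj₁ (∧-true {G i} (in-C i p))
        C-ind : ∀ i i′ → i ∈ᵇ C → i′ ∈ᵇ C → adj i i′ ≡ false
        C-ind i i′ p q with ∨-true {i == e} p | ∨-true {i′ == e} q
        ... | inj₁ x | inj₁ y = subst₂ (λ x y → adj x y ≡ false) (sym (==⇒≡ x)) (sym (==⇒≡ y)) (adj-irrefl e)
        ... | inj₁ x | inj₂ y = subst₂ (λ x y → adj x y ≡ false) (sym (==⇒≡ x)) (sym (==⇒≡ y)) (dis-adj ef)
        ... | inj₂ x | inj₁ y = subst₂ (λ x y → adj x y ≡ false) (sym (==⇒≡ x)) (sym (==⇒≡ y)) (trans (adj-sym≡ f e) (dis-adj ef))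
        ... | inj₂ x | inj₂ y = subst₂ (λ x y → adj x y ≡ false) (sym (==⇒≡ x)) (sym (==⇒≡ y)) (adj-irrefl f)
        C-size : ∑∈ C size ≤ s + s
        C-size = ≤-trans (∑∈-∪-≤ (_== e) (_== f) size) (≤-trans (≤-reflexive (cong₂ _+_ (∑-≡-pick e size) (∑-≡-pick f size)))
          (+-mono-≤ (nice e (C⊆G e (∨-introˡ (==-refl e)))) (nice f (C⊆G f (∨-introʳ {f == e} (==-refl f))))))
        A = Int {k} j (j + 1)
        unused : Unused D col A
        unused i p = ≢true⇒false (λ q → <⇒≱ (colours i p) (proj₁ (Int-elim {c = col i} q)))
        extension : Extension D col C A cap
        -- A single colour and `F = 0`: a pair of total size 2s cannot fill a class when 3s ≤ cap.
        extension = extend-fresh proper A cap s 0 0 C C-free unused (λ i p → nice i (C⊆G i p))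
          (≤-trans (s≤s C-size) (≤-trans (≤-reflexive (sym (m+n∸n≡m (suc (s + s)) s)))
            (≤-trans (∸-monoˡ-≤ s (s≤s (≤-trans (≤-reflexive (thrice s)) room))) (≤-reflexive (sym (+-identityʳ _))))))
          (≤-reflexive (sym (#-Int {k} j 1 (≤-trans (≤-reflexive (+-comm j 1)) j<k))))
          (λ S′ sub i p → i , p , ≤-reflexive (∑-0 (λ i′ → cong 𝟙 (lemma S′ sub i p i′))))
          where
          lemma : ∀ S′ → S′ ⊆ᵇ C → ∀ i → i ∈ᵇ S′ → ∀ i′ → S′ i′ ∧ adj i i′ ≡ false
          lemma S′ sub i p i′ with S′ i′ in eq
          ... | false = refl
          ... | true = C-ind i i′ (sub i p) (sub i′ eq)

        module Add (E : Extension D col C A cap) (hit : H′ < ∑∈ (needy D col) (λ g → 𝟙 (adj g e ∧ adj g f))) where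
          open Extension E
          old : ∀ i → i ∈ᵇ D → col′ i ≡ col i
          old i p = agree i (≢true⇒false (λ q → true≢false p (C-free i q)))
          new : ∀ i → i ∈ᵇ C → toℕ (col′ i) ≡ j
          new i p = let x , y = Int-elim {c = col′ i} (palette i p) in ≤-antisym (s≤s⁻¹ (≤-trans y (≤-reflexive (+-comm j 1)))) x
          D′-few : # D′ ≤ 2 + # D
          D′-few = ≤-trans (#-∪-≤ D C) (≤-trans (+-monoʳ-≤ (# D) (≤-trans (#-∪-≤ (_== e) (_== f)) (+-mono-≤ (single e) (single f)))) (≤-reflexive (+-comm (# D) 2)))
            where
            single : ∀ e → # (_== e) ≤ 1
            single e = #≤1 (λ x y p q → trans (==⇒≡ p) (sym (==⇒≡ q)))
          st′ : State (suc j) D′ col′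
          st′ = record
            { inside = λ i p → [ inside i , C⊆G i ]′ (∨-true {D i} p)
            ; proper = proper′
            ; colours = λ i p → [ (λ q → subst (λ c → toℕ c < suc j) (sym (old i q)) (m<n⇒m<1+n (colours i q))) ,
                                  (λ q → s≤s (≤-reflexive (new i q))) ]′ (∨-true {D i} p)
            ; loads = λ c → [ (λ q → ≤-trans (≤-reflexive q) (loads c)) , id ]′ (load′ c)
            ; used = ≤-trans D′-few D-few }
          save : ∀ g → saving D col g + 𝟙 (adj g e ∧ adj g f) ≤ saving D′ col′ g
          save = saving-pair {e = e} {f} (λ i p → ∨-introˡ p) old (∨-introʳ {D e} (∨-introˡ (==-refl e))) (∨-introʳ {D f} (∨-introʳ {f == e} (==-refl f)))
            e≢f (toℕ-injective (trans (new e (∨-introˡ (==-refl e))) (sym (new f (∨-introʳ {f == e} (==-refl f))))))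
            (λ i p q → <⇒≢ (colours i p) (trans (cong toℕ q) (new e (∨-introˡ (==-refl e)))))
          drop : Ψ D′ col′ + suc H′ ≤ Ψ D col
          drop = ≤-trans (+-monoʳ-≤ (Ψ D′ col′) hit) (≤-trans (≤-reflexive (sym (∑-+ _ _))) (∑-mono pt))
            where
            pt : ∀ g → 𝟙 (G g) * (σ ∸ saving D′ col′ g) + 𝟙 (needy D col g) * 𝟙 (adj g e ∧ adj g f) ≤ 𝟙 (G g) * (σ ∸ saving D col g)
            pt g with G g
            ... | false = z≤n
            ... | true with saving D col g <ᵇ σ in eq
            ... | false = +-monoˡ-≤ 0 (≤-trans (≤-reflexive (+-identityʳ _)) (∸-monoʳ-≤ σ (≤-trans (m≤m+n (saving D col g) (𝟙 (adj g e ∧ adj g f))) (save g))))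
            ... | true = lemma (saving D col g) (saving D′ col′ g) (adj g e ∧ adj g f) (<ᵇ-true {saving D col g} {σ} eq) (save g)
              where
              lemma : ∀ x y b → x < σ → x + 𝟙 b ≤ y → 1 * (σ ∸ y) + 1 * 𝟙 b ≤ 1 * (σ ∸ x)
              lemma x y false _ q = ≤-trans (≤-reflexive (+-identityʳ (1 * (σ ∸ y)))) (+-monoˡ-≤ 0 (∸-monoʳ-≤ σ (≤-trans (m≤m+n x 0) q)))
              lemma x y true p q = ≤-trans (+-monoˡ-≤ 1 (≤-trans (≤-reflexive (+-identityʳ _)) (∸-monoʳ-≤ σ q)))
                (≤-reflexive (trans (+-comm (σ ∸ (x + 1)) 1) (trans (trans (cong (λ y → suc (σ ∸ y)) (+-comm x 1)) (sym (+-∸-assoc 1 p))) (sym (+-identityʳ (σ ∸ x))))))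

      round : ∀ {j D col} → State j D col → j < k → 2 + # D ≤ u → η ≤ # (needy D col) →
              ∃ λ D′ → ∃ λ col′ → State (suc j) D′ col′ × # D′ ≤ 2 + # D × Ψ D′ col′ + suc H′ ≤ Ψ D col
      round {j} {D} {col} st j<k D-few many = add (Find.found D col (≤-trans (m≤n+m _ 2) D-few) many)
        where
        add : (∃ λ e → ∃ λ f → e ∈ᵇ unusedIn D × f ∈ᵇ unusedIn D × dis e f ≡ true × H′ < ∑∈ (needy D col) (λ g → 𝟙 (adj g e ∧ adj g f))) →
              ∃ λ D′ → ∃ λ col′ → State (suc j) D′ col′ × # D′ ≤ 2 + # D × Ψ D′ col′ + suc H′ ≤ Ψ D col
        add (e , f , e∈ , f∈ , ef , hit) = D′ , Extension.col′ extension , st′ , D′-few , drop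
          where
          open Pair st j<k D-few e f e∈ f∈ ef
          open Add extension hit

      Final : ℕ → Set
      Final j = ∃ λ D′ → ∃ λ col′ → State j D′ col′ × # (needy D′ col′) < η

      weaken : ∀ {j j′ D col} → j ≤ j′ → State j D col → State j′ D col
      weaken le st = record { inside = inside ; proper = proper ; loads = loads ; used = used
                            ; colours = λ i r → <-≤-trans (colours i r) le }
        where open State st

      rounds : ∀ J {j D col} → State j D col → j + J ≤ k → # D + 2 * J ≤ u → Ψ D col ≤ J * suc H′ → Final (j + J)
      -- Without potential no edge is needy, and `1 ≤ η` makes this a strict bound.
      rounds zero {j} {D} {col} st _ _ p = D , col , weaken (m≤m+n j 0) st , ≤-trans (s≤s (≤-trans (needy≤Ψ D col) p)) 1≤η
      rounds (suc J) {j} {D} {col} st jJ DJ p with η ≤? # (needy D col)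
      ... | no q = D , col , weaken (m≤m+n j (suc J)) st , ≰⇒> q
      ... | yes q = next (round st (≤-trans (m<m+n j (s≤s z≤n)) jJ)
                     (≤-trans (≤-reflexive (+-comm 2 (# D))) (≤-trans (+-monoʳ-≤ (# D) (*-monoʳ-≤ 2 (s≤s z≤n))) DJ)) q)
        where
        next : (∃ λ D′ → ∃ λ col′ → State (suc j) D′ col′ × # D′ ≤ 2 + # D × Ψ D′ col′ + suc H′ ≤ Ψ D col) → Final (j + suc J)
        next (D′ , col′ , st′ , few′ , drop) = subst Final (sym (+-suc j J))
          (rounds J st′ (≤-trans (≤-reflexive (sym (+-suc j J))) jJ)
            (≤-trans (+-monoˡ-≤ (2 * J) few′) (≤-trans (≤-reflexive (add-pair (# D) J)) DJ))
            (psi-arith J H′ (Ψ D col) (Ψ D′ col′) (suc H′) drop p ≤-refl))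

      -- The edges outside `G` and those still needy are few enough for the colours not spent on
      -- pairs. Every other uncoloured edge has saving at least `σ`, so room counts as `k₁ + σ`
      -- colours against `Δ` neighbours; this permits `Δ` above `k₁`.
      finish : ∀ k₁ J F sb Δ → k₁ ≤ k → (∀ j → j ∈ᵇ S → size j ≤ sb) → ∑∈ S size < suc F * (suc cap ∸ sb) →
               (∀ g → g ∈ᵇ G → deg S g ≤ Δ) → J + (ν + η + F) < k₁ → Δ + F < k₁ + σ → Final J → Coloured S (Int 0 k₁) cap
      finish k₁ J F sb Δ k₁≤k small total Δ-bound room-B room-C (D , col , st , few′) = last (coloured-extend start sub-JA D∉B phase-B)
        where
        open State st
        N₀ = needy D col
        D⊆S : D ⊆ᵇ S
        D⊆S i p = G⊆S i (inside i p)
        B : Pred m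
        B i = (S i ∧ not (D i)) ∧ (not (G i) ∨ N₀ i)
        B⊆S : B ⊆ᵇ S
        B⊆S i p = proj₁ (∧-true {S i} (proj₁ (∧-true {S i ∧ not (D i)} p)))
        B∉D : ∀ i → i ∈ᵇ B → i ∉ᵇ D
        B∉D i p = not-true (proj₂ (∧-true {S i} (proj₁ (∧-true {S i ∧ not (D i)} p))))
        D∉B : ∀ i → i ∈ᵇ D → i ∉ᵇ B
        D∉B i p = ≢true⇒false (λ q → true≢false p (B∉D i q))
        B-few : # B ≤ ν + η
        B-few = ≤-trans (∑-mono pt) (≤-trans (≤-reflexive (∑-+ _ _)) (+-mono-≤ few (<⇒≤ few′)))
          where
          pt : ∀ i → 𝟙 (B i) ≤ 𝟙 (S i ∧ not (G i)) + 𝟙 (N₀ i)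
          pt i with S i | D i | G i | N₀ i
          ... | false | _ | _ | _ = z≤n
          ... | true | true | _ | _ = z≤n
          ... | true | false | false | _ = s≤s z≤n
          ... | true | false | true | true = s≤s z≤n
          ... | true | false | true | false = z≤n
        J≤k₁ : J ≤ k₁
        J≤k₁ = ≤-trans (m≤m+n J _) (<⇒≤ room-B)
        start : Coloured D (Int 0 J) cap
        start = record { col = col ; proper = proper ; palette = λ i p → Int-intro {c = col i} z≤n (colours i p) ; loads = loads }
        sub-J : Int {k} 0 J ⊆ᵇ Int 0 k₁
        sub-J c p = Int-intro {c = c} z≤n (<-≤-trans (proj₂ (Int-elim {c = c} p)) J≤k₁)
        sub-JA : Int {k} 0 J ⊆ᵇ Int 0 k₁
        sub-JA = sub-J
        A = Int {k} J k₁
        J+ : J + (k₁ ∸ J) ≡ k₁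
        J+ = m+[n∸m]≡n J≤k₁
        A-size : # A ≡ k₁ ∸ J
        A-size = trans (cong (λ e → # (Int {k} J e)) (sym J+)) (#-Int {k} J (k₁ ∸ J) (≤-trans (≤-reflexive J+) k₁≤k))
        phase-B : Extension D col B (Int 0 k₁) cap
        phase-B = widen (extend-fresh proper A cap sb F (ν + η) B B∉D
          (λ i p → ≢true⇒false (λ q → <⇒≱ (colours i p) (proj₁ (Int-elim {c = col i} q))))
          (λ i p → small i (B⊆S i p)) (≤-<-trans (∑∈-monoˡ {S = B} {S} B⊆S) total)
          (≤-trans (m+n≤o⇒m≤o∸n (suc (ν + η + F)) (≤-trans (≤-reflexive (trans (+-comm _ J) (+-suc J _))) room-B)) (≤-reflexive (sym A-size)))
          (λ S′ sub i p → i , p , ≤-trans (#-mono (λ j q → sub j (proj₁ (∧-true {S′ j} q)))) B-few))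
          where
          widen : Extension D col B A cap → Extension D col B (Int 0 k₁) cap
          widen E = record { col′ = col′ ; agree = agree ; proper′ = proper′ ; load′ = load′
            ; palette = λ i p → Int-intro {c = col′ i} z≤n (proj₂ (Int-elim {c = col′ i} (palette i p))) }
            where open Extension E
        open Extension phase-B using (col′; agree)
        R : Pred m
        R i = (S i ∧ not (D i)) ∧ not (B i)
        D₁ = D ∪ᵇ B
        R-cases : ∀ i → i ∈ᵇ R → i ∈ᵇ S × i ∉ᵇ D × i ∈ᵇ G × i ∉ᵇ N₀
        R-cases i = ∖-∖ {S i} {D i} {G i} {N₀ i}
        D₁∉R : ∀ i → i ∈ᵇ D₁ → i ∉ᵇ R
        D₁∉R i = ∨-∉-∖ {S i} {D i} {B i}
        D₁⊆S : D₁ ⊆ᵇ S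
        D₁⊆S i p = [ D⊆S i , B⊆S i ]′ (∨-true {D i} p)
        all : ∀ i → (D₁ ∪ᵇ R) i ≡ S i
        all i = lemma (S i) (D i) (B i) (D⊆S i) (B⊆S i)
          where
          lemma : ∀ s d b → (d ≡ true → s ≡ true) → (b ≡ true → s ≡ true) → (d ∨ b) ∨ ((s ∧ not d) ∧ not b) ≡ s
          lemma true true b _ _ = refl
          lemma true false true _ _ = refl
          lemma true false false _ _ = refl
          lemma false true b f _ = sym (f refl)
          lemma false false true _ g = sym (g refl)
          lemma false false false _ _ = refl
        last : Coloured D₁ (Int 0 k₁) cap → Coloured S (Int 0 k₁) cap
        last C₁ = coloured-cong all (coloured-extend C′ (λ _ p → p) D₁∉R phase-C)
          where
          C′ : Coloured D₁ (Int 0 k₁) cap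
          C′ = coloured-extend start sub-JA D∉B phase-B
          A₀ = Int {k} 0 k₁
          total-C : ∑∈ D₁ (λ i → 𝟙 (A₀ (col′ i)) * size i) + ∑∈ R size < suc F * (suc cap ∸ sb)
          total-C = ≤-<-trans (≤-trans (+-monoˡ-≤ _ (∑∈-monoʳ {S = D₁} (λ i _ → ≤-trans (*-monoˡ-≤ (size i) (𝟙≤1 (A₀ (col′ i)))) (≤-reflexive (+-identityʳ _)))))
            (≤-reflexive (trans (sym (∑∈-∪ {S = D₁} {R} size (λ i p → ≢true⇒false (λ q → true≢false p (D₁∉R i q))))) (∑-cong (λ i → cong (λ b → 𝟙 b * size i) (all i)))))) total
          room-e : ∀ S′ → S′ ⊆ᵇ R → ∀ i → i ∈ᵇ S′ → ∃ λ e → e ∈ᵇ S′ × deg S′ e + # (A₀ ∩ᵇ seen D₁ col′ e) + F < # A₀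
          room-e S′ sub e e∈ = e , e∈ , ≤-trans (s≤s (+-monoˡ-≤ F (+-monoʳ-≤ (deg S′ e) (#-mono (λ c p → proj₂ (∧-true {A₀ c} p))))))
            (≤-trans (final-arith (deg S′ e) (deg D₁ e) (# (seen D₁ col′ e)) (saving D₁ col′ e) σ Δ F k₁
                degs (≤-reflexive (seen+saving D₁ col′ e)) saved room-C) (≤-reflexive (sym (#-Int {k} 0 k₁ k₁≤k))))
            where
            e-facts = R-cases e (sub e e∈)
            saved : σ ≤ saving D₁ col′ e
            saved = ≤-trans (<ᵇ-false (lemma (G e) (proj₁ (proj₂ (proj₂ e-facts))) (proj₂ (proj₂ (proj₂ e-facts)))))
              (saving-mono {D} {D₁} {col} {col′} (λ i p → ∨-introˡ p) (λ i p → agree i (D∉B i p)) e)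
              where
              lemma : ∀ b {c} → b ≡ true → b ∧ c ≡ false → c ≡ false
              lemma true _ p = p
            degs : deg S′ e + deg D₁ e ≤ Δ
            degs = ≤-trans (≤-trans (≤-reflexive (sym (∑-+ _ _))) (∑-mono pt)) (Δ-bound e (proj₁ (proj₂ (proj₂ e-facts))))
              where
              pt : ∀ i → 𝟙 (S′ i ∧ adj e i) + 𝟙 (D₁ i ∧ adj e i) ≤ 𝟙 (S i ∧ adj e i)
              pt i with S′ i in p | D₁ i in q
              ... | false | false = z≤n
              ... | false | true rewrite D₁⊆S i q = ≤-refl
              ... | true | false rewrite proj₁ (R-cases i (sub i p)) = ≤-reflexive (+-identityʳ _)
              ... | true | true = ⊥-elim (true≢false (sub i p) (D₁∉R i q))
          phase-C : Extension D₁ col′ R A₀ cap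
          phase-C = extend (Coloured.proper C′) A₀ cap sb F R (λ i p → ≢true⇒false (λ q → true≢false p (D₁∉R i q)))
            (λ i p → small i (proj₁ (R-cases i p))) total-C room-e

-- The three cases of a core away from the square root of n

module ColouringCases where
  open FiniteSums
  open GreedyColouring
  open LinearIncidence
  open DenseSubsets
  open Extensions
  open SparseColouring
  open SavedColours
  open PolynomialIdentities using (polynomial; _:=_; _:+_; _:*_; con)
  open import Data.Bool using (Bool; true; false; _∧_; not)
  open import Data.Fin using (Fin; suc)
  open import Data.Nat using (ℕ; suc; _+_; _*_; _∸_; _^_; _≤_; _<_; z≤n; s≤s)
  open import Data.Nat.Properties
  open import Data.Nat.Tactic.RingSolver using (solve-∀)
  open import Data.Product using (_,_; proj₁; proj₂)
  open import Data.Vec using ([]; _∷_)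
  open import Relation.Binary.PropositionalEquality
  open import Data.Nat.DivMod using (_/_; m/n*n≤m; m*n/n≡m; /-monoˡ-≤)
  c1-a : ∀ p n ρ → (2 + p) * (2 + p) * n ≤ (1 + p) * (1 + p) * ((1 + ρ) * (1 + ρ)) → 4 * (1 + p) ≤ ρ → 2 ≤ p → (2 + p) * (2 + p) * ((1 + p) * n) ≤ (2 + p) * (2 + p) * (p * ((1 + ρ) * ρ))
  c1-a p n ρ h1 h2 h3 = farkas 191 (+-mono-≤ (+-mono-≤ (+-mono-≤ (*-monoʳ-≤ (192 + 192 * p) h1) (*-monoʳ-≤ (48 + 96 * p + 48 * p * p + 96 * p * ρ + 49 * p * p * ρ) h2)) (*-monoʳ-≤ (600 * ρ + 540 * p * ρ + 4 * p * p * ρ) h3)) (*-monoʳ-≤ (96 * ρ) (≤-prod h2 h3)))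
    (polynomial (p ∷ n ∷ ρ ∷ []) (λ p n ρ → con 192 :* ((con 2 :+ p) :* (con 2 :+ p) :* ((con 1 :+ p) :* n)) :+ ((con 192 :+ con 192 :* p) :* ((con 1 :+ p) :* (con 1 :+ p) :* ((con 1 :+ ρ) :* (con 1 :+ ρ))) :+ (con 48 :+ con 96 :* p :+ con 48 :* p :* p :+ con 96 :* p :* ρ :+ con 49 :* p :* p :* ρ) :* ρ :+ (con 600 :* ρ :+ con 540 :* p :* ρ :+ con 4 :* p :* p :* ρ) :* p :+ (con 96 :* ρ) :* (ρ :* p :+ (con 4 :* (con 1 :+ p)) :* con 2)) :+ (con 143 :* p :* p :* ρ :* ρ) := con 192 :* ((con 2 :+ p) :* (con 2 :+ p) :* (p :* ((con 1 :+ ρ) :* ρ))) :+ ((con 192 :+ con 192 :* p) :* ((con 2 :+ p) :* (con 2 :+ p) :* n) :+ (con 48 :+ con 96 :* p :+ con 48 :* p :* p :+ con 96 :* p :* ρ :+ con 49 :* p :* p :* ρ) :* (con 4 :* (con 1 :+ p)) :+ (con 600 :* ρ :+ con 540 :* p :* ρ :+ con 4 :* p :* p :* ρ) :* con 2 :+ (con 96 :* ρ) :* ((con 4 :* (con 1 :+ p)) :* p :+ ρ :* con 2))) refl)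

  c1-b : ∀ p n R N → (1 + p) * n ≤ p * R → N * R ≤ n * n → R * ((1 + p) * N + n) ≤ R * ((1 + p) * n)
  c1-b p n R N h1 h2 = farkas 0 (+-mono-≤ (*-monoʳ-≤ n h1) (*-monoʳ-≤ (1 + p) h2))
    (polynomial (p ∷ n ∷ R ∷ N ∷ []) (λ p n R N → con 1 :* (R :* ((con 1 :+ p) :* N :+ n)) :+ (n :* (p :* R) :+ (con 1 :+ p) :* (n :* n)) :+ con 0 := con 1 :* (R :* ((con 1 :+ p) :* n)) :+ (n :* ((con 1 :+ p) :* n) :+ (con 1 :+ p) :* (N :* R))) refl)

  sp-c1 : ∀ LP n s ρ → LP ≤ ρ → LP * s ≤ n → LP * (n + s * ρ) ≤ 2 * (2 * n) * ρ
  sp-c1 LP n s ρ h1 h2 = farkas 0 (+-mono-≤ (*-monoʳ-≤ n h1) (*-monoʳ-≤ ρ h2))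
    (polynomial (LP ∷ n ∷ s ∷ ρ ∷ []) (λ LP n s ρ → con 1 :* (LP :* (n :+ s :* ρ)) :+ (n :* ρ :+ ρ :* n) :+ (con 2 :* n :* ρ) := con 1 :* (con 2 :* (con 2 :* n) :* ρ) :+ (n :* LP :+ ρ :* (LP :* s))) refl)

  cnt-mid : ∀ N ρ n A → N * ((1 + ρ) * ρ) ≤ n * n → n ≤ A * ((1 + ρ) * (1 + ρ)) → 1 ≤ ρ → (1 + ρ) * ρ * N ≤ (1 + ρ) * ρ * (2 * A * n)
  cnt-mid N ρ n A h1 h2 h3 = farkas 0 (+-mono-≤ (+-mono-≤ h1 (*-monoʳ-≤ n h2)) (*-monoʳ-≤ (A * n + A * n * ρ) h3))
    (polynomial (N ∷ ρ ∷ n ∷ A ∷ []) (λ N ρ n A → con 1 :* ((con 1 :+ ρ) :* ρ :* N) :+ ((n :* n) :+ n :* (A :* ((con 1 :+ ρ) :* (con 1 :+ ρ))) :+ (A :* n :+ A :* n :* ρ) :* ρ) :+ con 0 := con 1 :* ((con 1 :+ ρ) :* ρ :* (con 2 :* A :* n)) :+ ((N :* ((con 1 :+ ρ) :* ρ)) :+ n :* n :+ (A :* n :+ A :* n :* ρ) :* con 1)) refl)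

  -- With `kap-b` to `kap-d` this bounds common neighbours: s² ≤ (1 + 1/z)²(p/(1 + p))²n, and n/ρ +
  -- s² ≤ n - 8v once z and ρ are large against p.
  kap-a : ∀ p n z R S → (1 + p) * (1 + p) * R ≤ p * p * n → z * z * S ≤ (z + 1) * (z + 1) * R → z * z * ((1 + p) * (1 + p)) * S ≤ (z + 1) * (z + 1) * (p * p) * n
  kap-a p n z R S h1 h2 = farkas 0 (+-mono-≤ (*-monoʳ-≤ (1 + 2 * z + z * z) h1) (*-monoʳ-≤ (1 + 2 * p + p * p) h2))
    (polynomial (p ∷ n ∷ z ∷ R ∷ S ∷ []) (λ p n z R S → con 1 :* (z :* z :* ((con 1 :+ p) :* (con 1 :+ p)) :* S) :+ ((con 1 :+ con 2 :* z :+ z :* z) :* (p :* p :* n) :+ (con 1 :+ con 2 :* p :+ p :* p) :* ((z :+ con 1) :* (z :+ con 1) :* R)) :+ con 0 := con 1 :* ((z :+ con 1) :* (z :+ con 1) :* (p :* p) :* n) :+ ((con 1 :+ con 2 :* z :+ z :* z) :* ((con 1 :+ p) :* (con 1 :+ p) :* R) :+ (con 1 :+ con 2 :* p :+ p :* p) :* (z :* z :* S))) refl)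

  kap-b : ∀ p n z → 6 * (1 + p) ≤ z → 8 * ((z + 1) * (z + 1) * (p * p) * n) + 3 * (z * z * (1 + p) * n) ≤ 8 * (z * z * ((1 + p) * (1 + p)) * n)
  kap-b p n z h1 = farkas 2 (*-monoʳ-≤ (4 * n * p + 8 * n * p * z) h1)
    (polynomial (p ∷ n ∷ z ∷ []) (λ p n z → con 3 :* (con 8 :* ((z :+ con 1) :* (z :+ con 1) :* (p :* p) :* n) :+ con 3 :* (z :* z :* (con 1 :+ p) :* n)) :+ ((con 4 :* n :* p :+ con 8 :* n :* p :* z) :* z) :+ (con 24 :* n :* p :+ con 44 :* n :* p :* z :+ con 15 :* n :* z :* z :+ con 31 :* n :* p :* z :* z) := con 3 :* (con 8 :* (z :* z :* ((con 1 :+ p) :* (con 1 :+ p)) :* n)) :+ ((con 4 :* n :* p :+ con 8 :* n :* p :* z) :* (con 6 :* (con 1 :+ p)))) refl)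

  kap-c : ∀ p n z ρ v S → z * z * ((1 + p) * (1 + p)) * S ≤ (z + 1) * (z + 1) * (p * p) * n → 8 * ((z + 1) * (z + 1) * (p * p) * n) + 3 * (z * z * (1 + p) * n) ≤ 8 * (z * z * ((1 + p) * (1 + p)) * n) → 32 * (1 + p) * v ≤ n → 8 * (1 + p) ≤ ρ → z * z * ((1 + p) * (1 + p)) * (n + S * ρ + 8 * v * ρ) ≤ z * z * ((1 + p) * (1 + p)) * (n * ρ)
  kap-c p n z ρ v S h1 h2 h3 h4 = farkas 7 (+-mono-≤ (+-mono-≤ (+-mono-≤ (*-monoʳ-≤ (8 * ρ) h1) (*-monoʳ-≤ ρ h2)) (*-monoʳ-≤ (2 * z * z * ρ + 2 * p * z * z * ρ) h3)) (*-monoʳ-≤ (n * z * z + n * p * z * z) h4))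
    (polynomial (p ∷ n ∷ z ∷ ρ ∷ v ∷ S ∷ []) (λ p n z ρ v S → con 8 :* (z :* z :* ((con 1 :+ p) :* (con 1 :+ p)) :* (n :+ S :* ρ :+ con 8 :* v :* ρ)) :+ ((con 8 :* ρ) :* ((z :+ con 1) :* (z :+ con 1) :* (p :* p) :* n) :+ ρ :* (con 8 :* (z :* z :* ((con 1 :+ p) :* (con 1 :+ p)) :* n)) :+ (con 2 :* z :* z :* ρ :+ con 2 :* p :* z :* z :* ρ) :* n :+ (n :* z :* z :+ n :* p :* z :* z) :* ρ) :+ con 0 := con 8 :* (z :* z :* ((con 1 :+ p) :* (con 1 :+ p)) :* (n :* ρ)) :+ ((con 8 :* ρ) :* (z :* z :* ((con 1 :+ p) :* (con 1 :+ p)) :* S) :+ ρ :* (con 8 :* ((z :+ con 1) :* (z :+ con 1) :* (p :* p) :* n) :+ con 3 :* (z :* z :* (con 1 :+ p) :* n)) :+ (con 2 :* z :* z :* ρ :+ con 2 :* p :* z :* z :* ρ) :* (con 32 :* (con 1 :+ p) :* v) :+ (n :* z :* z :+ n :* p :* z :* z) :* (con 8 :* (con 1 :+ p)))) refl)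

  ps : ∀ G σ C n v V → G ≤ C * n → n ≤ 2 * V * v → G * σ ≤ v * (2 * C * V * σ)
  ps G σ C n v V h1 h2 = farkas 0 (+-mono-≤ (*-monoʳ-≤ σ h1) (*-monoʳ-≤ (C * σ) h2))
    (polynomial (G ∷ σ ∷ C ∷ n ∷ v ∷ V ∷ []) (λ G σ C n v V → con 1 :* (G :* σ) :+ (σ :* (C :* n) :+ (C :* σ) :* (con 2 :* V :* v)) :+ con 0 := con 1 :* (v :* (con 2 :* C :* V :* σ)) :+ (σ :* G :+ (C :* σ) :* n)) refl)

  hle : ∀ C n N v e V → N ≤ C * n → n ≤ 2 * V * v → N * (N * e) ≤ C * C * n * (2 * V * v) * e
  hle C n N v e V h1 h2 = farkas 0 (+-mono-≤ (*-monoʳ-≤ (N * e + C * e * n) h1) (*-monoʳ-≤ (C * C * e * n) h2))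
    (polynomial (C ∷ n ∷ N ∷ v ∷ e ∷ V ∷ []) (λ C n N v e V → con 1 :* (N :* (N :* e)) :+ ((N :* e :+ C :* e :* n) :* (C :* n) :+ (C :* C :* e :* n) :* (con 2 :* V :* v)) :+ con 0 := con 1 :* (C :* C :* n :* (con 2 :* V :* v) :* e) :+ ((N :* e :+ C :* e :* n) :* N :+ (C :* C :* e :* n) :* n)) refl)

  dl : ∀ dg ρ s n z ε M → dg * ρ ≤ s * n → z * s ≤ (z + 1) * (1 + ρ) → n ≤ 2 * M * ε → 8 * M ≤ z → 16 * M ≤ ρ → 1 ≤ z → z * ρ * (2 * dg) ≤ z * ρ * (2 * n + ε)
  dl dg ρ s n z ε M h1 h2 h3 h4 h5 h6 = farkas 3 (+-mono-≤ (+-mono-≤ (+-mono-≤ (+-mono-≤ (+-mono-≤ (*-monoʳ-≤ (8 * z) h1) (*-monoʳ-≤ (8 * n) h2)) (*-monoʳ-≤ (8 + 8 * z + 8 * ρ) h3)) (*-monoʳ-≤ (2 * ε * ρ) h4)) (*-monoʳ-≤ (ε + z * ε) h5)) (*-monoʳ-≤ (ε * ρ) h6))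
    (polynomial (dg ∷ ρ ∷ s ∷ n ∷ z ∷ ε ∷ M ∷ []) (λ dg ρ s n z ε M → con 4 :* (z :* ρ :* (con 2 :* dg)) :+ ((con 8 :* z) :* (s :* n) :+ (con 8 :* n) :* ((z :+ con 1) :* (con 1 :+ ρ)) :+ (con 8 :+ con 8 :* z :+ con 8 :* ρ) :* (con 2 :* M :* ε) :+ (con 2 :* ε :* ρ) :* z :+ (ε :+ z :* ε) :* ρ :+ (ε :* ρ) :* z) :+ con 0 := con 4 :* (z :* ρ :* (con 2 :* n :+ ε)) :+ ((con 8 :* z) :* (dg :* ρ) :+ (con 8 :* n) :* (z :* s) :+ (con 8 :+ con 8 :* z :+ con 8 :* ρ) :* n :+ (con 2 :* ε :* ρ) :* (con 8 :* M) :+ (ε :+ z :* ε) :* (con 16 :* M) :+ (ε :* ρ) :* con 1)) refl)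

  tot : ∀ T u Y B → 2 * T ≤ u * B → B ≤ 2 * Y → 1 ≤ Y → T < (1 + u) * Y
  tot T u Y B h1 h2 h3 = farkas 1 (+-mono-≤ (+-mono-≤ h1 (*-monoʳ-≤ u h2)) (*-monoʳ-≤ 2 h3))
    (polynomial (T ∷ u ∷ Y ∷ B ∷ []) (λ T u Y B → con 2 :* (con 1 :+ T) :+ ((u :* B) :+ u :* (con 2 :* Y) :+ con 2 :* Y) :+ con 0 := con 2 :* ((con 1 :+ u) :* Y) :+ ((con 2 :* T) :+ u :* B :+ con 2 :* con 1)) refl)

  c2-room : ∀ n y u → 64 * y ≤ n → u ≤ y → 1 ≤ y → 8 * y + u + 1 + (4 * y + 32 * u) ≤ n
  c2-room n y u h1 h2 h3 = farkas 31 (+-mono-≤ (+-mono-≤ (*-monoʳ-≤ 23 h1) (*-monoʳ-≤ 1056 h2)) (*-monoʳ-≤ 32 h3))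
    (polynomial (n ∷ y ∷ u ∷ []) (λ n y u → con 32 :* (con 8 :* y :+ u :+ con 1 :+ (con 4 :* y :+ con 32 :* u)) :+ (con 23 :* n :+ con 1056 :* y :+ con 32 :* y) :+ (con 9 :* n) := con 32 :* n :+ (con 23 :* (con 64 :* y) :+ con 1056 :* u :+ con 32 :* con 1)) refl)

  mid-few : ∀ Y N R vl n A V v → Y * vl ≤ 4 * (n * n) → N * R ≤ vl → n ≤ 2 * A * R → n ≤ 2 * V * v → 16 * A * V ≤ Y → 1 ≤ n → n * (16 * A * V * N) ≤ n * (16 * A * V * v)
  mid-few Y N R vl n A V v h1 h2 h3 h4 h5 h6 = farkas 0 (+-mono-≤ (+-mono-≤ (+-mono-≤ (+-mono-≤ (*-monoʳ-≤ (2 * A) h1) (*-monoʳ-≤ (32 * A * A * V) h2)) (*-monoʳ-≤ (16 * A * N * V) h3)) (*-monoʳ-≤ (8 * A * n) h4)) (*-monoʳ-≤ (2 * A * vl) h5))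
    (polynomial (Y ∷ N ∷ R ∷ vl ∷ n ∷ A ∷ V ∷ v ∷ []) (λ Y N R vl n A V v → con 1 :* (n :* (con 16 :* A :* V :* N)) :+ ((con 2 :* A) :* (con 4 :* (n :* n)) :+ (con 32 :* A :* A :* V) :* vl :+ (con 16 :* A :* N :* V) :* (con 2 :* A :* R) :+ (con 8 :* A :* n) :* (con 2 :* V :* v) :+ (con 2 :* A :* vl) :* Y) :+ con 0 := con 1 :* (n :* (con 16 :* A :* V :* v)) :+ ((con 2 :* A) :* (Y :* vl) :+ (con 32 :* A :* A :* V) :* (N :* R) :+ (con 16 :* A :* N :* V) :* n :+ (con 8 :* A :* n) :* n :+ (con 2 :* A :* vl) :* (con 16 :* A :* V))) refl)

  r-half : ∀ n A ρ → n ≤ A * ((1 + ρ) * (1 + ρ)) → 1 ≤ ρ → n ≤ 2 * A * ((1 + ρ) * ρ)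
  r-half n A ρ h1 h2 = farkas 0 (+-mono-≤ h1 (*-monoʳ-≤ (A + A * ρ) h2))
    (polynomial (n ∷ A ∷ ρ ∷ []) (λ n A ρ → con 1 :* n :+ ((A :* ((con 1 :+ ρ) :* (con 1 :+ ρ))) :+ (A :+ A :* ρ) :* ρ) :+ con 0 := con 1 :* (con 2 :* A :* ((con 1 :+ ρ) :* ρ)) :+ (n :+ (A :+ A :* ρ) :* con 1)) refl)

  mu-le : ∀ μ v D u n → μ + 4 * v ≤ n → n ≤ D + 64 * u → 64 * u ≤ v → μ + v + 2 * v ≤ D
  mu-le μ v D u n h1 h2 h3 = farkas 0 (+-mono-≤ (+-mono-≤ h1 h2) h3)
    (polynomial (μ ∷ v ∷ D ∷ u ∷ n ∷ []) (λ μ v D u n → con 1 :* (μ :+ v :+ con 2 :* v) :+ (n :+ (D :+ con 64 :* u) :+ v) :+ con 0 := con 1 :* D :+ ((μ :+ con 4 :* v) :+ n :+ (con 64 :* u))) refl)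

  h-le : ∀ κ μ v n → κ + 8 * v ≤ n → n ≤ μ + 4 * v → 1 ≤ v → 2 * v + κ + 1 ≤ μ
  h-le κ μ v n h1 h2 h3 = farkas 0 (+-mono-≤ (+-mono-≤ h1 h2) (*-monoʳ-≤ 2 h3))
    (polynomial (κ ∷ μ ∷ v ∷ n ∷ []) (λ κ μ v n → con 1 :* (con 2 :* v :+ κ :+ con 1) :+ (n :+ (μ :+ con 4 :* v) :+ con 2 :* v) :+ con 1 := con 1 :* μ :+ ((κ :+ con 8 :* v) :+ n :+ con 2 :* con 1)) refl)

  kap-d : ∀ n S ρ v κ → n + S * ρ + 8 * v * ρ ≤ n * ρ → n ≤ κ + 8 * v → n + S * ρ ≤ κ * ρ
  kap-d n S ρ v κ h1 h2 = farkas 0 (+-mono-≤ h1 (*-monoʳ-≤ ρ h2))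
    (polynomial (n ∷ S ∷ ρ ∷ v ∷ κ ∷ []) (λ n S ρ v κ → con 1 :* (n :+ S :* ρ) :+ ((n :* ρ) :+ ρ :* (κ :+ con 8 :* v)) :+ con 0 := con 1 :* (κ :* ρ) :+ ((n :+ S :* ρ :+ con 8 :* v :* ρ) :+ ρ :* n)) refl)

  hle2 : ∀ Q n V v C e μ → Q ≤ C * C * n * (2 * V * v) * e → (1 + 2 * C * C * V) * e ≤ v → 1 ≤ e → 1 ≤ n → 1 ≤ v → n ≤ 2 * μ → Q < v * (μ * (2 * v))
  hle2 Q n V v C e μ h1 h2 h3 h4 h5 h6 = farkas 0 (+-mono-≤ (+-mono-≤ (+-mono-≤ (+-mono-≤ h1 (*-monoʳ-≤ (n + n * v) h2)) (*-monoʳ-≤ (n + n * v) h3)) h4) (*-monoʳ-≤ (v * v) h6))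
    (polynomial (Q ∷ n ∷ V ∷ v ∷ C ∷ e ∷ μ ∷ []) (λ Q n V v C e μ → con 1 :* (con 1 :+ Q) :+ ((C :* C :* n :* (con 2 :* V :* v) :* e) :+ (n :+ n :* v) :* v :+ (n :+ n :* v) :* e :+ n :+ (v :* v) :* (con 2 :* μ)) :+ (con 2 :* C :* C :* V :* e :* n) := con 1 :* (v :* (μ :* (con 2 :* v))) :+ (Q :+ (n :+ n :* v) :* ((con 1 :+ con 2 :* C :* C :* V) :* e) :+ (n :+ n :* v) :* con 1 :+ con 1 :+ (v :* v) :* n)) refl)

  mu-half : ∀ μ v n → n ≤ μ + 4 * v → 8 * v ≤ n → n ≤ 2 * μ
  mu-half μ v n h1 h2 = farkas 0 (+-mono-≤ (*-monoʳ-≤ 2 h1) h2)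
    (polynomial (μ ∷ v ∷ n ∷ []) (λ μ v n → con 1 :* n :+ (con 2 :* (μ :+ con 4 :* v) :+ n) :+ con 0 := con 1 :* (con 2 :* μ) :+ (con 2 :* n :+ (con 8 :* v))) refl)

  dl2 : ∀ dg n ε u d → 2 * dg ≤ 2 * n + ε → 68 * u ≤ ε → d + 34 * u ≤ n + ε → n + ε ≤ d + 34 * u → dg ≤ d
  dl2 dg n ε u d h1 h2 h3 h4 = farkas 1 (+-mono-≤ (+-mono-≤ h1 h2) (*-monoʳ-≤ 2 h4))
    (polynomial (dg ∷ n ∷ ε ∷ u ∷ d ∷ []) (λ dg n ε u d → con 2 :* dg :+ ((con 2 :* n :+ ε) :+ ε :+ con 2 :* (d :+ con 34 :* u)) :+ con 0 := con 2 :* d :+ ((con 2 :* dg) :+ (con 68 :* u) :+ con 2 :* (n :+ ε))) refl)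

  fin-room : ∀ k₁ n u v → n ≤ k₁ + 32 * u → 64 * u ≤ v → 8 * v ≤ n → 1 ≤ v → v + (v + v + u) < k₁
  fin-room k₁ n u v h1 h2 h3 h4 = farkas 479 (+-mono-≤ (+-mono-≤ (+-mono-≤ (*-monoʳ-≤ 257 h1) (*-monoʳ-≤ 136 h2)) (*-monoʳ-≤ 257 h3)) (*-monoʳ-≤ 480 h4))
    (polynomial (k₁ ∷ n ∷ u ∷ v ∷ []) (λ k₁ n u v → con 480 :* (con 1 :+ (v :+ (v :+ v :+ u))) :+ (con 257 :* (k₁ :+ con 32 :* u) :+ con 136 :* v :+ con 257 :* n :+ con 480 :* v) :+ (con 223 :* k₁) := con 480 :* k₁ :+ (con 257 :* n :+ con 136 :* (con 64 :* u) :+ con 257 :* (con 8 :* v) :+ con 480 :* con 1)) refl)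

  fin-C : ∀ d u n ε k₁ → d + 34 * u ≤ n + ε → n ≤ k₁ + 32 * u → 1 ≤ u → d + u < k₁ + ε
  fin-C d u n ε k₁ h1 h2 h3 = farkas 0 (+-mono-≤ (+-mono-≤ h1 h2) h3)
    (polynomial (d ∷ u ∷ n ∷ ε ∷ k₁ ∷ []) (λ d u n ε k₁ → con 1 :* (con 1 :+ (d :+ u)) :+ ((n :+ ε) :+ (k₁ :+ con 32 :* u) :+ u) :+ con 0 := con 1 :* (k₁ :+ ε) :+ ((d :+ con 34 :* u) :+ n :+ con 1)) refl)

  three-s : ∀ z s r B → z * s ≤ (z + 1) * r → 3 ≤ z → 4 * r ≤ B → z * (3 * s) ≤ z * B
  three-s z s r B h1 h2 h3 = farkas 0 (+-mono-≤ (+-mono-≤ (*-monoʳ-≤ 3 h1) (*-monoʳ-≤ r h2)) (*-monoʳ-≤ z h3))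
    (polynomial (z ∷ s ∷ r ∷ B ∷ []) (λ z s r B → con 1 :* (z :* (con 3 :* s)) :+ (con 3 :* ((z :+ con 1) :* r) :+ r :* z :+ z :* B) :+ con 0 := con 1 :* (z :* B) :+ (con 3 :* (z :* s) :+ r :* con 3 :+ z :* (con 4 :* r))) refl)

  v-small : ∀ p v n → 32 * (1 + p) * v ≤ n → 8 * v ≤ n
  v-small p v n h1 = farkas 3 h1
    (polynomial (p ∷ v ∷ n ∷ []) (λ p v n → con 4 :* (con 8 :* v) :+ (n) :+ (con 3 :* n :+ con 32 :* p :* v) := con 4 :* n :+ ((con 32 :* (con 1 :+ p) :* v))) refl)

  -- Chosen so that, when n ≤ Gy, y rounds of gain L with threshold K = 1 + 4G² would collect more
  -- than the whole volume: yL > 32Kn.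
  gain : ℕ → ℕ
  gain G = suc (32 * (1 + 4 * G * G) * G)

  opaque
    -- The factor L · 2^(2L) required by `matching`. It is opaque because `Λ 128` serves as a
    -- constant and must not be evaluated.
    Λ : ℕ → ℕ
    Λ G = gain G * 2 ^ (gain G + gain G)

    Λ-spec : ∀ G → Λ G ≡ gain G * 2 ^ (gain G + gain G)
    Λ-spec G = refl

    2G≤Λ : ∀ G → 2 * G ≤ Λ G
    2G≤Λ G = ≤-trans (*-monoˡ-≤ G (≤-trans (s≤s (s≤s z≤n)) (*-monoʳ-≤ 32 (s≤s {n = 4 * G * G} z≤n))))
      (≤-trans (n≤1+n _) (≤-trans (≤-reflexive (sym (*-identityʳ (gain G)))) (*-monoʳ-≤ (gain G) (m^n>0 2 (gain G + gain G)))))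

  double-suc : ∀ y → suc (y + suc y) ≡ 2 * suc y
  double-suc = solve-∀

  two-halves : ∀ y Y → y * Y + y * Y ≡ 2 * y * Y
  two-halves = solve-∀

  move-factor : ∀ K G y → 32 * K * (G * y) ≡ y * (32 * K * G)
  move-factor = solve-∀

  33-units : ∀ x u → x + u + 32 * u ≡ x + 33 * u
  33-units = solve-∀

  z-split : ∀ z r → (z + z) * r ≡ z * (r + r)
  z-split = solve-∀

  palette-sum : ∀ y u → 8 * y + u + 1 + (2 * y + 2 * y) + 32 * u ≡ 8 * y + u + 1 + (4 * y + 32 * u)
  palette-sum = solve-∀

  2-inside : ∀ y x → y * (2 * x) ≡ 2 * (y * x)
  2-inside = solve-∀

  square-* : ∀ z s → z * z * (s * s) ≡ z * s * (z * s)
  square-* = solve-∀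

  module Cases {n m k : ℕ} (a : Fin m → Fin n → Bool)
    (lin : ∀ i j → i ≢ j → ∀ u v → u ∈ᵇ a i → u ∈ᵇ a j → v ∈ᵇ a i → v ∈ᵇ a j → u ≡ v) where

    open Sparse {n} {m} {k} a lin public
    open Savings {n} {m} {k} a lin public

    -- Of the 4y colours, 2y serve y rounds of matchings: y for their total size and y for rounding.
    -- The other 2y suffice for the light remainder, with fewer than y neighbours and at most y full
    -- colours.
    sparse : ∀ G {D col} b y ρ s cap Q → 1 ≤ G → 1 ≤ y → n ≤ G * y → 1 ≤ n → 1 ≤ ρ → Λ G ≤ ρ → Λ G ≤ n → Λ G * (s * s) ≤ n → s ≤ cap →
             Proper D col → (∀ i → i ∈ᵇ Q → i ∉ᵇ D) → (∀ j → j ∈ᵇ Q → suc ρ ≤ size j) → (∀ j → j ∈ᵇ Q → size j ≤ s) →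
             b + (2 * y + 2 * y) ≤ k → Unused D col (Int b (b + (2 * y + 2 * y))) → ∑∈ Q size ≤ y * (suc cap ∸ s) →
             Extension D col Q (Int b (b + (2 * y + 2 * y))) cap
    sparse G b (suc y) ρ s cap Q 1≤G _ n≤ 1≤n 1≤ρ Λ≤ρ Λ≤n Λs s≤cap pr disj low high room un total =
      sparse-colouring G (suc y) y (suc y) (2 * suc y) b (2 * suc y) Q refl 1≤G (≤-trans (2G≤Λ G) Λ≤ρ) rounds pr disj low high room un
        (≤-trans (+-monoʳ-≤ (suc y * suc Y′) total′) (≤-reflexive (two-halves (suc y) (suc Y′))))
        n≤ (≤-reflexive (double-suc y))
        (≤-trans (s≤s total′) (+-monoˡ-≤ (suc y * suc Y′) (s≤s z≤n)))
      where
      L = gain G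
      Y′ = cap ∸ s
      LP≤ : ∀ {x} → Λ G ≤ x → L * 2 ^ (L + L) ≤ x
      LP≤ = subst (_≤ _) (Λ-spec G)
      total′ : ∑∈ Q size ≤ suc y * suc Y′
      total′ = subst (λ z → ∑∈ Q size ≤ suc y * z) (+-∸-assoc 1 s≤cap) total
      rounds : 32 * (1 + 4 * G * G) * n < suc y * L
      rounds = ≤-<-trans (*-monoʳ-≤ (32 * (1 + 4 * G * G)) n≤) (≤-trans (s≤s (≤-reflexive (move-factor (1 + 4 * G * G) G (suc y))))
        (≤-trans (m<n+m (suc y * (32 * (1 + 4 * G * G) * G)) {suc y} (s≤s z≤n)) (≤-reflexive (sym (*-suc (suc y) _)))))
      open Iterate (rounds-of L ρ s (1 + 4 * G * G) cap Y′ (s≤s z≤n) 1≤ρ 1≤n (+-∸-assoc 1 s≤cap)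
        (sp-c1 (L * 2 ^ (L + L)) n (s * s) ρ (LP≤ Λ≤ρ) (subst (λ x → x * (s * s) ≤ n) (Λ-spec G) Λs))
        (LP≤ (≤-trans Λ≤n (≤-trans (m≤m+n n _) (m≤m+n (2 * n) _)))))

    widen : ∀ {D col S A B cap} → A ⊆ᵇ B → Extension D col S A cap → Extension D col S B cap
    widen sub E = record { col′ = col′ ; agree = agree ; proper′ = proper′ ; load′ = load′ ; palette = λ i p → sub (col′ i) (palette i p) }
      where open Extension E

    coloured-∅ : ∀ (c₀ : Fin k) A cap → Coloured (λ _ → false) A cap
    coloured-∅ c₀ A cap = record { col = λ _ → c₀ ; proper = λ _ _ () ; palette = λ _ ()
      ; loads = λ c → ≤-trans (≤-reflexive (∑-0 (λ i → refl))) z≤n }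

    record StuckData : Set where
      constructor stuck-data
      field
        k₁ u Bf sb : ℕ
        c₀ : Fin k
        k₁≤k : k₁ ≤ k
        k₁-eq : k₁ + 32 * u ≡ n
        S : Pred m
        ρ : ℕ
        e₀ : Fin m
        e₀∈ : e₀ ∈ᵇ S
        e₀-min : ∀ j → j ∈ᵇ S → suc ρ ≤ size j
        S-small : ∀ j → j ∈ᵇ S → size j ≤ sb
        sb-cap : Bf ≤ 2 * (suc Bf ∸ sb)
        sb≤Bf : sb ≤ Bf
        S-total : 2 * ∑∈ S size ≤ u * Bf
        1≤ρ : 1 ≤ ρ

    module Stuck (P : StuckData) where
      open StuckData P

      A₁ = Int {k} 0 k₁

      few-total : ∀ s → s ≤ sb → ∑∈ S size < suc u * (suc Bf ∸ s)
      few-total s s≤ = <-≤-trans (tot (∑∈ S size) u (suc Bf ∸ sb) Bf S-total sb-cap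
          (≤-trans (s≤s z≤n) (≤-reflexive (sym (+-∸-assoc 1 sb≤Bf))))) (*-monoʳ-≤ (suc u) (∸-monoʳ-≤ (suc Bf) s≤))

      count-ρ : # S * ((1 + ρ) * ρ) ≤ n * n
      count-ρ = ≤-trans (≤-reflexive (sym (∑∈-const S ((1 + ρ) * ρ)))) (≤-trans (∑∈-monoʳ {S = S} (λ j p →
        *-mono-≤ (e₀-min j p) (∸-monoˡ-≤ 1 (e₀-min j p)))) (vol≤n² S))

      ∅ : Pred m
      ∅ _ = false

      S∪∅ : ∀ {A cap} → Coloured (∅ ∪ᵇ S) A cap → Coloured S A cap
      S∪∅ = coloured-cong (λ _ → refl)

      -- From r ≥ (1 + 1/(1 + p))√n one gets r(r - 1) ≥ (1 + 1/p)n, so there are at most (1 - 1/(1 +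
      -- p))n edges. Bounding every degree by their number leaves room even for `u` full colours.
      case-long : ∀ p → 2 ≤ p → 4 * (1 + p) ≤ ρ → (2 + p) * (2 + p) * n ≤ (1 + p) * (1 + p) * ((1 + ρ) * (1 + ρ)) →
                  (1 + p) * (33 * u) < n → Coloured S A₁ Bf
      case-long p 2≤p ρ-big long u-small = S∪∅ (coloured-extend (coloured-∅ c₀ A₁ Bf) (λ _ q → q) (λ _ ())
        (extend-fresh (λ _ _ ()) A₁ Bf sb u (# S) S (λ _ _ → refl) (λ _ ()) S-small (few-total sb ≤-refl) room
          (λ S′ sub i p → i , p , #-mono (λ j q → sub j (proj₁ (∧-true {S′ j} q))))))
        where
        step : (1 + p) * n ≤ p * ((1 + ρ) * ρ)
        step = *-cancelˡ-≤ ((2 + p) * (2 + p)) (c1-a p n ρ long ρ-big 2≤p)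
        bound : (1 + p) * # S + n ≤ (1 + p) * n
        bound = *-cancelˡ-≤ ((1 + ρ) * ρ) ⦃ Data.Nat.>-nonZero (*-mono-≤ (s≤s (z≤n {ρ})) 1≤ρ) ⦄ (c1-b p n ((1 + ρ) * ρ) (# S) step count-ρ)
        strict : # S + 33 * u < n
        strict = *-cancelˡ-< (1 + p) _ _ (<-≤-trans (≤-<-trans (≤-reflexive (*-distribˡ-+ (1 + p) (# S) (33 * u))) (+-monoʳ-< ((1 + p) * # S) u-small)) bound)
        room : # S + u < # A₁
        room = ≤-trans (+-cancelʳ-≤ (32 * u) _ _ (≤-trans (s≤s (≤-reflexive (33-units (# S) u))) (≤-trans strict (≤-reflexive (sym k₁-eq)))))
                 (≤-reflexive (sym (#-Int {k} 0 k₁ k₁≤k)))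

      short-size : ∀ z j → j ∈ᵇ S ∖ᵇ Long z (suc ρ) → z * size j ≤ (z + 1) * suc ρ
      short-size z j p = Long-false z (suc ρ) j (not-true (proj₂ (∧-true {S j} p)))

      -- The edges of nearly minimal size have size at most 2r and fall under `sparse`, with 4y ≤
      -- n/16 colours. The longer ones have volume below n²/1024, so they are degenerate at K = 16,
      -- with degrees at most 8y.
      case-short : ∀ z y → 1 ≤ z → 1 ≤ y → 64 * y ≤ n → n ≤ 128 * y → u ≤ y → Λ 128 ≤ ρ → Λ 128 ≤ n →
                   Λ 128 * ((suc ρ + suc ρ) * (suc ρ + suc ρ)) ≤ n → suc ρ + suc ρ ≤ sb →
                   1024 * vol (S ∩ᵇ Long z (suc ρ)) < n * n → Coloured S A₁ Bf
      case-short z y 1≤z 1≤y 64y n≤ u≤y Λ≤ρ Λ≤n Λs 2r small-vol = coloured-cong rejoin (coloured-extend first sub₁ Q∉N second)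
        where
        N = S ∩ᵇ Long z (suc ρ)
        Q = S ∖ᵇ Long z (suc ρ)
        Q⊆S : Q ⊆ᵇ S
        Q⊆S i p = proj₁ (∧-true {S i} p)
        N⊆S : N ⊆ᵇ S
        N⊆S i p = proj₁ (∧-true {S i} p)
        Q∉N : ∀ i → i ∈ᵇ Q → i ∉ᵇ N
        Q∉N i p = ∧-not {S i} p
        N∉Q : ∀ i → i ∈ᵇ N → i ∉ᵇ Q
        N∉Q i p = ≢true⇒false (λ q → true≢false p (Q∉N i q))
        rejoin : ∀ i → (Q ∪ᵇ N) i ≡ S i
        rejoin = ∖-∪-∩ S (Long z (suc ρ))
        r = suc ρ
        high : ∀ j → j ∈ᵇ Q → size j ≤ r + r
        high j p = *-cancelˡ-≤ z ⦃ Data.Nat.>-nonZero 1≤z ⦄ (≤-trans (short-size z j p)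
          (≤-trans (*-monoˡ-≤ r (+-monoʳ-≤ z 1≤z)) (≤-reflexive (z-split z r))))
        4y≤ : 8 * y + u + 1 + (4 * y + 32 * u) ≤ n
        4y≤ = c2-room n y u 64y u≤y 1≤y
        k₁-room : 8 * y + u + 1 + (2 * y + 2 * y) ≤ k₁
        k₁-room = +-cancelʳ-≤ (32 * u) _ _ (≤-trans (≤-trans (≤-reflexive (palette-sum y u)) 4y≤) (≤-reflexive (sym k₁-eq)))
        yy = 2 * y + 2 * y
        yy≤k₁ : yy ≤ k₁
        yy≤k₁ = ≤-trans (m≤n+m yy (8 * y + u + 1)) k₁-room
        cap-half : Bf ≤ 2 * (suc Bf ∸ (r + r))
        cap-half = ≤-trans sb-cap (*-monoʳ-≤ 2 (∸-monoʳ-≤ (suc Bf) 2r))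
        load-Q : ∑∈ Q size ≤ y * (suc Bf ∸ (r + r))
        load-Q = *-cancelˡ-≤ 2 (≤-trans (*-monoʳ-≤ 2 (∑∈-monoˡ {S = Q} {S} Q⊆S)) (≤-trans S-total
          (≤-trans (*-mono-≤ u≤y cap-half) (≤-reflexive (2-inside y (suc Bf ∸ (r + r)))))))
        first : Coloured Q (Int 0 yy) Bf
        first = coloured-cong (λ _ → refl) (coloured-extend (coloured-∅ c₀ (Int 0 yy) Bf) (λ _ q → q) (λ _ ())
          (sparse 128 0 y ρ (r + r) Bf Q (s≤s z≤n) 1≤y n≤ (≤-trans (≤-trans (s≤s z≤n) 4y≥) 64y) 1≤ρ Λ≤ρ Λ≤n Λs (≤-trans 2r sb≤Bf)
            (λ _ _ ()) (λ _ _ → refl) (λ j p → e₀-min j (Q⊆S j p)) high (≤-trans yy≤k₁ k₁≤k) (λ _ ()) load-Q))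
          where
          4y≥ : 1 ≤ 64 * y
          4y≥ = ≤-trans 1≤y (m≤m+n y _)
        sub₁ : Int {k} 0 yy ⊆ᵇ A₁
        sub₁ c p = Int-intro {c = c} z≤n (<-≤-trans (proj₂ (Int-elim {c = c} p)) yy≤k₁)
        B = Int {k} yy k₁
        B-size : # B ≡ k₁ ∸ yy
        B-size = trans (cong (λ e → # (Int {k} yy e)) (sym (m+[n∸m]≡n yy≤k₁))) (#-Int {k} yy (k₁ ∸ yy) (≤-trans (≤-reflexive (m+[n∸m]≡n yy≤k₁)) k₁≤k))
        second : Extension Q (Coloured.col first) N A₁ Bf
        second = widen (λ c p → Int-intro {c = c} z≤n (proj₂ (Int-elim {c = c} p))) (
          extend-fresh (Coloured.proper first) B Bf sb u (8 * y) N N∉Q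
            (λ i p → ≢true⇒false (λ q → <⇒≱ (proj₂ (Int-elim {c = Coloured.col first i} (Coloured.palette first i p))) (proj₁ (Int-elim {c = Coloured.col first i} q))))
            (λ i p → S-small i (N⊆S i p)) (≤-<-trans (∑∈-monoˡ {S = N} {S} N⊆S) (few-total sb ≤-refl))
            (≤-trans (m+n≤o⇒m≤o∸n (suc (8 * y + u)) (≤-trans (≤-reflexive (cong (_+ yy) (+-comm 1 (8 * y + u)))) k₁-room)) (≤-reflexive (sym B-size)))
            (λ S′ sub i p → let e , q , t = degenerate 16 {N} (s≤s z≤n) (λ j v → ≤-trans (s≤s (≤-trans (2·16≤ 32≤Λ) Λ≤ρ)) (e₀-min j (N⊆S j v))) small-vol S′ sub i p
                            in e , q , *-cancelˡ-≤ 16 (≤-trans (<⇒≤ t) (≤-trans n≤ (≤-reflexive (*-assoc 16 8 y))))))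
          where
          32≤Λ : 32 ≤ Λ 128
          32≤Λ = ≤-trans (m≤m+n 32 224) (2G≤Λ 128)
          2·16≤ : 32 ≤ Λ 128 → 2 * 16 ≤ Λ 128
          2·16≤ p = p

      -- The lower bound on r limits the number of edges to Cn; the upper bound leaves enough
      -- disjoint pairs in each neighbourhood. After v rounds all but fewer than v edges of nearly
      -- minimal size save ε colours, whereas their degrees are at most n + ε/2. The surplus ε/2 ≥
      -- 34u outweighs the 32u missing colours and u full ones.
      case-middle : ∀ p V M z ε v Y D → let A = 4 * Λ 128 ; C = 2 * A ; H′ = 2 * C * V * ε in
                    n ≤ A * ((1 + ρ) * (1 + ρ)) → (1 + p) * (1 + p) * ((1 + ρ) * (1 + ρ)) ≤ p * p * n →
                    6 * (1 + p) ≤ z → 8 * (1 + p) ≤ ρ → 32 * (1 + p) * v ≤ n → n ≤ 2 * V * v → (1 + 2 * C * C * V) * H′ ≤ v → 1 ≤ H′ → 1 ≤ 16 * A * V →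
                    n ≤ 2 * M * ε → 8 * M ≤ z → 16 * M ≤ ρ → 1 ≤ u → 68 * u ≤ ε → 64 * u ≤ v → 1 ≤ v → 1 ≤ n →
                    16 * A * V ≤ Y → Y * vol (S ∩ᵇ Long z (suc ρ)) ≤ 4 * (n * n) → 4 * suc ρ ≤ Bf →
                    n ≤ D + 64 * u → (∀ j → j ∈ᵇ S → D ≤ deg S j) → Coloured S A₁ Bf
      case-middle p V M z@(suc z′) ε v Y D lo hi z-big ρ-big v-small₁ n≤v H-fit 1≤H′ 1≤AV n≤ε Mz Mρ 1≤u u-ε u-v 1≤v 1≤n AVY long-vol 4r D-eq dense =
        finish k₁ v u sb Δ k₁≤k S-small (few-total sb ≤-refl) Δ-bound
          (fin-room k₁ n u v (≤-reflexive (sym k₁-eq)) u-v 8v≤n 1≤v)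
          (fin-C Δ u n ε k₁ (≤-reflexive Δ-eq) (≤-reflexive (sym k₁-eq)) 1≤u)
          (rounds v start v≤k (≤-reflexive (cong (_+ 2 * v) (∑-0 (λ i → refl)))) Ψ₀)
        where
        A = 4 * Λ 128
        C = 2 * A
        H′ = 2 * C * V * ε
        r = suc ρ
        G = S ∖ᵇ Long z r
        s = (z + 1) * r / z
        8v≤n : 8 * v ≤ n
        8v≤n = v-small p v n v-small₁
        4v≤n : 4 * v ≤ n
        4v≤n = ≤-trans (*-monoˡ-≤ v (m≤m+n 4 4)) 8v≤n
        κ = n ∸ 8 * v
        κ-eq : κ + 8 * v ≡ n
        κ-eq = m∸n+n≡m 8v≤n
        μ = n ∸ 4 * v
        μ-eq : μ + 4 * v ≡ n
        μ-eq = m∸n+n≡m 4v≤n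
        zs : z * s ≤ (z + 1) * r
        zs = ≤-trans (≤-reflexive (*-comm z s)) (m/n*n≤m ((z + 1) * r) z)
        G⊆S : G ⊆ᵇ S
        G⊆S i q = proj₁ (∧-true {S i} q)
        nice : ∀ j → j ∈ᵇ G → size j ≤ s
        nice j q = ≤-trans (≤-reflexive (sym (m*n/n≡m (size j) z))) (/-monoˡ-≤ z (≤-trans (≤-reflexive (*-comm (size j) z)) (short-size z j q)))
        rρ-pos : 1 ≤ (1 + ρ) * ρ
        rρ-pos = *-mono-≤ (s≤s (z≤n {ρ})) 1≤ρ
        S-count : # S ≤ C * n
        S-count = *-cancelˡ-≤ ((1 + ρ) * ρ) ⦃ Data.Nat.>-nonZero rρ-pos ⦄ (cnt-mid (# S) ρ n A count-ρ lo 1≤ρ)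
        N = S ∩ᵇ Long z r
        N-vol : # N * ((1 + ρ) * ρ) ≤ vol N
        N-vol = ≤-trans (≤-reflexive (sym (∑∈-const N ((1 + ρ) * ρ)))) (∑∈-monoʳ {S = N} (λ j q → let x = proj₁ (∧-true {S j} q) in
          *-mono-≤ (e₀-min j x) (∸-monoˡ-≤ 1 (e₀-min j x))))
        few : # (S ∖ᵇ G) ≤ v
        few = ≤-trans (∑-mono (λ i → 𝟙-mono (lemma (S i) (Long z r i))))
          (*-cancelˡ-≤ (16 * A * V) ⦃ Data.Nat.>-nonZero 1≤AV ⦄ (*-cancelˡ-≤ n ⦃ Data.Nat.>-nonZero 1≤n ⦄
            (mid-few Y (# N) ((1 + ρ) * ρ) (vol N) n A V v long-vol N-vol (r-half n A ρ lo 1≤ρ) n≤v AVY 1≤n)))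
          where
          lemma : ∀ x y → x ∧ not (x ∧ not y) ≡ true → x ∧ y ≡ true
          lemma true true _ = refl
        common-fit : n + s * s * ρ ≤ κ * ρ
        common-fit = kap-d n (s * s) ρ v κ (*-cancelˡ-≤ (z * z * ((1 + p) * (1 + p))) (kap-c p n z ρ v (s * s)
          (kap-a p n z ((1 + ρ) * (1 + ρ)) (s * s) hi (≤-trans (≤-reflexive (square-* z s)) (≤-trans (*-mono-≤ zs zs) (≤-reflexive (sym (square-* (z + 1) r))))))
          (kap-b p n z z-big) v-small₁ ρ-big)) (≤-reflexive (sym κ-eq))
        H-ok : # S * (# S * H′) < v * (μ * (2 * v))
        H-ok = hle2 (# S * (# S * H′)) n V v C H′ μ (hle C n (# S) v H′ V S-count n≤v) H-fit 1≤H′ 1≤n 1≤v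
          (mu-half μ v n (≤-reflexive (sym μ-eq)) 8v≤n)
        room₃ : 3 * s ≤ Bf
        room₃ = *-cancelˡ-≤ z (three-s z s r Bf zs (≤-trans (s≤s (s≤s (s≤s z≤n))) (≤-trans (*-monoʳ-≤ 6 (s≤s (z≤n {p}))) z-big)) 4r)
        -- The v rounds colour at most 2v edges. Of at least n - 64u ≥ n - v neighbours, v may lie
        -- outside `G` and 2v may be used, which leaves μ = n - 4v; subtracting the common
        -- neighbours leaves h = 2v.
        open Pick (pick-data S G ρ s κ D v (2 * v) μ (2 * v) v H′ ε Bf 1≤ρ 1≤v e₀-min dense G⊆S nice few common-fit
          (mu-le μ v D u n (≤-reflexive μ-eq) D-eq u-v) (h-le κ μ v n (≤-reflexive κ-eq) (≤-reflexive (sym μ-eq)) 1≤v) H-ok room₃)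
        start : State 0 ∅ (λ _ → c₀)
        start = record { inside = λ _ () ; proper = λ _ _ () ; colours = λ _ ()
          ; loads = λ c → ≤-trans (≤-reflexive (∑-0 (λ i → refl))) z≤n ; used = ≤-trans (≤-reflexive (∑-0 (λ i → refl))) z≤n }
        Ψ₀ : Ψ ∅ (λ _ → c₀) ≤ v * suc H′
        Ψ₀ = ≤-trans (∑∈-monoʳ {S = G} (λ g _ → m∸n≤m ε (saving ∅ (λ _ → c₀) g))) (≤-trans (≤-reflexive (∑∈-const G ε))
          (≤-trans (ps (# G) ε C n v V (≤-trans (#-mono {S = G} {S} G⊆S) S-count) n≤v) (*-monoʳ-≤ v (n≤1+n H′))))
        v≤k : v ≤ k
        v≤k = ≤-trans (≤-trans (≤-trans (m≤m+n v (v + v + u)) (<⇒≤ (fin-room k₁ n u v (≤-reflexive (sym k₁-eq)) u-v 8v≤n 1≤v))) k₁≤k) ≤-refl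
        34u≤ : 34 * u ≤ n + ε
        34u≤ = ≤-trans (≤-trans (*-monoˡ-≤ u (m≤m+n 34 34)) u-ε) (m≤n+m ε n)
        Δ = n + ε ∸ 34 * u
        Δ-eq : Δ + 34 * u ≡ n + ε
        Δ-eq = m∸n+n≡m 34u≤
        Δ-bound : ∀ g → g ∈ᵇ G → deg S g ≤ Δ
        Δ-bound g q = dl2 (deg S g) n ε u Δ (*-cancelˡ-≤ (z * ρ) ⦃ Data.Nat.>-nonZero (*-mono-≤ (s≤s (z≤n {z′})) 1≤ρ) ⦄
          (dl (deg S g) ρ s n z ε M (≤-trans (deg-bound S ρ e₀-min g) (*-monoˡ-≤ n (nice g q))) zs n≤ε Mz Mρ (s≤s z≤n)))
          u-ε (≤-reflexive Δ-eq) (≤-reflexive (sym Δ-eq))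

-- Colouring with n colours when the volume sits near the square root of n

module NearPlanes where
  open FiniteSums
  open GreedyColouring
  open LinearIncidence
  open DenseSubsets
  open Extensions
  open DisjointPairs
  open PairColouring
  open SavedColours
  open PolynomialIdentities using (polynomial; _:=_; _:+_; _:*_; con)
  open import Data.Bool using (Bool; true; false; _∧_; _∨_; not)
  open import Data.Empty using (⊥-elim)
  open import Data.Fin using (Fin; zero; suc; toℕ)
  open import Data.Nat using (ℕ; zero; suc; _+_; _*_; _∸_; _≤_; _<_; z≤n; s≤s; s≤s⁻¹; _<ᵇ_; _≡ᵇ_)
  open import Data.Nat.Properties
  open import Data.Product using (∃; _×_; _,_; proj₁; proj₂)
  open import Data.Sum using (_⊎_; inj₁; inj₂)
  open import Data.Vec using ([]; _∷_)
  open import Relation.Binary.PropositionalEquality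
  open import Data.Nat.DivMod using (_mod_; m<n⇒m%n≡m)
  open import Data.Fin.Properties using (toℕ-injective; toℕ-fromℕ<)
  open import Relation.Nullary using (yes; no)
  tcount : ∀ N R n κ → N * R ≤ n * n → κ * n ≤ (1 + κ) * R → n * (κ * N) ≤ n * ((1 + κ) * n)
  tcount N R n κ h1 h2 = farkas 0 (+-mono-≤ (*-monoʳ-≤ (1 + κ) h1) (*-monoʳ-≤ N h2))
    (polynomial (N ∷ R ∷ n ∷ κ ∷ []) (λ N R n κ → con 1 :* (n :* (κ :* N)) :+ ((con 1 :+ κ) :* (n :* n) :+ N :* ((con 1 :+ κ) :* R)) :+ con 0 := con 1 :* (n :* ((con 1 :+ κ) :* n)) :+ ((con 1 :+ κ) :* (N :* R) :+ N :* (κ :* n))) refl)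

  x-small : ∀ N x n κ → κ * N ≤ (1 + κ) * n → n + x ≤ N → κ * x ≤ n
  x-small N x n κ h1 h2 = farkas 0 (+-mono-≤ h1 (*-monoʳ-≤ κ h2))
    (polynomial (N ∷ x ∷ n ∷ κ ∷ []) (λ N x n κ → con 1 :* (κ :* x) :+ (((con 1 :+ κ) :* n) :+ κ :* N) :+ con 0 := con 1 :* n :+ ((κ :* N) :+ κ :* (n :+ x))) refl)

  tw-count : ∀ N R n Ξ vl c f → N * R ≤ vl → Ξ * vl ≤ n * n → n ≤ 2 * R → n ≤ 32 * c * f → 64 * c ≤ Ξ → n * (64 * c * N) ≤ n * (64 * c * f)
  tw-count N R n Ξ vl c f h1 h2 h3 h4 h5 = farkas 0 (+-mono-≤ (+-mono-≤ (+-mono-≤ (+-mono-≤ (*-monoʳ-≤ (128 * c) h1) (*-monoʳ-≤ 2 h2)) (*-monoʳ-≤ (64 * N * c) h3)) (*-monoʳ-≤ (2 * n) h4)) (*-monoʳ-≤ (2 * vl) h5))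
    (polynomial (N ∷ R ∷ n ∷ Ξ ∷ vl ∷ c ∷ f ∷ []) (λ N R n Ξ vl c f → con 1 :* (n :* (con 64 :* c :* N)) :+ ((con 128 :* c) :* vl :+ con 2 :* (n :* n) :+ (con 64 :* N :* c) :* (con 2 :* R) :+ (con 2 :* n) :* (con 32 :* c :* f) :+ (con 2 :* vl) :* Ξ) :+ con 0 := con 1 :* (n :* (con 64 :* c :* f)) :+ ((con 128 :* c) :* (N :* R) :+ con 2 :* (Ξ :* vl) :+ (con 64 :* N :* c) :* n :+ (con 2 :* n) :* n :+ (con 2 :* vl) :* (con 64 :* c))) refl)

  w-deg : ∀ dg ρ s n t κ → dg * ρ ≤ s * n → s ≤ t → (1 + κ) * t ≤ κ * ρ → ρ * ((1 + κ) * dg) ≤ ρ * (κ * n)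
  w-deg dg ρ s n t κ h1 h2 h3 = farkas 0 (+-mono-≤ (+-mono-≤ (*-monoʳ-≤ (1 + κ) h1) (*-monoʳ-≤ (n + n * κ) h2)) (*-monoʳ-≤ n h3))
    (polynomial (dg ∷ ρ ∷ s ∷ n ∷ t ∷ κ ∷ []) (λ dg ρ s n t κ → con 1 :* (ρ :* ((con 1 :+ κ) :* dg)) :+ ((con 1 :+ κ) :* (s :* n) :+ (n :+ n :* κ) :* t :+ n :* (κ :* ρ)) :+ con 0 := con 1 :* (ρ :* (κ :* n)) :+ ((con 1 :+ κ) :* (dg :* ρ) :+ (n :+ n :* κ) :* s :+ n :* ((con 1 :+ κ) :* t))) refl)

  room2 : ∀ dg dt tw f n A c seen κ → (1 + κ) * dg ≤ κ * n → seen ≤ dg + tw → tw ≤ f → dt ≤ f → n ≤ A + 8 * f → 16 * c * f ≤ n → 1 + κ ≤ c → 1 ≤ f → (1 + κ) * (dt + seen + f) < (1 + κ) * A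
  room2 dg dt tw f n A c seen κ h1 h2 h3 h4 h5 h6 h7 h8 = farkas 15 (+-mono-≤ (+-mono-≤ (+-mono-≤ (+-mono-≤ (+-mono-≤ (+-mono-≤ (+-mono-≤ (*-monoʳ-≤ 16 h1) (*-monoʳ-≤ (16 + 16 * κ) h2)) (*-monoʳ-≤ (16 + 16 * κ) h3)) (*-monoʳ-≤ (16 + 16 * κ) h4)) (*-monoʳ-≤ (14 + 16 * κ) h5)) (*-monoʳ-≤ 11 h6)) (*-monoʳ-≤ (176 * f) h7)) (*-monoʳ-≤ 16 h8))
    (polynomial (dg ∷ dt ∷ tw ∷ f ∷ n ∷ A ∷ c ∷ seen ∷ κ ∷ []) (λ dg dt tw f n A c seen κ → con 16 :* (con 1 :+ ((con 1 :+ κ) :* (dt :+ seen :+ f))) :+ (con 16 :* (κ :* n) :+ (con 16 :+ con 16 :* κ) :* (dg :+ tw) :+ (con 16 :+ con 16 :* κ) :* f :+ (con 16 :+ con 16 :* κ) :* f :+ (con 14 :+ con 16 :* κ) :* (A :+ con 8 :* f) :+ con 11 :* n :+ (con 176 :* f) :* c :+ con 16 :* f) :+ (con 2 :* A :+ con 3 :* n) := con 16 :* ((con 1 :+ κ) :* A) :+ (con 16 :* ((con 1 :+ κ) :* dg) :+ (con 16 :+ con 16 :* κ) :* seen :+ (con 16 :+ con 16 :* κ) :* tw :+ (con 16 :+ con 16 :* κ) :* dt :+ (con 14 :+ con 16 :* κ) :* n :+ con 11 :* (con 16 :* c :* f) :+ (con 176 :* f) :* (con 1 :+ κ) :+ con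 16 :* con 1)) refl)

  room1 : ∀ dt seen f A bad → dt ≤ f → seen ≤ f → 8 * f ≤ A + bad → bad ≤ f → 1 ≤ f → dt + seen + f < A
  room1 dt seen f A bad h1 h2 h3 h4 h5 = farkas 6 (+-mono-≤ (+-mono-≤ (+-mono-≤ (+-mono-≤ (*-monoʳ-≤ 7 h1) (*-monoʳ-≤ 7 h2)) (*-monoʳ-≤ 4 h3)) (*-monoʳ-≤ 4 h4)) (*-monoʳ-≤ 7 h5))
    (polynomial (dt ∷ seen ∷ f ∷ A ∷ bad ∷ []) (λ dt seen f A bad → con 7 :* (con 1 :+ (dt :+ seen :+ f)) :+ (con 7 :* f :+ con 7 :* f :+ con 4 :* (A :+ bad) :+ con 4 :* f :+ con 7 :* f) :+ (con 3 :* A) := con 7 :* A :+ (con 7 :* dt :+ con 7 :* seen :+ con 4 :* (con 8 :* f) :+ con 4 :* bad :+ con 7 :* con 1)) refl)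

  module Planes {n m : ℕ} (a : Fin m → Fin n → Bool)
    (lin : ∀ i j → i ≢ j → ∀ u v → u ∈ᵇ a i → u ∈ᵇ a j → v ∈ᵇ a i → v ∈ᵇ a j → u ≡ v) where

    open Dense a lin
    open Savings {n} {m} {n} a lin
    open Extend {m} {n} adj adj-sym adj-irrefl size hiding (deg; deg-mono)
    open Pairings a lin using (ClassColouring; singletons; pairing-colouring; module Long-edges)

    load-outside : ∀ {D col S A cap c} (E : Extension D col S A cap) → (∀ i → i ∈ᵇ S → i ∉ᵇ D) → c ∉ᵇ A →
                   load (D ∪ᵇ S) (Extension.col′ E) c ≡ load D col c
    load-outside {D} {col} {S} {A} {cap} {c} E disj c∉ = ∑-cong pt
      where
      open Extension E
      pt : ∀ i → 𝟙 (D i ∨ S i) * (𝟙 (col′ i == c) * size i) ≡ 𝟙 (D i) * (𝟙 (col i == c) * size i)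
      pt i with D i in d | S i in s
      ... | true | true = ⊥-elim (true≢false d (disj i s))
      ... | true | false = cong (λ x → 1 * (𝟙 (x == c) * size i)) (agree i s)
      ... | false | false = refl
      ... | false | true rewrite ≢⇒== {i = col′ i} {c} (λ q → true≢false (subst (_∈ᵇ A) q (palette i s)) c∉) = refl

    -- A class outside `Cmed` obeys the ordinary cap or is dominated by one long edge. In the second
    -- case its bound depends on whether that edge is huge, which is decided later.
    record Outcome (t r₀ capM capB f : ℕ) : Set where
      field
        col      : Fin m → Fin n
        proper   : Proper (λ _ → true) col
        Cmed     : Pred n
        Cmed-few : # Cmed ≤ 8 * f
        medium   : ∀ i → size i ≤ r₀ → col i ∈ᵇ Cmed
        inMed    : ∀ c → c ∈ᵇ Cmed → load (λ _ → true) col c ≤ capM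
        outMed   : ∀ c → c ∉ᵇ Cmed → load (λ _ → true) col c ≤ capB ⊎
                   ∃ λ e → t ≤ size e × col e ≡ c × load (λ _ → true) col c ≤ 2 * size e

    -- The cut-off t = 2 + θ lies slightly below 1 + ρ, the least size in `W`. An edge shorter than
    -- t meets a number of edges of `W` bounded away from n and can be coloured greedily; an edge of
    -- size between t and 1 + ρ might meet almost n of them, so it is treated together with `W` as a
    -- long edge.
    record PlaneData : Set where
      constructor plane-data
      field
        1≤n : 1 ≤ n
        W : Pred m
        ρ θ Ξ c f r₁ r₀ capM capB κ κ₂ : ℕ
        1≤ρ : 1 ≤ ρ
        W-low : ∀ j → j ∈ᵇ W → suc ρ ≤ size j
        t≤ρ : 2 + θ ≤ suc ρ
        θ-big : 9 * n ≤ 10 * ((2 + θ) * θ)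
        θ-small : (2 + θ) * (2 + θ) ≤ 2 * n
        t-big : κ * n ≤ (1 + κ) * ((2 + θ) * (1 + θ))
        κ-big : 161 ≤ κ
        t-half : n ≤ 2 * ((2 + θ) * (1 + θ))
        t-ρ : (1 + κ₂) * (2 + θ) ≤ κ₂ * ρ
        W-vol : Ξ * (n * n) ≤ Ξ * vol W + n * n
        1≤f : 1 ≤ f
        f≤ : 16 * c * f ≤ n
        f≥ : n ≤ 32 * c * f
        c-big : 1 + κ₂ ≤ c
        Ξ-c : 64 * c ≤ Ξ
        Ξ-K : 4 * (32 * c) * (32 * c) < Ξ
        low : ∀ j → suc r₁ ≤ size j
        r₁-big : 2 * (32 * c) ≤ r₁
        r₀<t : r₀ < 2 + θ
        r₀≤capM : r₀ ≤ capM
        t≤capB : 2 + θ ≤ capB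
        total₁ : n * n ≤ r₁ * (f * (suc capM ∸ r₀))
        total₂ : n * n ≤ r₀ * (f * (suc capB ∸ (2 + θ)))
        1≤r₀ : 1 ≤ r₀
        bad-few : n * n ≤ (1 + θ) * (f * suc capM)
        med-deg : r₀ * n ≤ f * (1 + θ)

    module Construct (P : PlaneData) where
      open PlaneData P

      t = 2 + θ
      K = 32 * c
      T Md R : Pred m
      T j = not (size j <ᵇ t)
      Md j = size j <ᵇ suc r₀
      R j = (size j <ᵇ t) ∧ not (Md j)

      T-low : ∀ j → j ∈ᵇ T → t ≤ size j
      T-low j p = <ᵇ-false (not-true p)
      Md-high : ∀ j → j ∈ᵇ Md → size j ≤ r₀
      Md-high j p = s≤s⁻¹ (<ᵇ-true {size j} p)
      R-range : ∀ j → j ∈ᵇ R → size j < t × r₀ < size j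
      R-range j p with ∧-true {size j <ᵇ t} p
      ... | x , y = <ᵇ-true x , <ᵇ-false {size j} (not-true y)

      1≤c : 1 ≤ c
      1≤c = ≤-trans (s≤s z≤n) c-big

      instance
        nz-n : Data.Nat.NonZero n
        nz-n = Data.Nat.>-nonZero 1≤n

      T-count : κ * # T ≤ (1 + κ) * n
      T-count = *-cancelˡ-≤ n (tcount (# T) (t * (1 + θ)) n κ
        (≤-trans (≤-reflexive (sym (∑∈-const T (t * (1 + θ))))) (≤-trans (∑∈-monoʳ {S = T} (λ j p →
          *-mono-≤ (T-low j p) (∸-monoˡ-≤ 1 (T-low j p)))) (vol≤n² T))) t-big)

      8f≤n : 8 * f ≤ n
      8f≤n = ≤-trans (*-monoˡ-≤ f (≤-trans (m≤m+n 8 8) (≤-trans (≤-reflexive (sym (*-identityʳ 16))) (*-monoʳ-≤ 16 1≤c)))) f≤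

      -- There are at most n + n/κ long edges, and κ ≥ 161 keeps the excess x within the condition
      -- 160x < n of `pairing`.
      T-classes : ClassColouring T n
      T-classes with # T ≤? n
      ... | yes p = singletons n T p
      ... | no p = pairing-colouring n (pairing x T T-low (≤-reflexive eq) (small x (x-small (# T) x n κ T-count (≤-reflexive eq)))) (≤-reflexive (sym eq))
        where
        open Long-edges θ θ-big θ-small 1≤n using (pairing)
        x = # T ∸ n
        small : ∀ x → κ * x ≤ n → 160 * x < n
        small zero _ = 1≤n
        small (suc x) q = <-≤-trans (*-monoˡ-< (suc x) κ-big) q
        eq : n + x ≡ # T
        eq = m+[n∸m]≡n (<⇒≤ (≰⇒> p))

      module Coloured-T (classes : ClassColouring T n) where
        open ClassColouring classes

        colT : Fin m → Fin n
        colT i = colour i mod n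

        colT-val : ∀ i → i ∈ᵇ T → toℕ (colT i) ≡ colour i
        colT-val i p = trans (toℕ-fromℕ< _) (m<n⇒m%n≡m (bounded i p))

        T-proper : Proper T colT
        T-proper i j p q r eq = separate i j p q r (trans (sym (colT-val i p)) (trans (cong toℕ eq) (colT-val j q)))

        T-load : ∀ c → load T colT c ≡ 0 ⊎ ∃ λ e → e ∈ᵇ T × colT e ≡ c × load T colT c ≤ 2 * size e
        T-load c with class (toℕ c)
        ... | inj₁ none = inj₁ (∑-0 pt)
          where
          pt : ∀ i → 𝟙 (T i) * (𝟙 (colT i == c) * size i) ≡ 0
          pt i with T i in p
          ... | false = refl
          ... | true rewrite ≢⇒== {i = colT i} {c} (λ q → none i p (trans (sym (colT-val i p)) (cong toℕ q))) = refl
        ... | inj₂ (e , e∈ , ec , bound) = inj₂ (e , e∈ , toℕ-injective (trans (colT-val e e∈) ec) ,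
            ≤-trans (∑∈-monoʳ {S = T} pt) bound)
          where
          pt : ∀ i → i ∈ᵇ T → 𝟙 (colT i == c) * size i ≤ 𝟙 (colour i ≡ᵇ toℕ c) * size i
          pt i p = *-monoˡ-≤ (size i) (𝟙-mono (λ q → ≡ᵇ-true (trans (sym (colT-val i p)) (cong toℕ (==⇒≡ q)))))
            where
            ≡ᵇ-true : ∀ {x y} → x ≡ y → (x ≡ᵇ y) ≡ true
            ≡ᵇ-true {zero} refl = refl
            ≡ᵇ-true {suc x} refl = ≡ᵇ-true {x} refl

        outside-W : ∀ S → (∀ i → i ∈ᵇ S → i ∉ᵇ W) → Ξ * vol S ≤ n * n
        outside-W S disj = +-cancelˡ-≤ (Ξ * vol W) _ _ (≤-trans (≤-reflexive (sym (*-distribˡ-+ Ξ (vol W) (vol S))))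
          (≤-trans (*-monoʳ-≤ Ξ (≤-trans (≤-reflexive (sym (∑∈-∪ {S = W} {S} _ disj))) (vol≤n² (W ∪ᵇ S)))) W-vol))

        short∉W : ∀ i → size i < t → i ∉ᵇ W
        short∉W i p = ≢true⇒false (λ q → <⇒≱ p (≤-trans t≤ρ (W-low i q)))

        -- Edges shorter than t lie outside `W`, hence in a family of volume at most n²/Ξ, below the
        -- threshold of `degenerate`.
        degen : ∀ S → (∀ i → i ∈ᵇ S → size i < t) → ∀ S′ → S′ ⊆ᵇ S → ∀ i → i ∈ᵇ S′ → ∃ λ e → e ∈ᵇ S′ × deg S′ e ≤ f
        degen S short S′ sub i p with degenerate K {S} (≤-trans 1≤c (m≤m+n c _)) (λ j q → ≤-trans (s≤s r₁-big) (low j)) small S′ sub i p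
          where
          small : 4 * K * K * vol S < n * n
          small = below-suc (4 * K * K) (vol S) (*-mono-≤ 1≤n 1≤n) (≤-trans (*-monoˡ-≤ (vol S) Ξ-K) (outside-W S (λ i p → short∉W i (short i p))))
        ... | e , q , lt = e , q , <⇒≤ (*-cancelˡ-< K _ _ (<-≤-trans lt f≥))

        T-size : ∑∈ T size * (1 + θ) ≤ n * n
        T-size = ≤-trans (≤-reflexive (*-comm (∑∈ T size) (1 + θ))) (≤-trans (ρ∑size≤vol T (1 + θ) T-low) (vol≤n² T))

        heavy : Pred n
        heavy c = capM <ᵇ load T colT c

        -- Long edges may occupy all n colours already, so medium edges have to share. Among the
        -- first 8f colours, those on which long edges exceed the medium cap, at most f, are left
        -- out.
        Cmed : Pred n
        Cmed c = Int 0 (8 * f) c ∧ not (heavy c)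

        heavy-few : # heavy ≤ f
        heavy-few = *-cancelʳ-≤ (# heavy) f (suc capM) (*-cancelˡ-≤ (1 + θ) (≤-trans (*-monoʳ-≤ (1 + θ) load-sum)
          (≤-trans (≤-reflexive (*-comm (1 + θ) _)) (≤-trans T-size bad-few))))
          where
          load-sum : # heavy * suc capM ≤ ∑∈ T size
          load-sum = begin
            # heavy * suc capM ≡⟨ ∑∈-const heavy (suc capM) ⟨
            ∑∈ heavy (λ _ → suc capM) ≤⟨ ∑∈-monoʳ {S = heavy} (λ c p → <ᵇ-true {capM} p) ⟩
            ∑∈ heavy (load T colT) ≡⟨ load-total T colT heavy ⟩
            ∑∈ T (λ i → 𝟙 (heavy (colT i)) * size i) ≤⟨ ∑∈-monoʳ {S = T} (λ i _ → ≤-trans (*-monoˡ-≤ (size i) (𝟙≤1 (heavy (colT i)))) (≤-reflexive (+-identityʳ _))) ⟩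
            ∑∈ T size ∎
            where open ≤-Reasoning

        Cmed-few : # Cmed ≤ 8 * f
        Cmed-few = ≤-trans (#-mono (λ c p → proj₁ (∧-true {Int 0 (8 * f) c} p))) (≤-reflexive (#-Int {n} 0 (8 * f) 8f≤n))

        Cmed-many : 8 * f ≤ # Cmed + # heavy
        Cmed-many = ≤-trans (≤-reflexive (sym (#-Int {n} 0 (8 * f) 8f≤n))) (≤-trans (∑-mono (λ c → lemma (Int 0 (8 * f) c) (heavy c))) (≤-reflexive (∑-+ _ _)))
          where
          lemma : ∀ x y → 𝟙 x ≤ 𝟙 (x ∧ not y) + 𝟙 y
          lemma false y = z≤n
          lemma true true = ≤-refl
          lemma true false = ≤-refl

        ∑-part : ∀ (S : Pred m) (g : Fin m → Fin n) (A : Pred n) → ∑∈ S (λ i → 𝟙 (A (g i)) * size i) ≤ ∑∈ S size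
        ∑-part S g A = ∑∈-monoʳ {S = S} (λ i _ → ≤-trans (*-monoˡ-≤ (size i) (𝟙≤1 (A (g i)))) (≤-reflexive (+-identityʳ _)))

        Md∉T : ∀ i → i ∈ᵇ Md → i ∉ᵇ T
        Md∉T i p = cong not (<ᵇ-intro (≤-<-trans (Md-high i p) r₀<t))

        all-size : ∑∈ (T ∪ᵇ Md) size ≤ f * (suc capM ∸ r₀)
        all-size = *-cancelˡ-≤ r₁ ⦃ Data.Nat.>-nonZero (≤-trans (≤-trans 1≤c (≤-trans (m≤m+n c _) (m≤m+n K _))) r₁-big) ⦄
          (≤-trans (ρ∑size≤vol (T ∪ᵇ Md) r₁ (λ j _ → low j)) (≤-trans (vol≤n² (T ∪ᵇ Md)) total₁))

        phase₁ : Extension T colT Md Cmed capM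
        phase₁ = extend T-proper Cmed capM r₀ f Md Md∉T Md-high
          (<-≤-trans (s≤s (≤-trans (+-monoˡ-≤ _ (∑-part T colT Cmed)) (≤-trans (≤-reflexive (sym (∑∈-∪ {S = T} {Md} size Md∉T))) all-size)))
            (+-monoˡ-≤ _ (≤-trans (s≤s z≤n) (≤-reflexive (sym (+-∸-assoc 1 r₀≤capM))))))
          -- Neighbours in `Md`, colours seen on long edges, and full colours: at most f of each,
          -- against at least 7f colours.
          (λ S′ sub i p → let e , q , dt = degen Md (λ i p → ≤-<-trans (Md-high i p) r₀<t) S′ sub i p in e , q ,
            room1 (deg S′ e) (# (Cmed ∩ᵇ seen T colT e)) f (# Cmed) (# heavy) dt (seen≤ e (sub e q)) Cmed-many heavy-few 1≤f)
          where
          seen≤ : ∀ e → e ∈ᵇ Md → # (Cmed ∩ᵇ seen T colT e) ≤ f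
          seen≤ e p = ≤-trans (#-mono (λ c q → proj₂ (∧-true {Cmed c} q))) (≤-trans (seen≤deg T colT e)
            (*-cancelʳ-≤ _ _ (1 + θ) (≤-trans (deg-bound T (1 + θ) T-low e) (≤-trans (*-monoˡ-≤ n (Md-high e p)) med-deg))))

        module After-medium (E₁ : Extension T colT Md Cmed capM) where
          open Extension E₁ renaming (col′ to col₁; agree to agree₁; proper′ to proper₁; palette to palette₁; load′ to load₁)

          D₁ = T ∪ᵇ Md

          R∉D₁ : ∀ i → i ∈ᵇ R → i ∉ᵇ D₁
          R∉D₁ i p = lemma (size i <ᵇ t) (Md i) p
            where
            lemma : ∀ x y → x ∧ not y ≡ true → not x ∨ y ≡ false
            lemma true false _ = refl

          A₂ : Pred n
          A₂ c = not (Cmed c)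

          A₂-many : n ≤ # A₂ + 8 * f
          A₂-many = ≤-trans (≤-reflexive (sym (#-true {n} {λ _ → true} (λ _ → refl)))) (≤-trans (∑-mono (λ c → lemma (Cmed c)))
            (≤-trans (≤-reflexive (∑-+ _ _)) (+-monoʳ-≤ (# A₂) Cmed-few)))
            where
            lemma : ∀ x → 1 ≤ 𝟙 (not x) + 𝟙 x
            lemma true = ≤-refl
            lemma false = ≤-refl

          TW-few : # (T ∖ᵇ W) ≤ f
          TW-few = *-cancelˡ-≤ (64 * c) ⦃ Data.Nat.>-nonZero (≤-trans 1≤c (m≤m+n c _)) ⦄ (*-cancelˡ-≤ n
            (tw-count (# (T ∖ᵇ W)) (t * (1 + θ)) n Ξ (vol (T ∖ᵇ W)) c f
              (≤-trans (≤-reflexive (sym (∑∈-const (T ∖ᵇ W) (t * (1 + θ))))) (∑∈-monoʳ {S = T ∖ᵇ W} (λ j p → let x = T-low j (proj₁ (∧-true {T j} p)) in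
                *-mono-≤ x (∸-monoˡ-≤ 1 x))))
              (outside-W (T ∖ᵇ W) (λ i p → not-true (proj₂ (∧-true {T i} p)))) t-half f≥ Ξ-c))

          rest-size : ∑∈ D₁ (λ i → 𝟙 (A₂ (col₁ i)) * size i) + ∑∈ R size ≤ f * (suc capB ∸ t)
          rest-size = ≤-trans (+-monoˡ-≤ _ big-only) (≤-trans (≤-reflexive (sym (∑∈-∪ {S = T} {R} size R∉T)))
            (*-cancelˡ-≤ r₀ ⦃ Data.Nat.>-nonZero 1≤r₀ ⦄ (≤-trans (ρ∑size≤vol (T ∪ᵇ R) r₀ TR-low) (≤-trans (vol≤n² (T ∪ᵇ R)) total₂))))
            where
            R∉T : ∀ i → i ∈ᵇ R → i ∉ᵇ T
            R∉T i p = cong not (<ᵇ-intro (proj₁ (R-range i p)))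
            TR-low : ∀ i → i ∈ᵇ T ∪ᵇ R → suc r₀ ≤ size i
            TR-low i p with ∨-true {T i} p
            ... | inj₁ q = ≤-trans r₀<t (T-low i q)
            ... | inj₂ q = proj₂ (R-range i q)
            big-only : ∑∈ D₁ (λ i → 𝟙 (A₂ (col₁ i)) * size i) ≤ ∑∈ T size
            big-only = ∑-mono pt
              where
              pt : ∀ i → 𝟙 (D₁ i) * (𝟙 (A₂ (col₁ i)) * size i) ≤ 𝟙 (T i) * size i
              pt i with T i | Md i in q
              ... | true | _ = +-monoˡ-≤ 0 (≤-trans (*-monoˡ-≤ (size i) (𝟙≤1 (A₂ (col₁ i)))) (≤-reflexive (+-identityʳ _)))
              ... | false | false = z≤n
              ... | false | true rewrite palette₁ i q = z≤n

          -- An edge of `R` sees at most κ₂n/(1 + κ₂) colours on `W` and at most f on the remaining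
          -- long edges. Medium edges do not count, since their colours lie outside `A₂`.
          phase₂ : Extension D₁ col₁ R A₂ capB
          phase₂ = extend proper₁ A₂ capB t f R R∉D₁ (λ i p → <⇒≤ (proj₁ (R-range i p)))
            (<-≤-trans (s≤s rest-size) (+-monoˡ-≤ _ (≤-trans (s≤s z≤n) (≤-reflexive (sym (+-∸-assoc 1 t≤capB))))))
            (λ S′ sub i p → let e , q , dt = degen R (λ i p → proj₁ (R-range i p)) S′ sub i p in e , q ,
              *-cancelˡ-< (1 + κ₂) _ _ (room2 (deg W e) (deg S′ e) (# (T ∖ᵇ W)) f n (# A₂) c (# (A₂ ∩ᵇ seen D₁ col₁ e)) κ₂ (degW e (sub e q)) (seen≤ e) TW-few dt A₂-many f≤ c-big 1≤f))
            where
            degW : ∀ e → e ∈ᵇ R → (1 + κ₂) * deg W e ≤ κ₂ * n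
            degW e p = *-cancelˡ-≤ ρ ⦃ Data.Nat.>-nonZero 1≤ρ ⦄ (w-deg (deg W e) ρ (size e) n t κ₂ (deg-bound W ρ W-low e) (<⇒≤ (proj₁ (R-range e p))) t-ρ)
            seen≤ : ∀ e → # (A₂ ∩ᵇ seen D₁ col₁ e) ≤ deg W e + # (T ∖ᵇ W)
            seen≤ e = ≤-trans (#-mono sub) (≤-trans (seen≤deg T col₁ e) (≤-trans (∑-mono pt) (≤-reflexive (∑-+ _ _))))
              where
              pt : ∀ i → 𝟙 (T i ∧ adj e i) ≤ 𝟙 (W i ∧ adj e i) + 𝟙 (T i ∧ not (W i))
              pt i with T i | W i | adj e i
              ... | false | _ | _ = z≤n
              ... | true | _ | false = z≤n
              ... | true | true | true = s≤s z≤n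
              ... | true | false | true = s≤s z≤n
              sub : A₂ ∩ᵇ seen D₁ col₁ e ⊆ᵇ seen T col₁ e
              sub c p with ∧-true {A₂ c} p
              ... | x , y with some-true {P = λ i → (D₁ i ∧ adj e i) ∧ (col₁ i == c)} y
              ... | i , z with ∧-true {D₁ i ∧ adj e i} z
              ... | z₁ , ic with ∧-true {D₁ i} z₁
              ... | i∈ , ei with ∨-true {T i} i∈
              ... | inj₁ iT = some-intro {P = λ i → (T i ∧ adj e i) ∧ (col₁ i == c)} {i} (∧-intro (∧-intro iT ei) ic)
              ... | inj₂ iM = ⊥-elim (true≢false (subst (_∈ᵇ Cmed) (==⇒≡ ic) (palette₁ i iM)) (not-true x))

          module After-rest (E₂ : Extension D₁ col₁ R A₂ capB) where
            open Extension E₂ renaming (col′ to col₂; agree to agree₂; proper′ to proper₂; palette to palette₂; load′ to load₂)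

            all : ∀ i → (D₁ ∪ᵇ R) i ≡ true
            all i with size i <ᵇ t | Md i
            ... | false | _ = refl
            ... | true | true = refl
            ... | true | false = refl

            all-load : ∀ c → load (λ _ → true) col₂ c ≡ load (D₁ ∪ᵇ R) col₂ c
            all-load c = load-cong {D = λ _ → true} {D₁ ∪ᵇ R} c (λ i → sym (all i)) (λ _ _ → refl)

            outcome : Outcome t r₀ capM capB f
            outcome = record
              { col = col₂ ; proper = λ i j _ _ → proper₂ i j (all i) (all j) ; Cmed = Cmed ; Cmed-few = Cmed-few
              ; medium = λ i p → let q = <ᵇ-intro {size i} (s≤s p) in
                  subst (_∈ᵇ Cmed) (sym (agree₂ i (≢true⇒false (λ z → <⇒≱ (proj₂ (R-range i z)) p)))) (palette₁ i q)
              ; inMed = λ c p → ≤-trans (≤-reflexive (trans (all-load c) (load-outside E₂ R∉D₁ (cong not p)))) (in₁ c p)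
              ; outMed = λ c p → subst (λ x → x ≤ capB ⊎ ∃ λ e → t ≤ size e × col₂ e ≡ c × x ≤ 2 * size e) (sym (all-load c)) (out₂ c p) }
              where
              in₁ : ∀ c → c ∈ᵇ Cmed → load D₁ col₁ c ≤ capM
              in₁ c p with load₁ c
              ... | inj₂ q = q
              ... | inj₁ q = ≤-trans (≤-reflexive q) (<ᵇ-false (not-true (proj₂ (∧-true {Int 0 (8 * f) c} p))))
              out₂ : ∀ c → c ∉ᵇ Cmed → load (D₁ ∪ᵇ R) col₂ c ≤ capB ⊎ ∃ λ e → t ≤ size e × col₂ e ≡ c × load (D₁ ∪ᵇ R) col₂ c ≤ 2 * size e
              out₂ c p with load₂ c
              ... | inj₂ q = inj₁ q
              ... | inj₁ q with trans q (load-outside E₁ Md∉T p) | T-load c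
              ... | r | inj₁ z = inj₁ (≤-trans (≤-reflexive (trans r z)) z≤n)
              ... | r | inj₂ (e , e∈ , ec , bound) = inj₂ (e , T-low e e∈ , trans (agree₂ e eR) (trans (agree₁ e eM) ec) , ≤-trans (≤-reflexive r) bound)
                where
                eR : e ∉ᵇ R
                eR = ≢true⇒false (λ z → <⇒≱ (proj₁ (R-range e z)) (T-low e e∈))
                eM : e ∉ᵇ Md
                eM = ≢true⇒false (λ z → true≢false e∈ (Md∉T e z))

      outcome : Outcome t r₀ capM capB f
      outcome = After-rest.outcome phase₂
        where
        open Coloured-T T-classes
        open After-medium phase₁

-- Either the main palette suffices or the core is near the square root of n

module StructureDichotomy where
  open FiniteSums
  open GreedyColouring
  open LinearIncidence
  open DenseSubsets
  open Extensions
  open SparseColouring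
  open SavedColours
  open ColouringCases
  open PolynomialIdentities using (polynomial; _:=_; _:+_; _:*_; con)
  open import Data.Bool using (Bool; true; false; _∧_; _∨_)
  open import Data.Empty using (⊥-elim)
  open import Data.Fin using (Fin; zero; suc)
  open import Data.Nat using (ℕ; zero; suc; _+_; _*_; _∸_; _≤_; _<_; z≤n; s≤s; s≤s⁻¹)
  open import Data.Nat.Properties
  open import Data.Nat.Tactic.RingSolver using (solve-∀)
  open import Data.Product using (∃; _×_; _,_; proj₁; proj₂)
  open import Data.Sum using (_⊎_; inj₁; inj₂)
  open import Data.Vec using ([]; _∷_)
  open import Relation.Binary.PropositionalEquality
  open import Relation.Nullary using (yes; no)
  sb-cap : ∀ B sb Y → 2 * sb ≤ B → 1 + B ≤ sb + Y → B ≤ 2 * Y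
  sb-cap B sb Y h1 h2 = farkas 0 (+-mono-≤ h1 (*-monoʳ-≤ 2 h2))
    (polynomial (B ∷ sb ∷ Y ∷ []) (λ B sb Y → con 1 :* B :+ (B :+ con 2 :* (sb :+ Y)) :+ con 2 := con 1 :* (con 2 :* Y) :+ ((con 2 :* sb) :+ con 2 :* (con 1 :+ B))) refl)

  d-k : ∀ D k₁ u n dS dd → D + 64 * u ≤ n → n ≤ k₁ + 32 * u → dd + dS < D → 1 ≤ u → dd + dS + u < k₁
  d-k D k₁ u n dS dd h1 h2 h3 h4 = farkas 0 (+-mono-≤ (+-mono-≤ (+-mono-≤ h1 h2) h3) (*-monoʳ-≤ 31 h4))
    (polynomial (D ∷ k₁ ∷ u ∷ n ∷ dS ∷ dd ∷ []) (λ D k₁ u n dS dd → con 1 :* (con 1 :+ (dd :+ dS :+ u)) :+ (n :+ (k₁ :+ con 32 :* u) :+ D :+ con 31 :* u) :+ con 31 := con 1 :* k₁ :+ ((D :+ con 64 :* u) :+ n :+ (con 1 :+ (dd :+ dS)) :+ con 31 :* con 1)) refl)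

  four-fold : ∀ x → 2 * (x + x) ≡ 4 * x
  four-fold = solve-∀

  square-double : ∀ l r → l * ((r + r) * (r + r)) ≡ 4 * l * (r * r)
  square-double = solve-∀

  -- `8192 ≤ Y` yields 2048v ≤ x, more than the strict bound needs; 1024 = 4 · 16² is the factor in
  -- `degenerate` at K = 16.
  small-part : ∀ Y v {x} → 8192 ≤ Y → 1 ≤ x → Y * v ≤ 4 * x → 1024 * v < x
  small-part Y v {x} Y-big 1≤x h = below-suc 1024 v 1≤x (≤-trans (*-monoˡ-≤ v {1025} {2048} (m≤m+n 1025 1023))
    (*-cancelˡ-≤ 4 (≤-trans (≤-reflexive (sym (*-assoc 4 2048 v))) (≤-trans (*-monoˡ-≤ v Y-big) h))))

  -- The losses are ordered: `u` is small against `ε`, the saving sought in the middle case, and `u`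
  -- and `ε` against `v`, the number of paired colours, which is small against n. `q` measures how
  -- close core degrees are to n, `z` how close sizes are to the minimum, and `Y` = q/(z + 1) the
  -- resulting bound for long edges.
  record Scales (n m k : ℕ) : Set where
    constructor scales
    field
      k₁ u Bf sb D r₀ p V M z ε v Y q y : ℕ
      c₀ : Fin k
      k₁≤k : k₁ ≤ k
      k₁-eq : k₁ + 32 * u ≡ n
      D-eq : D + 64 * u ≡ n
      sb-half : 2 * sb ≤ Bf
      sb-half′ : Bf < 2 * suc sb
      1≤n : 1 ≤ n
      1≤u : 1 ≤ u
      2≤p : 2 ≤ p
      p-r₀ : 8 * (1 + p) ≤ r₀
      u-p : (1 + p) * (33 * u) < n
      z-big : 6 * (1 + p) ≤ z
      q-def : q ≡ (z + 1) * Y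
      2≤q : 2 ≤ q
      q-r₀ : q ≤ r₀
      q-u : q * (64 * u) ≤ n
      64y : 64 * y ≤ n
      128y : n ≤ 128 * y
      1≤y : 1 ≤ y
      u≤y : u ≤ y
      Λ-r₀ : Λ 128 ≤ r₀
      Λ-n : Λ 128 ≤ n
      Y-big : 8192 ≤ Y
      v-n : 32 * (1 + p) * v ≤ n
      n-v : n ≤ 2 * V * v
      H-fit : (1 + 2 * (2 * (4 * Λ 128)) * (2 * (4 * Λ 128)) * V) * (2 * (2 * (4 * Λ 128)) * V * ε) ≤ v
      1≤H : 1 ≤ 2 * (2 * (4 * Λ 128)) * V * ε
      1≤AV : 1 ≤ 16 * (4 * Λ 128) * V
      n-ε : n ≤ 2 * M * ε
      M-z : 8 * M ≤ z
      M-r₀ : 16 * M ≤ r₀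
      u-ε : 68 * u ≤ ε
      u-v : 64 * u ≤ v
      1≤v : 1 ≤ v
      Y-AV : 16 * (4 * Λ 128) * V ≤ Y
      X : Pred m

  module Dichotomy {n m k : ℕ} (a : Fin m → Fin n → Bool) (lin : ∀ i j → i ≢ j → ∀ u v → u ∈ᵇ a i → u ∈ᵇ a j → v ∈ᵇ a i → v ∈ᵇ a j → u ≡ v) (P : Scales n m k) where
    open Scales P

    open Cases {n} {m} {k} a lin

    A₁ = Int {k} 0 k₁

    module _ (X-low : ∀ j → j ∈ᵇ X → r₀ < size j) (X-high : ∀ j → j ∈ᵇ X → 4 * size j ≤ Bf) (X-total : 2 * ∑∈ X size ≤ u * Bf) where

      -- The remaining case: 1 + ρ is within a factor 1 ± 1/(1 + p) of √n.
      record Balanced : Set where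
        field
          S      : Pred m
          ρ      : ℕ
          r₀≤ρ   : r₀ ≤ ρ
          S-low  : ∀ j → j ∈ᵇ S → suc ρ ≤ size j
          below  : (1 + p) * (1 + p) * (suc ρ * suc ρ) < (2 + p) * (2 + p) * n
          above  : p * p * n < (1 + p) * (1 + p) * (suc ρ * suc ρ)
          few    : Y * vol (S ∩ᵇ Long z (suc ρ)) ≤ 4 * (n * n)
          dense  : q * (n * n) ≤ q * vol S + 4 * (n * n)

      sb≤Bf : sb ≤ Bf
      sb≤Bf = ≤-trans (m≤m+n sb _) sb-half

      cap-half : Bf ≤ 2 * (suc Bf ∸ sb)
      cap-half = sb-cap Bf sb (suc Bf ∸ sb) sb-half (≤-reflexive (sym (m+[n∸m]≡n (≤-trans sb≤Bf (n≤1+n Bf)))))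

      X-small : ∀ j → j ∈ᵇ X → size j + size j ≤ sb
      X-small j i = s≤s⁻¹ (*-cancelˡ-< 2 _ _ (≤-<-trans (≤-trans (≤-reflexive (four-fold (size j))) (X-high j i)) sb-half′))

      -- When a peeled edge is coloured, fewer than n - 64u of its neighbours have been coloured,
      -- against n - 32u colours; the margin absorbs at most u full ones.
      complete : ∀ S → S ⊆ᵇ X → (∀ S′ → S′ ⊆ᵇ X ∖ᵇ S → ∀ i → i ∈ᵇ S′ → ∃ λ e → e ∈ᵇ S′ × deg (S ∪ᵇ S′) e < D) →
                 Coloured S A₁ Bf → Coloured X A₁ Bf
      complete S S⊆X rest C = coloured-cong rejoin (coloured-extend C (λ _ i → i) S∉R (extend (Coloured.proper C) A₁ Bf sb u R R∉S
          (λ j i → ≤-trans (m≤m+n (size j) _) (X-small j (R⊆X j i))) total room))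
        where
        col = Coloured.col C
        R = X ∖ᵇ S
        R⊆X : R ⊆ᵇ X
        R⊆X i p = proj₁ (∧-true {X i} p)
        R∉S : ∀ i → i ∈ᵇ R → i ∉ᵇ S
        R∉S i p = not-true (proj₂ (∧-true {X i} p))
        S∉R : ∀ i → i ∈ᵇ S → i ∉ᵇ R
        S∉R i p = ≢true⇒false (λ q → true≢false p (R∉S i q))
        rejoin : ∀ i → (S ∪ᵇ R) i ≡ X i
        rejoin i with S i in s
        ... | true = sym (S⊆X i s)
        ... | false with X i
        ... | true = refl
        ... | false = refl
        total : ∑∈ S (λ i → 𝟙 (A₁ (col i)) * size i) + ∑∈ R size < suc u * (suc Bf ∸ sb)
        total = ≤-<-trans (≤-trans (+-monoˡ-≤ _ (∑∈-monoʳ {S = S} (λ i _ → ≤-trans (*-monoˡ-≤ (size i) (𝟙≤1 (A₁ (col i)))) (≤-reflexive (+-identityʳ _)))))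
          (≤-reflexive (trans (sym (∑∈-∪ {S = S} {R} size R∉S)) (∑-cong (λ i → cong (λ b → 𝟙 b * size i) (rejoin i))))))
          (tot (∑∈ X size) u (suc Bf ∸ sb) Bf X-total cap-half (≤-trans (s≤s z≤n) (≤-reflexive (sym (+-∸-assoc 1 sb≤Bf)))))
        room : ∀ S′ → S′ ⊆ᵇ R → ∀ i → i ∈ᵇ S′ → ∃ λ e → e ∈ᵇ S′ × deg S′ e + # (A₁ ∩ᵇ seen S col e) + u < # A₁
        room S′ sub i i∈ with rest S′ sub i i∈
        ... | e , e∈ , small = e , e∈ , ≤-trans (≤-trans (s≤s (+-monoˡ-≤ u (+-monoʳ-≤ (deg S′ e)
                (≤-trans (#-mono (λ c r → proj₂ (∧-true {A₁ c} r))) (seen≤deg S col e)))))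
                (d-k D k₁ u n (deg S e) (deg S′ e) (≤-reflexive D-eq) (≤-reflexive (sym k₁-eq)) (≤-<-trans both small) 1≤u))
                (≤-reflexive (sym (#-Int {k} 0 k₁ k₁≤k)))
          where
          both : deg S′ e + deg S e ≤ deg (S ∪ᵇ S′) e
          both = ≤-trans (≤-reflexive (sym (∑-+ _ _))) (∑-mono pt)
            where
            pt : ∀ i → 𝟙 (S′ i ∧ adj e i) + 𝟙 (S i ∧ adj e i) ≤ 𝟙 ((S i ∨ S′ i) ∧ adj e i)
            pt i with S i in x | S′ i in y
            ... | true | true = ⊥-elim (true≢false x (R∉S i (sub i y)))
            ... | true | false = ≤-refl
            ... | false | true = ≤-reflexive (+-identityʳ _)
            ... | false | false = z≤n

      stuck : ∀ S → S ⊆ᵇ X → (∀ e → e ∈ᵇ S → D ≤ deg S e) → ∀ e₀ → e₀ ∈ᵇ S → (∀ j → j ∈ᵇ S → size e₀ ≤ size j) → Coloured S A₁ Bf ⊎ Balanced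
      stuck S S⊆X dense e₀ e₀∈ min with suc≡ (≤-trans (s≤s z≤n) (X-low e₀ (S⊆X e₀ e₀∈)))
      ... | ρ , eq = decide
        where
        r₀≤ρ : r₀ ≤ ρ
        r₀≤ρ = s≤s⁻¹ (≤-trans (X-low e₀ (S⊆X e₀ e₀∈)) (≤-reflexive eq))
        1≤ρ : 1 ≤ ρ
        1≤ρ = ≤-trans (≤-trans (s≤s z≤n) p-r₀) r₀≤ρ
        low : ∀ j → j ∈ᵇ S → suc ρ ≤ size j
        low j i = ≤-trans (≤-reflexive (sym eq)) (min j i)
        uni = uniform q z ρ {S} {e₀} {D} 2≤q (≤-trans q-r₀ r₀≤ρ) e₀∈ eq min dense
          (≤-trans (≤-reflexive (trans (cong (q *_) (sym D-eq)) (*-distribˡ-+ q D (64 * u)))) (+-monoʳ-≤ (q * D) q-u))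
        long-vol : Y * vol (S ∩ᵇ Long z (suc ρ)) ≤ 4 * (n * n)
        long-vol = *-cancelˡ-≤ (z + 1) ⦃ Data.Nat.>-nonZero (m≤n+m 1 z) ⦄ (≤-trans (≤-reflexive (trans (sym (*-assoc (z + 1) Y _)) (cong (_* vol (S ∩ᵇ Long z (suc ρ))) (sym q-def)))) (proj₁ uni))
        small-vol : 1024 * vol (S ∩ᵇ Long z (suc ρ)) < n * n
        small-vol = small-part Y (vol (S ∩ᵇ Long z (suc ρ))) Y-big (*-mono-≤ 1≤n 1≤n) long-vol
        r-small : suc ρ + suc ρ ≤ sb
        r-small = ≤-trans (≤-reflexive (cong₂ _+_ (sym eq) (sym eq))) (X-small e₀ (S⊆X e₀ e₀∈))
        open Stuck (stuck-data k₁ u Bf sb c₀ k₁≤k k₁-eq S ρ e₀ e₀∈ low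
          (λ j i → ≤-trans (m≤m+n (size j) _) (X-small j (S⊆X j i))) cap-half sb≤Bf
          (≤-trans (*-monoʳ-≤ 2 (∑∈-monoˡ {S = S} {X} S⊆X)) X-total) 1≤ρ)
          using (case-long; case-short; case-middle)
        decide : Coloured S A₁ Bf ⊎ Balanced
        decide with (2 + p) * (2 + p) * n ≤? (1 + p) * (1 + p) * (suc ρ * suc ρ)
        ... | yes long = inj₁ (case-long p 2≤p (≤-trans (*-monoˡ-≤ (1 + p) (m≤m+n 4 4)) (≤-trans p-r₀ r₀≤ρ)) long u-p)
        ... | no ¬long with Λ 128 * ((suc ρ + suc ρ) * (suc ρ + suc ρ)) ≤? n
        ... | yes short = inj₁ (case-short z y (≤-trans (s≤s z≤n) (≤-trans (*-monoʳ-≤ 6 (s≤s (z≤n {p}))) z-big)) 1≤y 64y 128y u≤y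
                (≤-trans Λ-r₀ r₀≤ρ) Λ-n short r-small small-vol)
        ... | no ¬short with (1 + p) * (1 + p) * (suc ρ * suc ρ) ≤? p * p * n
        ... | yes mid = inj₁ (case-middle p V M z ε v Y D (≤-trans (<⇒≤ (≰⇒> ¬short)) (≤-reflexive (square-double (Λ 128) (suc ρ)))) mid z-big (≤-trans p-r₀ r₀≤ρ) v-n n-v H-fit 1≤H 1≤AV
                n-ε M-z (≤-trans M-r₀ r₀≤ρ) 1≤u u-ε u-v 1≤v 1≤n Y-AV long-vol
                (≤-trans (≤-reflexive (cong (4 *_) (sym eq))) (X-high e₀ (S⊆X e₀ e₀∈))) (≤-reflexive (sym D-eq)) dense)
        ... | no ¬mid = inj₂ (record { S = S ; ρ = ρ ; r₀≤ρ = r₀≤ρ ; S-low = low ; below = ≰⇒> ¬long ; above = ≰⇒> ¬mid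
                                     ; few = long-vol ; dense = proj₂ uni })

      dichotomy : Coloured X A₁ Bf ⊎ Balanced
      dichotomy with peel D X
      ... | S , S⊆X , dense , rest with some S in eq
      ... | false = inj₁ (complete S S⊆X rest (coloured-cong (λ i → sym (some-false {P = S} eq i)) (coloured-∅ c₀ A₁ Bf)))
      ... | true with some-true {P = S} eq
      ... | i , i∈ with min-element {S = S} size i∈
      ... | e₀ , e₀∈ , min with stuck S S⊆X dense e₀ e₀∈ min
      ... | inj₁ C = inj₁ (complete S S⊆X rest C)
      ... | inj₂ B = inj₂ B

-- Disjoint palettes for ordinary, medium and huge edges

module SeparatedColouring where
  open FiniteSums
  open GreedyColouring
  open LinearIncidence
  open DenseSubsets
  open Extensions
  open SparseColouring
  open SavedColours
  open ColouringCases
  open import Data.Bool using (Bool; true; false; _∧_; _∨_; not)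
  open import Data.Empty using (⊥-elim)
  open import Data.Fin using (Fin; suc; toℕ)
  open import Data.Nat using (ℕ; suc; _+_; _*_; _∸_; _≤_; _<_; z≤n; s≤s; s≤s⁻¹; _<ᵇ_)
  open import Data.Nat.Properties
  open import Data.Product using (_,_; proj₁; proj₂)
  open import Data.Sum using (inj₁; inj₂)
  open import Relation.Binary.PropositionalEquality
  open import Relation.Nullary using (yes; no)

  module Assemble {n m k : ℕ} (a : Fin m → Fin n → Bool)
    (lin : ∀ i j → i ≢ j → ∀ u v → u ∈ᵇ a i → u ∈ᵇ a j → v ∈ᵇ a i → v ∈ᵇ a j → u ≡ v) where

    open Cases {n} {m} {k} a lin

    record Separated (huge : Pred m) (r₀ capM capB s : ℕ) : Set where
      field
        col      : Fin m → Fin k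
        proper   : Proper (λ _ → true) col
        unique   : ∀ i j → i ∈ᵇ huge → col j ≡ col i → j ≡ i
        Cmed     : Pred k
        Cmed-few : # Cmed ≤ s
        medium   : ∀ i → size i ≤ r₀ → col i ∈ᵇ Cmed
        inMed    : ∀ c → c ∈ᵇ Cmed → load (λ _ → true) col c ≤ capM
        outMed   : ∀ c → c ∉ᵇ Cmed → (∀ i → i ∈ᵇ huge → col i ≢ c) → load (λ _ → true) col c ≤ capB

    module _ (huge : Pred m) (r₀ : ℕ) where

      Md X : Pred m
      Md i = size i <ᵇ suc r₀
      X i = not (Md i) ∧ not (huge i)

      record Reserve : Set where
        constructor reserve
        field
          k₁ y h Bf capM G ρ₁ : ℕ
          k-eq : k₁ + (2 * y + 2 * y) + h ≡ k
          huge-few : # huge < h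
          huge-large : ∀ i → i ∈ᵇ huge → i ∉ᵇ Md
          1≤G : 1 ≤ G
          1≤y : 1 ≤ y
          n≤ : n ≤ G * y
          1≤n : 1 ≤ n
          1≤ρ₁ : 1 ≤ ρ₁
          Λ-ρ : Λ G ≤ ρ₁
          Λ-n : Λ G ≤ n
          Λ-r₀ : Λ G * (r₀ * r₀) ≤ n
          r₀≤capM : r₀ ≤ capM
          low : ∀ j → suc ρ₁ ≤ size j
          total : ∑∈ Md size ≤ y * (suc capM ∸ r₀)

      module _ (P : Reserve) where
        open Reserve P

        k₂ = k₁ + (2 * y + 2 * y)

        k₂≤k : k₂ ≤ k
        k₂≤k = ≤-trans (m≤m+n k₂ h) (≤-reflexive k-eq)

        A₁ A₂ A₃ : Pred k
        A₁ = Int 0 k₁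
        A₂ = Int k₁ k₂
        A₃ = Int k₂ (k₂ + h)

        Md∉X : ∀ i → i ∈ᵇ Md → i ∉ᵇ X
        Md∉X i p rewrite p = refl

        phase₁ : (C : Coloured X A₁ Bf) → Extension X (Coloured.col C) Md A₂ capM
        phase₁ C = sparse G k₁ y ρ₁ r₀ capM Md 1≤G 1≤y n≤ 1≤n 1≤ρ₁ Λ-ρ Λ-n Λ-r₀ r₀≤capM proper Md∉X (λ j _ → low j)
          (λ j p → s≤s⁻¹ (<ᵇ-true {size j} p)) k₂≤k
          (λ i p → ≢true⇒false (λ q → <⇒≱ (proj₂ (Int-elim {c = col i} (palette i p))) (proj₁ (Int-elim {c = col i} q)))) total
          where open Coloured C

        -- Huge edges are declared pairwise adjacent, so that properness alone gives them distinct
        -- colours even when they are disjoint.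
        adj⁺ : Fin m → Fin m → Bool
        adj⁺ i j = adj i j ∨ (not (i == j) ∧ (huge i ∧ huge j))

        adj⁺-sym : ∀ i j → adj⁺ i j ≡ true → adj⁺ j i ≡ true
        adj⁺-sym i j p with ∨-true {adj i j} p
        ... | inj₁ q = ∨-introˡ (adj-sym i j q)
        ... | inj₂ q with ∧-true {not (i == j)} q
        ... | x , y with ∧-true {huge i} y
        ... | hi , hj = ∨-introʳ {adj j i} (∧-intro (trans (cong not (==-sym j i)) x) (∧-intro hj hi))

        adj⁺-irrefl : ∀ i → adj⁺ i i ≡ false
        adj⁺-irrefl i rewrite adj-irrefl i | ==-refl i = refl

        module E⁺ = Extend {m} {k} adj⁺ adj⁺-sym adj⁺-irrefl size

        module After-medium (C : Coloured X A₁ Bf) (E₁ : Extension X (Coloured.col C) Md A₂ capM) where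
          open Coloured C renaming (col to col₀; palette to palette₀; loads to loads₀)
          open Extension E₁ renaming (col′ to col₁; agree to agree₁; proper′ to proper₁; palette to palette₁; load′ to load₁)
          D₁ = X ∪ᵇ Md
          D₁-col : ∀ i → i ∈ᵇ D₁ → toℕ (col₁ i) < k₂
          D₁-col i p with ∨-true {X i} p
          ... | inj₂ q = proj₂ (Int-elim {c = col₁ i} (palette₁ i q))
          ... | inj₁ x = <-≤-trans (subst (λ c → toℕ c < k₁) (sym (agree₁ i (≢true⇒false (λ q → true≢false x (Md∉X i q)))))
                                          (proj₂ (Int-elim {c = col₀ i} (palette₀ i x)))) (m≤m+n k₁ _)
          huge∉D₁ : ∀ i → i ∈ᵇ huge → i ∉ᵇ D₁
          huge∉D₁ i p rewrite huge-large i p | p = refl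
          proper⁺ : E⁺.Proper D₁ col₁
          proper⁺ i j p q r with ∨-true {adj i j} r
          ... | inj₁ x = proper₁ i j p q x
          ... | inj₂ x = ⊥-elim (true≢false p (huge∉D₁ i (proj₁ (∧-true {huge i} (proj₂ (∧-true {not (i == j)} x))))))
          -- Private colours need no genuine cap; this value is large enough for `F = 0`.
          capH = ∑∈ huge size + n
          phase₂ : E⁺.Extension D₁ col₁ huge A₃ capH
          phase₂ = E⁺.extend-fresh proper⁺ A₃ capH n 0 (# huge) huge huge∉D₁
            (λ i p → ≢true⇒false (λ q → <⇒≱ (D₁-col i p) (proj₁ (Int-elim {c = col₁ i} q))))
            (λ i _ → #≤n (a i))
            (≤-reflexive (sym (trans (+-identityʳ _) (m+n∸n≡m (suc (∑∈ huge size)) n))))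
            (≤-trans (≤-trans (s≤s (≤-reflexive (+-identityʳ _))) huge-few) (≤-reflexive (sym (#-Int {k} k₂ h (≤-reflexive k-eq)))))
            (λ S′ sub i p → i , p , #-mono (λ j q → sub j (proj₁ (∧-true {S′ j} q))))

          module After-huge (E₂ : E⁺.Extension D₁ col₁ huge A₃ capH) where
            open E⁺.Extension E₂ renaming (col′ to col₂; agree to agree₂; proper′ to proper₂; palette to palette₂)
            all : ∀ i → (D₁ ∪ᵇ huge) i ≡ true
            all i with Md i | huge i
            ... | true | _ = refl
            ... | false | true = refl
            ... | false | false = refl
            old : ∀ i → i ∉ᵇ huge → i ∈ᵇ D₁
            old i p with ∨-true {D₁ i} (all i)
            ... | inj₁ q = q
            ... | inj₂ q = ⊥-elim (true≢false q p)
            low-load : ∀ c → toℕ c < k₂ → load (λ _ → true) col₂ c ≡ load D₁ col₁ c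
            low-load c lt = ∑-cong pt
              where
              pt : ∀ i → 1 * (𝟙 (col₂ i == c) * size i) ≡ 𝟙 (D₁ i) * (𝟙 (col₁ i == c) * size i)
              pt i with dec-Bool (huge i)
              ... | inj₂ q = cong₂ (λ b x → 𝟙 b * (𝟙 (x == c) * size i)) (sym (old i q)) (agree₂ i q)
              ... | inj₁ q rewrite huge∉D₁ i q | ≢⇒== {i = col₂ i} {c} (λ r → <⇒≱ lt (subst (λ x → k₂ ≤ toℕ x) r (proj₁ (Int-elim {c = col₂ i} (palette₂ i q))))) = refl
            med-load : ∀ c → c ∈ᵇ A₂ → load D₁ col₁ c ≤ capM
            med-load c p with load₁ c
            ... | inj₂ q = q
            ... | inj₁ q = ≤-trans (≤-reflexive (trans q (∑-0 pt))) z≤n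
              where
              pt : ∀ i → 𝟙 (X i) * (𝟙 (col₀ i == c) * size i) ≡ 0
              pt i with dec-Bool (X i)
              ... | inj₂ x = cong (λ b → 𝟙 b * (𝟙 (col₀ i == c) * size i)) x
              ... | inj₁ x rewrite x | ≢⇒== {i = col₀ i} {c} (λ r → <⇒≱ (proj₂ (Int-elim {c = col₀ i} (palette₀ i x))) (subst (λ w → k₁ ≤ toℕ w) (sym r) (proj₁ (Int-elim {c = c} p)))) = refl
            main-load : ∀ c → toℕ c < k₁ → load D₁ col₁ c ≤ Bf
            main-load c lt = ≤-trans (≤-reflexive (∑-cong pt)) (loads₀ c)
              where
              pt : ∀ i → 𝟙 (D₁ i) * (𝟙 (col₁ i == c) * size i) ≡ 𝟙 (X i) * (𝟙 (col₀ i == c) * size i)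
              pt i with dec-Bool (Md i)
              ... | inj₂ q = cong₂ (λ b x → 𝟙 b * (𝟙 (x == c) * size i)) (trans (cong (X i ∨_) q) (∨-false (X i))) (agree₁ i q)
                where
                ∨-false : ∀ x → x ∨ false ≡ x
                ∨-false true = refl
                ∨-false false = refl
              ... | inj₁ q = trans (cong (𝟙 (D₁ i) *_) zero-size) (trans (*-zeroʳ (𝟙 (D₁ i))) (sym (cong (λ b → 𝟙 b * (𝟙 (col₀ i == c) * size i)) (Md∉X i q))))
                where
                zero-size : 𝟙 (col₁ i == c) * size i ≡ 0
                zero-size rewrite ≢⇒== {i = col₁ i} {c} (λ r → <⇒≱ lt (subst (λ w → k₁ ≤ toℕ w) r (proj₁ (Int-elim {c = col₁ i} (palette₁ i q))))) = refl
            result : Separated huge r₀ capM Bf (2 * y + 2 * y)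
            result = record
              { col = col₂
              ; proper = λ i j _ _ r → proper₂ i j (all i) (all j) (∨-introˡ r)
              ; unique = unique
              ; Cmed = A₂
              ; Cmed-few = ≤-reflexive (#-Int {k} k₁ (2 * y + 2 * y) k₂≤k)
              ; medium = λ i p → let q = <ᵇ-intro {size i} (s≤s p) in
                  subst (_∈ᵇ A₂) (sym (agree₂ i (≢true⇒false (λ z → true≢false q (huge-large i z))))) (palette₁ i q)
              ; inMed = λ c p → ≤-trans (≤-reflexive (low-load c (proj₂ (Int-elim {c = c} p)))) (med-load c p)
              ; outMed = outMed }
              where
              unique : ∀ i j → i ∈ᵇ huge → col₂ j ≡ col₂ i → j ≡ i
              unique i j hi eq with dec-Bool (j == i)
              ... | inj₁ q = ==⇒≡ q
              ... | inj₂ q with dec-Bool (huge j)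
              ... | inj₁ hj = ⊥-elim (proper₂ j i (all j) (all i) (∨-introʳ {adj j i} (∧-intro (not-intro q) (∧-intro hj hi))) eq)
              ... | inj₂ hj = ⊥-elim (<⇒≱ (subst (λ x → toℕ x < k₂) (trans (sym (agree₂ j hj)) eq) (D₁-col j (old j hj))) (proj₁ (Int-elim {c = col₂ i} (palette₂ i hi))))
              outMed : ∀ c → c ∉ᵇ A₂ → (∀ i → i ∈ᵇ huge → col₂ i ≢ c) → load (λ _ → true) col₂ c ≤ Bf
              outMed c p none with toℕ c <? k₁
              ... | yes lt = ≤-trans (≤-reflexive (low-load c (<-≤-trans lt (m≤m+n k₁ _)))) (main-load c lt)
              ... | no ≥k₁ = ≤-trans (≤-reflexive (∑-0 pt)) z≤n
                where
                k₂≤c : k₂ ≤ toℕ c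
                k₂≤c = ≮⇒≥ (λ q → true≢false (Int-intro {c = c} (≮⇒≥ ≥k₁) q) p)
                pt : ∀ i → 1 * (𝟙 (col₂ i == c) * size i) ≡ 0
                pt i with dec-Bool (huge i)
                ... | inj₁ q rewrite ≢⇒== {i = col₂ i} {c} (none i q) = refl
                ... | inj₂ q rewrite ≢⇒== {i = col₂ i} {c} (λ r → <⇒≱ (subst (λ x → toℕ x < k₂) (trans (sym (agree₂ i q)) r) (D₁-col i (old i q))) k₂≤c) = refl

        separated : Coloured X A₁ Bf → Separated huge r₀ capM Bf (2 * y + 2 * y)
        separated C = After-medium.After-huge.result C (phase₁ C) (After-medium.phase₂ C (phase₁ C))

-- Choice of scales and assembly of the two outcomes

module Parameters where
  open FiniteSums
  open GreedyColouring
  open LinearIncidence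
  open DenseSubsets
  open Extensions
  open SavedColours
  open ColouringCases
  open NearPlanes
  open StructureDichotomy
  open SeparatedColouring
  open PolynomialIdentities using (polynomial; _:=_; _:+_; _:*_; con)
  open import Data.Bool using (Bool; not)
  open import Data.Empty using (⊥-elim)
  open import Data.Fin using (Fin; zero; suc)
  import Data.Fin as Fin
  open import Data.Nat using (ℕ; zero; suc; _+_; _*_; _∸_; _≤_; _<_; z≤n; s≤s; s≤s⁻¹)
  open import Data.Nat.Properties
  open import Data.Nat.Tactic.RingSolver using (solve-∀)
  open import Data.Product using (∃; _×_; _,_; proj₁; proj₂)
  open import Data.Sum using (_⊎_; inj₁; inj₂)
  open import Data.Vec using ([]; _∷_)
  open import Relation.Binary.PropositionalEquality
  unit-up : ∀ n U u → n < U + U * u → 1 ≤ u → n ≤ 2 * U * u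
  unit-up n U u h1 h2 = farkas 0 (+-mono-≤ h1 (*-monoʳ-≤ U h2))
    (polynomial (n ∷ U ∷ u ∷ []) (λ n U u → con 1 :* n :+ ((U :+ U :* u) :+ U :* u) :+ con 1 := con 1 :* (con 2 :* U :* u) :+ ((con 1 :+ n) :+ U :* con 1)) refl)

  eps-u : ∀ U u M ε n → U * u ≤ n → n ≤ 2 * M * ε → 2 * M * 68 ≤ U → 2 * M * (68 * u) ≤ 2 * M * ε
  eps-u U u M ε n h1 h2 h3 = farkas 0 (+-mono-≤ (+-mono-≤ h1 h2) (*-monoʳ-≤ u h3))
    (polynomial (U ∷ u ∷ M ∷ ε ∷ n ∷ []) (λ U u M ε n → con 1 :* (con 2 :* M :* (con 68 :* u)) :+ (n :+ (con 2 :* M :* ε) :+ u :* U) :+ con 0 := con 1 :* (con 2 :* M :* ε) :+ ((U :* u) :+ n :+ u :* (con 2 :* M :* con 68))) refl)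

  y-u : ∀ U u y n → U * u ≤ n → n ≤ 128 * y → 128 ≤ U → 128 * u ≤ 128 * y
  y-u U u y n h1 h2 h3 = farkas 0 (+-mono-≤ (+-mono-≤ h1 h2) (*-monoʳ-≤ u h3))
    (polynomial (U ∷ u ∷ y ∷ n ∷ []) (λ U u y n → con 1 :* (con 128 :* u) :+ (n :+ (con 128 :* y) :+ u :* U) :+ con 0 := con 1 :* (con 128 :* y) :+ ((U :* u) :+ n :+ u :* con 128)) refl)

  y1-u : ∀ U u g x n → g * x ≤ n → n ≤ 2 * U * u → U ≤ g → U * x ≤ U * (2 * u)
  y1-u U u g x n h1 h2 h3 = farkas 0 (+-mono-≤ (+-mono-≤ h1 h2) (*-monoʳ-≤ x h3))
    (polynomial (U ∷ u ∷ g ∷ x ∷ n ∷ []) (λ U u g x n → con 1 :* (U :* x) :+ (n :+ (con 2 :* U :* u) :+ x :* g) :+ con 0 := con 1 :* (U :* (con 2 :* u)) :+ ((g :* x) :+ n :+ x :* U)) refl)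

  x-tot : ∀ n U u b B r T → r * T ≤ n * n → n ≤ 2 * U * u → n ≤ 2 * b * B → 8 * U * b ≤ r → 4 * U * b * (2 * T) ≤ 4 * U * b * (u * B)
  x-tot n U u b B r T h1 h2 h3 h4 = farkas 0 (+-mono-≤ (+-mono-≤ (+-mono-≤ (+-mono-≤ h1 (*-monoʳ-≤ n h2)) (*-monoʳ-≤ n h3)) (*-monoʳ-≤ T h4)) (≤-prod h2 h3))
    (polynomial (n ∷ U ∷ u ∷ b ∷ B ∷ r ∷ T ∷ []) (λ n U u b B r T → con 1 :* (con 4 :* U :* b :* (con 2 :* T)) :+ ((n :* n) :+ n :* (con 2 :* U :* u) :+ n :* (con 2 :* b :* B) :+ T :* r :+ ((con 2 :* U :* u) :* (con 2 :* b :* B) :+ n :* n)) :+ con 0 := con 1 :* (con 4 :* U :* b :* (u :* B)) :+ ((r :* T) :+ n :* n :+ n :* n :+ T :* (con 8 :* U :* b) :+ (n :* (con 2 :* b :* B) :+ (con 2 :* U :* u) :* n))) refl)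

  med-tot : ∀ n g x r T w → r * T ≤ n * n → n ≤ 2 * g * x → x ≤ 2 * w → 8 * g * g ≤ r → 8 * g * g * T ≤ 8 * g * g * (x * w)
  med-tot n g x r T w h1 h2 h3 h4 = farkas 0 (+-mono-≤ (+-mono-≤ (+-mono-≤ (+-mono-≤ h1 (*-monoʳ-≤ (2 * n) h2)) (*-monoʳ-≤ (4 * g * g * x) h3)) (*-monoʳ-≤ T h4)) (≤-prod h2 h2))
    (polynomial (n ∷ g ∷ x ∷ r ∷ T ∷ w ∷ []) (λ n g x r T w → con 1 :* (con 8 :* g :* g :* T) :+ ((n :* n) :+ (con 2 :* n) :* (con 2 :* g :* x) :+ (con 4 :* g :* g :* x) :* (con 2 :* w) :+ T :* r :+ ((con 2 :* g :* x) :* (con 2 :* g :* x) :+ n :* n)) :+ con 0 := con 1 :* (con 8 :* g :* g :* (x :* w)) :+ ((r :* T) :+ (con 2 :* n) :* n :+ (con 4 :* g :* g :* x) :* x :+ T :* (con 8 :* g :* g) :+ (n :* (con 2 :* g :* x) :+ (con 2 :* g :* x) :* n))) refl)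

  tot1 : ∀ n c f g x r w → n ≤ 32 * c * f → n ≤ 2 * g * x → x ≤ 2 * w → 128 * c * g ≤ r → n * n ≤ r * (f * w)
  tot1 n c f g x r w h1 h2 h3 h4 = farkas 0 (+-mono-≤ (+-mono-≤ (+-mono-≤ (+-mono-≤ (*-monoʳ-≤ n h1) (*-monoʳ-≤ n h2)) (*-monoʳ-≤ (64 * c * f * g) h3)) (*-monoʳ-≤ (f * w) h4)) (≤-prod h1 h2))
    (polynomial (n ∷ c ∷ f ∷ g ∷ x ∷ r ∷ w ∷ []) (λ n c f g x r w → con 1 :* (n :* n) :+ (n :* (con 32 :* c :* f) :+ n :* (con 2 :* g :* x) :+ (con 64 :* c :* f :* g) :* (con 2 :* w) :+ (f :* w) :* r :+ ((con 32 :* c :* f) :* (con 2 :* g :* x) :+ n :* n)) :+ con 0 := con 1 :* (r :* (f :* w)) :+ (n :* n :+ n :* n :+ (con 64 :* c :* f :* g) :* x :+ (f :* w) :* (con 128 :* c :* g) :+ (n :* (con 2 :* g :* x) :+ (con 32 :* c :* f) :* n))) refl)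

  bad1 : ∀ n c f g x Z → n ≤ 32 * c * f → n ≤ 2 * g * x → 64 * c * g ≤ Z → n * n ≤ Z * (f * (1 + x))
  bad1 n c f g x Z h1 h2 h3 = farkas 0 (+-mono-≤ (+-mono-≤ (+-mono-≤ (*-monoʳ-≤ n h1) (*-monoʳ-≤ n h2)) (*-monoʳ-≤ (f * x) h3)) (≤-prod h1 h2))
    (polynomial (n ∷ c ∷ f ∷ g ∷ x ∷ Z ∷ []) (λ n c f g x Z → con 1 :* (n :* n) :+ (n :* (con 32 :* c :* f) :+ n :* (con 2 :* g :* x) :+ (f :* x) :* Z :+ ((con 32 :* c :* f) :* (con 2 :* g :* x) :+ n :* n)) :+ (Z :* f) := con 1 :* (Z :* (f :* (con 1 :+ x))) :+ (n :* n :+ n :* n :+ (f :* x) :* (con 64 :* c :* g) :+ (n :* (con 2 :* g :* x) :+ (con 32 :* c :* f) :* n))) refl)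

  meddeg : ∀ n c f r Z → n ≤ 32 * c * f → 32 * c * r ≤ Z → r * n ≤ f * Z
  meddeg n c f r Z h1 h2 = farkas 0 (+-mono-≤ (*-monoʳ-≤ r h1) (*-monoʳ-≤ f h2))
    (polynomial (n ∷ c ∷ f ∷ r ∷ Z ∷ []) (λ n c f r Z → con 1 :* (r :* n) :+ (r :* (con 32 :* c :* f) :+ f :* Z) :+ con 0 := con 1 :* (f :* Z) :+ (r :* n :+ f :* (con 32 :* c :* r))) refl)

  t-low : ∀ r t x κ₃ → κ₃ * x ≤ r → r ≤ t + x → κ₃ * r ≤ κ₃ * t + r
  t-low r t x κ₃ h1 h2 = farkas 0 (+-mono-≤ h1 (*-monoʳ-≤ κ₃ h2))
    (polynomial (r ∷ t ∷ x ∷ κ₃ ∷ []) (λ r t x κ₃ → con 1 :* (κ₃ :* r) :+ (r :+ κ₃ :* (t :+ x)) :+ con 0 := con 1 :* (κ₃ :* t :+ r) :+ ((κ₃ :* x) :+ κ₃ :* r)) refl)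

  t-big1 : ∀ r t k → (2 + k) * r ≤ (2 + k) * (1 + t) + r → 2 + k ≤ r → (2 + k) * ((2 + k) * (r * r)) ≤ (2 + k) * ((2 + k) * ((1 + t) * t) + 3 * (r * r))
  t-big1 r t k h1 h2 = farkas 0 (+-mono-≤ (*-monoʳ-≤ (r + 2 * t + k * r + k * t) h1) (*-monoʳ-≤ (r + k * r) h2))
    (polynomial (r ∷ t ∷ k ∷ []) (λ r t k → con 1 :* ((con 2 :+ k) :* ((con 2 :+ k) :* (r :* r))) :+ ((r :+ con 2 :* t :+ k :* r :+ k :* t) :* ((con 2 :+ k) :* (con 1 :+ t) :+ r) :+ (r :+ k :* r) :* r) :+ (con 2 :* r :* r) := con 1 :* ((con 2 :+ k) :* ((con 2 :+ k) :* ((con 1 :+ t) :* t) :+ con 3 :* (r :* r))) :+ ((r :+ con 2 :* t :+ k :* r :+ k :* t) :* ((con 2 :+ k) :* r) :+ (r :+ k :* r) :* (con 2 :+ k))) refl)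

  t-big2 : ∀ p n r₂ → p * p * n ≤ (1 + p) * (1 + p) * r₂ → (1 + p) * ((1 + p) * n) ≤ (1 + p) * ((1 + p) * r₂ + 2 * n)
  t-big2 p n r₂ h1 = farkas 0 h1
    (polynomial (p ∷ n ∷ r₂ ∷ []) (λ p n r₂ → con 1 :* ((con 1 :+ p) :* ((con 1 :+ p) :* n)) :+ (((con 1 :+ p) :* (con 1 :+ p) :* r₂)) :+ n := con 1 :* ((con 1 :+ p) :* ((con 1 :+ p) :* r₂ :+ con 2 :* n)) :+ ((p :* p :* n))) refl)

  t-big3 : ∀ κ n r₂ R → 8 * (1 + κ) * n ≤ 8 * (1 + κ) * r₂ + 2 * n → 8 * (1 + κ) * r₂ ≤ 8 * (1 + κ) * R + 3 * r₂ → r₂ ≤ 2 * n → 8 * (κ * n) ≤ 8 * ((1 + κ) * R)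
  t-big3 κ n r₂ R h1 h2 h3 = farkas 0 (+-mono-≤ (+-mono-≤ h1 h2) (*-monoʳ-≤ 3 h3))
    (polynomial (κ ∷ n ∷ r₂ ∷ R ∷ []) (λ κ n r₂ R → con 1 :* (con 8 :* (κ :* n)) :+ ((con 8 :* (con 1 :+ κ) :* r₂ :+ con 2 :* n) :+ (con 8 :* (con 1 :+ κ) :* R :+ con 3 :* r₂) :+ con 3 :* (con 2 :* n)) :+ con 0 := con 1 :* (con 8 :* ((con 1 :+ κ) :* R)) :+ ((con 8 :* (con 1 :+ κ) :* n) :+ (con 8 :* (con 1 :+ κ) :* r₂) :+ con 3 :* r₂)) refl)

  r-2n : ∀ p n r₂ → (1 + p) * (1 + p) * r₂ ≤ (2 + p) * (2 + p) * n → 2 ≤ p → (1 + p) * (1 + p) * r₂ ≤ (1 + p) * (1 + p) * (2 * n)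
  r-2n p n r₂ h1 h2 = farkas 1 (+-mono-≤ (*-monoʳ-≤ 2 h1) (*-monoʳ-≤ (2 * n + n * p) h2))
    (polynomial (p ∷ n ∷ r₂ ∷ []) (λ p n r₂ → con 2 :* ((con 1 :+ p) :* (con 1 :+ p) :* r₂) :+ (con 2 :* ((con 2 :+ p) :* (con 2 :+ p) :* n) :+ (con 2 :* n :+ n :* p) :* p) :+ (n :* p :* p) := con 2 :* ((con 1 :+ p) :* (con 1 :+ p) :* (con 2 :* n)) :+ (con 2 :* ((con 1 :+ p) :* (con 1 :+ p) :* r₂) :+ (con 2 :* n :+ n :* p) :* con 2)) refl)

  t-half-arith : ∀ κ n R → κ * n ≤ (1 + κ) * R → 1 ≤ κ → κ * n ≤ κ * (2 * R)
  t-half-arith κ n R h1 h2 = farkas 0 (+-mono-≤ h1 (*-monoʳ-≤ R h2))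
    (polynomial (κ ∷ n ∷ R ∷ []) (λ κ n R → con 1 :* (κ :* n) :+ (((con 1 :+ κ) :* R) :+ R :* κ) :+ con 0 := con 1 :* (κ :* (con 2 :* R)) :+ ((κ :* n) :+ R :* con 1)) refl)

  th-big : ∀ n R X T → 10 * n ≤ 10 * R + R → R ≤ X + T → 100 * T ≤ R → 9 * n ≤ 10 * X
  th-big n R X T h1 h2 h3 = farkas 9 (+-mono-≤ (+-mono-≤ (*-monoʳ-≤ 9 h1) (*-monoʳ-≤ 100 h2)) h3)
    (polynomial (n ∷ R ∷ X ∷ T ∷ []) (λ n R X T → con 10 :* (con 9 :* n) :+ (con 9 :* (con 10 :* R :+ R) :+ con 100 :* (X :+ T) :+ R) :+ con 0 := con 10 :* (con 10 :* X) :+ (con 9 :* (con 10 :* n) :+ con 100 :* R :+ (con 100 :* T))) refl)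

  t-up : ∀ κ₃ t x r → r < κ₃ + κ₃ * x → t + x ≤ r → κ₃ * t + r ≤ κ₃ * r + κ₃
  t-up κ₃ t x r h1 h2 = farkas 0 (+-mono-≤ h1 (*-monoʳ-≤ κ₃ h2))
    (polynomial (κ₃ ∷ t ∷ x ∷ r ∷ []) (λ κ₃ t x r → con 1 :* (κ₃ :* t :+ r) :+ ((κ₃ :+ κ₃ :* x) :+ κ₃ :* r) :+ con 1 := con 1 :* (κ₃ :* r :+ κ₃) :+ ((con 1 :+ r) :+ κ₃ :* (t :+ x))) refl)

  t-rho : ∀ κ₃ t ρ → κ₃ * t + (1 + ρ) ≤ κ₃ * (1 + ρ) + κ₃ → 5 * κ₃ ≤ ρ → 1 ≤ κ₃ → κ₃ * ((1 + 2 * κ₃) * t) ≤ κ₃ * (2 * κ₃ * ρ)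
  t-rho κ₃ t ρ h1 h2 h3 = farkas 4 (+-mono-≤ (+-mono-≤ (*-monoʳ-≤ (5 + 10 * κ₃) h1) (*-monoʳ-≤ (4 * κ₃) h2)) (*-monoʳ-≤ ρ h3))
    (polynomial (κ₃ ∷ t ∷ ρ ∷ []) (λ κ₃ t ρ → con 5 :* (κ₃ :* ((con 1 :+ con 2 :* κ₃) :* t)) :+ ((con 5 :+ con 10 :* κ₃) :* (κ₃ :* (con 1 :+ ρ) :+ κ₃) :+ (con 4 :* κ₃) :* ρ :+ ρ :* κ₃) :+ (con 5 :+ con 6 :* ρ) := con 5 :* (κ₃ :* (con 2 :* κ₃ :* ρ)) :+ ((con 5 :+ con 10 :* κ₃) :* (κ₃ :* t :+ (con 1 :+ ρ)) :+ (con 4 :* κ₃) :* (con 5 :* κ₃) :+ ρ :* con 1)) refl)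

  wvol : ∀ q Y Ξ n2 S W L → q * n2 ≤ q * S + 4 * n2 → Y * n2 ≤ Y * S + 4 * n2 → S ≤ L + W → Y * L ≤ 4 * n2 → 8 * Ξ ≤ Y → Y * n2 ≤ Y * W + 8 * n2
  wvol q Y Ξ n2 S W L h1 h2 h3 h4 h5 = farkas 0 (+-mono-≤ (+-mono-≤ h2 (*-monoʳ-≤ Y h3)) h4)
    (polynomial (q ∷ Y ∷ Ξ ∷ n2 ∷ S ∷ W ∷ L ∷ []) (λ q Y Ξ n2 S W L → con 1 :* (Y :* n2) :+ ((Y :* S :+ con 4 :* n2) :+ Y :* (L :+ W) :+ (con 4 :* n2)) :+ con 0 := con 1 :* (Y :* W :+ con 8 :* n2) :+ ((Y :* n2) :+ Y :* S :+ (Y :* L))) refl)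

  wvol2 : ∀ Ξ n2 W → 8 * Ξ * n2 ≤ 8 * Ξ * W + 8 * n2 → 8 * (Ξ * n2) ≤ 8 * (Ξ * W + n2)
  wvol2 Ξ n2 W h1 = farkas 0 h1
    (polynomial (Ξ ∷ n2 ∷ W ∷ []) (λ Ξ n2 W → con 1 :* (con 8 :* (Ξ :* n2)) :+ ((con 8 :* Ξ :* W :+ con 8 :* n2)) :+ con 0 := con 1 :* (con 8 :* (Ξ :* W :+ n2)) :+ ((con 8 :* Ξ :* n2))) refl)

  tB : ∀ t n B b → t * t ≤ 2 * n → n ≤ 2 * b * B → B ≤ 2 * t → n * n ≤ n * (32 * b * b)
  tB t n B b h1 h2 h3 = farkas 0 (+-mono-≤ (+-mono-≤ (+-mono-≤ (*-monoʳ-≤ (16 * b * b) h1) (*-monoʳ-≤ (2 * n) h2)) (*-monoʳ-≤ (4 * B * b * b + 8 * b * b * t) h3)) (≤-prod h2 h2))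
    (polynomial (t ∷ n ∷ B ∷ b ∷ []) (λ t n B b → con 1 :* (n :* n) :+ ((con 16 :* b :* b) :* (con 2 :* n) :+ (con 2 :* n) :* (con 2 :* b :* B) :+ (con 4 :* B :* b :* b :+ con 8 :* b :* b :* t) :* (con 2 :* t) :+ ((con 2 :* b :* B) :* (con 2 :* b :* B) :+ n :* n)) :+ con 0 := con 1 :* (n :* (con 32 :* b :* b)) :+ ((con 16 :* b :* b) :* (t :* t) :+ (con 2 :* n) :* n :+ (con 4 :* B :* b :* b :+ con 8 :* b :* b :* t) :* B :+ (n :* (con 2 :* b :* B) :+ (con 2 :* b :* B) :* n))) refl)

  fpp-lo : ∀ K p n r₂ s₂ → K ≤ 1 + p → p * p * n ≤ (1 + p) * (1 + p) * r₂ → r₂ ≤ s₂ → p * p * n ≤ (1 + p) * (1 + p) * s₂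
  fpp-lo K p n r₂ s₂ h1 h2 h3 = farkas 0 (+-mono-≤ h2 (*-monoʳ-≤ (1 + 2 * p + p * p) h3))
    (polynomial (K ∷ p ∷ n ∷ r₂ ∷ s₂ ∷ []) (λ K p n r₂ s₂ → con 1 :* (p :* p :* n) :+ (((con 1 :+ p) :* (con 1 :+ p) :* r₂) :+ (con 1 :+ con 2 :* p :+ p :* p) :* s₂) :+ con 0 := con 1 :* ((con 1 :+ p) :* (con 1 :+ p) :* s₂) :+ ((p :* p :* n) :+ (con 1 :+ con 2 :* p :+ p :* p) :* r₂)) refl)

  fpp-up : ∀ K z p → 4 * K ≤ z → 4 * K ≤ p → 1 ≤ K → K * (z + 1) * (2 + p) ≤ (K + 1) * z * (1 + p)
  fpp-up K z p h1 h2 h3 = farkas 3 (+-mono-≤ (*-monoʳ-≤ (2 + p) h1) (*-monoʳ-≤ z h2))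
    (polynomial (K ∷ z ∷ p ∷ []) (λ K z p → con 4 :* (K :* (z :+ con 1) :* (con 2 :+ p)) :+ ((con 2 :+ p) :* z :+ z :* p) :+ (con 2 :* z :+ con 2 :* p :* z) := con 4 :* ((K :+ con 1) :* z :* (con 1 :+ p)) :+ ((con 2 :+ p) :* (con 4 :* K) :+ z :* (con 4 :* K))) refl)

  small-w : ∀ K r n → r ≤ 2 * n → 32 * K * K ≤ n → 16 * K * K * r ≤ n * n
  small-w K r n h1 h2 = farkas 0 (+-mono-≤ (*-monoʳ-≤ (16 * K * K) h1) (*-monoʳ-≤ n h2))
    (polynomial (K ∷ r ∷ n ∷ []) (λ K r n → con 1 :* (con 16 :* K :* K :* r) :+ ((con 16 :* K :* K) :* (con 2 :* n) :+ n :* n) :+ con 0 := con 1 :* (n :* n) :+ ((con 16 :* K :* K) :* r :+ n :* (con 32 :* K :* K))) refl)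

  cmed : ∀ g c f n → 16 * c * f ≤ n → g ≤ 2 * c → g * (8 * f) ≤ n
  cmed g c f n h1 h2 = farkas 0 (+-mono-≤ h1 (*-monoʳ-≤ (8 * f) h2))
    (polynomial (g ∷ c ∷ f ∷ n ∷ []) (λ g c f n → con 1 :* (g :* (con 8 :* f)) :+ (n :+ (con 8 :* f) :* (con 2 :* c)) :+ con 0 := con 1 :* n :+ ((con 16 :* c :* f) :+ (con 8 :* f) :* g)) refl)

  k-sig : ∀ k u U n → k + 23 * u ≤ n → n ≤ 2 * U * u → 2 * U * k + n ≤ 2 * U * n
  k-sig k u U n h1 h2 = farkas 0 (+-mono-≤ (*-monoʳ-≤ (2 * U) h1) h2)
    (polynomial (k ∷ u ∷ U ∷ n ∷ []) (λ k u U n → con 1 :* (con 2 :* U :* k :+ n) :+ ((con 2 :* U) :* n :+ (con 2 :* U :* u)) :+ (con 44 :* U :* u) := con 1 :* (con 2 :* U :* n) :+ ((con 2 :* U) :* (k :+ con 23 :* u) :+ n)) refl)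

  open import Data.Sum using ([_,_]′)
  open import Data.Nat.DivMod using (_/_; _%_; m≡m%n+[m/n]*n; m%n<n; m/n*n≤m)

  -- Reads a ≤ b + c/P, which becomes weaker when `P` is replaced by a smaller `Q`.
  scale-down : ∀ Q P a b c → Q ≤ P → P * a ≤ P * b + c → Q * a ≤ Q * b + c
  scale-down Q P a b c Q≤P h with ≤-total a b
  ... | inj₁ a≤b = ≤-trans (*-monoʳ-≤ Q a≤b) (m≤m+n _ c)
  ... | inj₂ b≤a with m≤n⇒∃[o]m+o≡n b≤a
  ... | d , refl = ≤-trans (≤-reflexive (*-distribˡ-+ Q b d)) (+-monoʳ-≤ (Q * b) (≤-trans (*-monoˡ-≤ d Q≤P)
          (+-cancelˡ-≤ (P * b) _ _ (≤-trans (≤-reflexive (sym (*-distribˡ-+ P b d))) h))))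

  sq-cancel : ∀ {x y} → x * x ≤ y * y → x ≤ y
  sq-cancel {x} {y} h = ≮⇒≥ (λ lt → <⇒≱ (*-mono-< lt lt) h)

  Z₁ : ∀ a b c d → a ≤ a + b + c + d
  Z₁ a b c d = ≤-trans (m≤m+n a b) (≤-trans (m≤m+n (a + b) c) (m≤m+n (a + b + c) d))

  Z₂ : ∀ a b c d → b ≤ a + b + c + d
  Z₂ a b c d = ≤-trans (m≤n+m b a) (≤-trans (m≤m+n (a + b) c) (m≤m+n (a + b + c) d))

  Z₃ : ∀ a b c d → c ≤ a + b + c + d
  Z₃ a b c d = ≤-trans (m≤n+m c (a + b)) (m≤m+n (a + b + c) d)

  -- The integer part of n/N, known up to a factor 2, so that units for different `N` can be
  -- compared through their constants.
  record Unit (N n : ℕ) : Set where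
    field
      unit  : ℕ
      lower : N * unit ≤ n
      upper : n ≤ 2 * N * unit
      pos   : 1 ≤ unit

  unit-of′ : ∀ N n → 1 ≤ N → N ≤ n → Unit N n
  unit-of′ (suc N) n _ N≤n = record { unit = u ; lower = low ; pos = pos′ ; upper = unit-up n (suc N) u up pos′ }
    where
    u = n / suc N
    low : suc N * u ≤ n
    low = ≤-trans (≤-reflexive (*-comm (suc N) u)) (m/n*n≤m n (suc N))
    up : n < suc N + suc N * u
    up = ≤-<-trans (≤-reflexive (trans (m≡m%n+[m/n]*n n (suc N)) (cong (n % suc N +_) (*-comm u (suc N))))) (+-monoˡ-< (suc N * u) (m%n<n n (suc N)))
    pos′ : 1 ≤ u
    pos′ with u | up
    ... | zero | q = ⊥-elim (<⇒≱ q (≤-trans (≤-reflexive (trans (cong (suc N +_) (*-zeroʳ (suc N))) (+-identityʳ _))) N≤n))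
    ... | suc _ | _ = s≤s z≤n

  opaque
    unit-of : ∀ N n → 1 ≤ N → N ≤ n → Unit N n
    unit-of = unit-of′

  -- In the middle case n ≤ A · r² with A = 4Λ(128), so the number of edges is at most n²/r(r - 1) ≤
  -- 2An = Cn.
  C : ℕ
  C = 2 * (4 * Λ 128)

  double-sum : ∀ t x → t + x + (t + x) ≡ t + t + 2 * x
  double-sum = solve-∀

  -- The cut-off is t = r - ⌊r/(2 + k)⌋ with r = suc ρ; the lower bound on ρ only ensures t ≥ 2, so
  -- that t = 2 + θ.
  cut : ∀ ρ k → 5 * (2 + k) ≤ ρ → ∃ λ θ → ∃ λ x → 2 + θ + x ≡ suc ρ × (2 + k) * x ≤ suc ρ × suc ρ < 2 + k + (2 + k) * x
  cut ρ k big = t ∸ 2 , x , trans (cong (_+ x) (m+[n∸m]≡n t≥2)) t+x , lo , hi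
    where
    r = suc ρ
    x = r / (2 + k)
    t = r ∸ x
    lo : (2 + k) * x ≤ r
    lo = ≤-trans (≤-reflexive (*-comm (2 + k) x)) (m/n*n≤m r (2 + k))
    hi : r < 2 + k + (2 + k) * x
    hi = ≤-<-trans (≤-reflexive (trans (m≡m%n+[m/n]*n r (2 + k)) (cong (r % (2 + k) +_) (*-comm x (2 + k))))) (+-monoˡ-< ((2 + k) * x) (m%n<n r (2 + k)))
    t+x : t + x ≡ r
    t+x = m∸n+n≡m (≤-trans (m≤m+n x (suc k * x)) lo)
    r≤2t : r ≤ t + t
    r≤2t = +-cancelʳ-≤ r r (t + t) (≤-trans (≤-reflexive (cong₂ _+_ (sym t+x) (sym t+x)))
      (≤-trans (≤-reflexive (double-sum t x)) (+-monoʳ-≤ (t + t) (≤-trans (*-monoˡ-≤ x (m≤m+n 2 k)) lo))))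
    t≥2 : 2 ≤ t
    t≥2 = ≮⇒≥ (λ lt → <⇒≱ (s≤s (≤-trans (m≤m+n 2 8) (≤-trans (*-monoʳ-≤ 5 (m≤m+n 2 k)) big))) (≤-trans r≤2t (+-mono-≤ (s≤s⁻¹ lt) (s≤s⁻¹ lt))))

  -- The constants determined by δ and γ₂ alone, through `K` and `g₂`. `M-def` is arranged so that
  -- Mε = Vv when v is the number of rounds needed for a saving of ε.
  record Const (K g₂ : ℕ) : Set where
    field
      p V M z Y q U c Ξ κ k₃ : ℕ
    κ₃ : ℕ
    κ₃ = 2 + k₃
    field
      1≤K : 1 ≤ K
      2≤p : 2 ≤ p
      p-κ : 8 * (1 + κ) ≤ p
      p-K : 4 * K ≤ p
      κ-big : 161 ≤ κ
      κ₃-κ : 8 * (1 + κ) ≤ κ₃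
      V-def : V ≡ 32 * (1 + p)
      M-def : M ≡ V * ((1 + 2 * C * C * V) * (2 * C * V))
      1≤M : 1 ≤ M
      V≤M : V ≤ M
      z-def : z ≡ 8 * M
      q-def : q ≡ (z + 1) * Y
      2≤q : 2 ≤ q
      Y≤q : Y ≤ q
      U-def : U ≡ 64 * q
      U-M : 2 * M * 68 ≤ U
      U-128 : 128 ≤ U
      U-p : (1 + p) * 33 < U
      K-z : 4 * K ≤ z
      p-z : 6 * (1 + p) ≤ z
      c-κ₃ : 1 + 2 * κ₃ ≤ c
      c-g₂ : g₂ ≤ 2 * c
      Ξ-c : 64 * c ≤ Ξ
      Ξ-c² : 4 * (32 * c) * (32 * c) < Ξ
      Ξ-K² : 8 * K * K ≤ Ξ
      Ξ-K : K ≤ Ξ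
      Y-Ξ : 8 * Ξ ≤ Y
      Y-big : 8192 ≤ Y
      Y-V : 16 * (4 * Λ 128) * V ≤ Y
      1≤C : 1 ≤ 2 * C * V
      1≤AV : 1 ≤ 16 * (4 * Λ 128) * V

  palette-units : ∀ k u → k + (2 * (2 * u) + 2 * (2 * u)) + u + 23 * u ≡ k + 32 * u
  palette-units = solve-∀

  *-regroup : ∀ V a b e → V * (a * b) * e ≡ V * (a * (b * e))
  *-regroup = solve-∀

  64-front : ∀ q u → q * (64 * u) ≡ 64 * q * u
  64-front = solve-∀

  edge-square : ∀ b i → 4 * b * suc i * (4 * b * suc i) ≡ 16 * b * b * suc i * (1 + i)
  edge-square = solve-∀

  edge-volume : ∀ b i → 16 * b * b * suc i * (i + i) ≡ 32 * b * b * (suc i * i)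
  edge-volume = solve-∀

  module Core {K g₂ : ℕ} (P : Const K g₂) where
    open Const P

    record Medium (g r₁ : ℕ) : Set where
      field
        1≤g   : 1 ≤ g
        K≤g   : K ≤ g
        U≤g   : U ≤ g
        Λ-r₁  : Λ (2 * g) ≤ r₁
        tot-r₁ : 128 * c * g ≤ r₁
        c-r₁  : 2 * (32 * c) ≤ r₁
        g-r₁  : 8 * g * g ≤ r₁
        1≤r₁  : 1 ≤ r₁

    record Large (g b r₀ : ℕ) : Set where
      field
        1≤b  : 1 ≤ b
        K≤b  : K ≤ b
        p-r₀ : 8 * (1 + p) ≤ r₀
        q-r₀ : q ≤ r₀
        Λ-r₀ : Λ 128 ≤ r₀
        M-r₀ : 16 * M ≤ r₀
        U-r₀ : 8 * U * b ≤ r₀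
        c-r₀ : 128 * c * b ≤ r₀
        κ-r₀ : 5 * κ₃ ≤ r₀
        1≤r₀ : 1 ≤ r₀

    -- A lower bound for t - 1 that large n enforces through n ≤ 2t(t - 1). Its summands serve
    -- `bad-few`, `med-deg`, `r₀ < t` and `θ-big`.
    Z : ℕ → ℕ → ℕ
    Z g r₀ = 64 * c * g + 32 * c * r₀ + r₀ + 100

    record Order (g b r₀ n : ℕ) : Set where
      field
        U-n  : U ≤ n
        M-n  : M ≤ n
        64-n : 64 ≤ n
        g-n  : g ≤ n
        c-n  : 16 * c ≤ n
        b-n  : b ≤ n
        Λ-n  : Λ 128 ≤ n
        Λg-n : Λ (2 * g) ≤ n
        Λr-n : Λ (2 * g) * (r₀ * r₀) ≤ n
        Ub-n : 2 * U * (1 + 32 * b * b) ≤ n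
        br-n : 4 * b * r₀ < n
        gr-n : 2 * g * (2 * r₀) ≤ n
        bb-n : 32 * b * b < n
        KK-n : 32 * K * K ≤ n
        Z-n  : 2 * ((1 + Z g r₀) * Z g r₀) < n

    record Input : Set where
      constructor input
      field
        {n} : ℕ
        {m} : ℕ
        a : Fin m → Fin n → Bool
        lin : ∀ i j → i ≢ j → ∀ u v → u ∈ᵇ a i → u ∈ᵇ a j → v ∈ᵇ a i → v ∈ᵇ a j → u ≡ v
        {g} : ℕ
        {r₁} : ℕ
        {b} : ℕ
        {r₀} : ℕ
        md : Medium g r₁
        lg : Large g b r₀
        od : Order g b r₀ n
        low : ∀ j → suc r₁ ≤ # (a j)
        huge : Pred m
        Bf : ℕ
        huge-size : ∀ j → j ∈ᵇ huge → n ≤ 4 * b * # (a j)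
        huge-not : ∀ j → j ∉ᵇ huge → 4 * # (a j) ≤ Bf
        Bf-big : ∀ x → b * x ≤ n → x ≤ Bf

    module Colour (I : Input) where
      open Input I

      open Medium md
      open Large lg
      open Order od
      open Dense a lin

      1≤n : 1 ≤ n
      1≤n = ≤-trans (s≤s z≤n) 64-n
      1≤U : 1 ≤ U
      1≤U = ≤-trans (s≤s z≤n) U-128
      1≤c : 1 ≤ c
      1≤c = ≤-trans (s≤s z≤n) c-κ₃

      open Unit (unit-of U n 1≤U U-n) renaming (unit to u; lower to u-low; upper to u-up; pos to 1≤u)
      open Unit (unit-of M n 1≤M M-n) renaming (unit to ε; lower to ε-low; upper to ε-up; pos to 1≤ε)
      open Unit (unit-of 64 n (s≤s z≤n) 64-n) renaming (unit to y; lower to y-low; upper to y-up; pos to 1≤y)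
      -- `y₁` caps medium classes, `B₀` caps ordinary classes in the near-plane case, and `f` is the
      -- palette unit there.
      open Unit (unit-of g n 1≤g g-n) public renaming (unit to y₁; lower to y₁-low; upper to y₁-up; pos to 1≤y₁)
      open Unit (unit-of (16 * c) n (≤-trans 1≤c (m≤m+n c _)) c-n) public renaming (unit to f; lower to f-low; upper to f-up′; pos to 1≤f)
      open Unit (unit-of b n 1≤b b-n) public renaming (unit to B₀; lower to B₀-low; upper to B₀-up; pos to 1≤B₀)

      f-up : n ≤ 32 * c * f
      f-up = ≤-trans f-up′ (≤-reflexive (cong (_* f) (sym (*-assoc 2 16 c))))

      64u≤n : 64 * u ≤ n
      64u≤n = ≤-trans (*-monoˡ-≤ u (≤-trans (m≤m+n 64 64) U-128)) u-low
      32u≤n : 32 * u ≤ n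
      32u≤n = ≤-trans (*-monoˡ-≤ u (m≤m+n 32 32)) 64u≤n
      k₁ = n ∸ 32 * u
      D = n ∸ 64 * u
      k₁-eq : k₁ + 32 * u ≡ n
      k₁-eq = m∸n+n≡m 32u≤n
      D-eq : D + 64 * u ≡ n
      D-eq = m∸n+n≡m 64u≤n
      -- Ordinary, medium and huge edges. As y₁ ≤ 2u, at most 9u of the 32u withheld colours are
      -- spent, and 23u remain saved.
      k = k₁ + (2 * y₁ + 2 * y₁) + u
      k₁≤k : k₁ ≤ k
      k₁≤k = ≤-trans (m≤m+n k₁ _) (m≤m+n _ u)
      y₁≤2u : y₁ ≤ 2 * u
      y₁≤2u = *-cancelˡ-≤ U ⦃ Data.Nat.>-nonZero 1≤U ⦄ (y1-u U u g y₁ n y₁-low u-up U≤g)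
      k-small : k + 23 * u ≤ n
      k-small = begin
        k₁ + (2 * y₁ + 2 * y₁) + u + 23 * u ≤⟨ +-monoˡ-≤ (23 * u) (+-monoˡ-≤ u (+-monoʳ-≤ k₁ (+-mono-≤ (*-monoʳ-≤ 2 y₁≤2u) (*-monoʳ-≤ 2 y₁≤2u)))) ⟩
        k₁ + (2 * (2 * u) + 2 * (2 * u)) + u + 23 * u ≡⟨ palette-units k₁ u ⟩
        k₁ + 32 * u ≡⟨ k₁-eq ⟩
        n ∎
        where
        open ≤-Reasoning
      k-bound : 2 * U * k + n ≤ 2 * U * n
      k-bound = k-sig k u U n k-small u-up

      -- At most Cn ≤ 2CVv edges want a saving of ε, so v rounds worth `H` each suffice. The factor
      -- in `v` then makes averaging over at most (Cn)² pairs yield more than `H`.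
      H = 2 * C * V * ε
      v = (1 + 2 * C * C * V) * H
      Mε : M * ε ≡ V * v
      Mε = trans (cong (_* ε) M-def) (*-regroup V (1 + 2 * C * C * V) (2 * C * V) ε)
      1≤H : 1 ≤ H
      1≤H = *-mono-≤ 1≤C 1≤ε
      ε≤v : ε ≤ v
      ε≤v = ≤-trans (≤-trans (≤-reflexive (sym (*-identityˡ ε))) (*-monoˡ-≤ ε 1≤C)) (m≤m+n H _)
      u-ε : 68 * u ≤ ε
      u-ε = *-cancelˡ-≤ (2 * M) ⦃ Data.Nat.>-nonZero (≤-trans 1≤M (m≤m+n M _)) ⦄ (eps-u U u M ε n u-low ε-up U-M)

      1≤k : 1 ≤ k
      1≤k = ≤-trans 1≤u (m≤n+m u _)
      c₀ : Fin k
      c₀ = Fin.fromℕ< 1≤k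

      module As = Assemble {n} {m} {k} a lin
      X Md : Pred m
      X = As.X huge r₀
      Md = As.Md huge r₀

      -- As ordinary edges have size at most half the cap, a full colour carries at least half of
      -- it.
      sb = Bf / 2
      sb-low : 2 * sb ≤ Bf
      sb-low = ≤-trans (≤-reflexive (*-comm 2 sb)) (m/n*n≤m Bf 2)
      sb-up : Bf < 2 * suc sb
      sb-up = ≤-trans (s≤s (≤-reflexive (m≡m%n+[m/n]*n Bf 2))) (≤-trans (+-monoˡ-≤ (sb * 2) (m%n<n Bf 2))
        (≤-reflexive (trans (cong (2 +_) (*-comm sb 2)) (sym (*-suc 2 sb)))))

      Mε≤n : V * v ≤ n
      Mε≤n = ≤-trans (≤-reflexive (sym Mε)) ε-low

      q-u : q * (64 * u) ≤ n
      q-u = ≤-trans (≤-reflexive (trans (64-front q u) (cong (_* u) (sym U-def)))) u-low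

      module Ca = Cases {n} {m} {k} a lin

      the-scales : Scales n m k
      the-scales = scales k₁ u Bf sb D r₀ p V M z ε v Y q y c₀ k₁≤k k₁-eq D-eq sb-low sb-up 1≤n 1≤u 2≤p p-r₀
        (<-≤-trans (≤-<-trans (≤-reflexive (sym (*-assoc (1 + p) 33 u))) (*-monoˡ-< u ⦃ Data.Nat.>-nonZero 1≤u ⦄ U-p)) u-low)
        p-z q-def 2≤q q-r₀
        q-u
        y-low y-up 1≤y (*-cancelˡ-≤ 128 (y-u U u y n u-low y-up U-128)) Λ-r₀ Λ-n Y-big
        (≤-trans (≤-reflexive (cong (_* v) (sym V-def))) Mε≤n)
        (≤-trans ε-up (≤-reflexive (trans (*-assoc 2 M ε) (trans (cong (2 *_) Mε) (sym (*-assoc 2 V v))))))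
        ≤-refl 1≤H 1≤AV ε-up (≤-reflexive (sym z-def)) M-r₀ u-ε (≤-trans (*-monoˡ-≤ u (m≤m+n 64 4)) (≤-trans u-ε ε≤v)) (≤-trans 1≤ε ε≤v) Y-V X

      module Di = Dichotomy a lin the-scales

      X-low : ∀ j → j ∈ᵇ X → r₀ < size j
      X-low j x = <ᵇ-false {size j} (not-true (proj₁ (∧-true {not (Md j)} x)))

      X-high : ∀ j → j ∈ᵇ X → 4 * size j ≤ Bf
      X-high j x = huge-not j (not-true (proj₂ (∧-true {not (Md j)} x)))

      -- Edges longer than r₀ have total size at most n²/r₀, while u and B₀ are of order n with
      -- constants fixed before r₀.
      X-total : 2 * ∑∈ X size ≤ u * Bf
      X-total = ≤-trans (*-cancelˡ-≤ (4 * U * b) ⦃ Data.Nat.>-nonZero (*-mono-≤ {1} {4 * U} {1} {b} (≤-trans 1≤U (m≤m+n U _)) 1≤b) ⦄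
        (x-tot n U u b B₀ r₀ (∑∈ X size) (≤-trans (ρ∑size≤vol X r₀ X-low) (vol≤n² X)) u-up B₀-up U-r₀)) (*-monoʳ-≤ u (Bf-big B₀ B₀-low))

      half-r₀ : 2 * r₀ ≤ y₁
      half-r₀ = *-cancelˡ-≤ (2 * g) ⦃ Data.Nat.>-nonZero (≤-trans 1≤g (m≤m+n g _)) ⦄ (≤-trans gr-n y₁-up)

      r₀≤y₁ : r₀ ≤ y₁
      r₀≤y₁ = ≤-trans (m≤m+n r₀ _) half-r₀

      half-gap : ∀ x B → 2 * x ≤ B → B ≤ 2 * (suc B ∸ x)
      half-gap x B h = sb-cap B x (suc B ∸ x) h (≤-reflexive (sym (m+[n∸m]≡n (≤-trans (≤-trans (m≤m+n x _) h) (n≤1+n B)))))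

      -- A huge edge has volume at least n²/32b², because n ≤ 4b · size and size ≤ 2(size - 1). So
      -- there are at most 32b² of them, while u grows with n.
      huge-few : # huge < u
      huge-few = <-≤-trans (s≤s (*-cancelˡ-≤ (n * n) ⦃ Data.Nat.>-nonZero (*-mono-≤ 1≤n 1≤n) ⦄ count)) enough
        where
        enough : 1 + 32 * b * b ≤ u
        enough = *-cancelˡ-≤ (2 * U) ⦃ Data.Nat.>-nonZero (≤-trans 1≤U (m≤m+n U _)) ⦄ (≤-trans Ub-n u-up)
        pt : ∀ j → j ∈ᵇ huge → n * n ≤ 32 * b * b * (size j * (size j ∸ 1))
        pt j x with suc≡ (≤-trans (s≤s 1≤r₁) (low j))
        ... | i , eq rewrite eq = ≤-trans (*-mono-≤ h h) (big b i (s≤s⁻¹ (≤-trans (≤-trans (s≤s 1≤r₁) (low j)) (≤-reflexive eq))))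
          where
          h : n ≤ 4 * b * suc i
          h = subst (λ w → n ≤ 4 * b * w) eq (huge-size j x)
          big : ∀ b i → 1 ≤ i → 4 * b * suc i * (4 * b * suc i) ≤ 32 * b * b * (suc i * i)
          big b i q = ≤-trans (≤-reflexive (edge-square b i)) (≤-trans (*-monoʳ-≤ (16 * b * b * suc i) (+-monoˡ-≤ i q)) (≤-reflexive (edge-volume b i)))
        count : n * n * # huge ≤ n * n * (32 * b * b)
        count = begin
          n * n * # huge ≡⟨ trans (*-comm (n * n) (# huge)) (sym (∑∈-const huge (n * n))) ⟩
          ∑∈ huge (λ _ → n * n) ≤⟨ ∑∈-monoʳ {S = huge} pt ⟩
          ∑∈ huge (λ j → 32 * b * b * (size j * (size j ∸ 1))) ≡⟨ ∑∈-*ˡ huge (32 * b * b) _ ⟩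
          32 * b * b * vol huge ≤⟨ *-monoʳ-≤ (32 * b * b) (vol≤n² huge) ⟩
          32 * b * b * (n * n) ≡⟨ *-comm (32 * b * b) (n * n) ⟩
          n * n * (32 * b * b) ∎
          where open ≤-Reasoning

      huge-large : ∀ i → i ∈ᵇ huge → i ∉ᵇ Md
      huge-large i x = ≢true⇒false (λ q → <⇒≱ br-n (≤-trans (huge-size i x) (*-monoʳ-≤ (4 * b) (s≤s⁻¹ (<ᵇ-true {size i} q)))))

      separated : Ca.Coloured X Di.A₁ Bf → As.Separated huge r₀ y₁ Bf (2 * y₁ + 2 * y₁)
      separated = As.separated huge r₀ (As.reserve k₁ y₁ u Bf y₁ (2 * g) r₁ refl huge-few huge-large (≤-trans 1≤g (m≤m+n g _)) 1≤y₁ y₁-up 1≤n 1≤r₁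
        Λ-r₁ Λg-n Λr-n r₀≤y₁ low
        (*-cancelˡ-≤ (8 * g * g) ⦃ Data.Nat.>-nonZero (*-mono-≤ {1} {8 * g} {1} {g} (≤-trans 1≤g (m≤m+n g _)) 1≤g) ⦄
          (med-tot n g y₁ r₁ (∑∈ Md size) (suc y₁ ∸ r₀) (≤-trans (ρ∑size≤vol Md r₁ (λ j _ → low j)) (vol≤n² Md)) y₁-up (half-gap r₀ y₁ half-r₀) g-r₁)))

      module Fpp = Planes {n} {m} a lin

      record FPP : Set where
        field
          W       : Pred m
          r       : ℕ
          W-low   : ∀ j → j ∈ᵇ W → r ≤ size j
          W-high  : ∀ j → j ∈ᵇ W → z * size j ≤ (z + 1) * r
          below   : (1 + p) * (1 + p) * (r * r) ≤ (2 + p) * (2 + p) * n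
          above   : p * p * n ≤ (1 + p) * (1 + p) * (r * r)
          W-vol   : Ξ * (n * n) ≤ Ξ * vol W + n * n
          t       : ℕ
          outcome : Fpp.Outcome t r₀ y₁ B₀ f

      record BandData : Set where
        constructor band-data
        field
          S : Pred m
          ρ : ℕ
          r₀≤ρ : r₀ ≤ ρ
          S-low : ∀ j → j ∈ᵇ S → suc ρ ≤ size j
          below : (1 + p) * (1 + p) * (suc ρ * suc ρ) < (2 + p) * (2 + p) * n
          above : p * p * n < (1 + p) * (1 + p) * (suc ρ * suc ρ)
          few : Y * vol (S ∩ᵇ Long z (suc ρ)) ≤ 4 * (n * n)
          dense : q * (n * n) ≤ q * vol S + 4 * (n * n)
          θ x : ℕ
          t+x : 2 + θ + x ≡ suc ρ
          κ₃x : κ₃ * x ≤ suc ρ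
          r<κ₃x : suc ρ < κ₃ + κ₃ * x

      module Band (B : BandData) where
        open BandData B

        r : ℕ
        r = suc ρ
        W = S ∖ᵇ Long z r
        W-low : ∀ j → j ∈ᵇ W → r ≤ size j
        W-low j x = S-low j (proj₁ (∧-true {S j} x))
        W-high : ∀ j → j ∈ᵇ W → z * size j ≤ (z + 1) * r
        W-high j x = Long-false z r j (not-true (proj₂ (∧-true {S j} x)))
        W-vol : Ξ * (n * n) ≤ Ξ * vol W + n * n
        -- The core misses at most 4n²/q ≤ 4n²/Y of the volume and its long edges take at most
        -- 4n²/Y; the sum is at most n²/Ξ since 8Ξ ≤ Y.
        W-vol = *-cancelˡ-≤ 8 (wvol2 Ξ (n * n) (vol W) (scale-down (8 * Ξ) Y (n * n) (vol W) (8 * (n * n)) Y-Ξ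
          (wvol q Y Ξ (n * n) (vol S) (vol W) (vol (S ∩ᵇ Long z r)) dense
            (scale-down Y q (n * n) (vol S) (4 * (n * n)) Y≤q dense) (≤-reflexive (vol-split S (Long z r))) few Y-Ξ)))
        1≤ρ : 1 ≤ ρ
        1≤ρ = ≤-trans 1≤r₀ r₀≤ρ
        5κ₃≤ρ : 5 * κ₃ ≤ ρ
        5κ₃≤ρ = ≤-trans κ-r₀ r₀≤ρ
        t≤r : 2 + θ ≤ r
        t≤r = ≤-trans (m≤m+n (2 + θ) x) (≤-reflexive t+x)
        R = (2 + θ) * (1 + θ)
        lowT : κ₃ * r ≤ κ₃ * (2 + θ) + r
        lowT = t-low r (2 + θ) x κ₃ κ₃x (≤-reflexive (sym t+x))
        κ₃≤r : κ₃ ≤ r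
        κ₃≤r = ≤-trans (≤-trans (m≤m+n κ₃ _) 5κ₃≤ρ) (n≤1+n ρ)
        -- `big₁` gives R ≥ (1 - 3/κ₃)r² and `big₂` gives r² ≥ (1 - 2/(1 + p))n. With r² ≤ 2n and
        -- both denominators at least 8(1 + κ), the losses are 6/8 and 2/8 of n/(1 + κ), exactly
        -- what `t-big` allows.
        big₁ : κ₃ * (r * r) ≤ κ₃ * R + 3 * (r * r)
        big₁ = *-cancelˡ-≤ κ₃ (t-big1 r (1 + θ) k₃ lowT κ₃≤r)
        big₂ : (1 + p) * n ≤ (1 + p) * (r * r) + 2 * n
        big₂ = *-cancelˡ-≤ (1 + p) (t-big2 p n (r * r) (<⇒≤ above))
        r²≤2n : r * r ≤ 2 * n
        r²≤2n = *-cancelˡ-≤ ((1 + p) * (1 + p)) (r-2n p n (r * r) (<⇒≤ below) 2≤p)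
        t-big : κ * n ≤ (1 + κ) * R
        t-big = *-cancelˡ-≤ 8 (t-big3 κ n (r * r) R
          (scale-down (8 * (1 + κ)) (1 + p) n (r * r) (2 * n) (≤-trans p-κ (n≤1+n p)) big₂)
          (scale-down (8 * (1 + κ)) κ₃ (r * r) R (3 * (r * r)) κ₃-κ big₁) r²≤2n)
        1≤κ : 1 ≤ κ
        1≤κ = ≤-trans (s≤s z≤n) κ-big
        t-half′ : n ≤ 2 * R
        t-half′ = *-cancelˡ-≤ κ ⦃ Data.Nat.>-nonZero 1≤κ ⦄ (t-half-arith κ n R t-big 1≤κ)
        t-half = t-half′
        Z≤ : Z g r₀ ≤ 1 + θ
        Z≤ = ≮⇒≥ (λ lt → <⇒≱ Z-n (≤-trans t-half′ (*-monoʳ-≤ 2 (*-mono-≤ {2 + θ} {1 + Z g r₀} (s≤s (<⇒≤ lt)) (<⇒≤ lt)))))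
        θ-big : 9 * n ≤ 10 * ((2 + θ) * θ)
        θ-big = th-big n R ((2 + θ) * θ) (2 + θ)
          (scale-down 10 κ n R R (≤-trans (m≤m+n 10 151) κ-big) (≤-trans t-big (≤-reflexive (+-comm R (κ * R)))))
          (≤-reflexive (trans (*-suc (2 + θ) θ) (+-comm (2 + θ) _)))
          (≤-trans (≤-reflexive (*-comm 100 (2 + θ))) (*-monoʳ-≤ (2 + θ) (≤-trans (m≤n+m 100 (64 * c * g + 32 * c * r₀ + r₀)) Z≤)))
        θ-small : (2 + θ) * (2 + θ) ≤ 2 * n
        θ-small = ≤-trans (*-mono-≤ t≤r t≤r) r²≤2n
        t-ρ : (1 + 2 * κ₃) * (2 + θ) ≤ 2 * κ₃ * ρ
        t-ρ = *-cancelˡ-≤ κ₃ (t-rho κ₃ (2 + θ) ρ (t-up κ₃ (2 + θ) x r r<κ₃x (≤-reflexive t+x)) 5κ₃≤ρ (s≤s z≤n))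
        r₀<t : r₀ < 2 + θ
        r₀<t = s≤s (≤-trans (Z₃ (64 * c * g) (32 * c * r₀) r₀ 100) Z≤)
        -- t is at most √(2n), whereas B₀ is at least n/2b.
        2t≤B₀ : 2 * (2 + θ) ≤ B₀
        2t≤B₀ = ≮⇒≥ (λ lt → <⇒≱ bb-n (*-cancelˡ-≤ n ⦃ Data.Nat.>-nonZero 1≤n ⦄ (tB (2 + θ) n B₀ b θ-small B₀-up (<⇒≤ lt))))
        fpp : FPP
        fpp = record { W = W ; r = r ; W-low = W-low ; W-high = W-high ; below = <⇒≤ below ; above = <⇒≤ above ; W-vol = W-vol
                       ; t = 2 + θ ; outcome = Fpp.Construct.outcome (Fpp.plane-data 1≤n W ρ θ Ξ c f r₁ r₀ y₁ B₀ κ (2 * κ₃) 1≤ρ W-low t≤r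
                           θ-big θ-small t-big κ-big t-half t-ρ W-vol 1≤f f-low f-up c-κ₃ Ξ-c Ξ-c² low c-r₁ r₀<t r₀≤y₁
                           (≤-trans (m≤m+n (2 + θ) (2 + θ + 0)) 2t≤B₀)
                           (tot1 n c f g y₁ r₁ (suc y₁ ∸ r₀) f-up y₁-up (half-gap r₀ y₁ half-r₀) tot-r₁)
                           (tot1 n c f b B₀ r₀ (suc B₀ ∸ (2 + θ)) f-up B₀-up (half-gap (2 + θ) B₀ 2t≤B₀) c-r₀) 1≤r₀
                           (bad1 n c f g y₁ (1 + θ) f-up y₁-up (≤-trans (Z₁ (64 * c * g) (32 * c * r₀) r₀ 100) Z≤))
                           (meddeg n c f r₀ (1 + θ) f-up (≤-trans (Z₂ (64 * c * g) (32 * c * r₀) r₀ 100) Z≤))) }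

      fpp : (X-l : ∀ j → j ∈ᵇ X → r₀ < size j) (X-h : ∀ j → j ∈ᵇ X → 4 * size j ≤ Bf) (X-t : 2 * ∑∈ X size ≤ u * Bf) →
            Di.Balanced X-l X-h X-t → FPP
      fpp X-l X-h X-t bal = from (cut ρ k₃ (≤-trans κ-r₀ r₀≤ρ))
        where
        open Di.Balanced bal
        from : (∃ λ θ → ∃ λ x → 2 + θ + x ≡ suc ρ × κ₃ * x ≤ suc ρ × suc ρ < κ₃ + κ₃ * x) → FPP
        from (θ , x , t+x , lo , hi) = Band.fpp (band-data S ρ r₀≤ρ S-low below above few dense θ x t+x lo hi)

      result : As.Separated huge r₀ y₁ Bf (2 * y₁ + 2 * y₁) ⊎ FPP
      result = [ (λ col → inj₁ (separated col)) , (λ bal → inj₂ (fpp X-low X-high X-total bal)) ]′ (Di.dichotomy X-low X-high X-total)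

-- Translation between rational conditions and natural-number inequalities

module RationalBounds where
  open import Defs
  open FiniteSums
  open NibblePotential using (ι; ι-+; ι-*; ι-mono; ι-cancel; ι≥0; 0≤*; 0≤-; ≤-by)
  open IndependentSets using (ι-pos; ratio; *-cancel)
  open import Data.Bool using (Bool; true; false)
  open import Data.Empty using (⊥-elim)
  open import Data.Fin as Fin using (Fin; zero; suc)
  open import Data.Fin.Subset using (Subset; _∈_; ∣_∣; ⋃; _∪_)
  open import Data.Fin.Subset.Properties using (∣⊥∣≡0)
  import Data.Integer as ℤ
  import Data.Integer.Properties as ℤₚ
  open import Data.List using (List; []; _∷_; map; filter; tabulate)
  open import Data.Nat as ℕ using (ℕ; zero; suc; z≤n; s≤s)
  open import Data.Nat.Combinatorics using (_C_; nC1≡n; nCk+nC[k+1]≡[n+1]C[k+1])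
  import Data.Nat.Properties as ℕₚ
  open import Data.Nat.ListAction using (sum)
  open import Data.Nat.Tactic.RingSolver using (solve-∀)
  open import Data.Product using (∃; _×_; _,_; proj₂)
  open import Data.Rational hiding (∣_∣)
  import Data.Rational.Properties as ℚₚ
  import Data.Rational.Unnormalised as ℚᵘ
  import Data.Rational.Unnormalised.Properties as ℚᵘₚ
  open import Data.Rational.Solver using (module +-*-Solver)
  open import Data.Vec as Vec using (Vec; []; _∷_; lookup)
  import Data.Vec.Properties as Vecₚ
  open import Function using (_∘_; id)
  open import Relation.Binary.PropositionalEquality hiding (J)
  open import Relation.Nullary using (¬_; yes; no; does)
  open import Relation.Unary using (Decidable)

  sum-filter : ∀ {n m} {P : Fin m → Set} (P? : Decidable P) (g : Fin n → Fin m) (f : Fin m → ℕ) →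
               sum (map f (filter P? (tabulate g))) ≡ ∑ (λ i → 𝟙 (does (P? (g i))) ℕ.* f (g i))
  sum-filter {zero} P? g f = sym (∑-zero _)
  sum-filter {suc n} P? g f = trans (lemma (P? (g zero))) (trans (cong (𝟙 (does (P? (g zero))) ℕ.* f (g zero) ℕ.+_) (sum-filter P? (g ∘ suc) f)) (sym (∑-suc _)))
    where
    lemma : ∀ d → sum (map f (filter P? (tabulate g))) ≡ 𝟙 (does (P? (g zero))) ℕ.* f (g zero) ℕ.+ sum (map f (filter P? (tabulate (g ∘ suc))))
    lemma _ with does (P? (g zero))
    ... | true = cong (ℕ._+ sum (map f (filter P? (tabulate (g ∘ suc))))) (sym (ℕₚ.+-identityʳ (f (g zero))))
    ... | false = refl

  ∣∣-# : ∀ {n} (p : Subset n) → ∣ p ∣ ≡ # (lookup p)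
  ∣∣-# [] = sym (∑-zero _)
  ∣∣-# (true ∷ p) = trans (cong suc (∣∣-# p)) (sym (∑-suc _))
  ∣∣-# (false ∷ p) = trans (∣∣-# p) (sym (∑-suc _))

  ∣∪∣≤ : ∀ {n} (p q : Subset n) → ∣ p ∪ q ∣ ℕ.≤ ∣ p ∣ ℕ.+ ∣ q ∣
  ∣∪∣≤ [] [] = z≤n
  ∣∪∣≤ (true ∷ p) (true ∷ q) = s≤s (ℕₚ.≤-trans (∣∪∣≤ p q) (ℕₚ.+-monoʳ-≤ ∣ p ∣ (ℕₚ.n≤1+n _)))
  ∣∪∣≤ (true ∷ p) (false ∷ q) = s≤s (∣∪∣≤ p q)
  ∣∪∣≤ (false ∷ p) (true ∷ q) = ℕₚ.≤-trans (s≤s (∣∪∣≤ p q)) (ℕₚ.≤-reflexive (sym (ℕₚ.+-suc ∣ p ∣ ∣ q ∣)))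
  ∣∪∣≤ (false ∷ p) (false ∷ q) = ∣∪∣≤ p q

  ∣⋃∣≤ : ∀ {n m} (e : Fin m → Subset n) (l : List (Fin m)) → ∣ ⋃ (map e l) ∣ ℕ.≤ sum (map (λ i → ∣ e i ∣) l)
  ∣⋃∣≤ {n} e [] = ℕₚ.≤-reflexive (∣⊥∣≡0 n)
  ∣⋃∣≤ e (i ∷ l) = ℕₚ.≤-trans (∣∪∣≤ (e i) (⋃ (map e l))) (ℕₚ.+-monoʳ-≤ ∣ e i ∣ (∣⋃∣≤ e l))

  2-inside-ℕ : ∀ b x → 2 ℕ.* (b ℕ.* x) ≡ b ℕ.* (2 ℕ.* x)
  2-inside-ℕ = solve-∀

  module Incidence {n} (H : Hypergraph n) where

    a : Fin (m H) → Fin n → Bool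
    a i = lookup (edge H i)

    a-∈ : ∀ i v → v ∈ᵇ a i → v ∈ edge H i
    a-∈ i v p = Vecₚ.lookup⇒[]= v (edge H i) p

    ∈-a : ∀ i v → v ∈ edge H i → v ∈ᵇ a i
    ∈-a i v p = Vecₚ.[]=⇒lookup p

    linear : Linear H → ∀ i j → i ≢ j → ∀ u v → u ∈ᵇ a i → u ∈ᵇ a j → v ∈ᵇ a i → v ∈ᵇ a j → u ≡ v
    linear lin i j i≢j u v ui uj vi vj = lin i j i≢j u v (a-∈ i u ui) (a-∈ j u uj) (a-∈ i v vi) (a-∈ j v vj)

    size-≡ : ∀ i → ∣e∣ H i ≡ # (a i)
    size-≡ i = ∣∣-# (edge H i)

    -- The link between loads and the vertex counts in the theorem.
    incident≤ : ∀ {k} (c : Colouring H k) col → ∣ incident H c col ∣ ℕ.≤ ∑∈ (λ _ → true) (λ i → 𝟙 (c i == col) ℕ.* # (a i))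
    incident≤ c col = ℕₚ.≤-trans (∣⋃∣≤ (edge H) (colourClass H c col)) (ℕₚ.≤-reflexive (trans (sum-filter (λ i → c i Fin.≟ col) id (∣e∣ H))
      (∑-cong (λ i → trans (cong₂ (λ b s → 𝟙 b ℕ.* s) (sym (==-does (c i) col)) (size-≡ i)) (sym (ℕₚ.+-identityʳ _))))))

    setOf : ∀ {k} → Pred k → Subset k
    setOf = Vec.tabulate

    setOf-∈ : ∀ {k} {S : Pred k} {i} → i ∈ᵇ S → i ∈ setOf S
    setOf-∈ {S = S} {i} p = Vecₚ.lookup⇒[]= i (setOf S) (trans (Vecₚ.lookup∘tabulate S i) p)

    ∈-setOf : ∀ {k} {S : Pred k} {i} → i ∈ setOf S → i ∈ᵇ S
    ∈-setOf {S = S} {i} p = trans (sym (Vecₚ.lookup∘tabulate S i)) (Vecₚ.[]=⇒lookup p)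

    ∣setOf∣ : ∀ {k} (S : Pred k) → ∣ setOf S ∣ ≡ # S
    ∣setOf∣ S = trans (∣∣-# (setOf S)) (∑-cong (λ i → cong 𝟙 (Vecₚ.lookup∘tabulate S i)))

    choose₂ : ∀ s → 2 ℕ.* (s C 2) ≡ s ℕ.* (s ℕ.∸ 1)
    choose₂ zero = refl
    choose₂ (suc zero) = refl
    choose₂ (suc (suc s)) = trans (cong (2 ℕ.*_) (sym (nCk+nC[k+1]≡[n+1]C[k+1] (suc s) 1)))
      (trans (cong (λ x → 2 ℕ.* (x ℕ.+ suc s C 2)) (nC1≡n (suc s))) (trans (ℕₚ.*-distribˡ-+ 2 (suc s) (suc s C 2))
      (trans (cong (2 ℕ.* suc s ℕ.+_) (choose₂ (suc s))) (eq s))))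
      where
      eq : ∀ s → 2 ℕ.* suc s ℕ.+ suc s ℕ.* s ≡ suc (suc s) ℕ.* suc s
      eq = solve-∀

    volumeSum-≡ : ∀ (W : Pred (m H)) → 2 ℕ.* volumeSum H (setOf W) ≡ ∑∈ W (λ i → # (a i) ℕ.* (# (a i) ℕ.∸ 1))
    volumeSum-≡ W = trans (cong (2 ℕ.*_) (sum-filter (λ i → _∈?_ i (setOf W)) id (λ i → ∣e∣ H i C 2)))
      (trans (∑-*ˡ 2 _) (∑-cong (λ i → trans (2-inside-ℕ (𝟙 (does (i ∈? setOf W))) (∣e∣ H i C 2)) (cong₂ (λ b s → 𝟙 b ℕ.* s) (member i)
        (trans (choose₂ (∣e∣ H i)) (cong (λ s → s ℕ.* (s ℕ.∸ 1)) (size-≡ i)))))))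
      where
      open import Data.Fin.Subset.Properties using (_∈?_)
      member : ∀ i → does (i ∈? setOf W) ≡ W i
      member i with i ∈? setOf W
      ... | yes p = sym (∈-setOf p)
      ... | no p = sym (≢true⇒false (λ q → p (setOf-∈ q)))

  -- The successor step is carried out with unnormalised fractions, where no common divisor
  -- intervenes.
  toℚ-ι : ∀ n → toℚ n ≡ ι n
  toℚ-ι zero = refl
  toℚ-ι (suc n) = trans (ℚₚ.toℚᵘ-injective (ℚᵘₚ.≃-trans (ℚₚ.toℚᵘ-fromℚᵘ (ℚᵘ.mkℚᵘ (ℤ.+ suc n) 0))
    (ℚᵘₚ.≃-sym (ℚᵘₚ.≃-trans (ℚₚ.toℚᵘ-homo-+ 1ℚ (toℚ n))
      (ℚᵘₚ.≃-trans (ℚᵘₚ.+-congʳ ℚᵘ.1ℚᵘ (ℚₚ.toℚᵘ-fromℚᵘ (ℚᵘ.mkℚᵘ (ℤ.+ n) 0))) (ℚᵘ.*≡* (eq n))))))) (cong (1ℚ +_) (toℚ-ι n))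
    where
    eq : ∀ n → (ℤ.+ 1 ℤ.+ ℤ.+ n ℤ.* ℤ.+ 1) ℤ.* ℤ.+ 1 ≡ ℤ.+ suc n ℤ.* ℤ.+ 1
    eq n = cong (λ x → (ℤ.+ 1 ℤ.+ x) ℤ.* ℤ.+ 1) (ℤₚ.*-identityʳ (ℤ.+ n))

  open +-*-Solver using (solve; _:=_; _:+_; _:*_; _:-_; con)

  Reciprocal : ℕ → ℚ → Set
  Reciprocal K x = InUnit x × ι K * x ≡ 1ℚ

  reciprocal′ : ∀ K x → ι (suc K) * x ≡ 1ℚ → Reciprocal (suc K) x
  reciprocal′ K x eq = (x>0 , *-cancel (ι-pos K) (subst₂ _≤_ (sym eq) (sym (ℚₚ.*-identityʳ (ι (suc K)))) (ι-mono {1} {suc K} (s≤s z≤n)))) , eq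
    where
    x>0 : 0ℚ < x
    x>0 = ℚₚ.≰⇒> (λ p → ℚₚ.<-irrefl refl (ℚₚ.<-≤-trans (ι-pos 0) (subst₂ _≤_ eq (ℚₚ.*-zeroʳ (ι (suc K)))
                   (ℚₚ.*-monoˡ-≤-nonNeg (ι (suc K)) ⦃ nonNegative (ι≥0 (suc K)) ⦄ p))))

  reciprocal : ∀ K → 1 ℕ.≤ K → ∃ (Reciprocal K)
  reciprocal (suc K) _ = let x , _ , eq = ratio 1 K in x , reciprocal′ K x eq

  -- The denominator serves: multiplied by it, a positive rational becomes its numerator, which is
  -- at least 1.
  archimedean : ∀ x → 0ℚ < x → ∃ λ K → 1 ℕ.≤ K × 1ℚ ≤ x * ι K
  archimedean x@(mkℚ (ℤ.+ suc p) d c) _ = suc d , s≤s z≤n , subst (λ y → 1ℚ ≤ x * y) (toℚ-ι (suc d)) (ℚₚ.toℚᵘ-cancel-≤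
    (ℚᵘₚ.≤-respʳ-≃ (ℚᵘₚ.≃-sym (ℚᵘₚ.≃-trans (ℚₚ.toℚᵘ-homo-* x (toℚ (suc d))) (ℚᵘₚ.*-congˡ {toℚᵘ x} (ℚₚ.toℚᵘ-fromℚᵘ (ℚᵘ.mkℚᵘ (ℤ.+ suc d) 0)))))
      (ℚᵘ.*≤* (ℤ.+≤+ (ℕₚ.≤-trans (ℕₚ.≤-reflexive (eq d)) (ℕₚ.≤-trans (ℕₚ.m≤m+n (suc d) (p ℕ.* suc d)) (ℕₚ.≤-reflexive (sym (ℕₚ.*-identityʳ _)))))))))
    where
    eq : ∀ d → 1 ℕ.* (suc d ℕ.* 1) ≡ suc d
    eq d = trans (ℕₚ.*-identityˡ _) (ℕₚ.*-identityʳ _)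
  archimedean (mkℚ (ℤ.+ 0) d c) p = ⊥-elim (ℚₚ.<-irrefl refl (ℚₚ.<-≤-trans p (ℚₚ.nonPositive⁻¹ _)))
  archimedean (mkℚ ℤ.-[1+ n ] d c) p = ⊥-elim (ℚₚ.<-irrefl refl (ℚₚ.<-≤-trans p (ℚₚ.nonPositive⁻¹ _)))

  scale≤ : ∀ {x K a n} → 0ℚ ≤ x → 1ℚ ≤ x * ι K → K ℕ.* a ℕ.≤ n → ι a ≤ x * ι n
  scale≤ {x} {K} {a} {n} 0≤x h p = ℚₚ.≤-trans (subst (_≤ x * ι K * ι a) (ℚₚ.*-identityˡ (ι a)) (ℚₚ.*-monoʳ-≤-nonNeg (ι a) ⦃ nonNegative (ι≥0 a) ⦄ h))
    (subst (_≤ x * ι n) (trans (cong (x *_) (ι-* K a)) (sym (ℚₚ.*-assoc x (ι K) (ι a)))) (ℚₚ.*-monoˡ-≤-nonNeg x ⦃ nonNegative 0≤x ⦄ (ι-mono p)))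

  toℚ≤ : ∀ {x K a n} → 0ℚ < x → 1ℚ ≤ x * ι K → K ℕ.* a ℕ.≤ n → toℚ a ≤ x * toℚ n
  toℚ≤ {x} {K} {a} {n} 0<x h p = subst₂ (λ u v → u ≤ x * v) (sym (toℚ-ι a)) (sym (toℚ-ι n)) (scale≤ {x} {K} {a} {n} (ℚₚ.<⇒≤ 0<x) h p)

  invLe : ∀ {R r t} → Reciprocal R t → InvLe r t → R ℕ.≤ r
  invLe {R} {r} {t} (_ , eq) (_ , h) = ι-cancel (subst₂ _≤_ (ℚₚ.*-identityʳ (ι R))
    (trans (sym (ℚₚ.*-assoc (ι R) t (toℚ r))) (trans (cong (_* toℚ r) eq) (trans (ℚₚ.*-identityˡ _) (toℚ-ι r))))
    (ℚₚ.*-monoˡ-≤-nonNeg (ι R) ⦃ nonNegative (ι≥0 R) ⦄ h))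

  -- The integer part, found by descent from a known upper bound.
  ι-floor : ∀ n x → 0ℚ ≤ x → x < ι (suc n) → ∃ λ b → ι b ≤ x × x < ι (suc b)
  ι-floor zero x 0≤x h = 0 , 0≤x , h
  ι-floor (suc n) x 0≤x h with ι (suc n) ℚₚ.≤? x
  ... | yes p = suc n , p , h
  ... | no p = ι-floor n x 0≤x (ℚₚ.≰⇒> p)

  colours≤ : ∀ {S σ* σ k n} → 1 ℕ.≤ S → Reciprocal S σ* → σ ≤ σ* → S ℕ.* k ℕ.+ n ℕ.≤ S ℕ.* n → toℚ k ≤ (1ℚ - σ) * toℚ n
  colours≤ {suc S} {σ*} {σ} {k} {n} _ (_ , eq) σ≤ h = subst₂ (λ u v → u ≤ (1ℚ - σ) * v) (sym (toℚ-ι k)) (sym (toℚ-ι n))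
    (*-cancel (ι-pos S) (ℚₚ.≤-trans main (≤-by _ (0≤* (0≤* (ι≥0 (suc S)) (0≤- σ≤)) (ι≥0 n)) (id₂ (ι (suc S)) σ* σ (ι n)))))
    where
    s = ι (suc S)
    sum≤ : s * ι k + ι n ≤ s * ι n
    sum≤ = subst₂ _≤_ (trans (ι-+ (suc S ℕ.* k) n) (cong (_+ ι n) (ι-* (suc S) k))) (ι-* (suc S) n) (ι-mono h)
    id₁ : ∀ s σ* n k → s * ((1ℚ - σ*) * n) ≡ s * n - s * σ* * n
    id₁ = solve 4 (λ s σ* n k → s :* ((con 1ℚ :- σ*) :* n) := s :* n :- s :* σ* :* n) refl
    id₃ : ∀ s n k → s * n - 1ℚ * n ≡ s * k + (s * n - (s * k + n))
    id₃ = solve 3 (λ s n k → s :* n :- con 1ℚ :* n := s :* k :+ (s :* n :- (s :* k :+ n))) refl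
    main : s * ι k ≤ s * ((1ℚ - σ*) * ι n)
    main = ≤-by _ (0≤- sum≤) (trans (id₁ s σ* (ι n) (ι k)) (trans (cong (λ y → s * ι n - y * ι n) eq) (id₃ s (ι n) (ι k))))
    id₂ : ∀ s σ* σ n → s * ((1ℚ - σ) * n) ≡ s * ((1ℚ - σ*) * n) + s * (σ* - σ) * n
    id₂ = solve 4 (λ s σ* σ n → s :* ((con 1ℚ :- σ) :* n) := s :* ((con 1ℚ :- σ*) :* n) :+ s :* (σ* :- σ) :* n) refl

  -- From δ ≥ 1/(K + 1) follow 1 - δ ≤ K/(K + 1) and 1 + δ ≥ (K + 2)/(K + 1), so ratios of
  -- consecutive integers certify the extremal range and the volume.
  module Band (δ : ℚ) (δ-unit : InUnit δ) (K : ℕ) (1≤K : 1ℚ ≤ δ * ι (suc K)) where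
    k = ι (suc K)
    0≤1-δ : 0ℚ ≤ 1ℚ - δ
    0≤1-δ = 0≤- (proj₂ δ-unit)
    lo : k * (1ℚ - δ) ≤ ι K
    lo = ≤-by _ (0≤- 1≤K) (solve 2 (λ κ δ → κ := (con 1ℚ :+ κ) :* (con 1ℚ :- δ) :+ (δ :* (con 1ℚ :+ κ) :- con 1ℚ)) refl (ι K) δ)
    hi : ι (suc (suc K)) ≤ k * (1ℚ + δ)
    hi = ≤-by _ (0≤- 1≤K) (solve 2 (λ k δ → k :* (con 1ℚ :+ δ) := (con 1ℚ :+ k) :+ (δ :* k :- con 1ℚ)) refl k δ)

    below : ∀ {s n} → K ℕ.* K ℕ.* n ℕ.≤ suc K ℕ.* suc K ℕ.* s → (1ℚ - δ) * (1ℚ - δ) * toℚ n ≤ toℚ s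
    below {s} {n} h = subst₂ (λ u v → (1ℚ - δ) * (1ℚ - δ) * u ≤ v) (sym (toℚ-ι n)) (sym (toℚ-ι s)) (*-cancel (ι-pos K) (*-cancel (ι-pos K)
      (ℚₚ.≤-trans (subst (_≤ ι K * ι K * ι n) (solve 3 (λ k e n → k :* e :* (k :* e) :* n := k :* (k :* (e :* e :* n))) refl k (1ℚ - δ) (ι n))
          (ℚₚ.*-monoʳ-≤-nonNeg (ι n) ⦃ nonNegative (ι≥0 n) ⦄ (*-mono′ lo)))
        (subst₂ _≤_ (trans (ι-* (K ℕ.* K) n) (cong (_* ι n) (ι-* K K)))
          (trans (ι-* (suc K ℕ.* suc K) s) (trans (cong (_* ι s) (ι-* (suc K) (suc K))) (ℚₚ.*-assoc k k (ι s)))) (ι-mono h)))))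
      where
      *-mono′ : ∀ {y} → k * (1ℚ - δ) ≤ y → k * (1ℚ - δ) * (k * (1ℚ - δ)) ≤ y * y
      *-mono′ {y} p = ℚₚ.≤-trans (ℚₚ.*-monoˡ-≤-nonNeg (k * (1ℚ - δ)) ⦃ nonNegative (0≤* (ι≥0 (suc K)) 0≤1-δ) ⦄ p)
        (ℚₚ.*-monoʳ-≤-nonNeg y ⦃ nonNegative (ℚₚ.≤-trans (0≤* (ι≥0 (suc K)) 0≤1-δ) p) ⦄ p)

    above : ∀ {s n} → suc K ℕ.* suc K ℕ.* s ℕ.≤ suc (suc K) ℕ.* suc (suc K) ℕ.* n → toℚ s ≤ (1ℚ + δ) * (1ℚ + δ) * toℚ n
    above {s} {n} h = subst₂ (λ u v → v ≤ (1ℚ + δ) * (1ℚ + δ) * u) (sym (toℚ-ι n)) (sym (toℚ-ι s)) (*-cancel (ι-pos K) (*-cancel (ι-pos K)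
      (ℚₚ.≤-trans (subst₂ _≤_ (trans (ι-* (suc K ℕ.* suc K) s) (trans (cong (_* ι s) (ι-* (suc K) (suc K))) (ℚₚ.*-assoc k k (ι s))))
          (trans (ι-* (suc (suc K) ℕ.* suc (suc K)) n) (cong (_* ι n) (ι-* (suc (suc K)) (suc (suc K))))) (ι-mono h))
        (subst (ι (suc (suc K)) * ι (suc (suc K)) * ι n ≤_) (solve 3 (λ k e n → k :* e :* (k :* e) :* n := k :* (k :* (e :* e :* n))) refl k (1ℚ + δ) (ι n))
          (ℚₚ.*-monoʳ-≤-nonNeg (ι n) ⦃ nonNegative (ι≥0 n) ⦄ sq)))))
      where
      j = ι (suc (suc K))
      sq : j * j ≤ k * (1ℚ + δ) * (k * (1ℚ + δ))
      sq = ℚₚ.≤-trans (ℚₚ.*-monoˡ-≤-nonNeg j ⦃ nonNegative (ι≥0 (suc (suc K))) ⦄ hi)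
        (ℚₚ.*-monoʳ-≤-nonNeg (k * (1ℚ + δ)) ⦃ nonNegative (ℚₚ.≤-trans (ι≥0 (suc (suc K))) hi) ⦄ hi)

    volume : ∀ {N V} → K ℕ.* N ℕ.≤ suc K ℕ.* V → (1ℚ - δ) * toℚ N ≤ toℚ V
    volume {N} {V} h = subst₂ (λ u v → (1ℚ - δ) * u ≤ v) (sym (toℚ-ι N)) (sym (toℚ-ι V)) (*-cancel (ι-pos K)
      (ℚₚ.≤-trans (subst (_≤ ι K * ι N) (ℚₚ.*-assoc k (1ℚ - δ) (ι N)) (ℚₚ.*-monoʳ-≤-nonNeg (ι N) ⦃ nonNegative (ι≥0 N) ⦄ lo))
        (subst₂ _≤_ (ι-* K N) (ι-* (suc K) V) (ι-mono h))))

  quarter : ∀ β N → ι 4 * ((ℤ.+ 1 / 4) * β * N) ≡ β * N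
  quarter = solve 2 (λ β N → con (ι 4) :* (con (ℤ.+ 1 / 4) :* β :* N) := β :* N) refl

  huge⇒ : ∀ {n} (H : Hypergraph n) β i → Huge H β i → β * ι n ≤ ι (4 ℕ.* ∣e∣ H i)
  huge⇒ {n} H β i h = subst₂ _≤_ (trans (quarter β (toℚ n)) (cong (β *_) (toℚ-ι n)))
    (trans (cong (ι 4 *_) (toℚ-ι (∣e∣ H i))) (sym (ι-* 4 (∣e∣ H i)))) (ℚₚ.*-monoˡ-≤-nonNeg (ι 4) ⦃ nonNegative (ι≥0 4) ⦄ h)

  ¬huge⇒ : ∀ {n} (H : Hypergraph n) β i → ¬ Huge H β i → ι (4 ℕ.* ∣e∣ H i) < β * ι n
  ¬huge⇒ {n} H β i h = subst₂ _<_ (trans (cong (ι 4 *_) (toℚ-ι (∣e∣ H i))) (sym (ι-* 4 (∣e∣ H i))))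
    (trans (quarter β (toℚ n)) (cong (β *_) (toℚ-ι n))) (ℚₚ.*-monoʳ-<-pos (ι 4) ⦃ Data.Rational.positive (ι-pos 3) ⦄ (ℚₚ.≰⇒> h))

-- Explicit constants and thresholds

module Constants where
  open FiniteSums
  open LinearIncidence using (farkas)
  open ColouringCases using (Λ; 2G≤Λ)
  open Parameters
  open PolynomialIdentities using (polynomial; _:=_; _:+_; _:*_; con)
  open import Data.Fin using (zero; suc)
  open import Data.Fin.Patterns
  open import Data.List using (List; []; _∷_; lookup)
  open import Data.Nat using (ℕ; suc; _+_; _*_; _≤_; _<_; z≤n; s≤s)
  open import Data.Nat.ListAction using (sum)
  open import Data.Nat.Properties
  open import Data.Vec using ([]; _∷_)
  open import Relation.Binary.PropositionalEquality

  c-p-z : ∀ p M → 32 * (1 + p) ≤ M → 6 * (1 + p) ≤ 8 * M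
  c-p-z p M h1 = farkas 15 (*-monoʳ-≤ 3 h1)
    (polynomial (p ∷ M ∷ []) (λ p M → con 16 :* (con 6 :* (con 1 :+ p)) :+ (con 3 :* M) :+ (con 125 :* M) := con 16 :* (con 8 :* M) :+ (con 3 :* (con 32 :* (con 1 :+ p)))) refl)

  c-K-z : ∀ K p M → 32 * (1 + p) ≤ M → 4 * K ≤ p → 4 * K ≤ 8 * M
  c-K-z K p M h1 h2 = farkas 31 (+-mono-≤ h1 (*-monoʳ-≤ 32 h2))
    (polynomial (K ∷ p ∷ M ∷ []) (λ K p M → con 32 :* (con 4 :* K) :+ (M :+ con 32 :* p) :+ (con 32 :+ con 255 :* M) := con 32 :* (con 8 :* M) :+ ((con 32 :* (con 1 :+ p)) :+ con 32 :* (con 4 :* K))) refl)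

  vol-half : ∀ K V n2 → (1 + K) * n2 ≤ (1 + K) * V + n2 → K * n2 ≤ (1 + K) * V
  vol-half K V n2 h1 = farkas 0 h1
    (polynomial (K ∷ V ∷ n2 ∷ []) (λ K V n2 → con 1 :* (K :* n2) :+ (((con 1 :+ K) :* V :+ n2)) :+ con 0 := con 1 :* ((con 1 :+ K) :* V) :+ (((con 1 :+ K) :* n2))) refl)

  out-edge : ∀ K Ξ n2 R S → Ξ * R ≤ n2 → S ≤ 2 * R → 8 * K * K ≤ Ξ → K * 2 * (K * 2) * S ≤ n2
  out-edge K Ξ n2 R S h1 h2 h3 = farkas 0 (+-mono-≤ (+-mono-≤ h1 (*-monoʳ-≤ (4 * K * K) h2)) (*-monoʳ-≤ R h3))
    (polynomial (K ∷ Ξ ∷ n2 ∷ R ∷ S ∷ []) (λ K Ξ n2 R S → con 1 :* (K :* con 2 :* (K :* con 2) :* S) :+ (n2 :+ (con 4 :* K :* K) :* (con 2 :* R) :+ R :* Ξ) :+ con 0 := con 1 :* n2 :+ ((Ξ :* R) :+ (con 4 :* K :* K) :* S :+ R :* (con 8 :* K :* K))) refl)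

  in-edge : ∀ K n2 r₂ S → S ≤ 4 * r₂ → 16 * K * K * r₂ ≤ n2 → K * 2 * (K * 2) * S ≤ n2
  in-edge K n2 r₂ S h1 h2 = farkas 0 (+-mono-≤ (*-monoʳ-≤ (4 * K * K) h1) h2)
    (polynomial (K ∷ n2 ∷ r₂ ∷ S ∷ []) (λ K n2 r₂ S → con 1 :* (K :* con 2 :* (K :* con 2) :* S) :+ ((con 4 :* K :* K) :* (con 4 :* r₂) :+ n2) :+ con 0 := con 1 :* n2 :+ ((con 4 :* K :* K) :* S :+ (con 16 :* K :* K :* r₂))) refl)

  z-half : ∀ z s r → z * s ≤ (z + 1) * r → 1 ≤ z → z * s ≤ z * (2 * r)
  z-half z s r h1 h2 = farkas 0 (+-mono-≤ h1 (*-monoʳ-≤ r h2))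
    (polynomial (z ∷ s ∷ r ∷ []) (λ z s r → con 1 :* (z :* s) :+ (((z :+ con 1) :* r) :+ r :* z) :+ con 0 := con 1 :* (z :* (con 2 :* r)) :+ ((z :* s) :+ r :* con 1)) refl)

  lo-ratio : ∀ K p → 1 + K ≤ 1 + p → K * (1 + p) ≤ p * (1 + K)
  lo-ratio K p h1 = farkas 0 h1
    (polynomial (K ∷ p ∷ []) (λ K p → con 1 :* (K :* (con 1 :+ p)) :+ ((con 1 :+ p)) :+ con 0 := con 1 :* (p :* (con 1 :+ K)) :+ ((con 1 :+ K))) refl)

  sum≤⇒lookup≤ : ∀ xs {n} → sum xs ≤ n → ∀ i → lookup xs i ≤ n
  sum≤⇒lookup≤ (x ∷ xs) h zero = m+n≤o⇒m≤o x h
  sum≤⇒lookup≤ (x ∷ xs) h (suc i) = sum≤⇒lookup≤ xs (m+n≤o⇒n≤o x h) i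

  2≤Λ : 2 ≤ Λ 128
  2≤Λ = ≤-trans (m≤m+n 2 254) (2G≤Λ 128)

  -- κ = 161 must exceed the 160 of `pairing`; 1296 = 8(1 + κ) is the bound on p and on κ₃, and 2593
  -- = 1 + 2 · 1296 the one on c. `Ξ` and `Y` are sums of the lower bounds imposed on them.
  constants′ : ∀ K g₂ → 1 ≤ K → Const K g₂
  constants′ K g₂ 1≤K = build (1296 + 4 * K) (2593 + g₂) refl refl _ refl _ refl _ refl _ refl
    where
    -- The values enter as variables with equations, so that checking the constraints never unfolds
    -- these large terms.
    build : ∀ p c → p ≡ 1296 + 4 * K → c ≡ 2593 + g₂ → ∀ Ξ → Ξ ≡ suc (64 * c + 4 * (32 * c) * (32 * c) + 8 * K * K + K) →
            ∀ V → V ≡ 32 * (1 + p) → ∀ M → M ≡ V * ((1 + 2 * C * C * V) * (2 * C * V)) →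
            ∀ Y → Y ≡ 8 * Ξ + 8192 + 16 * (4 * Λ 128) * V → Const K g₂
    build p c p≡ c≡ Ξ Ξ≡ V V≡ M M≡ Y Y≡ = record
      { p = p ; V = V ; M = M ; z = 8 * M ; Y = Y ; q = q ; U = 64 * q ; c = c ; Ξ = Ξ ; κ = 161 ; k₃ = 1294
      ; 1≤K = 1≤K ; 2≤p = ≤-trans (m≤m+n 2 1294) p≥ ; p-κ = p≥ ; p-K = p-K ; κ-big = ≤-refl ; κ₃-κ = ≤-refl
      ; V-def = V≡ ; M-def = M≡ ; 1≤M = 1≤M ; V≤M = V≤M ; z-def = refl ; q-def = refl ; 2≤q = 2≤q ; Y≤q = Y≤q ; U-def = refl
      ; U-M = U-M ; U-128 = *-monoʳ-≤ 64 2≤q ; U-p = U-p ; K-z = c-K-z K p M pM p-K ; p-z = c-p-z p M pM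
      ; c-κ₃ = ≤-trans (m≤m+n 2593 g₂) (≤-reflexive (sym c≡))
      ; c-g₂ = ≤-trans (m≤n+m g₂ 2593) (≤-trans (≤-reflexive (sym c≡)) (m≤m+n c _))
      ; Ξ-c = ≤-trans (≤-trans (≤-trans (≤-trans (m≤m+n (64 * c) _) (m≤m+n _ _)) (m≤m+n _ K)) (n≤1+n _)) (≤-reflexive (sym Ξ≡))
      ; Ξ-c² = ≤-trans (s≤s (≤-trans (≤-trans (m≤n+m (4 * (32 * c) * (32 * c)) (64 * c)) (m≤m+n _ _)) (m≤m+n _ K))) (≤-reflexive (sym Ξ≡))
      ; Ξ-K² = ≤-trans (≤-trans (≤-trans (m≤n+m (8 * K * K) _) (m≤m+n _ K)) (n≤1+n _)) (≤-reflexive (sym Ξ≡))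
      ; Ξ-K = ≤-trans (≤-trans (m≤n+m K _) (n≤1+n _)) (≤-reflexive (sym Ξ≡))
      ; Y-Ξ = ≤-trans (≤-trans (m≤m+n (8 * Ξ) 8192) (m≤m+n _ _)) (≤-reflexive (sym Y≡))
      ; Y-big = Y-big ; Y-V = ≤-trans (m≤n+m _ _) (≤-reflexive (sym Y≡)) ; 1≤C = 1≤CV
      ; 1≤AV = *-mono-≤ {1} {16 * (4 * Λ 128)} {1} {V} (*-mono-≤ {1} {16} {1} {4 * Λ 128} (s≤s z≤n) 1≤4Λ) 1≤V }
      where
      q = (8 * M + 1) * Y
      p≥ : 1296 ≤ p
      p≥ = subst (1296 ≤_) (sym p≡) (m≤m+n 1296 (4 * K))
      p-K : 4 * K ≤ p
      p-K = subst (4 * K ≤_) (sym p≡) (m≤n+m (4 * K) 1296)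
      1≤4Λ : 1 ≤ 4 * Λ 128
      1≤4Λ = ≤-trans (≤-trans (s≤s z≤n) 2≤Λ) (m≤m+n (Λ 128) (3 * Λ 128))
      1≤C : 1 ≤ C
      1≤C = ≤-trans 1≤4Λ (m≤m+n (4 * Λ 128) (1 * (4 * Λ 128)))
      pV : 1 + p ≤ V
      pV = ≤-trans (m≤m+n (1 + p) _) (≤-reflexive (sym V≡))
      1≤V : 1 ≤ V
      1≤V = ≤-trans (s≤s z≤n) pV
      1≤CV : 1 ≤ 2 * C * V
      1≤CV = *-mono-≤ {1} {2 * C} {1} {V} (≤-trans 1≤C (m≤m+n C _)) 1≤V
      V≤M : V ≤ M
      V≤M = ≤-trans (≤-reflexive (sym (*-identityʳ V))) (≤-trans (*-monoʳ-≤ V (*-mono-≤ {1} {1 + 2 * C * C * V} {1} {2 * C * V} (s≤s z≤n) 1≤CV)) (≤-reflexive (sym M≡)))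
      1≤M : 1 ≤ M
      1≤M = ≤-trans 1≤V V≤M
      pM : 32 * (1 + p) ≤ M
      pM = ≤-trans (≤-reflexive (sym V≡)) V≤M
      Y-big : 8192 ≤ Y
      Y-big = ≤-trans (≤-trans (m≤n+m 8192 (8 * Ξ)) (m≤m+n _ _)) (≤-reflexive (sym Y≡))
      Y≤q : Y ≤ q
      Y≤q = ≤-trans (≤-reflexive (sym (*-identityˡ Y))) (*-monoˡ-≤ Y (m≤n+m 1 (8 * M)))
      2≤q : 2 ≤ q
      2≤q = ≤-trans (≤-trans (m≤m+n 2 8190) Y-big) Y≤q
      8M≤q : 8 * M ≤ q
      8M≤q = ≤-trans (m≤m+n (8 * M) 1) (≤-trans (≤-reflexive (sym (*-identityʳ (8 * M + 1)))) (*-monoʳ-≤ (8 * M + 1) (≤-trans (m≤m+n 1 8191) Y-big)))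
      U-M : 2 * M * 68 ≤ 64 * q
      U-M = ≤-trans (≤-reflexive (trans (*-assoc 2 M 68) (trans (cong (2 *_) (*-comm M 68)) (sym (*-assoc 2 68 M)))))
        (≤-trans (*-monoˡ-≤ M (m≤m+n 136 376)) (≤-trans (≤-reflexive (*-assoc 64 8 M)) (*-monoʳ-≤ 64 8M≤q)))
      U-p : (1 + p) * 33 < 64 * q
      U-p = ≤-trans (+-monoˡ-≤ ((1 + p) * 33) (s≤s (z≤n {p}))) (≤-trans (≤-reflexive (sym (*-suc (1 + p) 33)))
        (≤-trans (*-monoʳ-≤ (1 + p) (m≤m+n 34 30)) (≤-trans (≤-reflexive (*-comm (1 + p) 64)) (*-monoʳ-≤ 64 (≤-trans pV (≤-trans V≤M (≤-trans (m≤m+n M _) 8M≤q)))))))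

  opaque
    constants : ∀ K g₂ → 1 ≤ K → Const K g₂
    constants = constants′

  module Thresholds {K g₂ : ℕ} (P : Const K g₂) where
    open Const P
    open Core P

    1≤2U : 1 ≤ 2 * U
    1≤2U = ≤-trans (≤-trans (s≤s z≤n) U-128) (m≤m+n U _)

    -- Each threshold is the sum of the lower bounds listed, hence at least each of them; the
    -- positive first entry makes the threshold itself positive.
    r₁-terms r₀-terms : ℕ → List ℕ
    r₁-terms g = 1 ∷ Λ (2 * g) ∷ 128 * c * g ∷ 2 * (32 * c) ∷ 8 * g * g ∷ []
    r₀-terms b = 1 ∷ 8 * (1 + p) ∷ q ∷ Λ 128 ∷ 16 * M ∷ 8 * U * b ∷ 128 * c * b ∷ 5 * κ₃ ∷ []

    n-terms : ℕ → ℕ → ℕ → List ℕ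
    n-terms g b r₀ = 64 ∷ U ∷ M ∷ g ∷ 16 * c ∷ b ∷ Λ 128 ∷ Λ (2 * g) ∷ Λ (2 * g) * (r₀ * r₀) ∷ 2 * U * (1 + 32 * b * b) ∷ suc (4 * b * r₀)
      ∷ 2 * g * (2 * r₀) ∷ suc (32 * b * b) ∷ 32 * K * K ∷ suc (2 * ((1 + Z g r₀) * Z g r₀)) ∷ []

    opaque
      g : ℕ → ℕ
      -- `K` keeps medium classes within δn, `U` gives y₁ ≤ 2u, and `4 * g₁` keeps the 4y₁ medium
      -- colours within γ₁n.
      g g₁ = K + U + 4 * g₁

      R₁ : ℕ → ℕ
      R₁ g₁ = sum (r₁-terms (g g₁))

      R₀ : ℕ → ℕ
      R₀ b = sum (r₀-terms b)

      N : ℕ → ℕ → ℕ → ℕ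
      N g₁ b r₀ = sum (n-terms (g g₁) b r₀)

      1≤R₁ : ∀ g₁ → 1 ≤ R₁ g₁
      1≤R₁ _ = s≤s z≤n

      1≤R₀ : ∀ b → 1 ≤ R₀ b
      1≤R₀ _ = s≤s z≤n

      1≤N : ∀ g₁ b r₀ → 1 ≤ N g₁ b r₀
      1≤N _ _ _ = s≤s z≤n

      4g₁≤g : ∀ g₁ → 4 * g₁ ≤ g g₁
      4g₁≤g g₁ = m≤n+m (4 * g₁) (K + U)

      medium : ∀ g₁ {r₁} → R₁ g₁ ≤ r₁ → Medium (g g₁) r₁
      medium g₁ {r₁} h = record { 1≤g = ≤-trans 1≤K K≤g ; K≤g = K≤g ; U≤g = ≤-trans (m≤n+m U K) (m≤m+n (K + U) (4 * g₁))
        ; Λ-r₁ = x 1F ; tot-r₁ = x 2F ; c-r₁ = x 3F ; g-r₁ = x 4F ; 1≤r₁ = x 0F }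
        where
        K≤g : K ≤ g g₁
        K≤g = ≤-trans (m≤m+n K U) (m≤m+n (K + U) (4 * g₁))
        x : ∀ i → lookup (r₁-terms (g g₁)) i ≤ r₁
        x = sum≤⇒lookup≤ (r₁-terms (g g₁)) h

      large : ∀ {g b r₀} → K ≤ b → R₀ b ≤ r₀ → Large g b r₀
      large {_} {b} {r₀} K≤b h = record { 1≤b = ≤-trans 1≤K K≤b ; K≤b = K≤b ; p-r₀ = x 1F ; q-r₀ = x 2F
        ; Λ-r₀ = x 3F ; M-r₀ = x 4F ; U-r₀ = x 5F ; c-r₀ = x 6F ; κ-r₀ = x 7F ; 1≤r₀ = x 0F }
        where
        x : ∀ i → lookup (r₀-terms b) i ≤ r₀
        x = sum≤⇒lookup≤ (r₀-terms b) h

      order : ∀ {g₁ b r₀ n} → N g₁ b r₀ ≤ n → Order (g g₁) b r₀ n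
      order {g₁} {b} {r₀} {n} h = record
        { U-n = x 1F ; M-n = x 2F ; 64-n = x 0F ; g-n = x 3F ; c-n = x 4F ; b-n = x 5F ; Λ-n = x 6F ; Λg-n = x 7F ; Λr-n = x 8F ; Ub-n = x 9F
        ; br-n = x (suc 9F) ; gr-n = x (suc (suc 9F)) ; bb-n = x (suc (suc (suc 9F))) ; KK-n = x (suc (suc (suc (suc 9F))))
        ; Z-n = x (suc (suc (suc (suc (suc 9F))))) }
        where
        x : ∀ i → lookup (n-terms (g g₁) b r₀) i ≤ n
        x = sum≤⇒lookup≤ (n-terms (g g₁) b r₀) h

-- Derivation of the two outcomes

module Conclusion where
  open PolynomialIdentities using (polynomial; _:=_; _:+_; _:*_; con)
  open import Defs
  open import Data.Nat using (ℕ; _<_)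
  open import Data.Rational using (ℚ; _≤_)
  open import Data.Product using (_×_)
  open import Data.Sum using (_⊎_)
  open import Data.Fin using (Fin)
  open FiniteSums
  open DenseSubsets using (module Dense)
  open NibblePotential using (ι; ι-*; ι-mono; ι-cancel; ι≥0; 0≤*)
  open Parameters hiding (C)
  open RationalBounds
  open Constants
  open import Data.Bool using (true)
  open import Data.Empty using (⊥-elim)
  open import Data.Nat as ℕ using (suc; z≤n; s≤s)
  open import Data.Nat.Combinatorics using (_C_)
  import Data.Nat.Properties as ℕₚ
  open import Data.Nat.Tactic.RingSolver using (solve-∀)
  open import Data.Product using (∃; _,_; proj₁; proj₂)
  open import Data.Rational as ℚ using (0ℚ; 1ℚ)
  import Data.Integer as ℤ
  import Data.Rational.Properties as ℚₚ
  open import Data.Sum using (inj₁; inj₂; [_,_]′)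
  open import Data.Vec using ([]; _∷_)
  open import Relation.Binary.PropositionalEquality
  open import Relation.Nullary using (¬_; yes; no; does; Dec)
  open import Relation.Nullary.Decidable using (dec-true)

  -- Composes s ≤ (1 + 1/z)r with r ≤ (1 + 1/(1 + p))√n to s ≤ (1 + 1/K)√n, in squares so that no
  -- root appears.
  above-ratio : ∀ K z p r s n → 1 ℕ.≤ z → z ℕ.* s ℕ.≤ (z ℕ.+ 1) ℕ.* r →
                (1 ℕ.+ p) ℕ.* (1 ℕ.+ p) ℕ.* (r ℕ.* r) ℕ.≤ (2 ℕ.+ p) ℕ.* (2 ℕ.+ p) ℕ.* n →
                K ℕ.* (z ℕ.+ 1) ℕ.* (2 ℕ.+ p) ℕ.≤ (K ℕ.+ 1) ℕ.* z ℕ.* (1 ℕ.+ p) → K ℕ.* K ℕ.* (s ℕ.* s) ℕ.≤ suc K ℕ.* suc K ℕ.* n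
  above-ratio K z p r s n 1≤z h₁ h₂ h₃ = *-cancelˡ-≤ (z * z * ((1 + p) * (1 + p))) ⦃ ℕ.>-nonZero (*-mono-≤ {1} {z * z} {1} (*-mono-≤ 1≤z 1≤z) (s≤s z≤n)) ⦄ (begin
    z * z * ((1 + p) * (1 + p)) * (K * K * (s * s))         ≡⟨ e₁ K z p s ⟩
    (1 + p) * K * ((1 + p) * K) * (z * s * (z * s))         ≤⟨ *-monoʳ-≤ ((1 + p) * K * ((1 + p) * K)) (*-mono-≤ h₁ h₁) ⟩
    (1 + p) * K * ((1 + p) * K) * ((z + 1) * r * ((z + 1) * r)) ≡⟨ e₂ K z p r ⟩
    K * (z + 1) * (K * (z + 1)) * ((1 + p) * (1 + p) * (r * r)) ≤⟨ *-monoʳ-≤ (K * (z + 1) * (K * (z + 1))) h₂ ⟩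
    K * (z + 1) * (K * (z + 1)) * ((2 + p) * (2 + p) * n)   ≡⟨ e₃ K z p n ⟩
    K * (z + 1) * (2 + p) * (K * (z + 1) * (2 + p)) * n     ≤⟨ *-monoˡ-≤ n (*-mono-≤ h₃ h₃) ⟩
    (K + 1) * z * (1 + p) * ((K + 1) * z * (1 + p)) * n     ≡⟨ e₄ K z p n ⟩
    z * z * ((1 + p) * (1 + p)) * (suc K * suc K * n) ∎)
    where
    open Data.Nat using (_*_; _+_)
    open ℕₚ using (*-cancelˡ-≤; *-mono-≤; *-monoʳ-≤; *-monoˡ-≤)
    open ℕₚ.≤-Reasoning
    e₁ : ∀ K z p s → z * z * ((1 + p) * (1 + p)) * (K * K * (s * s)) ≡ (1 + p) * K * ((1 + p) * K) * (z * s * (z * s))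
    e₁ = solve-∀
    e₂ : ∀ K z p r → (1 + p) * K * ((1 + p) * K) * ((z + 1) * r * ((z + 1) * r)) ≡ K * (z + 1) * (K * (z + 1)) * ((1 + p) * (1 + p) * (r * r))
    e₂ = solve-∀
    e₃ : ∀ K z p n → K * (z + 1) * (K * (z + 1)) * ((2 + p) * (2 + p) * n) ≡ K * (z + 1) * (2 + p) * (K * (z + 1) * (2 + p)) * n
    e₃ = solve-∀
    e₄ : ∀ K z p n → (K + 1) * z * (1 + p) * ((K + 1) * z * (1 + p)) * n ≡ z * z * ((1 + p) * (1 + p)) * (suc K * suc K * n)
    e₄ = solve-∀

  below-ratio : ∀ K p n s → K ℕ.* (1 ℕ.+ p) ℕ.≤ p ℕ.* (1 ℕ.+ K) → p ℕ.* p ℕ.* n ℕ.≤ (1 ℕ.+ p) ℕ.* (1 ℕ.+ p) ℕ.* s →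
                K ℕ.* K ℕ.* n ℕ.≤ suc K ℕ.* suc K ℕ.* s
  below-ratio K p n s h₁ h₂ = *-cancelˡ-≤ ((1 + p) * (1 + p)) (begin
    (1 + p) * (1 + p) * (K * K * n)       ≡⟨ e₁ K p n ⟩
    K * (1 + p) * (K * (1 + p)) * n       ≤⟨ *-monoˡ-≤ n (*-mono-≤ h₁ h₁) ⟩
    p * (1 + K) * (p * (1 + K)) * n       ≡⟨ e₂ K p n ⟩
    (1 + K) * (1 + K) * (p * p * n)       ≤⟨ *-monoʳ-≤ ((1 + K) * (1 + K)) h₂ ⟩
    (1 + K) * (1 + K) * ((1 + p) * (1 + p) * s) ≡⟨ e₃ K p s ⟩
    (1 + p) * (1 + p) * (suc K * suc K * s) ∎)
    where
    open Data.Nat using (_*_; _+_)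
    open ℕₚ using (*-cancelˡ-≤; *-mono-≤; *-monoʳ-≤; *-monoˡ-≤)
    open ℕₚ.≤-Reasoning
    e₁ : ∀ K p n → (1 + p) * (1 + p) * (K * K * n) ≡ K * (1 + p) * (K * (1 + p)) * n
    e₁ = solve-∀
    e₂ : ∀ K p n → p * (1 + K) * (p * (1 + K)) * n ≡ (1 + K) * (1 + K) * (p * p * n)
    e₂ = solve-∀
    e₃ : ∀ K p s → (1 + K) * (1 + K) * ((1 + p) * (1 + p) * s) ≡ (1 + p) * (1 + p) * (suc K * suc K * s)
    e₃ = solve-∀

  s²≤2s[s-1] : ∀ s → 2 ℕ.≤ s → s ℕ.* s ℕ.≤ 2 ℕ.* (s ℕ.* (s ℕ.∸ 1))
  s²≤2s[s-1] (suc s) (s≤s 1≤s) = ℕₚ.≤-trans (ℕₚ.*-monoʳ-≤ (suc s) (ℕₚ.+-monoˡ-≤ s 1≤s)) (ℕₚ.≤-reflexive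
    (polynomial (s ∷ []) (λ s → (con 1 :+ s) :* (s :+ s) := con 2 :* ((con 1 :+ s) :* s)) refl))

  does-true : ∀ {A : Set} (d : Dec A) → does d ≡ true → A
  does-true (yes a) _ = a

  does-false : ∀ {A : Set} (d : Dec A) → ¬ (does d ≡ true) → ¬ A
  does-false (yes a) h = ⊥-elim (h refl)
  does-false (no ¬a) _ = ¬a

  1-unit : InUnit 1ℚ
  1-unit = ℚₚ.positive⁻¹ 1ℚ , ℚₚ.≤-refl

  square-2* : ∀ r → 2 ℕ.* r ℕ.* (2 ℕ.* r) ≡ 4 ℕ.* (r ℕ.* r)
  square-2* = solve-∀

  record Choice : Set where
    constructor choice
    field
      {K} : ℕ
      {g₂} : ℕ
      {g₁} : ℕ
      {g} : ℕ
      {r₁} : ℕ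
      {b} : ℕ
      {r₀} : ℕ
      {n} : ℕ
      {γ₂} : ℚ
      {δ} : ℚ
      {σ*} : ℚ
      {σ} : ℚ
      {γ₁} : ℚ
      {β} : ℚ
      γ₂-unit : InUnit γ₂
      δ-unit : InUnit δ
      γ₁-unit : InUnit γ₁
      β-unit : InUnit β
      γ₂g₂ : 1ℚ ≤ γ₂ ℚ.* ι g₂
      δK : 1ℚ ≤ δ ℚ.* ι (suc K)
      γ₁g₁ : 1ℚ ≤ γ₁ ℚ.* ι g₁
      βb : 1ℚ ≤ β ℚ.* ι b
      P : Const (suc K) g₂
      σ*-rec : Reciprocal (2 ℕ.* Const.U P) σ*
      σ≤ : σ ≤ σ*
      4g₁≤g : 4 ℕ.* g₁ ℕ.≤ g
      md : Core.Medium P g r₁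
      lg : Core.Large P g b r₀
      od : Core.Order P g b r₀ n
      H : Hypergraph n
      lin : Linear H
      low : ∀ i → r₁ ℕ.< ∣e∣ H i

  module Conclude (Ch : Choice) where
    open Choice Ch

    open Data.Nat using (_*_; _+_; _∸_)
    open Const P
    open Incidence H

    1≤2U : 1 ℕ.≤ 2 * U
    1≤2U = ℕₚ.≤-trans (ℕₚ.≤-trans (s≤s z≤n) U-128) (ℕₚ.m≤m+n U _)

    0≤β : 0ℚ ≤ β
    0≤β = ℚₚ.<⇒≤ (proj₁ β-unit)

    open Dense a (linear lin)

    Huge? : ∀ i → Dec (Huge H β i)
    Huge? i = ((ℤ.+ 1 ℚ./ 4) ℚ.* β ℚ.* toℚ n) ℚₚ.≤? toℚ (∣e∣ H i)

    huge : Pred (m H)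
    huge i = does (Huge? i)

    βn<n+1 : β ℚ.* ι n ℚ.< ι (suc n)
    βn<n+1 = ℚₚ.≤-<-trans (subst (β ℚ.* ι n ≤_) (ℚₚ.*-identityˡ (ι n)) (ℚₚ.*-monoʳ-≤-nonNeg (ι n) ⦃ ℚ.nonNegative (ι≥0 n) ⦄ (proj₂ β-unit)))
      (ℚₚ.≰⇒> (λ h → ℕₚ.1+n≰n (ι-cancel {suc n} {n} h)))

    -- Sizes are integers, so the bound βn may be replaced by its integer part: an edge that is not
    -- huge has four times its size at most `Bf`.
    Bf-choice : ∃ λ B → ι B ≤ β ℚ.* ι n × β ℚ.* ι n ℚ.< ι (suc B)
    Bf-choice = ι-floor n (β ℚ.* ι n) (0≤* 0≤β (ι≥0 n)) βn<n+1
    Bf = proj₁ Bf-choice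

    ≤Bf : ∀ {x} → ι x ≤ β ℚ.* ι n → x ℕ.≤ Bf
    ≤Bf h = ℕₚ.≮⇒≥ (λ lt → ℚₚ.<-irrefl refl (ℚₚ.<-≤-trans (proj₂ (proj₂ Bf-choice)) (ℚₚ.≤-trans (ι-mono lt) h)))

    Bf-big : ∀ x → b * x ℕ.≤ n → x ℕ.≤ Bf
    Bf-big x h = ≤Bf (scale≤ {β} {b} {x} {n} 0≤β βb h)

    huge-size : ∀ i → i ∈ᵇ huge → n ℕ.≤ 4 * b * # (a i)
    huge-size i p = subst (n ℕ.≤_) (trans (eq b (∣e∣ H i)) (cong (4 * b *_) (size-≡ i))) (ι-cancel (ℚₚ.≤-trans
      (subst₂ _≤_ (ℚₚ.*-identityˡ (ι n)) (trans (cong (ℚ._* ι n) (ℚₚ.*-comm β (ι b))) (ℚₚ.*-assoc (ι b) β (ι n)))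
        (ℚₚ.*-monoʳ-≤-nonNeg (ι n) ⦃ ℚ.nonNegative (ι≥0 n) ⦄ βb))
      (subst (ι b ℚ.* (β ℚ.* ι n) ≤_) (sym (ι-* b (4 * ∣e∣ H i)))
        (ℚₚ.*-monoˡ-≤-nonNeg (ι b) ⦃ ℚ.nonNegative (ι≥0 b) ⦄ (huge⇒ H β i (does-true (Huge? i) p))))))
      where
      eq : ∀ b s → b * (4 * s) ≡ 4 * b * s
      eq = solve-∀

    huge-not : ∀ i → i ∉ᵇ huge → 4 * # (a i) ℕ.≤ Bf
    huge-not i p = subst (λ s → 4 * s ℕ.≤ Bf) (size-≡ i) (≤Bf (ℚₚ.<⇒≤ (¬huge⇒ H β i (does-false (Huge? i) (λ q → true≢false q p)))))

    the-input : Core.Input P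
    the-input = Core.input a (linear lin) md lg od
      (λ j → subst (r₁ ℕ.<_) (size-≡ j) (low j)) huge Bf huge-size huge-not Bf-big

    module Coloured = Core.Colour P the-input
    open Coloured using (y₁; y₁-low; B₀; B₀-low; f; f-low; k; k-bound; result; FPP; module FPP; module As; module Fpp)

    narrow : ∀ {x N s} {S : ℕ} → 0ℚ ℚ.< x → 1ℚ ≤ x ℚ.* ι N → N * S ℕ.≤ n → s ℕ.≤ S → toℚ s ≤ x ℚ.* toℚ n
    narrow {x} {N} {s} 0<x h h₁ h₂ = toℚ≤ {x} {N} {s} {n} 0<x h (ℕₚ.≤-trans (ℕₚ.*-monoʳ-≤ N h₂) h₁)

    in-γ₁ : ∀ {s} → s ℕ.≤ y₁ → toℚ s ≤ γ₁ ℚ.* toℚ n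
    in-γ₁ = narrow {γ₁} {g₁} (proj₁ γ₁-unit) (γ₁g₁)
      (ℕₚ.≤-trans (ℕₚ.*-monoˡ-≤ y₁ (ℕₚ.≤-trans (ℕₚ.m≤m+n g₁ _) (4g₁≤g))) y₁-low)

    in-β : ∀ {s} → s ℕ.≤ Bf → toℚ s ≤ β ℚ.* toℚ n
    in-β {s} h = subst₂ (λ u v → u ≤ β ℚ.* v) (sym (toℚ-ι s)) (sym (toℚ-ι n)) (ℚₚ.≤-trans (ι-mono h) (proj₁ (proj₂ Bf-choice)))

    in-δ : ∀ {s S} → suc K * S ℕ.≤ n → s ℕ.≤ S → toℚ s ≤ δ ℚ.* toℚ n
    in-δ = narrow {δ} {suc K} (proj₁ δ-unit) (δK)

    Load : ∀ {k} → (Fin (m H) → Fin k) → Fin k → ℕ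
    Load col c = ∑∈ (λ _ → true) (λ i → 𝟙 (col i == c) * # (a i))

    colour-A : As.Separated huge r₀ y₁ Bf (2 * y₁ + 2 * y₁) → OutcomeA H r₁ r₀ β γ₁ σ
    colour-A s = k , col , (λ i j i≢j (v , vi , vj) → proper i j refl refl (adj-intro i≢j (∈-a i v vi) (∈-a j v vj)))
      , colours≤ {2 * U} {σ*} {σ} {k} {n} 1≤2U σ*-rec σ≤ k-bound
      , (λ i j h → unique i j (huge-true i h))
      , setOf Cmed
      , narrow {γ₁} {g₁} (proj₁ γ₁-unit) (γ₁g₁) few (ℕₚ.≤-trans (ℕₚ.≤-reflexive (∣setOf∣ Cmed)) Cmed-few)
      , (λ i (_ , p) → setOf-∈ {S = Cmed} (medium′ i (subst (ℕ._≤ r₀) (size-≡ i) p)))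
      , (λ c p → in-γ₁ (ℕₚ.≤-trans (incident≤ col c) (inMed c (∈-setOf {S = Cmed} p))))
      , (λ c p q → in-β (ℕₚ.≤-trans (incident≤ col c) (outMed c (≢true⇒false (λ r → p (setOf-∈ {S = Cmed} r)))
          (λ i hi eq → q (i , does-true (Huge? i) hi , eq)))))
      where
      open As.Separated s renaming (medium to medium′)
      huge-true : ∀ i → Huge H β i → i ∈ᵇ huge
      huge-true i h = dec-true (Huge? i) h
      few : g₁ * (2 * y₁ + 2 * y₁) ℕ.≤ n
      few = ℕₚ.≤-trans (ℕₚ.≤-reflexive (eq g₁ y₁)) (ℕₚ.≤-trans (ℕₚ.*-monoˡ-≤ y₁ (4g₁≤g)) y₁-low)
        where
        eq : ∀ g y → g * (2 * y + 2 * y) ≡ 4 * g * y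
        eq = solve-∀

    module Plane (fpp : FPP) where
      open FPP fpp
      open Fpp.Outcome outcome renaming (medium to medium′)
      module Bd = Band δ δ-unit K (δK)

      1≤z : 1 ℕ.≤ z
      1≤z = ℕₚ.≤-trans (s≤s z≤n) (ℕₚ.≤-trans K-z ℕₚ.≤-refl)

      square : ∀ i → ∣e∣ H i * ∣e∣ H i ≡ size i * size i
      square i = cong₂ _*_ (size-≡ i) (size-≡ i)

      extremal : ∀ i → i ∈ᵇ W → FPPExtremal H δ i
      extremal i i∈W = Bd.below {∣e∣ H i * ∣e∣ H i} {n} (subst (λ s → K * K * n ℕ.≤ suc K * suc K * s) (sym (square i))
          (below-ratio K p n (size i * size i) (lo-ratio K p K≤p)
            (fpp-lo (suc K) p n (r * r) (size i * size i) K≤p above (ℕₚ.*-mono-≤ (W-low i i∈W) (W-low i i∈W)))))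
        , Bd.above {∣e∣ H i * ∣e∣ H i} {n} (subst (λ s → suc K * suc K * s ℕ.≤ suc (suc K) * suc (suc K) * n) (sym (square i))
          (above-ratio (suc K) z p r (size i) n 1≤z (W-high i i∈W) below (fpp-up (suc K) z p K-z p-K (s≤s z≤n))))
        where
        K≤p : suc K ℕ.≤ 1 + p
        K≤p = ℕₚ.≤-trans (ℕₚ.m≤m+n (suc K) _) (ℕₚ.≤-trans p-K (ℕₚ.n≤1+n p))

      volume : NormVolumeAtLeast H (setOf W) (1ℚ ℚ.- δ)
      volume = Bd.volume {n C 2} {volumeSum H (setOf W)} (ℕₚ.*-cancelˡ-≤ 2 (begin
        2 * (K * (n C 2)) ≡⟨ 2-inside-ℕ K (n C 2) ⟩
        K * (2 * (n C 2)) ≡⟨ cong (K *_) (choose₂ n) ⟩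
        K * (n * (n ∸ 1)) ≤⟨ ℕₚ.*-monoʳ-≤ K (ℕₚ.*-monoʳ-≤ n (ℕₚ.m∸n≤m n 1)) ⟩
        K * (n * n) ≤⟨ vol-half K (vol W) (n * n) (scale-down (suc K) Ξ (n * n) (vol W) (n * n) Ξ-K W-vol) ⟩
        suc K * vol W ≡⟨ cong (suc K *_) (sym (volumeSum-≡ W)) ⟩
        suc K * (2 * volumeSum H (setOf W)) ≡⟨ sym (2-inside-ℕ (suc K) (volumeSum H (setOf W))) ⟩
        2 * (suc K * volumeSum H (setOf W)) ∎))
        where
        open ℕₚ.≤-Reasoning

      r²≤2n : r * r ℕ.≤ 2 * n
      r²≤2n = ℕₚ.*-cancelˡ-≤ ((1 + p) * (1 + p)) (r-2n p n (r * r) below 2≤p)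

      -- Edges of `W` have size about √n, and an edge outside `W` has volume at most n²/Ξ. Thus even
      -- a class dominated by a huge edge covers at most δn vertices, as outcome (b) demands.
      edge-small : ∀ e → suc K * (2 * size e) ℕ.≤ n
      edge-small e = ℕₚ.≤-trans (ℕₚ.≤-reflexive (sym (ℕₚ.*-assoc (suc K) 2 (size e)))) (sq-cancel (ℕₚ.≤-trans (ℕₚ.≤-reflexive (eq (suc K) (size e))) (bound (dec-Bool (W e)))))
        where
        eq : ∀ K s → K * 2 * s * (K * 2 * s) ≡ K * 2 * (K * 2) * (s * s)
        eq = solve-∀
        bound : e ∈ᵇ W ⊎ e ∉ᵇ W → suc K * 2 * (suc K * 2) * (size e * size e) ℕ.≤ n * n
        bound (inj₁ e∈W) = in-edge (suc K) (n * n) (r * r) (size e * size e)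
          (ℕₚ.≤-trans (ℕₚ.*-mono-≤ e≤2r e≤2r) (ℕₚ.≤-reflexive (square-2* r)))
          (small-w (suc K) (r * r) n r²≤2n (Core.Order.KK-n od))
          where
          e≤2r : size e ℕ.≤ 2 * r
          e≤2r = ℕₚ.*-cancelˡ-≤ z ⦃ ℕ.>-nonZero 1≤z ⦄ (z-half z (size e) r (W-high e e∈W) 1≤z)
        bound (inj₂ e∉W) = out-edge (suc K) Ξ (n * n) (size e * (size e ∸ 1)) (size e * size e) outside
          (s²≤2s[s-1] (size e) (ℕₚ.≤-trans (s≤s (Core.Medium.1≤r₁ md)) (subst (r₁ ℕ.<_) (size-≡ e) (low e)))) Ξ-K²
          where
          disj : ∀ i → i ∈ᵇ (_== e) → i ∉ᵇ W
          disj i q = trans (cong W (==⇒≡ q)) e∉W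
          outside : Ξ * (size e * (size e ∸ 1)) ℕ.≤ n * n
          outside = ℕₚ.+-cancelˡ-≤ (Ξ * vol W) _ _ (ℕₚ.≤-trans (ℕₚ.≤-reflexive (sym (ℕₚ.*-distribˡ-+ Ξ (vol W) _)))
            (ℕₚ.≤-trans (ℕₚ.*-monoʳ-≤ Ξ (ℕₚ.≤-trans (ℕₚ.≤-reflexive (trans (cong (vol W +_) (sym (∑-≡-pick e _)))
              (sym (∑∈-∪ {S = W} {_== e} _ disj)))) (vol≤n² (W ∪ᵇ (_== e))))) W-vol))

      huge-load : ∀ c → suc K * Load col c ℕ.≤ n
      huge-load c = [ (λ p → by (inMed c p) (ℕₚ.≤-trans (ℕₚ.*-monoˡ-≤ y₁ (Core.Medium.K≤g md)) y₁-low)) , other ]′ (dec-Bool (Cmed c))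
        where
        by : ∀ {S} → Load col c ℕ.≤ S → suc K * S ℕ.≤ n → suc K * Load col c ℕ.≤ n
        by p = ℕₚ.≤-trans (ℕₚ.*-monoʳ-≤ (suc K) p)
        other : c ∉ᵇ Cmed → suc K * Load col c ℕ.≤ n
        other p = [ (λ q → by q (ℕₚ.≤-trans (ℕₚ.*-monoˡ-≤ B₀ (Core.Large.K≤b lg)) B₀-low))
                  , (λ (e , _ , _ , q) → by q (edge-small e)) ]′ (outMed c p)

      colour-B : OutcomeB H r₁ r₀ β γ₁ δ γ₂
      colour-B = (setOf W , (λ i p → extremal i (∈-setOf {S = W} p)) , volume)
        , n , col , (λ i j i≢j (v , vi , vj) → proper i j refl refl (adj-intro i≢j (∈-a i v vi) (∈-a j v vj)))
        , ℕₚ.≤-refl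
        , (λ c _ → in-δ (huge-load c) (incident≤ col c))
        , setOf Cmed
        , narrow {γ₂} {g₂} (proj₁ γ₂-unit) (γ₂g₂) (cmed g₂ c f n f-low c-g₂) (ℕₚ.≤-trans (ℕₚ.≤-reflexive (∣setOf∣ Cmed)) Cmed-few)
        , (λ i (_ , p) → setOf-∈ {S = Cmed} (medium′ i (subst (ℕ._≤ r₀) (size-≡ i) p)))
        , (λ c p → in-γ₁ (ℕₚ.≤-trans (incident≤ col c) (inMed c (∈-setOf {S = Cmed} p))))
        , (λ c p q → in-β (ℕₚ.≤-trans (incident≤ col c) ([ (λ h → ℕₚ.≤-trans h (Bf-big B₀ B₀-low)) , single c q ]′
            (outMed c (≢true⇒false (λ r → p (setOf-∈ {S = Cmed} r)))))))
        where
        single : ∀ c → ¬ HugeColour H col β c → (∃ λ e → t ℕ.≤ size e × col e ≡ c × Load col c ℕ.≤ 2 * size e) → Load col c ℕ.≤ Bf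
        -- As no huge edge has colour `c`, the dominating edge is not huge, and twice its size is
        -- within `Bf`.
        single c q (e , _ , ec , h) = ℕₚ.≤-trans h (ℕₚ.≤-trans (ℕₚ.*-monoˡ-≤ (size e) (s≤s (s≤s (z≤n {2}))))
          (huge-not e (≢true⇒false (λ p → q (e , does-true (Huge? e) p , ec)))))

    outcome : OutcomeA H r₁ r₀ β γ₁ σ ⊎ OutcomeB H r₁ r₀ β γ₁ δ γ₂
    outcome = [ (λ s → inj₁ (colour-A s)) , (λ f → inj₂ (Plane.colour-B f)) ]′ result

-- The quantifier hierarchy

open import Defs
open import Data.Nat using (ℕ; _≥_; _<_)
open import Data.Rational using (ℚ; _≤_)
open import Data.Product using (Σ; _×_)
open import Data.Sum using (_⊎_)
open import Data.Fin using (Fin)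
import Data.Nat as ℕ
open import Data.Nat using (suc; s≤s; z≤n)
import Data.Nat.Properties as ℕₚ
open import Data.Product using (∃; _,_; proj₁)
import Data.Rational as ℚ
open import Data.Rational using (0ℚ; 1ℚ)
import Data.Rational.Properties as ℚₚ
open NibblePotential using (ι; ι-mono)
open Parameters using (Const)
open RationalBounds using (reciprocal; archimedean; invLe)
open Constants using (constants; module Thresholds)
open Conclusion using (1-unit; choice; module Conclude)

archimedean⁺ : ∀ x → 0ℚ ℚ.< x → ∃ λ K → 1ℚ ≤ x ℚ.* ι (suc K)
archimedean⁺ x 0<x with archimedean x 0<x
... | suc K , _ , h = K , h

archimedean-above : ∀ K x → 0ℚ ℚ.< x → ∃ λ b → K ℕ.≤ b × 1ℚ ≤ x ℚ.* ι b
archimedean-above K x 0<x with archimedean x 0<x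
... | b , _ , h = K ℕ.+ b , ℕₚ.m≤m+n K b ,
  ℚₚ.≤-trans h (ℚₚ.*-monoˡ-≤-nonNeg x ⦃ ℚ.nonNegative (ℚₚ.<⇒≤ 0<x) ⦄ (ι-mono (ℕₚ.m≤n+m b K)))

theorem6p1 :
  ∀ γ₂ → InUnit γ₂ →
  Σ ℚ λ δ* → InUnit δ* × (∀ δ → InUnit δ → δ ≤ δ* →
  Σ ℚ λ σ* → InUnit σ* × (∀ σ → InUnit σ → σ ≤ σ* →
  Σ ℚ λ γ₁* → InUnit γ₁* × (∀ γ₁ → InUnit γ₁ → γ₁ ≤ γ₁* →
  Σ ℚ λ t₁ → InUnit t₁ × (∀ (r₁ : ℕ) (β : ℚ) → InvLe r₁ t₁ → InUnit β → β ≤ t₁ →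
  Σ ℚ λ t₀ → InUnit t₀ × (∀ (r₀ : ℕ) → InvLe r₀ t₀ →
  Σ ℚ λ t → InUnit t × (∀ (n₀ : ℕ) → InvLe n₀ t →
  ∀ (n : ℕ) → n ≥ n₀ → (H : Hypergraph n) → Linear H →
  (∀ (i : Fin (m H)) → r₁ < ∣e∣ H i) →
  OutcomeA H r₁ r₀ β γ₁ σ ⊎ OutcomeB H r₁ r₀ β γ₁ δ γ₂))))))
-- Each given rational enters through a natural number bounding its reciprocal, and σ*, t₁, t₀ and t
-- are reciprocals of natural numbers computed from those at hand.
theorem6p1 γ₂ γ₂-unit = 1ℚ , 1-unit , λ δ δ-unit _ →
  let g₂ , _ , γ₂g₂ = archimedean γ₂ (proj₁ γ₂-unit)
      K , δK = archimedean⁺ δ (proj₁ δ-unit)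
      P = constants (suc K) g₂ (s≤s z≤n)
      σ* , σ*-rec = reciprocal (2 ℕ.* Const.U P) (Thresholds.1≤2U P)
  in σ* , proj₁ σ*-rec , λ σ _ σ≤ → 1ℚ , 1-unit , λ γ₁ γ₁-unit _ →
  let g₁ , _ , γ₁g₁ = archimedean γ₁ (proj₁ γ₁-unit)
      t₁ , t₁-rec = reciprocal (Thresholds.R₁ P g₁) (Thresholds.1≤R₁ P g₁)
  in t₁ , proj₁ t₁-rec , λ r₁ β r₁≥ β-unit _ →
  -- Taking b ≥ K + 1 puts an ordinary class, of load at most n/b in the near-plane case, within δn.
  let b , K≤b , βb = archimedean-above (suc K) β (proj₁ β-unit)
      t₀ , t₀-rec = reciprocal (Thresholds.R₀ P b) (Thresholds.1≤R₀ P b)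
  in t₀ , proj₁ t₀-rec , λ r₀ r₀≥ →
  let t , t-rec = reciprocal (Thresholds.N P g₁ b r₀) (Thresholds.1≤N P g₁ b r₀)
  in t , proj₁ t-rec , λ n₀ n₀≥ n n≥n₀ H lin low →
  Conclude.outcome (choice {K} {g₂} {g₁} γ₂-unit δ-unit γ₁-unit β-unit γ₂g₂ δK γ₁g₁ βb P σ*-rec σ≤ (Thresholds.4g₁≤g P g₁)
    (Thresholds.medium P g₁ (invLe t₁-rec r₁≥)) (Thresholds.large P K≤b (invLe t₀-rec r₀≥))
    (Thresholds.order P (ℕₚ.≤-trans (invLe t-rec n₀≥) n≥n₀)) H lin low)
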